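{- Fix $r \geq 2$ and an $r$-critical graph $F$. There is a sequence $(m_n)$ such that with probability tending to $1$ as $n\to\infty$, $\alpha_F(G_{n,1/2}) \in [m_n-r,m_n]$.
   Context: A graph $F$ is $r$-critical if its chromatic number is $r+1$ and $F$ contains an edge whose deletion reduces its chromatic number to $r$. A graph is $F$-free if it contains no (not necessarily induced) subgraph isomorphic to $F$. For a graph $G$, $\alpha_F(G)$ is the maximum number of vertices of an $F$-free induced subgraph of $G$. $G_{n,1/2}$ is the binomial random graph on $[n]$ with edge probability $1/2$. -}

module Defs where

open import Data.Nat using (ℕ; suc; _+_; _*_; _∸_; _^_; _≤_; _<_)
open import Data.Nat.Combinatorics using (_C_)
open import Data.Bool using (Bool; true; false)
open import Data.Fin using (Fin)
open import Data.Fin.Subset using (Subset; _∈_; ∣_∣)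
open import Data.List using (List; length)
open import Data.List.Relation.Unary.All using (All)
open import Data.List.Relation.Unary.AllPairs using (AllPairs)
open import Data.Product using (Σ; _×_)
open import Data.Sum using (_⊎_)
open import Relation.Nullary using (¬_)
open import Relation.Binary.PropositionalEquality using (_≡_; _≢_)
open import Function.Definitions using (Injective)

record Graph (n : ℕ) : Set where
  field
    adj    : Fin n → Fin n → Bool
    sym    : ∀ i j → adj i j ≡ adj j i
    irrefl : ∀ i → adj i i ≡ false
open Graph public

Adj : ∀ {n} → Graph n → Fin n → Fin n → Set
Adj G i j = adj G i j ≡ true

Colorable : ∀ {k} → (Fin k → Fin k → Set) → ℕ → Set
Colorable {k} E c = Σ (Fin k → Fin c) λ f → ∀ i j → E i j → f i ≢ f j

HasChromaticNumber : ∀ {k} → (Fin k → Fin k → Set) → ℕ → Set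
HasChromaticNumber E c = Colorable E c × (∀ d → d < c → ¬ Colorable E d)

DeleteEdge : ∀ {k} → Graph k → Fin k → Fin k → Fin k → Fin k → Set
DeleteEdge F u v i j = Adj F i j × ¬ ((i ≡ u × j ≡ v) ⊎ (i ≡ v × j ≡ u))

Critical : ℕ → ∀ {k} → Graph k → Set
Critical r {k} F =
  HasChromaticNumber (Adj F) (suc r) ×
  Σ (Fin k) λ u → Σ (Fin k) λ v → Adj F u v × HasChromaticNumber (DeleteEdge F u v) r

ContainsIn : ∀ {k n} → Graph k → Graph n → Subset n → Set
ContainsIn {k} {n} F G S =
  Σ (Fin k → Fin n) λ φ → Injective _≡_ _≡_ φ × (∀ i → φ i ∈ S) ×
    (∀ i j → Adj F i j → Adj G (φ i) (φ j))

FFree : ∀ {k n} → Graph k → Graph n → Subset n → Set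
FFree F G S = ¬ ContainsIn F G S

IsAlphaF : ∀ {k n} → Graph k → Graph n → ℕ → Set
IsAlphaF {n = n} F G a =
  (Σ (Subset n) λ S → FFree F G S × ∣ S ∣ ≡ a) ×
  (∀ (S : Subset n) → FFree F G S → ∣ S ∣ ≤ a)

DifferentGraphs : ∀ {n} → Graph n → Graph n → Set
DifferentGraphs G H = ¬ (∀ i j → adj G i j ≡ adj H i j)

-- P holds for G_{n,1/2} with probability tending to 1.
-- G_{n,1/2} is uniform over the 2^(n choose 2) labelled graphs on [n];
-- "Pr[P] ≥ 1 - 1/(k+1)" is witnessed by a list of pairwise different graphs
-- satisfying P, of length L with (k+1)·(2^(n C 2) - L) ≤ 2^(n C 2).
WHP : (∀ n → Graph n → Set) → Set
WHP P = ∀ (k : ℕ) → Σ ℕ λ N → ∀ n → N ≤ n →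
  Σ (List (Graph n)) λ gs →
    AllPairs DifferentGraphs gs × All (P n) gs ×
    suc k * (2 ^ (n C 2) ∸ length gs) ≤ 2 ^ (n C 2)

{-# OPTIONS --safe #-}
-- Let t be the largest size for which the expected number of independent t-sets is at least about n^(1/2r),
-- a = t + 1 and m_n = r a. Graphs on [n] are settings of one bit per pair, and probabilities are counts of settings.
--
-- Lower bound: by the second moment method the independent t-sets are with high probability so numerous, and intersect
-- so rarely, that r pairwise disjoint ones can be chosen greedily. Their union is r-colourable, hence F-free, and has
-- r t = m_n − r vertices.
--
-- Upper bound: the number of F-free graphs on m vertices is at most C r^m 2^((r-1)m²/2r), so a union bound over the
-- vertex sets of size m_n + 1 applies. The count is an induction on m. F embeds into a complete r-partite graph with
-- large parts plus one edge inside a part. Hence an F-free graph is either r-colourable, or it contains one of a few rare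
-- configurations: a largest complete ρ-partite subgraph with ρ < r and large parts that few vertices see fully; a
-- complete r-partite subgraph A inducing a partition in which many vertices miss a second part; an unbalanced or
-- irregular partition; an edge uv inside a class, whose common neighbourhood in another class is then small. In each
-- case the graph is counted by removing the configuration (A, or u and v): the bits between it and the remaining
-- vertices contribute exponentially fewer settings than the growth of the bound permits.
module Submission where

open import Data.Nat
open import Data.Nat.Properties
open import Data.Nat.Tactic.RingSolver using (solve-∀)
open import Data.Bool using (Bool; true; false; not; if_then_else_; _∧_; _∨_; T)
open import Data.Fin using (Fin; zero; suc; toℕ; combine; inject≤)
import Data.Fin.Properties as Fin
import Data.Bool.Properties as Bool
import Data.List
import Data.Vec
import Data.List.Relation.Unary.Unique.Propositional.Properties
open import Data.Vec using (Vec; []; _∷_; lookup; _[_]≔_; tabulate)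
open import Data.Vec.Properties using ([]≔-commutes; lookup∘update; lookup∘update′; lookup∘tabulate; lookup-map)
open import Data.List using (List; []; _∷_; _++_; map; length; concatMap; allFin; upTo; take; drop; cartesianProduct)
open import Data.List.Properties using (length-++; length-map; length-tabulate; length-upTo; map-∘; map-++; drop-drop; take++drop≡id; ++-assoc; ++-identityʳ)
open import Data.List.Membership.Propositional using (_∈_; _∉_)
open import Data.List.Membership.Propositional.Properties
  using (∈-++⁻; ∈-++⁺ˡ; ∈-++⁺ʳ; ∈-map⁺; ∈-map⁻; ∈-∃++; ∈-allFin; ∈-lookup; ∈-upTo⁺; ∈-upTo⁻)
open import Data.List.Relation.Unary.Any using (here; there)
open import Data.List.Relation.Unary.All as All using (All; []; _∷_)
open import Data.List.Relation.Unary.AllPairs as AllPairs using (AllPairs; []; _∷_)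
open import Data.List.Relation.Unary.Unique.Propositional using (Unique)
open import Data.List.Relation.Binary.Permutation.Propositional
  using (_↭_; ↭-sym; ↭-trans; ↭-reflexive; prep; swap; refl; trans)
import Data.List.Relation.Binary.Permutation.Propositional.Properties as Perm
open import Data.Product using (Σ; ∃; _×_; _,_; proj₁; proj₂)
open import Data.Sum using (_⊎_; inj₁; inj₂)
open import Data.Empty using (⊥; ⊥-elim)
open import Relation.Binary.Definitions using (tri<; tri≈; tri>)
open import Relation.Nullary using (¬_; Dec; yes; no; does; contradiction)
open import Relation.Binary.PropositionalEquality
  using (_≡_; _≢_; refl; sym; cong; cong₂; subst; subst₂; module ≡-Reasoning) renaming (trans to ≡-trans)
open import Function using (_∘_; id; case_of_)
import Data.List.Membership.DecPropositional as DecMem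
open import Data.Fin.Permutation.Components using (transpose; transpose-inverse)
open import Relation.Nullary.Decidable using (map′; _×-dec_; _→-dec_; ¬?; dec-true; dec-false)
open import Defs hiding (sym)
open import Data.Nat.DivMod using (m*n/n≡m; /-monoˡ-≤; +-distrib-/-∣ʳ; m/n*n≤m; m≡m%n+[m/n]*n; m%n<n)
open import Data.Nat.Divisibility using (m∣m*n)
open import Data.Nat.Induction using (<-rec)
open import Data.Nat.Combinatorics using (nC1≡n; nCk+nC[k+1]≡[n+1]C[k+1]) renaming (_C_ to _choose_)
open import Data.Fin.Subset using (Subset; ∣_∣)
open import Data.Fin.Subset.Properties using (anySubset?)
open import Data.Vec.Properties using ([]=⇒lookup; lookup⇒[]=)
import Data.List.Relation.Unary.AllPairs.Properties as AllPairs
import Data.List.Relation.Unary.All.Properties as All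

-- Finite sums and products over lists.

-- Why the threshold is n^(1/2r). An r-coloured set of r a + 1 vertices is r blocks of size a and
-- one extra vertex, so the expected number of F-free sets of this size is at most about E^r n
-- 2^(-a), up to powers of log n, where E is the expected number of independent a-sets. E below
-- n^(1/2r) turns this into n^(3/2) 2^(-a), and 2^a is at least n^(7/4). At size t the expectation
-- is still a power of n, which absorbs the logarithmic losses of the second moment.
--
-- The obstacle in the count is that C must not grow with m, so a rare configuration has to pay for
-- every choice made in describing it. Parts of constant size cost m^O(1) choices against a gain
-- exponential in m. An irregular partition gains 2^(c m²), which pays for all r^m partitions. An
-- edge uv gains only 2^(c m) with c small, too little for r^m partitions; so the partition of the
-- rest is read off from a small multipartite subgraph, which leaves r^t partitions with t a small
-- fraction of m.
--
-- Probabilities are multiplied out and roots are compared through powers, so only natural numbers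
-- occur.

∑ : {A : Set} → List A → (A → ℕ) → ℕ
∑ []       f = 0
∑ (x ∷ xs) f = f x + ∑ xs f

∏ : {A : Set} → List A → (A → ℕ) → ℕ
∏ []       f = 1
∏ (x ∷ xs) f = f x * ∏ xs f

𝟙 : Bool → ℕ
𝟙 true  = 1
𝟙 false = 0

𝟙≤1 : ∀ b → 𝟙 b ≤ 1
𝟙≤1 true  = ≤-refl
𝟙≤1 false = z≤n

module _ {A : Set} where

  ∑-cong∈ : ∀ (L : List A) {f g} → (∀ x → x ∈ L → f x ≡ g x) → ∑ L f ≡ ∑ L g
  ∑-cong∈ []      h = refl
  ∑-cong∈ (x ∷ L) h = cong₂ _+_ (h x (here refl)) (∑-cong∈ L λ y y∈ → h y (there y∈))

  ∑-cong : ∀ (L : List A) {f g} → (∀ x → f x ≡ g x) → ∑ L f ≡ ∑ L g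
  ∑-cong L h = ∑-cong∈ L λ x _ → h x

  ∑-mono∈ : ∀ (L : List A) {f g} → (∀ x → x ∈ L → f x ≤ g x) → ∑ L f ≤ ∑ L g
  ∑-mono∈ []      h = z≤n
  ∑-mono∈ (x ∷ L) h = +-mono-≤ (h x (here refl)) (∑-mono∈ L λ y y∈ → h y (there y∈))

  ∑-mono : ∀ (L : List A) {f g} → (∀ x → f x ≤ g x) → ∑ L f ≤ ∑ L g
  ∑-mono L h = ∑-mono∈ L λ x _ → h x

  ∑-+ : ∀ (L : List A) f g → ∑ L (λ x → f x + g x) ≡ ∑ L f + ∑ L g
  ∑-+ []      f g = refl
  ∑-+ (x ∷ L) f g = ≡-trans (cong (f x + g x +_) (∑-+ L f g)) (lem (f x) (g x) (∑ L f) (∑ L g))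
    where
    lem : ∀ a b c d → a + b + (c + d) ≡ a + c + (b + d)
    lem = solve-∀

  ∑-*ˡ : ∀ (L : List A) c f → ∑ L (λ x → c * f x) ≡ c * ∑ L f
  ∑-*ˡ []      c f = sym (*-zeroʳ c)
  ∑-*ˡ (x ∷ L) c f = ≡-trans (cong (c * f x +_) (∑-*ˡ L c f)) (sym (*-distribˡ-+ c (f x) (∑ L f)))

  ∑-*ʳ : ∀ (L : List A) c f → ∑ L (λ x → f x * c) ≡ ∑ L f * c
  ∑-*ʳ L c f = ≡-trans (∑-cong L λ x → *-comm (f x) c) (≡-trans (∑-*ˡ L c f) (*-comm c _))

  ∑-const : ∀ (L : List A) c → ∑ L (λ _ → c) ≡ length L * c
  ∑-const []      c = refl
  ∑-const (x ∷ L) c = cong (c +_) (∑-const L c)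

  ∑-zero : ∀ (L : List A) → ∑ L (λ _ → 0) ≡ 0
  ∑-zero L = ≡-trans (∑-const L 0) (*-zeroʳ (length L))

  ∑-bound : ∀ (L : List A) {f} c → (∀ x → x ∈ L → f x ≤ c) → ∑ L f ≤ length L * c
  ∑-bound L c h = ≤-trans (∑-mono∈ L h) (≤-reflexive (∑-const L c))

  ∑-++ : ∀ (L M : List A) f → ∑ (L ++ M) f ≡ ∑ L f + ∑ M f
  ∑-++ []      M f = refl
  ∑-++ (x ∷ L) M f = ≡-trans (cong (f x +_) (∑-++ L M f)) (sym (+-assoc (f x) _ _))

  ∑-∈ : ∀ {L : List A} {x} f → x ∈ L → f x ≤ ∑ L f
  ∑-∈ f (here refl) = m≤m+n _ _
  ∑-∈ f (there x∈)  = ≤-trans (∑-∈ f x∈) (m≤n+m _ _)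

  ∑-↭ : ∀ {L M : List A} f → L ↭ M → ∑ L f ≡ ∑ M f
  ∑-↭ f refl         = refl
  ∑-↭ f (prep x p)   = cong (f x +_) (∑-↭ f p)
  ∑-↭ f (swap {xs = L} {ys = M} x y p) =
    ≡-trans (cong (λ s → f x + (f y + s)) (∑-↭ f p)) (lem (f x) (f y) (∑ M f))
    where
    lem : ∀ a b c → a + (b + c) ≡ b + (a + c)
    lem = solve-∀
  ∑-↭ f (trans p q)  = ≡-trans (∑-↭ f p) (∑-↭ f q)

  ∏-cong∈ : ∀ (L : List A) {f g} → (∀ x → x ∈ L → f x ≡ g x) → ∏ L f ≡ ∏ L g
  ∏-cong∈ []      h = refl
  ∏-cong∈ (x ∷ L) h = cong₂ _*_ (h x (here refl)) (∏-cong∈ L λ y y∈ → h y (there y∈))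

  ∏-mono∈ : ∀ (L : List A) {f g} → (∀ x → x ∈ L → f x ≤ g x) → ∏ L f ≤ ∏ L g
  ∏-mono∈ []      h = ≤-refl
  ∏-mono∈ (x ∷ L) h = *-mono-≤ (h x (here refl)) (∏-mono∈ L λ y y∈ → h y (there y∈))

  ∏-const : ∀ (L : List A) c → ∏ L (λ _ → c) ≡ c ^ length L
  ∏-const []      c = refl
  ∏-const (x ∷ L) c = cong (c *_) (∏-const L c)

  ∏-* : ∀ (L : List A) f g → ∏ L (λ x → f x * g x) ≡ ∏ L f * ∏ L g
  ∏-* []      f g = refl
  ∏-* (x ∷ L) f g = ≡-trans (cong (f x * g x *_) (∏-* L f g)) (lem (f x) (g x) (∏ L f) (∏ L g))
    where
    lem : ∀ a b c d → a * b * (c * d) ≡ a * c * (b * d)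
    lem = solve-∀

  ∏-pow : ∀ (L : List A) c f → ∏ L (λ x → c ^ f x) ≡ c ^ ∑ L f
  ∏-pow []      c f = refl
  ∏-pow (x ∷ L) c f = ≡-trans (cong (c ^ f x *_) (∏-pow L c f)) (sym (^-distribˡ-+-* c (f x) (∑ L f)))

  ∏-one : ∀ (L : List A) {f} → (∀ x → x ∈ L → f x ≡ 1) → ∏ L f ≡ 1
  ∏-one []      h = refl
  ∏-one (x ∷ L) h rewrite h x (here refl) | ∏-one L (λ y y∈ → h y (there y∈)) = refl

∑-map : ∀ {A B : Set} (g : A → B) (L : List A) f → ∑ (map g L) f ≡ ∑ L (f ∘ g)
∑-map g []      f = refl
∑-map g (x ∷ L) f = cong (f (g x) +_) (∑-map g L f)

∑-swap : ∀ {A B : Set} (L : List A) (M : List B) (f : A → B → ℕ) →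
  ∑ L (λ x → ∑ M (f x)) ≡ ∑ M (λ y → ∑ L λ x → f x y)
∑-swap []      M f = sym (∑-zero M)
∑-swap (x ∷ L) M f = ≡-trans (cong (∑ M (f x) +_) (∑-swap L M f)) (sym (∑-+ M (f x) _))

∑-concatMap : ∀ {A B : Set} (g : A → List B) (L : List A) f → ∑ (concatMap g L) f ≡ ∑ L (λ x → ∑ (g x) f)
∑-concatMap g []      f = refl
∑-concatMap g (x ∷ L) f = ≡-trans (∑-++ (g x) _ f) (cong (∑ (g x) f +_) (∑-concatMap g L f))

length-concatMap : ∀ {A B : Set} (g : A → List B) (L : List A) → length (concatMap g L) ≡ ∑ L (length ∘ g)
length-concatMap g []      = refl
length-concatMap g (x ∷ L) = ≡-trans (length-++ (g x)) (cong (length (g x) +_) (length-concatMap g L))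

-- Counting and filtering in lists.

cnt : {A : Set} → (A → Bool) → List A → ℕ
cnt p L = ∑ L (λ x → 𝟙 (p x))

cnt≤length : ∀ {A : Set} (p : A → Bool) L → cnt p L ≤ length L
cnt≤length p L = ≤-trans (∑-bound L 1 λ x _ → 𝟙≤1 (p x)) (≤-reflexive (*-identityʳ _))

keep : {A : Set} → (A → Bool) → List A → List A
keep p []      = []
keep p (x ∷ L) = if p x then x ∷ keep p L else keep p L

module _ {A : Set} (p : A → Bool) where

  length-keep : ∀ L → length (keep p L) ≡ cnt p L
  length-keep []      = refl
  length-keep (x ∷ L) with p x
  ... | true  = cong suc (length-keep L)
  ... | false = length-keep L

  ∈-keep⁺ : ∀ {L x} → x ∈ L → p x ≡ true → x ∈ keep p L
  ∈-keep⁺ {x ∷ L} (here refl) px rewrite px = here refl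
  ∈-keep⁺ {y ∷ L} (there x∈) px with p y
  ... | true  = there (∈-keep⁺ x∈ px)
  ... | false = ∈-keep⁺ x∈ px

  ∈-keep⁻ : ∀ {L x} → x ∈ keep p L → x ∈ L × p x ≡ true
  ∈-keep⁻ {y ∷ L} x∈ with p y in eq
  ∈-keep⁻ {y ∷ L} (here refl) | true = here refl , eq
  ∈-keep⁻ {y ∷ L} (there x∈)  | true = let a , b = ∈-keep⁻ x∈ in there a , b
  ∈-keep⁻ {y ∷ L} x∈          | false = let a , b = ∈-keep⁻ x∈ in there a , b

  keep-All : ∀ {P : A → Set} {L} → All P L → All P (keep p L)
  keep-All []       = []
  keep-All {L = x ∷ L} (a ∷ as) with p x
  ... | true  = a ∷ keep-All as
  ... | false = keep-All as

  keep-unique : ∀ {L} → Unique L → Unique (keep p L)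
  keep-unique []       = []
  keep-unique {x ∷ L} (a ∷ u) with p x
  ... | true  = keep-All a ∷ keep-unique u
  ... | false = keep-unique u

  keep-split : ∀ L → L ↭ keep p L ++ keep (not ∘ p) L
  keep-split []      = refl
  keep-split (x ∷ L) with p x
  ... | true  = prep x (keep-split L)
  ... | false = ↭-trans (prep x (keep-split L)) (↭-sym (Perm.shift x (keep p L) _))

-- Sublists, permutations and duplicate-free lists.

module _ {A : Set} where

  take-All : ∀ {P : A → Set} k {L} → All P L → All P (take k L)
  take-All zero    as       = []
  take-All (suc k) []       = []
  take-All (suc k) (a ∷ as) = a ∷ take-All k as

  take-unique : ∀ k {L : List A} → Unique L → Unique (take k L)
  take-unique zero    u       = []
  take-unique (suc k) []      = []
  take-unique (suc k) (a ∷ u) = take-All k a ∷ take-unique k u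

  ∈-take⁻ : ∀ k {L : List A} {x} → x ∈ take k L → x ∈ L
  ∈-take⁻ (suc k) {_ ∷ L} (here e)   = here e
  ∈-take⁻ (suc k) {_ ∷ L} (there x∈) = there (∈-take⁻ k x∈)

  ∈-drop⁻ : ∀ k {L : List A} {x} → x ∈ drop k L → x ∈ L
  ∈-drop⁻ zero    x∈ = x∈
  ∈-drop⁻ (suc k) {_ ∷ L} x∈ = there (∈-drop⁻ k x∈)

  length-take≤ : ∀ k (L : List A) → k ≤ length L → length (take k L) ≡ k
  length-take≤ zero    L       le       = refl
  length-take≤ (suc k) (x ∷ L) (s≤s le) = cong suc (length-take≤ k L le)

  unique-↭ : ∀ {L M : List A} → L ↭ M → Unique L → Unique M
  unique-↭ refl       u = u
  unique-↭ (prep x p) (a ∷ u) = Perm.All-resp-↭ p a ∷ unique-↭ p u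
  unique-↭ (swap x y p) ((x≢y ∷ a) ∷ (b ∷ u)) =
    ((λ e → x≢y (sym e)) ∷ Perm.All-resp-↭ p b) ∷ (Perm.All-resp-↭ p a ∷ unique-↭ p u)
  unique-↭ (trans p q) u = unique-↭ q (unique-↭ p u)

  ∉⇒All≢ : ∀ {x : A} L → x ∉ L → All (x ≢_) L
  ∉⇒All≢ []      x∉ = []
  ∉⇒All≢ (y ∷ L) x∉ = (λ e → x∉ (here e)) ∷ ∉⇒All≢ L (x∉ ∘ there)

  All≢⇒∉ : ∀ {x : A} {L} → All (x ≢_) L → x ∉ L
  All≢⇒∉ (a ∷ as) (here e)   = a e
  All≢⇒∉ (a ∷ as) (there x∈) = All≢⇒∉ as x∈

  All-++ : ∀ {P : A → Set} {L M} → All P L → All P M → All P (L ++ M)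
  All-++ []       bs = bs
  All-++ (a ∷ as) bs = a ∷ All-++ as bs

  All-++ˡ : ∀ {P : A → Set} L {M} → All P (L ++ M) → All P L
  All-++ˡ []      as       = []
  All-++ˡ (x ∷ L) (a ∷ as) = a ∷ All-++ˡ L as

  All-++ʳ : ∀ {P : A → Set} L {M} → All P (L ++ M) → All P M
  All-++ʳ []      as       = as
  All-++ʳ (x ∷ L) (a ∷ as) = All-++ʳ L as

  unique-++ : ∀ {L M : List A} → Unique L → Unique M → (∀ {x} → x ∈ L → x ∈ M → ⊥) → Unique (L ++ M)
  unique-++ []      v d = v
  unique-++ {x ∷ L} (a ∷ u) v d = All-++ a (∉⇒All≢ _ (d (here refl))) ∷ unique-++ u v (d ∘ there)

  unique-++ˡ : ∀ (L : List A) {M} → Unique (L ++ M) → Unique L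
  unique-++ˡ []      u       = []
  unique-++ˡ (x ∷ L) (a ∷ u) = All-++ˡ L a ∷ unique-++ˡ L u

  unique-++ʳ : ∀ (L : List A) {M} → Unique (L ++ M) → Unique M
  unique-++ʳ []      u       = u
  unique-++ʳ (x ∷ L) (a ∷ u) = unique-++ʳ L u

  unique-disj : ∀ (L : List A) {M x} → Unique (L ++ M) → x ∈ L → x ∈ M → ⊥
  unique-disj (y ∷ L) (a ∷ u) (here refl) x∈M = All≢⇒∉ (All-++ʳ L a) x∈M
  unique-disj (y ∷ L) (a ∷ u) (there x∈)  x∈M = unique-disj L u x∈ x∈M

  pick : ∀ {x : A} {L} → x ∈ L → ∃ λ R → L ↭ x ∷ R
  pick {x} x∈ with ∈-∃++ x∈
  ... | ys , zs , refl = ys ++ zs , Perm.shift x ys zs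

  -- Extracting the elements of `M` one at a time leaves a complement `R`. This is how a set of bits
  -- is separated from the others before a sum is split.
  sub-↭ : ∀ {L M : List A} → Unique M → (∀ {x} → x ∈ M → x ∈ L) → ∃ λ R → L ↭ M ++ R
  sub-↭ {L} {[]}    u h = L , refl
  sub-↭ {L} {x ∷ M} (a ∷ u) h with pick (h (here refl))
  ... | R , p with sub-↭ {R} {M} u (λ {y} y∈ → strip (Perm.∈-resp-↭ p (h (there y∈))) λ { refl → All≢⇒∉ a y∈ })
    where
    strip : ∀ {y} → y ∈ x ∷ R → ¬ (y ≡ x) → y ∈ R
    strip (here e)   n = contradiction e n
    strip (there y∈) n = y∈
  ... | R′ , p′ = R′ , ↭-trans p (prep x p′)

  sub-length : ∀ {L M : List A} → Unique M → (∀ {x} → x ∈ M → x ∈ L) → length M ≤ length L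
  sub-length {L} {M} u h with sub-↭ u h
  ... | R , p = ≤-trans (m≤m+n (length M) (length R)) (≤-reflexive (sym (≡-trans (Perm.↭-length p) (length-++ M))))

-- Random bits: 𝔼 Q ω X is the sum of X over all 2^∣Q∣ settings of the bits Q, the other bits being those of ω.

module Bits (N : ℕ) where

  Ω : Set
  Ω = Vec Bool N

  Key : Set
  Key = Fin N

  enum : List Key → Ω → List Ω
  enum []      ω = ω ∷ []
  enum (e ∷ Q) ω = enum Q (ω [ e ]≔ false) ++ enum Q (ω [ e ]≔ true)

  𝔼 : List Key → Ω → (Ω → ℕ) → ℕ
  𝔼 Q ω X = ∑ (enum Q ω) X

  𝔼-∷ : ∀ e Q ω X → 𝔼 (e ∷ Q) ω X ≡ 𝔼 Q (ω [ e ]≔ false) X + 𝔼 Q (ω [ e ]≔ true) X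
  𝔼-∷ e Q ω X = ∑-++ (enum Q _) _ X

  length-enum : ∀ Q ω → length (enum Q ω) ≡ 2 ^ length Q
  length-enum []      ω = refl
  length-enum (e ∷ Q) ω = ≡-trans (length-++ (enum Q _))
    (≡-trans (cong₂ _+_ (length-enum Q _) (length-enum Q _)) (cong (2 ^ length Q +_) (sym (+-identityʳ _))))

  𝔼-++ : ∀ P Q ω X → 𝔼 (P ++ Q) ω X ≡ 𝔼 P ω (λ ω′ → 𝔼 Q ω′ X)
  𝔼-++ []      Q ω X = sym (+-identityʳ _)
  𝔼-++ (e ∷ P) Q ω X = ≡-trans (𝔼-∷ e (P ++ Q) ω X)
    (≡-trans (cong₂ _+_ (𝔼-++ P Q _ X) (𝔼-++ P Q _ X)) (sym (𝔼-∷ e P ω _)))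

  𝔼-mono : ∀ Q ω {X Y} → (∀ ω → X ω ≤ Y ω) → 𝔼 Q ω X ≤ 𝔼 Q ω Y
  𝔼-mono Q ω h = ∑-mono (enum Q ω) h

  𝔼-cong : ∀ Q ω {X Y} → (∀ ω → X ω ≡ Y ω) → 𝔼 Q ω X ≡ 𝔼 Q ω Y
  𝔼-cong Q ω h = ∑-cong (enum Q ω) h

  𝔼-bound : ∀ Q ω {X} c → (∀ ω → X ω ≤ c) → 𝔼 Q ω X ≤ 2 ^ length Q * c
  𝔼-bound Q ω c h = ≤-trans (∑-bound (enum Q ω) c λ ω′ _ → h ω′) (≤-reflexive (cong (_* c) (length-enum Q ω)))

  𝔼-const : ∀ Q ω c → 𝔼 Q ω (λ _ → c) ≡ 2 ^ length Q * c
  𝔼-const Q ω c = ≡-trans (∑-const (enum Q ω) c) (cong (_* c) (length-enum Q ω))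

  infix 4 _⟂_
  -- Stands in for independence: a variable that ignores the bits `Q` at every setting is a constant
  -- factor in any sum over `Q`.
  _⟂_ : (Ω → ℕ) → List Key → Set
  X ⟂ Q = ∀ ω e b → e ∈ Q → X (ω [ e ]≔ b) ≡ X ω

  𝔼-pull : ∀ Q ω X Y → Y ⟂ Q → 𝔼 Q ω (λ ω → Y ω * X ω) ≡ Y ω * 𝔼 Q ω X
  𝔼-pull []      ω X Y h = ≡-trans (+-identityʳ _) (cong (Y ω *_) (sym (+-identityʳ _)))
  𝔼-pull (e ∷ Q) ω X Y h = begin
    𝔼 (e ∷ Q) ω (λ ω → Y ω * X ω)
      ≡⟨ 𝔼-∷ e Q ω _ ⟩
    𝔼 Q (ω [ e ]≔ false) (λ ω → Y ω * X ω) + 𝔼 Q (ω [ e ]≔ true) (λ ω → Y ω * X ω)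
      ≡⟨ cong₂ _+_ (𝔼-pull Q _ X Y h′) (𝔼-pull Q _ X Y h′) ⟩
    Y (ω [ e ]≔ false) * 𝔼 Q (ω [ e ]≔ false) X + Y (ω [ e ]≔ true) * 𝔼 Q (ω [ e ]≔ true) X
      ≡⟨ cong₂ _+_ (cong (_* 𝔼 Q _ X) (h ω e false (here refl))) (cong (_* 𝔼 Q _ X) (h ω e true (here refl))) ⟩
    Y ω * 𝔼 Q (ω [ e ]≔ false) X + Y ω * 𝔼 Q (ω [ e ]≔ true) X
      ≡⟨ *-distribˡ-+ (Y ω) _ _ ⟨
    Y ω * (𝔼 Q (ω [ e ]≔ false) X + 𝔼 Q (ω [ e ]≔ true) X)
      ≡⟨ cong (Y ω *_) (𝔼-∷ e Q ω X) ⟨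
    Y ω * 𝔼 (e ∷ Q) ω X ∎
    where
    open ≡-Reasoning
    h′ : Y ⟂ Q
    h′ ω e b e∈ = h ω e b (there e∈)

  𝔼-swap₂ : ∀ e e′ Q ω X → 𝔼 (e ∷ e′ ∷ Q) ω X ≡ 𝔼 (e′ ∷ e ∷ Q) ω X
  𝔼-swap₂ e e′ Q ω X with e Fin.≟ e′
  ... | yes refl = refl
  ... | no  e≢e′ = begin
    𝔼 (e ∷ e′ ∷ Q) ω X
      ≡⟨ ≡-trans (𝔼-∷ e (e′ ∷ Q) ω X) (cong₂ _+_ (𝔼-∷ e′ Q _ X) (𝔼-∷ e′ Q _ X)) ⟩
    (g false false + g false true) + (g true false + g true true)
      ≡⟨ lem (g false false) _ _ _ ⟩
    (g false false + g true false) + (g false true + g true true)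
      ≡⟨ cong₂ _+_ (cong₂ _+_ (sw false false) (sw true false)) (cong₂ _+_ (sw false true) (sw true true)) ⟩
    _ ≡⟨ ≡-trans (𝔼-∷ e′ (e ∷ Q) ω X) (cong₂ _+_ (𝔼-∷ e Q _ X) (𝔼-∷ e Q _ X)) ⟨
    𝔼 (e′ ∷ e ∷ Q) ω X ∎
    where
    open ≡-Reasoning
    g : Bool → Bool → ℕ
    g b c = 𝔼 Q ((ω [ e ]≔ b) [ e′ ]≔ c) X
    sw : ∀ b c → g b c ≡ 𝔼 Q ((ω [ e′ ]≔ c) [ e ]≔ b) X
    sw b c = cong (λ ω → 𝔼 Q ω X) ([]≔-commutes ω e e′ e≢e′)
    lem : ∀ a b c d → (a + b) + (c + d) ≡ (a + c) + (b + d)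
    lem = solve-∀

  𝔼-prep : ∀ e P Q → (∀ ω X → 𝔼 P ω X ≡ 𝔼 Q ω X) → ∀ ω X → 𝔼 (e ∷ P) ω X ≡ 𝔼 (e ∷ Q) ω X
  𝔼-prep e P Q h ω X =
    ≡-trans (𝔼-∷ e P ω X) (≡-trans (cong₂ _+_ (h _ X) (h _ X)) (sym (𝔼-∷ e Q ω X)))

  𝔼-↭ : ∀ {P Q} → P ↭ Q → ∀ ω X → 𝔼 P ω X ≡ 𝔼 Q ω X
  𝔼-↭ refl ω X = refl
  𝔼-↭ (prep {P} {Q} e p) ω X = 𝔼-prep e P Q (𝔼-↭ p) ω X
  𝔼-↭ (swap {P} {Q} e e′ p) ω X = ≡-trans (𝔼-swap₂ e e′ P ω X)
    (𝔼-prep e′ (e ∷ P) (e ∷ Q) (𝔼-prep e P Q (𝔼-↭ p)) ω X)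
  𝔼-↭ (trans p q) ω X = ≡-trans (𝔼-↭ p ω X) (𝔼-↭ q ω X)

  ⟂-* : ∀ {X Y Q} → X ⟂ Q → Y ⟂ Q → (λ ω → X ω * Y ω) ⟂ Q
  ⟂-* f g ω e b e∈ = cong₂ _*_ (f ω e b e∈) (g ω e b e∈)

  ⟂-∏ : ∀ {I : Set} (L : List I) (X : I → Ω → ℕ) {Q} → (∀ x → x ∈ L → X x ⟂ Q) → (λ ω → ∏ L λ x → X x ω) ⟂ Q
  ⟂-∏ L X h ω e b e∈ = ∏-cong∈ L λ x x∈ → h x x∈ ω e b e∈

  ⟂-concatMap : ∀ {I : Set} {X} (L : List I) (Q : I → List Key) → (∀ x → x ∈ L → X ⟂ Q x) → X ⟂ concatMap Q L
  ⟂-concatMap (x ∷ L) Q h ω e b e∈ with ∈-++⁻ (Q x) e∈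
  ... | inj₁ e∈₁ = h x (here refl) ω e b e∈₁
  ... | inj₂ e∈₂ = ⟂-concatMap L Q (λ y y∈ → h y (there y∈)) ω e b e∈₂

  -- The product rule for independent variables, with a one-sided hypothesis: a factor has to ignore
  -- the blocks of later factors but may depend on earlier ones. This suffices because the bounds
  -- `b` hold at every setting, so the blocks are summed out from the last to the first.
  𝔼-∏ : ∀ {I : Set} (L : List I) (Q : I → List Key) (w : I → Ω → ℕ) (b : I → ℕ) →
    AllPairs (λ x y → w x ⟂ Q y) L → (∀ x → x ∈ L → ∀ ω → 𝔼 (Q x) ω (w x) ≤ b x) →
    ∀ ω → 𝔼 (concatMap Q L) ω (λ ω → ∏ L λ x → w x ω) ≤ ∏ L b
  𝔼-∏ []      Q w b _ _ ω = ≤-refl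
  𝔼-∏ (x ∷ L) Q w b (a ∷ ap) h ω = begin
    𝔼 (Q x ++ concatMap Q L) ω (λ ω → w x ω * ∏ L λ y → w y ω)
      ≡⟨ 𝔼-++ (Q x) _ ω _ ⟩
    𝔼 (Q x) ω (λ ω → 𝔼 (concatMap Q L) ω (λ ω → w x ω * ∏ L λ y → w y ω))
      ≡⟨ 𝔼-cong (Q x) ω (λ ω → 𝔼-pull (concatMap Q L) ω _ (w x) (⟂-concatMap L Q λ y y∈ → All.lookup a y∈)) ⟩
    𝔼 (Q x) ω (λ ω → w x ω * 𝔼 (concatMap Q L) ω (λ ω → ∏ L λ y → w y ω))
      ≤⟨ 𝔼-mono (Q x) ω (λ ω → *-monoʳ-≤ (w x ω) (𝔼-∏ L Q w b ap (λ y y∈ → h y (there y∈)) ω)) ⟩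
    𝔼 (Q x) ω (λ ω → w x ω * ∏ L b)
      ≡⟨ ∑-*ʳ (enum (Q x) ω) (∏ L b) (w x) ⟩
    𝔼 (Q x) ω (w x) * ∏ L b
      ≤⟨ *-monoˡ-≤ (∏ L b) (h x (here refl) ω) ⟩
    b x * ∏ L b ∎
    where open ≤-Reasoning

-- Graphs on n labelled vertices as settings of bits, one bit per unordered pair.

module Edges (n : ℕ) where

  open Bits (n * n) public

  V : Set
  V = Fin n

  open DecMem (Fin._≟_ {n}) public using (_∈?_)

  abstract

    -- The endpoints are sorted before they are encoded, so that both orders of a pair own the same
    -- bit. The remaining keys encode no pair of distinct vertices.
    key : V → V → Key
    key u v = if toℕ u ≤ᵇ toℕ v then combine u v else combine v u

    key-sym : ∀ u v → key u v ≡ key v u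
    key-sym u v with toℕ u ≤ᵇ toℕ v in p | toℕ v ≤ᵇ toℕ u in q
    ... | true  | false = refl
    ... | false | true  = refl
    ... | true  | true  = cong₂ combine e (sym e)
      where
      e : u ≡ v
      e = Fin.toℕ-injective (≤-antisym (≤ᵇ⇒≤ _ _ (subst T (sym p) _)) (≤ᵇ⇒≤ _ _ (subst T (sym q) _)))
    ... | false | false with ≤-total (toℕ u) (toℕ v)
    ...   | inj₁ le = ⊥-elim (subst T p (≤⇒≤ᵇ le))
    ...   | inj₂ le = ⊥-elim (subst T q (≤⇒≤ᵇ le))

    key-inj : ∀ {u v u′ v′} → key u v ≡ key u′ v′ → (u ≡ u′ × v ≡ v′) ⊎ (u ≡ v′ × v ≡ u′)
    key-inj {u} {v} {u′} {v′} eq with toℕ u ≤ᵇ toℕ v | toℕ u′ ≤ᵇ toℕ v′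
    ... | true  | true  = inj₁ (Fin.combine-injective _ _ _ _ eq)
    ... | true  | false = inj₂ (Fin.combine-injective _ _ _ _ eq)
    ... | false | true  = let a , b = Fin.combine-injective _ _ _ _ eq in inj₂ (b , a)
    ... | false | false = let a , b = Fin.combine-injective _ _ _ _ eq in inj₁ (b , a)

    E : Ω → V → V → Bool
    E ω u v = not (does (u Fin.≟ v)) ∧ lookup ω (key u v)

    E-irr : ∀ ω u → E ω u u ≡ false
    E-irr ω u rewrite dec-true (u Fin.≟ u) refl = refl

    E⇒≢ : ∀ ω {u v} → E ω u v ≡ true → u ≢ v
    E⇒≢ ω {u} p refl with ≡-trans (sym (E-irr ω u)) p
    ... | ()

    E-≢ : ∀ ω {u v} → u ≢ v → E ω u v ≡ lookup ω (key u v)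
    E-≢ ω {u} {v} u≢v rewrite dec-false (u Fin.≟ v) u≢v = refl

    E-sym : ∀ ω u v → E ω u v ≡ E ω v u
    E-sym ω u v with u Fin.≟ v
    ... | yes refl = sym (E-irr ω u)
    ... | no  u≢v  = ≡-trans (cong (lookup ω) (key-sym u v)) (sym (E-≢ ω (u≢v ∘ sym)))

    E-upd : ∀ ω e b u v → e ≢ key u v → E (ω [ e ]≔ b) u v ≡ E ω u v
    E-upd ω e b u v e≢ = cong (not (does (u Fin.≟ v)) ∧_) (lookup∘update′ (e≢ ∘ sym) ω b)

  pairs : List V → List Key
  pairs []      = []
  pairs (x ∷ L) = map (key x) L ++ pairs L

  -- Grouped by the vertices of `R`: each of them owns a row of bits towards `Z`, and weights that
  -- read single rows can be multiplied by `𝔼-∏`.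
  cross : List V → List V → List Key
  cross Z R = concatMap (λ x → map (key x) Z) R

  pairs-↭ : ∀ {L M} → L ↭ M → pairs L ↭ pairs M
  pairs-↭ refl = refl
  pairs-↭ (prep x p) = Perm.++⁺ (Perm.map⁺ (key x) p) (pairs-↭ p)
  pairs-↭ (swap {L} {M} x y p) = ↭-trans
    (prep (key x y) (↭-trans (Perm.shifts (map (key x) L) (map (key y) L))
      (Perm.++⁺ (Perm.map⁺ (key y) p) (Perm.++⁺ (Perm.map⁺ (key x) p) (pairs-↭ p)))))
    (↭-reflexive (cong (_∷ (map (key y) M ++ map (key x) M ++ pairs M)) (key-sym x y)))
  pairs-↭ (trans p q) = ↭-trans (pairs-↭ p) (pairs-↭ q)

  cross-[] : ∀ R → cross [] R ≡ []
  cross-[] []      = refl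
  cross-[] (x ∷ R) = cross-[] R

  cross-∷ : ∀ z Z R → cross (z ∷ Z) R ↭ map (key z) R ++ cross Z R
  cross-∷ z Z []      = refl
  cross-∷ z Z (x ∷ R) = ↭-trans (↭-reflexive (cong (_∷ (map (key x) Z ++ cross (z ∷ Z) R)) (key-sym x z)))
    (prep (key z x) (↭-trans (Perm.++⁺ˡ (map (key x) Z) (cross-∷ z Z R)) (Perm.shifts (map (key x) Z) (map (key z) R))))

  pairs-++ : ∀ Z R → pairs (Z ++ R) ↭ pairs Z ++ (pairs R ++ cross Z R)
  pairs-++ []      R = ↭-reflexive (sym (≡-trans (cong (pairs R ++_) (cross-[] R)) (++-identityʳ _)))
  pairs-++ (z ∷ Z) R =
    ↭-trans (Perm.++⁺ˡ (map (key z) (Z ++ R)) (pairs-++ Z R))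
    (↭-trans (↭-reflexive (≡-trans (cong (_++ rest) (map-++ (key z) Z R)) (++-assoc (map (key z) Z) _ _)))
    (↭-trans (Perm.++⁺ˡ (map (key z) Z) mid) (↭-reflexive (sym (++-assoc (map (key z) Z) (pairs Z) _)))))
    where
    rest = pairs Z ++ (pairs R ++ cross Z R)
    mid : map (key z) R ++ rest ↭ pairs Z ++ (pairs R ++ cross (z ∷ Z) R)
    mid = ↭-trans (Perm.shifts (map (key z) R) (pairs Z)) (Perm.++⁺ˡ (pairs Z)
      (↭-trans (Perm.shifts (map (key z) R) (pairs R)) (Perm.++⁺ˡ (pairs R) (↭-sym (cross-∷ z Z R)))))

  ∈-pairs : ∀ L {e} → Unique L → e ∈ pairs L → ∃ λ u → ∃ λ v → u ∈ L × v ∈ L × u ≢ v × e ≡ key u v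
  ∈-pairs (x ∷ L) (a ∷ u) e∈ with ∈-++⁻ (map (key x) L) e∈
  ... | inj₁ e∈₁ = let v , v∈ , eq = ∈-map⁻ (key x) e∈₁ in x , v , here refl , there v∈ , All.lookup a v∈ , eq
  ... | inj₂ e∈₂ = let u , v , u∈ , v∈ , ne , eq = ∈-pairs L u e∈₂ in u , v , there u∈ , there v∈ , ne , eq

  pairs-∈ : ∀ L {u v} → u ∈ L → v ∈ L → u ≢ v → key u v ∈ pairs L
  pairs-∈ (x ∷ L) (here refl) (here refl) ne = contradiction refl ne
  pairs-∈ (x ∷ L) (here refl) (there v∈)  ne = ∈-++⁺ˡ (∈-map⁺ (key x) v∈)
  pairs-∈ (x ∷ L) {u} (there u∈) (here refl) ne = subst (_∈ _) (key-sym x u) (∈-++⁺ˡ (∈-map⁺ (key x) u∈))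
  pairs-∈ (x ∷ L) (there u∈) (there v∈)  ne = ∈-++⁺ʳ (map (key x) L) (pairs-∈ L u∈ v∈ ne)

  ∈-cross : ∀ Z R {e} → e ∈ cross Z R → ∃ λ z → ∃ λ x → z ∈ Z × x ∈ R × e ≡ key x z
  ∈-cross Z (x ∷ R) e∈ with ∈-++⁻ (map (key x) Z) e∈
  ... | inj₁ e∈₁ = let z , z∈ , eq = ∈-map⁻ (key x) e∈₁ in z , x , z∈ , here refl , eq
  ... | inj₂ e∈₂ = let z , y , z∈ , y∈ , eq = ∈-cross Z R e∈₂ in z , y , z∈ , there y∈ , eq

  cross-off : ∀ {Z R} → Unique (Z ++ R) → ∀ {e u v} → e ∈ cross Z R → u ∈ R → v ∈ R → e ≢ key u v
  cross-off {Z} {R} uq e∈ u∈ v∈ eq with ∈-cross Z R e∈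
  ... | z , x , z∈ , x∈ , refl with key-inj eq
  ...   | inj₁ (_ , refl) = unique-disj Z uq z∈ v∈
  ...   | inj₂ (_ , refl) = unique-disj Z uq z∈ u∈

  unique-row : ∀ x {L} → Unique L → Unique (map (key x) L)
  unique-row x []      = []
  unique-row x {y ∷ L} (a ∷ u) = ∉⇒All≢ _ no-rep ∷ unique-row x u
    where
    no-rep : key x y ∉ map (key x) L
    no-rep e∈ with ∈-map⁻ (key x) e∈
    ... | z , z∈ , eq with key-inj eq
    ...   | inj₁ (_ , refl)    = All≢⇒∉ a z∈
    ...   | inj₂ (refl , refl) = All≢⇒∉ a z∈

  unique-pairs : ∀ {L} → Unique L → Unique (pairs L)
  unique-pairs []      = []
  unique-pairs {x ∷ L} (a ∷ u) = unique-++ (unique-row x u) (unique-pairs u) dis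
    where
    dis : ∀ {e} → e ∈ map (key x) L → e ∈ pairs L → ⊥
    dis e∈ e∈′ with ∈-map⁻ (key x) e∈ | ∈-pairs L u e∈′
    ... | z , z∈ , refl | p , q , p∈ , q∈ , _ , eq with key-inj eq
    ...   | inj₁ (refl , _) = All≢⇒∉ a p∈
    ...   | inj₂ (refl , _) = All≢⇒∉ a q∈

  length-pairs : ∀ L → 2 * length (pairs L) + length L ≡ length L * length L
  length-pairs []      = refl
  length-pairs (x ∷ L) = begin
    2 * length (map (key x) L ++ pairs L) + suc l
      ≡⟨ cong (λ z → 2 * z + suc l) (≡-trans (length-++ (map (key x) L)) (cong (_+ length (pairs L)) (length-map (key x) L))) ⟩
    2 * (l + length (pairs L)) + suc l
      ≡⟨ lem l (length (pairs L)) ⟩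
    (2 * length (pairs L) + l) + (l + suc l)
      ≡⟨ cong (_+ (l + suc l)) (length-pairs L) ⟩
    l * l + (l + suc l)
      ≡⟨ lem₂ l ⟩
    suc l * suc l ∎
    where
    open ≡-Reasoning
    l = length L
    lem : ∀ l p → 2 * (l + p) + suc l ≡ (2 * p + l) + (l + suc l)
    lem = solve-∀
    lem₂ : ∀ l → l * l + (l + suc l) ≡ suc l * suc l
    lem₂ = solve-∀

  length-pairs≤ : ∀ L → length (pairs L) ≤ length L * length L
  length-pairs≤ L = ≤-trans (≤-trans (m≤m+n p (p + 0)) (m≤m+n (2 * p) (length L))) (≤-reflexive (length-pairs L))
    where p = length (pairs L)

  -- Summing out the bits at a removed set Z: first those inside Z, then those inside R, then those between Z and R.
  piece : ∀ {S} Z R → S ↭ Z ++ R → ∀ (X Y : Ω → ℕ) (M D G : ℕ) →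
    (∀ ω → M * 𝔼 (cross Z R) ω X ≤ D * Y ω) → (∀ ω → 𝔼 (pairs R) ω Y ≤ G) →
    ∀ ω → M * 𝔼 (pairs S) ω X ≤ 2 ^ (length Z * length Z) * (D * G)
  piece {S} Z R p X Y M D G hd hg ω = begin
    M * 𝔼 (pairs S) ω X
      ≡⟨ cong (M *_) (≡-trans (𝔼-↭ (↭-trans (pairs-↭ p) (pairs-++ Z R)) ω X) (𝔼-++ (pairs Z) _ ω X)) ⟩
    M * 𝔼 (pairs Z) ω (λ ω → 𝔼 (pairs R ++ cross Z R) ω X)
      ≡⟨ ∑-*ˡ (enum (pairs Z) ω) M _ ⟨
    𝔼 (pairs Z) ω (λ ω → M * 𝔼 (pairs R ++ cross Z R) ω X)
      ≤⟨ 𝔼-bound (pairs Z) ω (D * G) inner ⟩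
    2 ^ length (pairs Z) * (D * G)
      ≤⟨ *-monoˡ-≤ (D * G) (^-monoʳ-≤ 2 (length-pairs≤ Z)) ⟩
    2 ^ (length Z * length Z) * (D * G) ∎
    where
    open ≤-Reasoning
    inner : ∀ ω → M * 𝔼 (pairs R ++ cross Z R) ω X ≤ D * G
    inner ω = begin
      M * 𝔼 (pairs R ++ cross Z R) ω X                     ≡⟨ cong (M *_) (𝔼-++ (pairs R) _ ω X) ⟩
      M * 𝔼 (pairs R) ω (λ ω → 𝔼 (cross Z R) ω X)          ≡⟨ ∑-*ˡ (enum (pairs R) ω) M _ ⟨
      𝔼 (pairs R) ω (λ ω → M * 𝔼 (cross Z R) ω X)          ≤⟨ 𝔼-mono (pairs R) ω hd ⟩
      𝔼 (pairs R) ω (λ ω → D * Y ω)                        ≡⟨ ∑-*ˡ (enum (pairs R) ω) D Y ⟩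
      D * 𝔼 (pairs R) ω Y                                  ≤⟨ *-monoʳ-≤ D (hg ω) ⟩
      D * G ∎

  -- Produces the hypothesis of `piece` when the summand is a variable of the remaining vertices
  -- times an event about the bits `Q`. What is left to prove is a bound for the event alone.
  pulled : ∀ Q (Y ev : Ω → ℕ) (M D : ℕ) → Y ⟂ Q → (∀ ω → M * 𝔼 Q ω ev ≤ D) →
    ∀ ω → M * 𝔼 Q ω (λ ω → Y ω * ev ω) ≤ D * Y ω
  pulled Q Y ev M D yi hd ω = begin
    M * 𝔼 Q ω (λ ω → Y ω * ev ω) ≡⟨ cong (M *_) (𝔼-pull Q ω ev Y yi) ⟩
    M * (Y ω * 𝔼 Q ω ev)         ≡⟨ lem M (Y ω) _ ⟩
    M * 𝔼 Q ω ev * Y ω           ≤⟨ *-monoˡ-≤ (Y ω) (hd ω) ⟩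
    D * Y ω ∎
    where
    open ≤-Reasoning
    lem : ∀ a b c → a * (b * c) ≡ a * c * b
    lem = solve-∀

-- Copies of F.

anyVec? : ∀ {n} k {P : Vec (Fin n) k → Set} → (∀ v → Dec (P v)) → Dec (∃ P)
anyVec? zero    P? = map′ (λ p → [] , p) (λ { ([] , p) → p }) (P? [])
anyVec? (suc k) P? = map′ (λ { (x , v , p) → x ∷ v , p }) (λ { (x ∷ v , p) → x , v , p })
  (Fin.any? λ x → anyVec? k λ v → P? (x ∷ v))

List-lookup-injective : ∀ {A : Set} {L : List A} → Unique L → ∀ i j → Data.List.lookup L i ≡ Data.List.lookup L j → i ≡ j
List-lookup-injective {L = x ∷ L} (a ∷ u) zero    zero    eq = refl
List-lookup-injective {L = x ∷ L} (a ∷ u) zero    (suc j) eq = contradiction eq (All.lookup a (∈-lookup j))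
List-lookup-injective {L = x ∷ L} (a ∷ u) (suc i) zero    eq = contradiction (sym eq) (All.lookup a (∈-lookup i))
List-lookup-injective {L = x ∷ L} (a ∷ u) (suc i) (suc j) eq = cong suc (List-lookup-injective u i j eq)

transpose-at : ∀ {n} (i j : Fin n) → transpose i j i ≡ j
transpose-at i j rewrite dec-true (i Fin.≟ i) refl = refl

transpose-injective : ∀ {n} (i j : Fin n) {x y} → transpose i j x ≡ transpose i j y → x ≡ y
transpose-injective i j {x} {y} eq =
  ≡-trans (sym (transpose-inverse j i)) (≡-trans (cong (transpose j i) eq) (transpose-inverse j i))

module Copies (n : ℕ) {k : ℕ} (F : Graph k) where

  open Edges n public

  IsCopy : Ω → List V → (Fin k → V) → Set
  IsCopy ω S φ = (∀ i j → φ i ≡ φ j → i ≡ j) × (∀ i → φ i ∈ S) × (∀ i j → adj F i j ≡ true → E ω (φ i) (φ j) ≡ true)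

  Contains : Ω → List V → Set
  Contains ω S = ∃ λ φ → IsCopy ω S φ

  IsCopy-≗ : ∀ {ω S φ ψ} → (∀ i → φ i ≡ ψ i) → IsCopy ω S φ → IsCopy ω S ψ
  IsCopy-≗ {ω} {S} h (inj , mem , edge) =
    (λ i j eq → inj i j (≡-trans (h i) (≡-trans eq (sym (h j))))) ,
    (λ i → subst (_∈ S) (h i) (mem i)) ,
    (λ i j a → subst₂ (λ u v → E ω u v ≡ true) (h i) (h j) (edge i j a))

  abstract
    contains? : ∀ ω S → Dec (Contains ω S)
    contains? ω S = map′ (λ (v , p) → lookup v , p)
      (λ (φ , p) → tabulate φ , IsCopy-≗ (λ i → sym (lookup∘tabulate φ i)) p)
      (anyVec? k λ v →
        Fin.all? (λ i → Fin.all? λ j → (lookup v i Fin.≟ lookup v j) →-dec (i Fin.≟ j)) ×-dec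
        Fin.all? (λ i → lookup v i ∈? S) ×-dec
        Fin.all? (λ i → Fin.all? λ j → (adj F i j Bool.≟ true) →-dec (E ω (lookup v i) (lookup v j) Bool.≟ true)))

  ff : List V → Ω → ℕ
  ff S ω = 𝟙 (not (does (contains? ω S)))

  ff-one : ∀ {S ω} → ¬ Contains ω S → ff S ω ≡ 1
  ff-one {S} {ω} h rewrite dec-false (contains? ω S) h = refl

  ff-zero : ∀ {S ω} → Contains ω S → ff S ω ≡ 0
  ff-zero {S} {ω} h rewrite dec-true (contains? ω S) h = refl

  ff≤1 : ∀ S ω → ff S ω ≤ 1
  ff≤1 S ω = 𝟙≤1 _

  Contains-⊆ : ∀ {ω R S} → (∀ {x} → x ∈ R → x ∈ S) → Contains ω R → Contains ω S
  Contains-⊆ h (φ , inj , mem , edge) = φ , inj , (λ i → h (mem i)) , edge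

  Contains-local : ∀ {ω ω′ R} → (∀ u v → u ∈ R → v ∈ R → E ω u v ≡ E ω′ u v) → Contains ω R → Contains ω′ R
  Contains-local h (φ , inj , mem , edge) =
    φ , inj , mem , λ i j a → ≡-trans (sym (h (φ i) (φ j) (mem i) (mem j))) (edge i j a)

  ff-⟂ : ∀ R Q → (∀ {e u v} → e ∈ Q → u ∈ R → v ∈ R → e ≢ key u v) → ff R ⟂ Q
  ff-⟂ R Q h ω e b e∈ = go (contains? ω R)
    where
    go : Dec (Contains ω R) → ff R (ω [ e ]≔ b) ≡ ff R ω
    go (yes c) = ≡-trans (ff-zero (Contains-local (λ u v u∈ v∈ → sym (E-upd ω e b u v (h e∈ u∈ v∈))) c)) (sym (ff-zero c))
    go (no ¬c) = ≡-trans (ff-one (¬c ∘ Contains-local (λ u v u∈ v∈ → E-upd ω e b u v (h e∈ u∈ v∈)))) (sym (ff-one ¬c))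

  Cross : ∀ {r} → Ω → (Fin r → List V) → Set
  Cross ω D = ∀ i j → i ≢ j → ∀ {a b} → a ∈ D i → b ∈ D j → E ω a b ≡ true

  -- A critical F embeds into a complete r-partite graph with large parts and one additional edge inside a part.
  module _ {r : ℕ} (crit : Critical r F) where

    private
      x y : Fin k
      x = proj₁ (proj₂ crit)
      y = proj₁ (proj₂ (proj₂ crit))
      col : Colorable (DeleteEdge F x y) r
      col = proj₁ (proj₂ (proj₂ (proj₂ (proj₂ crit))))
      χ : Fin k → Fin r
      χ = proj₁ col
      notcol : ¬ Colorable (Adj F) r
      notcol = proj₂ (proj₁ crit) r ≤-refl

      χx≡χy : χ x ≡ χ y
      χx≡χy with χ x Fin.≟ χ y
      ... | yes e = e
      ... | no ne = contradiction (χ , proper) notcol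
        where
        proper : ∀ i j → Adj F i j → χ i ≢ χ j
        proper i j a with (i Fin.≟ x) ×-dec (j Fin.≟ y) | (i Fin.≟ y) ×-dec (j Fin.≟ x)
        ... | yes (refl , refl) | _ = ne
        ... | no _ | yes (refl , refl) = ne ∘ sym
        ... | no p | no q = proj₂ col i j (a , λ { (inj₁ e) → p e ; (inj₂ e) → q e })

    -- The colouring of `F` without the edge `x` `y` gives `x` and `y` the same colour, since
    -- otherwise it would colour `F` itself. After a transposition of colours this colour is `i`;
    -- the edge goes to `u` `v`, and every other vertex goes to the part of its colour.
    edge-copy : ∀ {ω S} i {u v} (D : Fin r → List V) → u ∈ S → v ∈ S → E ω u v ≡ true →
      (∀ j → k ≤ length (D j)) → (∀ j → Unique (D j)) → (∀ j {d} → d ∈ D j → d ∈ S) → Cross ω D →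
      (∀ j → j ≢ i → ∀ {d} → d ∈ D j → E ω u d ≡ true × E ω v d ≡ true) →
      (∀ {d} → d ∈ D i → d ≢ u × d ≢ v) → Contains ω S
    edge-copy {ω} {S} i {u} {v} D u∈ v∈ u~v len uq mem cr nb av = φ , inj , memφ , edgeφ
      where
      σ : Fin r → Fin r
      σ = transpose (χ x) i
      σ-x : σ (χ x) ≡ i
      σ-x = transpose-at (χ x) i
      σ-y : σ (χ y) ≡ i
      σ-y = ≡-trans (cong σ (sym χx≡χy)) σ-x
      -- A vertex of `F` is its own index in the list of its part, so vertices in a common part have
      -- distinct images and `k` entries per part are enough.
      at : Fin k → V
      at w = Data.List.lookup (D (σ (χ w))) (inject≤ w (len _))
      at∈ : ∀ w → at w ∈ D (σ (χ w))
      at∈ w = ∈-lookup _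
      φ : Fin k → V
      φ w with w Fin.≟ x | w Fin.≟ y
      ... | yes _ | _     = u
      ... | no _  | yes _ = v
      ... | no _  | no _  = at w
      at≢ : ∀ w → at w ≢ u × at w ≢ v
      at≢ w with σ (χ w) Fin.≟ i
      ... | yes e = av (subst (λ c → at w ∈ D c) e (at∈ w))
      ... | no ne = (λ e → E⇒≢ ω (proj₁ (nb _ ne (at∈ w))) (sym e)) , (λ e → E⇒≢ ω (proj₂ (nb _ ne (at∈ w))) (sym e))
      at-inj : ∀ w w′ → at w ≡ at w′ → w ≡ w′
      at-inj w w′ eq with σ (χ w) Fin.≟ σ (χ w′)
      ... | no ne = contradiction eq (E⇒≢ ω (cr _ _ ne (at∈ w) (at∈ w′)))
      ... | yes e = same _ _ e (len _) (len _) eq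
        where
        same : ∀ c c′ → c ≡ c′ → ∀ (p : k ≤ length (D c)) (p′ : k ≤ length (D c′)) →
          Data.List.lookup (D c) (inject≤ w p) ≡ Data.List.lookup (D c′) (inject≤ w′ p′) → w ≡ w′
        same c .c refl p p′ eq = Fin.inject≤-injective p p′ w w′ (List-lookup-injective (uq c) _ _ eq)
      u≢v = E⇒≢ ω u~v
      inj : ∀ w w′ → φ w ≡ φ w′ → w ≡ w′
      inj w w′ eq with w Fin.≟ x | w Fin.≟ y | w′ Fin.≟ x | w′ Fin.≟ y
      ... | yes refl | _ | yes refl | _ = refl
      ... | yes refl | _ | no _ | yes refl = contradiction eq u≢v
      ... | yes refl | _ | no _ | no _ = contradiction (sym eq) (proj₁ (at≢ w′))
      ... | no _ | yes refl | yes refl | _ = contradiction (sym eq) u≢v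
      ... | no _ | yes refl | no _ | yes refl = refl
      ... | no _ | yes refl | no _ | no _ = contradiction (sym eq) (proj₂ (at≢ w′))
      ... | no _ | no _ | yes refl | _ = contradiction eq (proj₁ (at≢ w))
      ... | no _ | no _ | no _ | yes refl = contradiction eq (proj₂ (at≢ w))
      ... | no _ | no _ | no _ | no _ = at-inj w w′ eq
      memφ : ∀ w → φ w ∈ S
      memφ w with w Fin.≟ x | w Fin.≟ y
      ... | yes _ | _     = u∈
      ... | no _  | yes _ = v∈
      ... | no _  | no _  = mem _ (at∈ w)
      irr : ∀ w → adj F w w ≢ true
      irr w e with ≡-trans (sym (irrefl F w)) e
      ... | ()
      colours : ∀ w w′ → adj F w w′ ≡ true → ¬ (w ≡ x × w′ ≡ y) → ¬ (w ≡ y × w′ ≡ x) → σ (χ w) ≢ σ (χ w′)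
      colours w w′ a p q e = proj₂ col w w′ (a , λ { (inj₁ e) → p e ; (inj₂ e) → q e }) (transpose-injective (χ x) i e)
      edgeφ : ∀ w w′ → adj F w w′ ≡ true → E ω (φ w) (φ w′) ≡ true
      edgeφ w w′ a with w Fin.≟ x | w Fin.≟ y | w′ Fin.≟ x | w′ Fin.≟ y
      ... | yes refl | _ | yes refl | _ = contradiction a (irr w)
      ... | yes refl | _ | no _ | yes refl = u~v
      ... | yes refl | _ | no _ | no w′≢y =
        proj₁ (nb _ (λ e → colours w w′ a (λ { (_ , e) → w′≢y e }) (λ { (e , refl) → irr w a }) (≡-trans σ-x (sym e))) (at∈ w′))
      ... | no _ | yes refl | yes refl | _ = ≡-trans (E-sym ω v u) u~v
      ... | no _ | yes refl | no _ | yes refl = contradiction a (irr w)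
      ... | no _ | yes refl | no w′≢x | no _ =
        proj₂ (nb _ (λ e → colours w w′ a (λ { (_ , refl) → irr w a }) (λ { (_ , e) → w′≢x e }) (≡-trans σ-y (sym e))) (at∈ w′))
      ... | no _ | no w≢y | yes refl | _ = ≡-trans (E-sym ω _ u)
        (proj₁ (nb _ (λ e → colours w w′ a (λ { (refl , _) → irr w a }) (λ { (e , _) → w≢y e }) (≡-trans e (sym σ-x))) (at∈ w)))
      ... | no w≢x | no _ | no _ | yes refl = ≡-trans (E-sym ω _ v)
        (proj₂ (nb _ (λ e → colours w w′ a (λ { (e , _) → w≢x e }) (λ { (refl , _) → irr w a }) (≡-trans e (sym σ-y))) (at∈ w)))
      ... | no w≢x | no w≢y | no _ | no _ =
        cr _ _ (colours w w′ a (λ { (e , _) → w≢x e }) (λ { (e , _) → w≢y e })) (at∈ w) (at∈ w′)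

    -- The head `v` of `D i` is used as the other end of the additional edge: it is adjacent to `u`
    -- and already joined to the other parts. The part `D i` loses it, hence `suc k` in place of
    -- `k`.
    star-copy : ∀ {ω S} (i : Fin r) {u} (D : Fin r → List V) → u ∈ S →
      (∀ j → suc k ≤ length (D j)) → (∀ j → Unique (D j)) → (∀ j {d} → d ∈ D j → d ∈ S) → Cross ω D →
      (∀ j {d} → d ∈ D j → E ω u d ≡ true) → Contains ω S
    star-copy {ω} {S} i {u} D u∈ len uq mem cr nb with D i in eq | len i | uq i
    ... | v ∷ L | s≤s le | v≢ ∷ uqL =
      edge-copy i D′ u∈ (mem i v∈) (nb i v∈) len′ uq′ (λ j d∈ → mem j (sub j d∈))
        (λ a b ne d∈ d∈′ → cr a b ne (sub a d∈) (sub b d∈′))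
        (λ j ne d∈ → nb j (sub j d∈) , cr i j (ne ∘ sym) v∈ (sub j d∈))
        avoid
      where
      v∈ : v ∈ D i
      v∈ = subst (v ∈_) (sym eq) (here refl)
      D′ : Fin r → List V
      D′ j with j Fin.≟ i
      ... | yes _ = L
      ... | no  _ = D j
      sub : ∀ j {d} → d ∈ D′ j → d ∈ D j
      sub j d∈ with j Fin.≟ i
      ... | yes refl = subst (_ ∈_) (sym eq) (there d∈)
      ... | no  _    = d∈
      len′ : ∀ j → k ≤ length (D′ j)
      len′ j with j Fin.≟ i
      ... | yes _ = le
      ... | no  _ = ≤-trans (n≤1+n k) (len j)
      uq′ : ∀ j → Unique (D′ j)
      uq′ j with j Fin.≟ i
      ... | yes _ = uqL
      ... | no  _ = uq j
      inL : ∀ {d} → d ∈ D′ i → d ∈ L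
      inL d∈ with i Fin.≟ i
      ... | yes _ = d∈
      ... | no ne = contradiction refl ne
      avoid : ∀ {d} → d ∈ D′ i → d ≢ u × d ≢ v
      avoid {d} d∈ = (λ e → E⇒≢ ω (nb i (sub i d∈)) (sym e)) , λ e → All≢⇒∉ v≢ (subst (_∈ L) e (inL d∈))

    r-coloured-free : ∀ {ω S} (c : V → Fin r) → (∀ {u v} → u ∈ S → v ∈ S → E ω u v ≡ true → c u ≢ c v) → ¬ Contains ω S
    r-coloured-free c h (φ , inj , mem , edge) =
      notcol ((λ w → c (φ w)) , λ i j a → h (mem i) (mem j) (edge i j a))

-- Enumerations.

∈-concatMap⁻′ : ∀ {A B : Set} (f : A → List B) L {y} → y ∈ concatMap f L → ∃ λ x → x ∈ L × y ∈ f x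
∈-concatMap⁻′ f (x ∷ L) y∈ with ∈-++⁻ (f x) y∈
... | inj₁ h = x , here refl , h
... | inj₂ h = let z , z∈ , h′ = ∈-concatMap⁻′ f L h in z , there z∈ , h′

∈-concatMap⁺′ : ∀ {A B : Set} (f : A → List B) {L x y} → x ∈ L → y ∈ f x → y ∈ concatMap f L
∈-concatMap⁺′ f (here refl) h = ∈-++⁺ˡ h
∈-concatMap⁺′ f {z ∷ L} (there x∈) h = ∈-++⁺ʳ (f z) (∈-concatMap⁺′ f x∈ h)

-- Closes a Pascal recursion: it yields the bound (l + 1)^q for sums of binomial coefficients
-- without evaluating them.
tail-step : ∀ l q → (suc l) ^ suc q + (suc l) ^ q ≤ (suc (suc l)) ^ suc q
tail-step l q = begin
  suc l ^ suc q + suc l ^ q   ≡⟨ +-comm (suc l ^ suc q) _ ⟩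
  suc (suc l) * suc l ^ q     ≤⟨ *-monoʳ-≤ (suc (suc l)) (^-monoˡ-≤ q (n≤1+n (suc l))) ⟩
  suc (suc l) ^ suc q         ∎
  where open ≤-Reasoning

module _ {A : Set} where

  combs : ℕ → List A → List (List A)
  combs zero    L       = [] ∷ []
  combs (suc k) []      = []
  combs (suc k) (x ∷ L) = map (x ∷_) (combs k L) ++ combs (suc k) L

  length-combs≤ : ∀ k L → length (combs k L) ≤ suc (length L) ^ k
  length-combs≤ zero    L       = ≤-refl
  length-combs≤ (suc k) []      = z≤n
  length-combs≤ (suc k) (x ∷ L) = begin
    length (map (x ∷_) (combs k L) ++ combs (suc k) L)
      ≡⟨ ≡-trans (length-++ (map (x ∷_) (combs k L))) (cong (_+ length (combs (suc k) L)) (length-map (x ∷_) (combs k L))) ⟩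
    length (combs k L) + length (combs (suc k) L)
      ≤⟨ +-mono-≤ (length-combs≤ k L) (length-combs≤ (suc k) L) ⟩
    suc (length L) ^ k + suc (length L) ^ suc k
      ≡⟨ +-comm (suc (length L) ^ k) _ ⟩
    suc (length L) ^ suc k + suc (length L) ^ k
      ≤⟨ tail-step (length L) k ⟩
    suc (suc (length L)) ^ suc k ∎
    where open ≤-Reasoning

  length-combs≤2^ : ∀ k L → length (combs k L) ≤ 2 ^ length L
  length-combs≤2^ zero    L       = m^n>0 2 (length L)
  length-combs≤2^ (suc k) []      = z≤n
  length-combs≤2^ (suc k) (x ∷ L) = begin
    length (map (x ∷_) (combs k L) ++ combs (suc k) L)
      ≡⟨ ≡-trans (length-++ (map (x ∷_) (combs k L))) (cong (_+ length (combs (suc k) L)) (length-map (x ∷_) (combs k L))) ⟩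
    length (combs k L) + length (combs (suc k) L)
      ≤⟨ +-mono-≤ (length-combs≤2^ k L) (length-combs≤2^ (suc k) L) ⟩
    2 ^ length L + 2 ^ length L
      ≡⟨ cong (2 ^ length L +_) (sym (+-identityʳ _)) ⟩
    2 ^ suc (length L) ∎
    where open ≤-Reasoning

  combs-length : ∀ k L {M} → M ∈ combs k L → length M ≡ k
  combs-length zero    L       (here refl) = refl
  combs-length (suc k) (x ∷ L) M∈ with ∈-++⁻ (map (x ∷_) (combs k L)) M∈
  ... | inj₂ h = combs-length (suc k) L h
  ... | inj₁ h with ∈-map⁻ (x ∷_) h
  ...   | M′ , h′ , refl = cong suc (combs-length k L h′)

  combs-⊆ : ∀ k L {M} → M ∈ combs k L → ∀ {y} → y ∈ M → y ∈ L
  combs-⊆ zero    L       (here refl) ()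
  combs-⊆ (suc k) (x ∷ L) M∈ y∈ with ∈-++⁻ (map (x ∷_) (combs k L)) M∈
  ... | inj₂ h = there (combs-⊆ (suc k) L h y∈)
  ... | inj₁ h with ∈-map⁻ (x ∷_) h | y∈
  ...   | M′ , h′ , refl | here e    = here e
  ...   | M′ , h′ , refl | there y∈′ = there (combs-⊆ k L h′ y∈′)

  combs-unique : ∀ k {L M} → Unique L → M ∈ combs k L → Unique M
  combs-unique zero    u (here refl) = []
  combs-unique (suc k) {x ∷ L} (a ∷ u) M∈ with ∈-++⁻ (map (x ∷_) (combs k L)) M∈
  ... | inj₂ h = combs-unique (suc k) u h
  ... | inj₁ h with ∈-map⁻ (x ∷_) h
  ...   | M′ , h′ , refl = ∉⇒All≢ M′ (λ x∈ → All≢⇒∉ a (combs-⊆ k L h′ x∈)) ∷ combs-unique k u h′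

  take-keep-combs : ∀ (p : A → Bool) k L → k ≤ length (keep p L) → take k (keep p L) ∈ combs k L
  take-keep-combs p zero    L       le = here refl
  take-keep-combs p (suc k) (x ∷ L) le with p x | take-keep-combs p (suc k) L
  take-keep-combs p (suc k) (x ∷ L) (s≤s le) | true | _ = ∈-++⁺ˡ (∈-map⁺ (x ∷_) (take-keep-combs p k L le))
  ... | false | h = ∈-++⁺ʳ (map (x ∷_) (combs k L)) (h le)

  vecs : ∀ r → List A → List (Vec A r)
  vecs zero    L = [] ∷ []
  vecs (suc r) L = concatMap (λ x → map (x ∷_) (vecs r L)) L

  length-vecs : ∀ r L → length (vecs r L) ≡ length L ^ r
  length-vecs zero    L = refl
  length-vecs (suc r) L = begin
    length (vecs (suc r) L)                              ≡⟨ length-concatMap _ L ⟩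
    ∑ L (λ x → length (map (x ∷_) (vecs r L)))           ≡⟨ ∑-cong L (λ x → length-map (x ∷_) (vecs r L)) ⟩
    ∑ L (λ _ → length (vecs r L))                        ≡⟨ ∑-const L _ ⟩
    length L * length (vecs r L)                         ≡⟨ cong (length L *_) (length-vecs r L) ⟩
    length L ^ suc r                                     ∎
    where open ≡-Reasoning

  ∈-vecs⁺ : ∀ {r L} (v : Vec A r) → (∀ i → lookup v i ∈ L) → v ∈ vecs r L
  ∈-vecs⁺ []      h = here refl
  ∈-vecs⁺ (x ∷ v) h = ∈-concatMap⁺′ _ (h zero) (∈-map⁺ (x ∷_) (∈-vecs⁺ v λ i → h (suc i)))

  ∈-vecs⁻ : ∀ {r L} {v : Vec A r} → v ∈ vecs r L → ∀ i → lookup v i ∈ L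
  ∈-vecs⁻ {suc r} {L} v∈ i with ∈-concatMap⁻′ _ L v∈
  ... | x , x∈ , h with ∈-map⁻ (x ∷_) h
  ∈-vecs⁻ {suc r} {L} v∈ zero    | x , x∈ , h | w , w∈ , refl = x∈
  ∈-vecs⁻ {suc r} {L} v∈ (suc i) | x , x∈ , h | w , w∈ , refl = ∈-vecs⁻ w∈ i

  picks : List A → List (A × List A)
  picks []      = []
  picks (x ∷ L) = (x , L) ∷ map (λ (y , R) → y , x ∷ R) (picks L)

  length-picks : ∀ L → length (picks L) ≡ length L
  length-picks []      = refl
  length-picks (x ∷ L) = cong suc (≡-trans (length-map _ (picks L)) (length-picks L))

  picks-↭ : ∀ L {x R} → (x , R) ∈ picks L → L ↭ x ∷ R
  picks-↭ (y ∷ L) (here refl) = refl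
  picks-↭ (y ∷ L) (there h) with ∈-map⁻ _ h
  ... | (x , R) , h′ , refl = ↭-trans (prep y (picks-↭ L h′)) (swap y x refl)

  ∈-picks : ∀ {L x} → x ∈ L → ∃ λ R → (x , R) ∈ picks L
  ∈-picks {y ∷ L} (here refl) = L , here refl
  ∈-picks {y ∷ L} (there x∈) = let R , h = ∈-picks x∈ in y ∷ R , there (∈-map⁺ _ h)

  -- Ordered selections, paired with what remains. The excess over the number of sets is harmless,
  -- and the remainder is kept because the induction on vertex sets continues with it.
  sel : ℕ → List A → List (List A × List A)
  sel zero    L = ([] , L) ∷ []
  sel (suc j) L = concatMap (λ (x , R) → map (λ (Z , R′) → x ∷ Z , R′) (sel j R)) (picks L)

  sel-↭ : ∀ j L {Z R} → (Z , R) ∈ sel j L → L ↭ Z ++ R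
  sel-↭ zero    L (here refl) = refl
  sel-↭ (suc j) L h with ∈-concatMap⁻′ _ (picks L) h
  ... | (x , R) , x∈ , h₁ with ∈-map⁻ _ h₁
  ...   | (Z , R′) , h₂ , refl = ↭-trans (picks-↭ L x∈) (prep x (sel-↭ j R h₂))

  sel-length : ∀ j L {Z R} → (Z , R) ∈ sel j L → length Z ≡ j
  sel-length zero    L (here refl) = refl
  sel-length (suc j) L h with ∈-concatMap⁻′ _ (picks L) h
  ... | (x , R) , x∈ , h₁ with ∈-map⁻ _ h₁
  ...   | (Z , R′) , h₂ , refl = cong suc (sel-length j R h₂)

  length-sel : ∀ j L → length (sel j L) ≤ length L ^ j
  length-sel zero    L = ≤-refl
  length-sel (suc j) L = begin
    length (sel (suc j) L)
      ≡⟨ length-concatMap _ (picks L) ⟩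
    ∑ (picks L) (λ (x , R) → length (map (λ (Z , R′) → x ∷ Z , R′) (sel j R)))
      ≤⟨ ∑-bound (picks L) (length L ^ j) (λ (x , R) h → begin
           length (map (λ (Z , R′) → x ∷ Z , R′) (sel j R)) ≡⟨ length-map _ (sel j R) ⟩
           length (sel j R)                                 ≤⟨ length-sel j R ⟩
           length R ^ j                                     ≤⟨ ^-monoˡ-≤ j (≤-trans (n≤1+n _) (≤-reflexive (sym (Perm.↭-length (picks-↭ L h))))) ⟩
           length L ^ j                                     ∎) ⟩
    length (picks L) * length L ^ j
      ≡⟨ cong (_* length L ^ j) (length-picks L) ⟩
    length L ^ suc j ∎
    where open ≤-Reasoning

  ∈-sel : ∀ Z {L} → Unique Z → (∀ {x} → x ∈ Z → x ∈ L) → ∃ λ R → (Z , R) ∈ sel (length Z) L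
  ∈-sel []      {L} u h = L , here refl
  ∈-sel (z ∷ Z) {L} (a ∷ u) h with ∈-picks (h (here refl))
  ... | R , p with ∈-sel Z {R} u (λ {x} x∈ → strip (Perm.∈-resp-↭ (picks-↭ L p) (h (there x∈))) (λ { refl → All≢⇒∉ a x∈ }))
    where
    strip : ∀ {y} → y ∈ z ∷ R → ¬ (y ≡ z) → y ∈ R
    strip (here e)   n = contradiction e n
    strip (there y∈) n = y∈
  ... | R′ , q = R′ , ∈-concatMap⁺′ _ p (∈-map⁺ _ q)

  flat : ∀ {ρ} → Vec (List A) ρ → List A
  flat []      = []
  flat (Z ∷ A) = Z ++ flat A

  ∈-flat⁺ : ∀ {ρ} (A : Vec (List A) ρ) i {x} → x ∈ lookup A i → x ∈ flat A
  ∈-flat⁺ (Z ∷ A) zero    x∈ = ∈-++⁺ˡ x∈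
  ∈-flat⁺ (Z ∷ A) (suc i) x∈ = ∈-++⁺ʳ Z (∈-flat⁺ A i x∈)

  ∈-flat⁻ : ∀ {ρ} (A : Vec (List A) ρ) {x} → x ∈ flat A → ∃ λ i → x ∈ lookup A i
  ∈-flat⁻ (Z ∷ A) x∈ with ∈-++⁻ Z x∈
  ... | inj₁ h = zero , h
  ... | inj₂ h = let i , h′ = ∈-flat⁻ A h in suc i , h′

  flat-unique : ∀ {ρ} (A : Vec (List A) ρ) → (∀ i → Unique (lookup A i)) →
    (∀ i j → i ≢ j → ∀ {x} → x ∈ lookup A i → x ∈ lookup A j → ⊥) → Unique (flat A)
  flat-unique []      u d = []
  flat-unique (Z ∷ A) u d = unique-++ (u zero)
    (flat-unique A (λ i → u (suc i)) λ i j ne → d (suc i) (suc j) (ne ∘ Fin.suc-injective))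
    λ x∈ x∈′ → let i , h = ∈-flat⁻ A x∈′ in d zero (suc i) (λ ()) x∈ h

  length-flat : ∀ {ρ} s (A : Vec (List A) ρ) → (∀ i → length (lookup A i) ≡ s) → length (flat A) ≡ ρ * s
  length-flat s []      h = refl
  length-flat s (Z ∷ A) h = ≡-trans (length-++ Z) (cong₂ _+_ (h zero) (length-flat s A λ i → h (suc i)))

  flat-unique-at : ∀ {ρ} (A : Vec (List A) ρ) → Unique (flat A) → ∀ i → Unique (lookup A i)
  flat-unique-at (Z ∷ A) u zero    = unique-++ˡ Z u
  flat-unique-at (Z ∷ A) u (suc i) = flat-unique-at A (unique-++ʳ Z u) i

  flat-disj : ∀ {ρ} (A : Vec (List A) ρ) → Unique (flat A) → ∀ i j → i ≢ j → ∀ {x} → x ∈ lookup A i → x ∈ lookup A j → ⊥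
  flat-disj (Z ∷ A) u zero    zero    ne p q = ne refl
  flat-disj (Z ∷ A) u zero    (suc j) ne p q = unique-disj Z u p (∈-flat⁺ A j q)
  flat-disj (Z ∷ A) u (suc i) zero    ne p q = unique-disj Z u q (∈-flat⁺ A i p)
  flat-disj (Z ∷ A) u (suc i) (suc j) ne p q = flat-disj A (unique-++ʳ Z u) i j (ne ∘ cong suc) p q

  sels : ∀ ρ → ℕ → List A → List (Vec (List A) ρ × List A)
  sels zero    s L = ([] , L) ∷ []
  sels (suc ρ) s L = concatMap (λ (Z , R) → map (λ (A , R′) → Z ∷ A , R′) (sels ρ s R)) (sel s L)

  sels-↭ : ∀ ρ s L {A R} → (A , R) ∈ sels ρ s L → L ↭ flat A ++ R
  sels-↭ zero    s L (here refl) = refl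
  sels-↭ (suc ρ) s L h with ∈-concatMap⁻′ _ (sel s L) h
  ... | (Z , R) , p , h₁ with ∈-map⁻ _ h₁
  ...   | (A , R′) , q , refl = ↭-trans (sel-↭ s L p)
    (↭-trans (Perm.++⁺ˡ Z (sels-↭ ρ s R q)) (↭-reflexive (sym (++-assoc Z (flat A) R′))))

  sels-length : ∀ ρ s L {A R} → (A , R) ∈ sels ρ s L → ∀ i → length (lookup A i) ≡ s
  sels-length (suc ρ) s L h i with ∈-concatMap⁻′ _ (sel s L) h
  ... | (Z , R) , p , h₁ with ∈-map⁻ _ h₁
  sels-length (suc ρ) s L h zero    | (Z , R) , p , h₁ | (A , R′) , q , refl = sel-length s L p
  sels-length (suc ρ) s L h (suc i) | (Z , R) , p , h₁ | (A , R′) , q , refl = sels-length ρ s R q i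

  length-sels : ∀ ρ s L → length (sels ρ s L) ≤ length L ^ (ρ * s)
  length-sels zero    s L = ≤-refl
  length-sels (suc ρ) s L = begin
    length (sels (suc ρ) s L)
      ≡⟨ length-concatMap _ (sel s L) ⟩
    ∑ (sel s L) (λ (Z , R) → length (map (λ (A , R′) → Z ∷ A , R′) (sels ρ s R)))
      ≤⟨ ∑-bound (sel s L) (length L ^ (ρ * s)) (λ (Z , R) h → begin
           length (map (λ (A , R′) → Z ∷ A , R′) (sels ρ s R)) ≡⟨ length-map _ (sels ρ s R) ⟩
           length (sels ρ s R)                                 ≤⟨ length-sels ρ s R ⟩
           length R ^ (ρ * s)                                  ≤⟨ ^-monoˡ-≤ (ρ * s) (begin
             length R              ≤⟨ m≤n+m (length R) (length Z) ⟩
             length Z + length R   ≡⟨ length-++ Z ⟨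
             length (Z ++ R)       ≡⟨ Perm.↭-length (sel-↭ s L h) ⟨
             length L              ∎) ⟩
           length L ^ (ρ * s) ∎) ⟩
    length (sel s L) * length L ^ (ρ * s)
      ≤⟨ *-monoˡ-≤ (length L ^ (ρ * s)) (length-sel s L) ⟩
    length L ^ s * length L ^ (ρ * s)
      ≡⟨ ^-distribˡ-+-* (length L) s (ρ * s) ⟨
    length L ^ (s + ρ * s) ∎
    where open ≤-Reasoning

  ∈-sels : ∀ {ρ} s (A : Vec (List A) ρ) {L} → (∀ i → length (lookup A i) ≡ s) → Unique (flat A) →
    (∀ {x} → x ∈ flat A → x ∈ L) → ∃ λ R → (A , R) ∈ sels ρ s L
  ∈-sels s []      {L} len u h = L , here refl
  ∈-sels s (Z ∷ A) {L} len u h with ∈-sel Z {L} (unique-++ˡ Z u) (λ x∈ → h (∈-++⁺ˡ x∈))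
  ... | R , p with ∈-sels s A {R} (λ i → len (suc i)) (unique-++ʳ Z u) mem
    where
    mem : ∀ {x} → x ∈ flat A → x ∈ R
    mem x∈ with ∈-++⁻ Z (Perm.∈-resp-↭ (sel-↭ (length Z) L p) (h (∈-++⁺ʳ Z x∈)))
    ... | inj₁ x∈Z = ⊥-elim (unique-disj Z u x∈Z x∈)
    ... | inj₂ x∈R = x∈R
  ...   | R′ , q = R′ , ∈-concatMap⁺′ _ (subst (λ s → (Z , R) ∈ sel s L) (len zero) p) (∈-map⁺ _ q)

module Colourings {n r : ℕ} (i₀ : Fin r) where

  _[_↦_] : (Fin n → Fin r) → Fin n → Fin r → Fin n → Fin r
  (c [ x ↦ i ]) y = if does (y Fin.≟ x) then i else c y

  ↦-same : ∀ c x i → (c [ x ↦ i ]) x ≡ i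
  ↦-same c x i rewrite dec-true (x Fin.≟ x) refl = refl

  ↦-other : ∀ c {x} i {y} → y ≢ x → (c [ x ↦ i ]) y ≡ c y
  ↦-other c {x} i {y} ne rewrite dec-false (y Fin.≟ x) ne = refl

  -- One representative per colouring of `S`, with the default colour `i₀` elsewhere. A given
  -- colouring is found in the list only up to its values on `S`, which is what `cols-choice`
  -- expresses.
  cols : List (Fin n) → List (Fin n → Fin r)
  cols []      = (λ _ → i₀) ∷ []
  cols (x ∷ S) = concatMap (λ c → map (c [ x ↦_]) (allFin r)) (cols S)

  cols-choice : ∀ {S} → Unique S → (P : Fin n → Fin r → Set) → (∀ x → x ∈ S → ∃ (P x)) →
    ∃ λ c → c ∈ cols S × (∀ x → x ∈ S → P x (c x))
  cols-choice {[]}    u P h = _ , here refl , λ x ()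
  cols-choice {x ∷ S} (a ∷ u) P h with cols-choice u P (λ y y∈ → h y (there y∈)) | h x (here refl)
  ... | c , c∈ , hc | i , pi = c [ x ↦ i ] , ∈-concatMap⁺′ _ c∈ (∈-map⁺ _ (∈-allFin i)) , val
    where
    val : ∀ y → y ∈ x ∷ S → P y ((c [ x ↦ i ]) y)
    val y (here refl) = subst (P y) (sym (↦-same c y i)) pi
    val y (there y∈)  = subst (P y) (sym (↦-other c i λ e → All≢⇒∉ a (subst (_∈ S) e y∈))) (hc y y∈)

  -- Expanding the product on the right chooses one colour at each vertex. It counts colourings that
  -- satisfy a condition at each vertex separately.
  ∑-cols : ∀ {S} → Unique S → (g : Fin n → Fin r → ℕ) →
    ∑ (cols S) (λ c → ∏ S (λ x → g x (c x))) ≡ ∏ S (λ x → ∑ (allFin r) (g x))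
  ∑-cols {[]}    u g = refl
  ∑-cols {x ∷ S} (a ∷ u) g = begin
    ∑ (cols (x ∷ S)) (λ c → g x (c x) * ∏ S (λ y → g y (c y)))
      ≡⟨ ∑-concatMap _ (cols S) _ ⟩
    ∑ (cols S) (λ c → ∑ (map (c [ x ↦_]) (allFin r)) (λ c → g x (c x) * ∏ S (λ y → g y (c y))))
      ≡⟨ ∑-cong (cols S) (λ c → ∑-map (c [ x ↦_]) (allFin r) _) ⟩
    ∑ (cols S) (λ c → ∑ (allFin r) (λ i → g x ((c [ x ↦ i ]) x) * ∏ S (λ y → g y ((c [ x ↦ i ]) y))))
      ≡⟨ ∑-cong (cols S) (λ c → ∑-cong (allFin r) λ i → cong₂ _*_ (cong (g x) (↦-same c x i))
           (∏-cong∈ S λ y y∈ → cong (g y) (↦-other c i λ e → All≢⇒∉ a (subst (_∈ S) e y∈)))) ⟩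
    ∑ (cols S) (λ c → ∑ (allFin r) (λ i → g x i * ∏ S (λ y → g y (c y))))
      ≡⟨ ∑-cong (cols S) (λ c → ∑-*ʳ (allFin r) _ (g x)) ⟩
    ∑ (cols S) (λ c → ∑ (allFin r) (g x) * ∏ S (λ y → g y (c y)))
      ≡⟨ ∑-*ˡ (cols S) (∑ (allFin r) (g x)) _ ⟩
    ∑ (allFin r) (g x) * ∑ (cols S) (λ c → ∏ S (λ y → g y (c y)))
      ≡⟨ cong (∑ (allFin r) (g x) *_) (∑-cols u g) ⟩
    ∏ (x ∷ S) (λ y → ∑ (allFin r) (g y)) ∎
    where open ≡-Reasoning

  length-cols : ∀ {S} → Unique S → length (cols S) ≡ r ^ length S
  length-cols {S} u = begin
    length (cols S)                                     ≡⟨ *-identityʳ _ ⟨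
    length (cols S) * 1                                 ≡⟨ ∑-const (cols S) 1 ⟨
    ∑ (cols S) (λ _ → 1)                                ≡⟨ ∑-cong (cols S) (λ c → sym (∏-one S λ _ _ → refl)) ⟩
    ∑ (cols S) (λ c → ∏ S (λ x → 1))                    ≡⟨ ∑-cols u (λ _ _ → 1) ⟩
    ∏ S (λ x → ∑ (allFin r) (λ _ → 1))                  ≡⟨ ∏-const S _ ⟩
    ∑ (allFin r) (λ _ → 1) ^ length S                   ≡⟨ cong (_^ length S) (≡-trans (∑-const (allFin r) 1) (≡-trans (*-identityʳ _) (length-tabulate {n = r} id))) ⟩
    r ^ length S                                        ∎
    where open ≡-Reasoning

-- Exponential-moment bounds for the bits between a removed set and the rest.

<ᵇ-true : ∀ {m n} → m < n → (m <ᵇ n) ≡ true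
<ᵇ-true {m} {n} p with m <ᵇ n | <⇒<ᵇ p
... | true | _ = refl

<ᵇ-true⁻ : ∀ {m n} → (m <ᵇ n) ≡ true → m < n
<ᵇ-true⁻ {m} {n} p = <ᵇ⇒< m n (subst T (sym p) _)

<ᵇ-false⁻ : ∀ {m n} → (m <ᵇ n) ≡ false → n ≤ m
<ᵇ-false⁻ {m} {n} p with n ≤? m
... | yes q = q
... | no ¬q with ≡-trans (sym (<ᵇ-true {m} {n} (≰⇒> ¬q))) p
...   | ()

^-distribʳ-* : ∀ k a b → (a * b) ^ k ≡ a ^ k * b ^ k
^-distribʳ-* zero    a b = refl
^-distribʳ-* (suc k) a b = ≡-trans (cong (a * b *_) (^-distribʳ-* k a b)) (lem a b (a ^ k) (b ^ k))
  where
  lem : ∀ a b c d → a * b * (c * d) ≡ a * c * (b * d)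
  lem = solve-∀

cnt-split : ∀ {A : Set} (p : A → Bool) L → cnt p L + cnt (not ∘ p) L ≡ length L
cnt-split p L = ≡-trans (sym (∑-+ L _ _)) (≡-trans (∑-cong L λ x → lem (p x)) (≡-trans (∑-const L 1) (*-identityʳ _)))
  where
  lem : ∀ b → 𝟙 b + 𝟙 (not b) ≡ 1
  lem true  = refl
  lem false = refl

module Rows (n : ℕ) where

  open Edges n

  𝔼-cong∈ : ∀ Q ω {X Y} → (∀ ω′ → ω′ ∈ enum Q ω → X ω′ ≡ Y ω′) → 𝔼 Q ω X ≡ 𝔼 Q ω Y
  𝔼-cong∈ Q ω h = ∑-cong∈ (enum Q ω) h

  enum-off : ∀ Q ω {ω′ e} → e ∉ Q → ω′ ∈ enum Q ω → lookup ω′ e ≡ lookup ω e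
  enum-off []      ω e∉ (here refl) = refl
  enum-off (f ∷ Q) ω e∉ ω∈ with ∈-++⁻ (enum Q (ω [ f ]≔ false)) ω∈
  ... | inj₁ h = ≡-trans (enum-off Q _ (e∉ ∘ there) h) (lookup∘update′ (λ e → e∉ (here e)) ω false)
  ... | inj₂ h = ≡-trans (enum-off Q _ (e∉ ∘ there) h) (lookup∘update′ (λ e → e∉ (here e)) ω true)

  deg : Ω → V → List V → ℕ
  deg ω x B = cnt (E ω x) B

  deg-local : ∀ {ω ω′ x} B → (∀ z → z ∈ B → E ω x z ≡ E ω′ x z) → deg ω x B ≡ deg ω′ x B
  deg-local B h = ∑-cong∈ B λ z z∈ → cong 𝟙 (h z z∈)

  -- Counts the subsets of `B` with fewer than `q` elements: the bit of the first vertex gives a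
  -- Pascal recursion. The result is polynomial in the size of `B`, against 2^|B| settings of the
  -- row.
  tail : ∀ x B q ω → Unique B → x ∉ B → 𝔼 (map (key x) B) ω (λ ω → 𝟙 (deg ω x B <ᵇ q)) ≤ suc (length B) ^ q
  tail x B zero ω u x∉ = ≤-trans (𝔼-mono (map (key x) B) ω {Y = λ _ → 0} λ _ → ≤-refl)
    (≤-trans (≤-reflexive (∑-zero (enum (map (key x) B) ω))) z≤n)
  tail x [] (suc q) ω u x∉ = m^n>0 1 (suc q)
  tail x (b ∷ B) (suc q) ω (a ∷ u) x∉ = begin
    𝔼 (key x b ∷ K) ω (λ ω → 𝟙 (𝟙 (E ω x b) + deg ω x B <ᵇ suc q))
      ≡⟨ 𝔼-∷ (key x b) K ω _ ⟩
    𝔼 K (ω [ key x b ]≔ false) _ + 𝔼 K (ω [ key x b ]≔ true) _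
      ≡⟨ cong₂ _+_ (𝔼-cong∈ K _ λ ω′ h → cong (λ z → 𝟙 (𝟙 z + deg ω′ x B <ᵇ suc q)) (val false h))
                   (𝔼-cong∈ K _ λ ω′ h → cong (λ z → 𝟙 (𝟙 z + deg ω′ x B <ᵇ suc q)) (val true h)) ⟩
    𝔼 K (ω [ key x b ]≔ false) (λ ω → 𝟙 (deg ω x B <ᵇ suc q)) + 𝔼 K (ω [ key x b ]≔ true) (λ ω → 𝟙 (deg ω x B <ᵇ q))
      ≤⟨ +-mono-≤ (tail x B (suc q) _ u (x∉ ∘ there)) (tail x B q _ u (x∉ ∘ there)) ⟩
    suc (length B) ^ suc q + suc (length B) ^ q
      ≤⟨ tail-step (length B) q ⟩
    suc (suc (length B)) ^ suc q ∎
    where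
    open ≤-Reasoning
    K = map (key x) B
    off : key x b ∉ K
    off e∈ = All≢⇒∉ (AllPairs.head (unique-row x (a ∷ u))) e∈
    val : ∀ c {ω′} → ω′ ∈ enum K (ω [ key x b ]≔ c) → E ω′ x b ≡ c
    val c {ω′} h = ≡-trans (E-≢ ω′ λ e → x∉ (here e)) (≡-trans (enum-off K _ off h) (lookup∘update (key x b) ω c))

  -- The degrees into the disjoint lists `B₁` and `B₂` read different bits of the row, and the other
  -- `d` bits are free.
  tail₂ : ∀ x Z B₁ B₂ q θ d ω → Unique (B₁ ++ B₂) → (∀ {z} → z ∈ B₁ ++ B₂ → z ∈ Z) → x ∉ Z →
    length Z ≡ length B₁ + length B₂ + d →
    𝔼 (map (key x) Z) ω (λ ω → 𝟙 (deg ω x B₁ <ᵇ q) * 𝟙 (deg ω x B₂ <ᵇ θ)) ≤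
      suc (length B₁) ^ q * suc (length B₂) ^ θ * 2 ^ d
  tail₂ x Z B₁ B₂ q θ d ω u sub x∉ len with sub-↭ u sub
  ... | R , p = begin
    𝔼 (map (key x) Z) ω f
      ≡⟨ 𝔼-↭ (↭-trans (Perm.map⁺ (key x) p) (↭-trans (↭-reflexive (map-++ (key x) (B₁ ++ B₂) R))
           (↭-trans (Perm.++-comm (map (key x) (B₁ ++ B₂)) (map (key x) R))
             (↭-reflexive (cong (map (key x) R ++_) (map-++ (key x) B₁ B₂)))))) ω f ⟩
    𝔼 (KR ++ (K₁ ++ K₂)) ω f
      ≡⟨ 𝔼-++ KR (K₁ ++ K₂) ω f ⟩
    𝔼 KR ω (λ ω → 𝔼 (K₁ ++ K₂) ω f)
      ≤⟨ 𝔼-bound KR ω (suc (length B₁) ^ q * suc (length B₂) ^ θ) inner ⟩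
    2 ^ length KR * (suc (length B₁) ^ q * suc (length B₂) ^ θ)
      ≡⟨ *-comm (2 ^ length KR) _ ⟩
    suc (length B₁) ^ q * suc (length B₂) ^ θ * 2 ^ length KR
      ≡⟨ cong (λ z → suc (length B₁) ^ q * suc (length B₂) ^ θ * 2 ^ z) lenR ⟩
    suc (length B₁) ^ q * suc (length B₂) ^ θ * 2 ^ d ∎
    where
    open ≤-Reasoning
    f₁ f₂ f : Ω → ℕ
    f₁ ω = 𝟙 (deg ω x B₁ <ᵇ q)
    f₂ ω = 𝟙 (deg ω x B₂ <ᵇ θ)
    f ω = f₁ ω * f₂ ω
    K₁ = map (key x) B₁
    K₂ = map (key x) B₂
    KR = map (key x) R
    lenR : length KR ≡ d
    lenR = ≡-trans (length-map (key x) R) (+-cancelˡ-≡ (length B₁ + length B₂) _ _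
      (≡-trans (sym (≡-trans (Perm.↭-length p) (≡-trans (length-++ (B₁ ++ B₂)) (cong (_+ length R) (length-++ B₁))))) len))
    f₁⟂ : f₁ ⟂ K₂
    f₁⟂ ω e b e∈ with ∈-map⁻ (key x) e∈
    ... | z , z∈ , refl = cong (λ t → 𝟙 (t <ᵇ q)) (deg-local {ω [ key x z ]≔ b} {ω} B₁ λ y y∈ → E-upd ω _ b x y λ eq → apart y∈ (key-inj eq))
      where
      apart : ∀ {y} → y ∈ B₁ → (x ≡ x × z ≡ y) ⊎ (x ≡ y × z ≡ x) → ⊥
      apart y∈ (inj₁ (_ , refl)) = unique-disj B₁ u y∈ z∈
      apart y∈ (inj₂ (refl , refl)) = x∉ (sub (∈-++⁺ˡ y∈))
    inner : ∀ ω → 𝔼 (K₁ ++ K₂) ω f ≤ suc (length B₁) ^ q * suc (length B₂) ^ θ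
    inner ω = begin
      𝔼 (K₁ ++ K₂) ω f                     ≡⟨ 𝔼-++ K₁ K₂ ω f ⟩
      𝔼 K₁ ω (λ ω → 𝔼 K₂ ω f)              ≡⟨ 𝔼-cong K₁ ω (λ ω → 𝔼-pull K₂ ω f₂ f₁ f₁⟂) ⟩
      𝔼 K₁ ω (λ ω → f₁ ω * 𝔼 K₂ ω f₂)      ≤⟨ 𝔼-mono K₁ ω (λ ω → *-monoʳ-≤ (f₁ ω)
          (tail x B₂ θ ω (unique-++ʳ B₁ u) λ h → x∉ (sub (∈-++⁺ʳ B₁ h)))) ⟩
      𝔼 K₁ ω (λ ω → f₁ ω * suc (length B₂) ^ θ) ≡⟨ ∑-*ʳ (enum K₁ ω) (suc (length B₂) ^ θ) f₁ ⟩
      𝔼 K₁ ω f₁ * suc (length B₂) ^ θ      ≤⟨ *-monoˡ-≤ (suc (length B₂) ^ θ)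
          (tail x B₁ q ω (unique-++ˡ B₁ u) λ h → x∉ (sub (∈-++⁺ˡ h))) ⟩
      suc (length B₁) ^ q * suc (length B₂) ^ θ ∎

  tail₁ : ∀ x Z B q d ω → Unique B → (∀ {z} → z ∈ B → z ∈ Z) → x ∉ Z → length Z ≡ length B + d →
    𝔼 (map (key x) Z) ω (λ ω → 𝟙 (deg ω x B <ᵇ q)) ≤ suc (length B) ^ q * 2 ^ d
  tail₁ x Z B q d ω u sub x∉ len = begin
    𝔼 (map (key x) Z) ω (λ ω → 𝟙 (deg ω x B <ᵇ q))
      ≡⟨ 𝔼-cong (map (key x) Z) ω (λ ω → sym (*-identityʳ _)) ⟩
    𝔼 (map (key x) Z) ω (λ ω → 𝟙 (deg ω x B <ᵇ q) * 𝟙 (deg ω x [] <ᵇ 1))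
      ≤⟨ tail₂ x Z B [] q 1 d ω (subst Unique (sym (++-identityʳ B)) u) (λ h → sub (subst (_ ∈_) (++-identityʳ B) h)) x∉
           (≡-trans len (cong (_+ d) (sym (+-identityʳ _)))) ⟩
    suc (length B) ^ q * 1 * 2 ^ d
      ≡⟨ cong (_* 2 ^ d) (*-identityʳ (suc (length B) ^ q)) ⟩
    suc (length B) ^ q * 2 ^ d ∎
    where open ≤-Reasoning

  module Row (Z R : List V) (uq : Unique (Z ++ R)) where

    RowLocal : (V → Ω → ℕ) → Set
    RowLocal w = ∀ x ω ω′ → (∀ z → z ∈ Z → E ω x z ≡ E ω′ x z) → w x ω ≡ w x ω′

    row-∉ : ∀ {x} → x ∈ R → x ∉ Z
    row-∉ x∈ z∈ = unique-disj Z uq z∈ x∈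

    rows⟂ : ∀ w → RowLocal w → AllPairs (λ x y → w x ⟂ map (key y) Z) R
    rows⟂ w loc = go R (unique-++ʳ Z uq) id
      where
      go : ∀ L → Unique L → (∀ {x} → x ∈ L → x ∈ R) → AllPairs (λ x y → w x ⟂ map (key y) Z) L
      go []      u sub = []
      go (x ∷ L) (a ∷ u) sub = All.tabulate step ∷ go L u (sub ∘ there)
        where
        step : ∀ {y} → y ∈ L → w x ⟂ map (key y) Z
        step {y} y∈ ω e b e∈ with ∈-map⁻ (key y) e∈
        ... | z , z∈ , refl = loc x _ ω λ z′ z′∈ → E-upd ω _ b x z′ λ eq → apart z′∈ (key-inj eq)
          where
          apart : ∀ {z′} → z′ ∈ Z → (y ≡ x × z ≡ z′) ⊎ (y ≡ z′ × z ≡ x) → ⊥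
          apart _   (inj₁ (refl , _)) = All≢⇒∉ a y∈
          apart z′∈ (inj₂ (refl , _)) = row-∉ (sub (there y∈)) z′∈

    -- Markov's inequality for a product of row weights, which behave independently because the rows
    -- use distinct bits; `M` and `K` carry the denominators. The estimates for `ev₁`, `ev₂` and
    -- `ev₄` are instances.
    markov : ∀ (w : V → Ω → ℕ) (b : V → ℕ) (ev : Ω → ℕ) M K → RowLocal w →
      (∀ x → x ∈ R → ∀ ω → 𝔼 (map (key x) Z) ω (w x) ≤ b x) →
      (∀ ω → M * ev ω ≤ K * ∏ R (λ x → w x ω)) →
      ∀ ω → M * 𝔼 (cross Z R) ω ev ≤ K * ∏ R b
    markov w b ev M K loc hb hev ω = begin
      M * 𝔼 (cross Z R) ω ev                                ≡⟨ ∑-*ˡ (enum (cross Z R) ω) M ev ⟨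
      𝔼 (cross Z R) ω (λ ω → M * ev ω)                      ≤⟨ 𝔼-mono (cross Z R) ω hev ⟩
      𝔼 (cross Z R) ω (λ ω → K * ∏ R (λ x → w x ω))         ≡⟨ ∑-*ˡ (enum (cross Z R) ω) K _ ⟩
      K * 𝔼 (cross Z R) ω (λ ω → ∏ R (λ x → w x ω))         ≤⟨ *-monoʳ-≤ K (𝔼-∏ R _ w b (rows⟂ w loc) hb ω) ⟩
      K * ∏ R b ∎
      where open ≤-Reasoning

  low : ∀ {ρ} → ℕ → Vec (List V) ρ → Ω → V → Bool
  low q A ω x = does (Fin.any? λ i → deg ω x (lookup A i) <? q)

  low⁻ : ∀ {ρ} q (A : Vec (List V) ρ) ω x → low q A ω x ≡ true → ∃ λ i → deg ω x (lookup A i) < q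
  low⁻ q A ω x h with Fin.any? (λ i → deg ω x (lookup A i) <? q)
  ... | yes p = p

  low⁺ : ∀ {ρ} q (A : Vec (List V) ρ) ω x i → deg ω x (lookup A i) < q → low q A ω x ≡ true
  low⁺ q A ω x i p = dec-true (Fin.any? λ i → deg ω x (lookup A i) <? q) (i , p)

  low-false⁻ : ∀ {ρ} q (A : Vec (List V) ρ) ω x → low q A ω x ≡ false → ∀ i → q ≤ deg ω x (lookup A i)
  low-false⁻ q A ω x h i with q ≤? deg ω x (lookup A i)
  ... | yes p = p
  ... | no ¬p with ≡-trans (sym h) (low⁺ q A ω x i (≰⇒> ¬p))
  ...   | ()

  𝟙low≤ : ∀ {ρ} q (A : Vec (List V) ρ) ω x → 𝟙 (low q A ω x) ≤ ∑ (allFin ρ) (λ i → 𝟙 (deg ω x (lookup A i) <ᵇ q))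
  𝟙low≤ q A ω x with low q A ω x in eq
  ... | false = z≤n
  ... | true  = let i , p = low⁻ q A ω x eq in
    ≤-trans (≤-reflexive (cong 𝟙 (sym (<ᵇ-true p)))) (∑-∈ _ (∈-allFin i))

  low-local : ∀ {ρ} q (A : Vec (List V) ρ) {ω ω′ x} → (∀ z → z ∈ flat A → E ω x z ≡ E ω′ x z) → low q A ω x ≡ low q A ω′ x
  low-local q A {ω} {ω′} {x} h with low q A ω x in e | low q A ω′ x in e′
  ... | true  | true  = refl
  ... | false | false = refl
  ... | true  | false = let i , p = low⁻ q A ω x e in
    contradiction (subst (_< q) (deg-local (lookup A i) λ z z∈ → h z (∈-flat⁺ A i z∈)) p) (≤⇒≯ (low-false⁻ q A ω′ x e′ i))
  ... | false | true  = let i , p = low⁻ q A ω′ x e′ in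
    contradiction (subst (_< q) (sym (deg-local (lookup A i) λ z z∈ → h z (∈-flat⁺ A i z∈))) p) (≤⇒≯ (low-false⁻ q A ω x e i))

  rare : ∀ {ρ} → ℕ → Vec (List V) ρ → Fin ρ → List V → ℕ → Ω → V → Bool
  rare q A i B θ ω x = (deg ω x (lookup A i) <ᵇ q) ∧ (deg ω x B <ᵇ θ)

  -- Few vertices have q neighbours in every part.
  ev₁ : ∀ {ρ} → ℕ → Vec (List V) ρ → List V → ℕ → Ω → ℕ
  ev₁ q A R N ω = 𝟙 (cnt (λ x → not (low q A ω x)) R <ᵇ N)

  -- Every vertex has few neighbours in some part, and a proportion 1/e of them has few in A i and in B.
  ev₂ : ∀ {ρ} → ℕ → Vec (List V) ρ → List V → ℕ → ℕ → Fin ρ → List V → ℕ → Ω → ℕ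
  ev₂ q A R m e i B θ ω = ∏ R (λ x → 𝟙 (low q A ω x)) * 𝟙 (m <ᵇ suc (e * cnt (rare q A i B θ ω) R))

  module Piece {ρ′ s : ℕ} (A : Vec (List V) (suc ρ′)) (R : List V) (uq : Unique (flat A ++ R))
               (len : ∀ i → length (lookup A i) ≡ s) (q : ℕ) where

    open Row (flat A) R uq

    private
      ρ = suc ρ′
      Z = flat A
      uZ : Unique Z
      uZ = unique-++ˡ Z uq
      lenZ : length Z ≡ s + ρ′ * s
      lenZ = length-flat s A len

    -- In a low row one part admits only polynomially many patterns while the other `ρ′` parts are
    -- free: about 2^(ρ′s) rows out of 2^(ρs).
    low-sum : ∀ x → x ∈ R → ∀ ω →
      𝔼 (map (key x) Z) ω (λ ω → ∑ (allFin ρ) (λ i → 𝟙 (deg ω x (lookup A i) <ᵇ q))) ≤ ρ * (suc s ^ q * 2 ^ (ρ′ * s))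
    low-sum x x∈ ω = begin
      𝔼 (map (key x) Z) ω (λ ω → ∑ (allFin ρ) (λ i → 𝟙 (deg ω x (lookup A i) <ᵇ q)))
        ≡⟨ ∑-swap (enum (map (key x) Z) ω) (allFin ρ) _ ⟩
      ∑ (allFin ρ) (λ i → 𝔼 (map (key x) Z) ω (λ ω → 𝟙 (deg ω x (lookup A i) <ᵇ q)))
        ≤⟨ ∑-bound (allFin ρ) (suc s ^ q * 2 ^ (ρ′ * s)) (λ i _ → ≤-trans
             (tail₁ x Z (lookup A i) q (ρ′ * s) ω (flat-unique-at A uZ i) (∈-flat⁺ A i) (row-∉ x∈)
               (≡-trans lenZ (cong (_+ ρ′ * s) (sym (len i)))))
             (≤-reflexive (cong (λ t → suc t ^ q * 2 ^ (ρ′ * s)) (len i)))) ⟩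
      length (allFin ρ) * (suc s ^ q * 2 ^ (ρ′ * s))
        ≡⟨ cong (_* (suc s ^ q * 2 ^ (ρ′ * s))) (length-tabulate {n = ρ} id) ⟩
      ρ * (suc s ^ q * 2 ^ (ρ′ * s)) ∎
      where open ≤-Reasoning

    -- The weight of a low row is the number `Λ` of all rows. So the rows that are not low add just
    -- one `Λ` to the weighted sum, and the fewer than `N` exceptional vertices cost a factor `Λ`
    -- each.
    ev₁-bound : ∀ N ω → 𝔼 (cross Z R) ω (ev₁ q A R N) ≤ 2 ^ (ρ * s * N) * suc (ρ * (suc s ^ q * 2 ^ (ρ′ * s))) ^ length R
    ev₁-bound N ω = *-cancelˡ-≤ (Λ ^ length R) {{m^n≢0 Λ (length R) {{m^n≢0 2 (ρ * s)}}}} (begin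
      Λ ^ length R * 𝔼 (cross Z R) ω (ev₁ q A R N)
        ≤⟨ markov w (λ _ → Λ * suc u) (ev₁ q A R N) (Λ ^ length R) (Λ ^ N) wloc wb wev ω ⟩
      Λ ^ N * ∏ R (λ _ → Λ * suc u)
        ≡⟨ cong (Λ ^ N *_) (≡-trans (∏-const R (Λ * suc u)) (^-distribʳ-* (length R) Λ (suc u))) ⟩
      Λ ^ N * (Λ ^ length R * suc u ^ length R)
        ≡⟨ lem (Λ ^ N) (Λ ^ length R) _ ⟩
      Λ ^ length R * (Λ ^ N * suc u ^ length R)
        ≡⟨ cong (λ t → Λ ^ length R * (t * suc u ^ length R)) (^-*-assoc 2 (ρ * s) N) ⟩
      Λ ^ length R * (2 ^ (ρ * s * N) * suc u ^ length R) ∎)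
      where
      open ≤-Reasoning
      Λ = 2 ^ (ρ * s)
      instance
        Λ≢0 : NonZero Λ
        Λ≢0 = m^n≢0 2 (ρ * s)
      u = ρ * (suc s ^ q * 2 ^ (ρ′ * s))
      lem : ∀ a b c → a * (b * c) ≡ b * (a * c)
      lem = solve-∀
      w : V → Ω → ℕ
      w x ω = Λ ^ 𝟙 (low q A ω x)
      wloc : RowLocal w
      wloc x ω ω′ h = cong (λ t → Λ ^ 𝟙 t) (low-local q A h)
      w≤ : ∀ x ω → w x ω ≤ Λ * ∑ (allFin ρ) (λ i → 𝟙 (deg ω x (lookup A i) <ᵇ q)) + 1
      w≤ x ω with low q A ω x | 𝟙low≤ q A ω x
      ... | true  | h = ≤-trans (*-monoʳ-≤ Λ h) (m≤m+n _ 1)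
      ... | false | h = m≤n+m 1 _
      wb : ∀ x → x ∈ R → ∀ ω → 𝔼 (map (key x) Z) ω (w x) ≤ Λ * suc u
      wb x x∈ ω = begin
        𝔼 K ω (w x)                          ≤⟨ 𝔼-mono K ω (w≤ x) ⟩
        𝔼 K ω (λ ω → Λ * g ω + 1)            ≡⟨ ∑-+ (enum K ω) (λ ω → Λ * g ω) (λ _ → 1) ⟩
        𝔼 K ω (λ ω → Λ * g ω) + 𝔼 K ω (λ _ → 1)
          ≡⟨ cong₂ _+_ (∑-*ˡ (enum K ω) Λ g) (≡-trans (𝔼-const K ω 1) (≡-trans (*-identityʳ _)
               (cong (2 ^_) (≡-trans (length-map (key x) Z) lenZ)))) ⟩
        Λ * 𝔼 K ω g + Λ                      ≤⟨ +-monoˡ-≤ Λ (*-monoʳ-≤ Λ (low-sum x x∈ ω)) ⟩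
        Λ * u + Λ                            ≡⟨ +-comm (Λ * u) Λ ⟩
        Λ + Λ * u                            ≡⟨ *-suc Λ u ⟨
        Λ * suc u ∎
        where
        K = map (key x) Z
        g : Ω → ℕ
        g ω = ∑ (allFin ρ) (λ i → 𝟙 (deg ω x (lookup A i) <ᵇ q))
      wev : ∀ ω → Λ ^ length R * ev₁ q A R N ω ≤ Λ ^ N * ∏ R (λ x → w x ω)
      wev ω with cnt (λ x → not (low q A ω x)) R <ᵇ N in eq
      ... | false = ≤-trans (≤-reflexive (*-zeroʳ (Λ ^ length R))) z≤n
      ... | true  = begin
        Λ ^ length R * 1 ≡⟨ *-identityʳ _ ⟩
        Λ ^ length R     ≡⟨ cong (Λ ^_) (cnt-split (low q A ω) R) ⟨
        Λ ^ (cnt (low q A ω) R + cnt (not ∘ low q A ω) R)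
          ≤⟨ ^-monoʳ-≤ Λ (+-monoʳ-≤ (cnt (low q A ω) R) (<⇒≤ (<ᵇ-true⁻ {cnt (not ∘ low q A ω) R} {N} eq))) ⟩
        Λ ^ (cnt (low q A ω) R + N)   ≡⟨ ≡-trans (cong (Λ ^_) (+-comm (cnt (low q A ω) R) N)) (^-distribˡ-+-* Λ N (cnt (low q A ω) R)) ⟩
        Λ ^ N * Λ ^ cnt (low q A ω) R ≡⟨ cong (Λ ^ N *_) (∏-pow R Λ (λ x → 𝟙 (low q A ω x))) ⟨
        Λ ^ N * ∏ R (λ x → w x ω) ∎

    -- The low rows of a vertex contribute at most 2^(D+ρ′s). By `hB` the weight `Λ` on rare rows at
    -- most doubles this, while m/e rare vertices bring the product of the weights to 2^((D+2)m).
    -- The difference of the exponents D + 2 and D + 1 is the gain 2^m.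
    ev₂-bound : ∀ m e D i j B θ → i ≢ j → Unique B → (∀ {z} → z ∈ B → z ∈ lookup A j) → length B ≤ ρ′ * s →
      length R ≤ m → ρ * suc s ^ q ≤ 2 ^ D → suc (length B) ^ θ * 2 ^ (e * (D + 2)) ≤ 2 ^ length B →
      ∀ ω → 2 ^ m * 𝔼 (cross Z R) ω (ev₂ q A R m e i B θ) ≤ 2 ^ (ρ′ * s * m)
    ev₂-bound m e D i j B θ i≢j uB subB lenB lenR hD hB ω =
      *-cancelˡ-≤ (2 ^ (suc D * m)) {{m^n≢0 2 (suc D * m)}} (begin
      2 ^ (suc D * m) * (2 ^ m * 𝔼 (cross Z R) ω ev)
        ≡⟨ *-assoc (2 ^ (suc D * m)) (2 ^ m) _ ⟨
      2 ^ (suc D * m) * 2 ^ m * 𝔼 (cross Z R) ω ev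
        ≡⟨ cong (_* 𝔼 (cross Z R) ω ev) (≡-trans (sym (^-distribˡ-+-* 2 (suc D * m) m)) (cong (2 ^_) (lem₁ D m))) ⟩
      2 ^ ((D + 2) * m) * 𝔼 (cross Z R) ω ev
        ≤⟨ markov w (λ _ → 2 ^ (suc D + ρ′ * s)) ev (2 ^ ((D + 2) * m)) 1 wloc wb wev ω ⟩
      1 * ∏ R (λ _ → 2 ^ (suc D + ρ′ * s))
        ≡⟨ ≡-trans (*-identityˡ _) (≡-trans (∏-const R _) (^-*-assoc 2 (suc D + ρ′ * s) (length R))) ⟩
      2 ^ ((suc D + ρ′ * s) * length R)
        ≤⟨ ^-monoʳ-≤ 2 (*-monoʳ-≤ (suc D + ρ′ * s) lenR) ⟩
      2 ^ ((suc D + ρ′ * s) * m)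
        ≡⟨ cong (2 ^_) (*-distribʳ-+ m (suc D) (ρ′ * s)) ⟩
      2 ^ (suc D * m + ρ′ * s * m)
        ≡⟨ ^-distribˡ-+-* 2 (suc D * m) (ρ′ * s * m) ⟩
      2 ^ (suc D * m) * 2 ^ (ρ′ * s * m) ∎)
      where
      open ≤-Reasoning
      ev = ev₂ q A R m e i B θ
      lem₁ : ∀ D m → suc D * m + m ≡ (D + 2) * m
      lem₁ = solve-∀
      Λ = 2 ^ (e * (D + 2))
      w : V → Ω → ℕ
      w x ω = 𝟙 (low q A ω x) * Λ ^ 𝟙 (rare q A i B θ ω x)
      wloc : RowLocal w
      wloc x ω ω′ h = cong₂ (λ a b → 𝟙 a * Λ ^ 𝟙 b) (low-local q A h)
        (cong₂ (λ a b → (a <ᵇ q) ∧ (b <ᵇ θ)) (deg-local (lookup A i) λ z z∈ → h z (∈-flat⁺ A i z∈))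
                                              (deg-local B λ z z∈ → h z (∈-flat⁺ A j (subB z∈))))
      w≤ : ∀ x ω → w x ω ≤ ∑ (allFin ρ) (λ i → 𝟙 (deg ω x (lookup A i) <ᵇ q)) +
        Λ * (𝟙 (deg ω x (lookup A i) <ᵇ q) * 𝟙 (deg ω x B <ᵇ θ))
      w≤ x ω with low q A ω x | 𝟙low≤ q A ω x | deg ω x (lookup A i) <ᵇ q | deg ω x B <ᵇ θ
      ... | false | _ | _     | _     = z≤n
      ... | true  | h | true  | true  = ≤-trans (≤-reflexive (+-identityʳ (Λ * 1))) (m≤n+m (Λ * 1) _)
      ... | true  | h | true  | false = ≤-trans h (m≤m+n _ _)
      ... | true  | h | false | _     = ≤-trans h (m≤m+n _ _)
      wb : ∀ x → x ∈ R → ∀ ω → 𝔼 (map (key x) Z) ω (w x) ≤ 2 ^ (suc D + ρ′ * s)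
      wb x x∈ ω = begin
        𝔼 K ω (w x)                                    ≤⟨ 𝔼-mono K ω (w≤ x) ⟩
        𝔼 K ω (λ ω → g ω + Λ * h ω)                    ≡⟨ ∑-+ (enum K ω) g _ ⟩
        𝔼 K ω g + 𝔼 K ω (λ ω → Λ * h ω)                ≡⟨ cong (𝔼 K ω g +_) (∑-*ˡ (enum K ω) Λ h) ⟩
        𝔼 K ω g + Λ * 𝔼 K ω h                          ≤⟨ +-mono-≤ first second ⟩
        2 ^ (D + ρ′ * s) + 2 ^ (D + ρ′ * s)            ≡⟨ cong (2 ^ (D + ρ′ * s) +_) (sym (+-identityʳ _)) ⟩
        2 ^ (suc D + ρ′ * s) ∎
        where
        K = map (key x) Z
        g h : Ω → ℕ
        g ω = ∑ (allFin ρ) (λ i → 𝟙 (deg ω x (lookup A i) <ᵇ q))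
        h ω = 𝟙 (deg ω x (lookup A i) <ᵇ q) * 𝟙 (deg ω x B <ᵇ θ)
        first : 𝔼 K ω g ≤ 2 ^ (D + ρ′ * s)
        first = begin
          𝔼 K ω g                        ≤⟨ low-sum x x∈ ω ⟩
          ρ * (suc s ^ q * 2 ^ (ρ′ * s)) ≡⟨ *-assoc ρ (suc s ^ q) (2 ^ (ρ′ * s)) ⟨
          ρ * suc s ^ q * 2 ^ (ρ′ * s)   ≤⟨ *-monoˡ-≤ (2 ^ (ρ′ * s)) hD ⟩
          2 ^ D * 2 ^ (ρ′ * s)           ≡⟨ ^-distribˡ-+-* 2 D (ρ′ * s) ⟨
          2 ^ (D + ρ′ * s) ∎
        d = ρ′ * s ∸ length B
        second : Λ * 𝔼 K ω h ≤ 2 ^ (D + ρ′ * s)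
        second = begin
          Λ * 𝔼 K ω h
            ≤⟨ *-monoʳ-≤ Λ (tail₂ x Z (lookup A i) B q θ d ω
                 (unique-++ (flat-unique-at A uZ i) uB λ p p′ → flat-disj A uZ i j i≢j p (subB p′))
                 (λ z∈ → case ∈-++⁻ (lookup A i) z∈ of λ { (inj₁ p) → ∈-flat⁺ A i p ; (inj₂ p) → ∈-flat⁺ A j (subB p) })
                 (row-∉ x∈)
                 (≡-trans lenZ (≡-trans (cong₂ _+_ (sym (len i)) (sym (m+[n∸m]≡n lenB))) (sym (+-assoc (length (lookup A i)) (length B) d))))) ⟩
          Λ * (suc (length (lookup A i)) ^ q * suc (length B) ^ θ * 2 ^ d)
            ≡⟨ cong (λ t → Λ * (suc t ^ q * suc (length B) ^ θ * 2 ^ d)) (len i) ⟩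
          Λ * (suc s ^ q * suc (length B) ^ θ * 2 ^ d)
            ≡⟨ rearr Λ (suc s ^ q) (suc (length B) ^ θ) (2 ^ d) ⟩
          suc s ^ q * (suc (length B) ^ θ * Λ * 2 ^ d)
            ≤⟨ *-mono-≤ (≤-trans (m≤m+n (suc s ^ q) (ρ′ * suc s ^ q)) hD) (*-monoˡ-≤ (2 ^ d) hB) ⟩
          2 ^ D * (2 ^ length B * 2 ^ d)
            ≡⟨ cong (2 ^ D *_) (≡-trans (sym (^-distribˡ-+-* 2 (length B) d)) (cong (2 ^_) (m+[n∸m]≡n lenB))) ⟩
          2 ^ D * 2 ^ (ρ′ * s)
            ≡⟨ ^-distribˡ-+-* 2 D (ρ′ * s) ⟨
          2 ^ (D + ρ′ * s) ∎
          where
          rearr : ∀ a b c d → a * (b * c * d) ≡ b * (c * a * d)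
          rearr = solve-∀
      wev : ∀ ω → 2 ^ ((D + 2) * m) * ev ω ≤ 1 * ∏ R (λ x → w x ω)
      wev ω with m <ᵇ suc (e * cnt (rare q A i B θ ω) R) in eq
      ... | false = ≤-trans (≤-reflexive (≡-trans (cong (2 ^ ((D + 2) * m) *_) (*-zeroʳ (∏ R _))) (*-zeroʳ (2 ^ ((D + 2) * m))))) z≤n
      ... | true  = begin
        2 ^ ((D + 2) * m) * (P * 1)          ≤⟨ *-monoˡ-≤ (P * 1) (^-monoʳ-≤ 2 bits) ⟩
        2 ^ (e * (D + 2) * c) * (P * 1)      ≡⟨ cong₂ _*_ (sym (^-*-assoc 2 (e * (D + 2)) c)) (*-identityʳ P) ⟩
        Λ ^ c * P                            ≡⟨ cong (_* P) (∏-pow R Λ (λ x → 𝟙 (rare q A i B θ ω x))) ⟨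
        ∏ R (λ x → Λ ^ 𝟙 (rare q A i B θ ω x)) * P ≡⟨ *-comm _ P ⟩
        P * ∏ R (λ x → Λ ^ 𝟙 (rare q A i B θ ω x)) ≡⟨ ∏-* R (λ x → 𝟙 (low q A ω x)) _ ⟨
        ∏ R (λ x → w x ω)                    ≡⟨ *-identityˡ _ ⟨
        1 * ∏ R (λ x → w x ω) ∎
        where
        c = cnt (rare q A i B θ ω) R
        P = ∏ R (λ x → 𝟙 (low q A ω x))
        bits : (D + 2) * m ≤ e * (D + 2) * c
        bits = begin
          (D + 2) * m        ≤⟨ *-monoʳ-≤ (D + 2) (s≤s⁻¹ (<ᵇ-true⁻ {m} {suc (e * c)} eq)) ⟩
          (D + 2) * (e * c)  ≡⟨ rearr (D + 2) e c ⟩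
          e * (D + 2) * c ∎
          where
          rearr : ∀ a b c → a * (b * c) ≡ b * a * c
          rearr = solve-∀

-- Complete multipartite subgraphs and the partition they induce.

cnt-mono : ∀ {A : Set} {p p′ : A → Bool} L → (∀ x → x ∈ L → p x ≡ true → p′ x ≡ true) → cnt p L ≤ cnt p′ L
cnt-mono {p = p} {p′} L h = ∑-mono∈ L λ x x∈ → lem (p x) (p′ x) (h x x∈)
  where
  lem : ∀ a b → (a ≡ true → b ≡ true) → 𝟙 a ≤ 𝟙 b
  lem false b h = z≤n
  lem true  b h rewrite h refl = ≤-refl

cnt-keep : ∀ {A : Set} (p p′ : A → Bool) L → cnt p′ (keep p L) ≡ cnt (λ x → p x ∧ p′ x) L
cnt-keep p p′ []      = refl
cnt-keep p p′ (x ∷ L) with p x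
... | true  = cong (𝟙 (p′ x) +_) (cnt-keep p p′ L)
... | false = cnt-keep p p′ L

∑-take≤ : ∀ {A : Set} (f : A → ℕ) k L → ∑ (take k L) f ≤ ∑ L f
∑-take≤ f zero    L       = z≤n
∑-take≤ f (suc k) []      = ≤-refl
∑-take≤ f (suc k) (x ∷ L) = +-monoʳ-≤ (f x) (∑-take≤ f k L)

∧-true : ∀ {a b} → a ∧ b ≡ true → a ≡ true × b ≡ true
∧-true {true} {true} h = refl , refl

true-∧ : ∀ {a b} → a ≡ true → b ≡ true → a ∧ b ≡ true
true-∧ refl refl = refl

infix 5 _==_
_==_ : ∀ {n} → Fin n → Fin n → Bool
i == j = does (i Fin.≟ j)

==-true : ∀ {n} {i j : Fin n} → (i == j) ≡ true → i ≡ j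
==-true {i = i} {j} h with i Fin.≟ j
... | yes e = e

==-refl : ∀ {n} (i : Fin n) → (i == i) ≡ true
==-refl i = dec-true (i Fin.≟ i) refl

==-false : ∀ {n} {i j : Fin n} → i ≢ j → (i == j) ≡ false
==-false {i = i} {j} ne = dec-false (i Fin.≟ j) ne

cnt-== : ∀ {n} (u : Fin n) {L} → Unique L → cnt (_== u) L ≤ 1
cnt-== u []      = z≤n
cnt-== u {x ∷ L} (a ∷ uq) with x Fin.≟ u
... | no _ = cnt-== u uq
... | yes refl = s≤s (≤-trans (∑-mono∈ L {g = λ _ → 0} λ y y∈ → ≤-reflexive (cong 𝟙 (==-false (λ e → All≢⇒∉ a (subst (_∈ L) e y∈)))))
                      (≤-reflexive (∑-zero L)))

off₂ : ∀ {n} → Fin n → Fin n → Fin n → Bool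
off₂ u v x = not (x == u) ∧ not (x == v)

off₂⁻ : ∀ {n} {u v x : Fin n} → off₂ u v x ≡ true → x ≢ u × x ≢ v
off₂⁻ {u = u} {v} {x} h with x Fin.≟ u | x Fin.≟ v
... | no p | no q = p , q

cnt-off₂ : ∀ {n} (u v : Fin n) {L} → Unique L → length L ≤ 2 + cnt (off₂ u v) L
cnt-off₂ u v {L} uq = begin
  length L                                                    ≡⟨ *-identityʳ _ ⟨
  length L * 1                                                ≡⟨ ∑-const L 1 ⟨
  ∑ L (λ _ → 1)                                               ≤⟨ ∑-mono L (λ x → lem (x == u) (x == v)) ⟩
  ∑ L (λ x → 𝟙 (x == u) + 𝟙 (x == v) + 𝟙 (off₂ u v x))        ≡⟨ ≡-trans (∑-+ L _ _) (cong (_+ cnt (off₂ u v) L) (∑-+ L _ _)) ⟩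
  cnt (_== u) L + cnt (_== v) L + cnt (off₂ u v) L            ≤⟨ +-monoˡ-≤ _ (+-mono-≤ (cnt-== u uq) (cnt-== v uq)) ⟩
  2 + cnt (off₂ u v) L                                        ∎
  where
  open ≤-Reasoning
  lem : ∀ a b → 1 ≤ 𝟙 a + 𝟙 b + 𝟙 (not a ∧ not b)
  lem true  b     = s≤s z≤n
  lem false true  = s≤s z≤n
  lem false false = s≤s z≤n

module Multipartite (n : ℕ) {k : ℕ} (F : Graph k) where

  open Copies n F
  open Rows n using (deg; low; low⁻; low⁺; low-false⁻; rare)

  record Multi {ρ} (ω : Ω) (S : List V) (s : ℕ) (A : Vec (List V) ρ) : Set where
    field
      len : ∀ i → length (lookup A i) ≡ s
      uq  : ∀ i → Unique (lookup A i)
      sub : ∀ i {x} → x ∈ lookup A i → x ∈ S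
      cr  : Cross ω (lookup A)

    flat-uq : Unique (flat A)
    flat-uq = flat-unique A uq λ i j ne x∈ x∈′ → E⇒≢ ω (cr i j ne x∈ x∈′) refl

    flat-sub : ∀ {x} → x ∈ flat A → x ∈ S
    flat-sub x∈ = let i , h = ∈-flat⁻ A x∈ in sub i h

  trim : ∀ {ρ} → ℕ → (V → Bool) → Vec (List V) ρ → Vec (List V) ρ
  trim s p A = Data.Vec.map (λ L → take s (keep p L)) A

  trim-at : ∀ {ρ} s p (A : Vec (List V) ρ) i → lookup (trim s p A) i ≡ take s (keep p (lookup A i))
  trim-at s p A i = lookup-map i _ A

  trim-∈ : ∀ {ρ} s p (A : Vec (List V) ρ) i {x} → x ∈ lookup (trim s p A) i → x ∈ lookup A i × p x ≡ true
  trim-∈ s p A i x∈ = ∈-keep⁻ p (∈-take⁻ s (subst (_ ∈_) (trim-at s p A i) x∈))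

  Multi-trim : ∀ {ρ ω S S′ t} s p {A : Vec (List V) ρ} → Multi ω S t A → (∀ i → s ≤ cnt p (lookup A i)) →
    (∀ {x} → x ∈ S → p x ≡ true → x ∈ S′) → Multi ω S′ s (trim s p A)
  Multi-trim s p {A} M h sub′ = record
    { len = λ i → ≡-trans (cong length (trim-at s p A i))
        (length-take≤ s _ (≤-trans (h i) (≤-reflexive (sym (length-keep p (lookup A i))))))
    ; uq  = λ i → subst Unique (sym (trim-at s p A i)) (take-unique s (keep-unique p (Multi.uq M i)))
    ; sub = λ i x∈ → let a , b = trim-∈ s p A i x∈ in sub′ (Multi.sub M i a) b
    ; cr  = λ i j ne x∈ y∈ → Multi.cr M i j ne (proj₁ (trim-∈ s p A i x∈)) (proj₁ (trim-∈ s p A j y∈))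
    }

  -- Each `z` splits the candidates by adjacency to `z`, and a half that is large enough is kept;
  -- after |Z| halvings the survivors have the same neighbourhood in `Z`.
  pigeon : ∀ ω Z X N → Unique X → 2 ^ length Z * N ≤ length X →
    ∃ λ X′ → (∀ {x} → x ∈ X′ → x ∈ X) × Unique X′ × N ≤ length X′ ×
      (∀ {x y z} → x ∈ X′ → y ∈ X′ → z ∈ Z → E ω x z ≡ E ω y z)
  pigeon ω []      X N u le = X , id , u , ≤-trans (≤-reflexive (sym (+-identityʳ N))) le , λ _ _ ()
  pigeon ω (z ∷ Z) X N u le with 2 ^ length Z * N ≤? length (keep p X)
    where
    p : V → Bool
    p x = E ω x z
  ... | yes le′ with pigeon ω Z (keep (λ x → E ω x z) X) N (keep-unique _ u) le′
  ...   | X′ , sub , u′ , len , same = X′ , (λ h → proj₁ (∈-keep⁻ _ (sub h))) , u′ , len ,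
    λ { x∈ y∈ (here refl) → ≡-trans (proj₂ (∈-keep⁻ (λ x → E ω x z) {X} (sub x∈))) (sym (proj₂ (∈-keep⁻ (λ x → E ω x z) {X} (sub y∈)))) ; x∈ y∈ (there z∈) → same x∈ y∈ z∈ }
  pigeon ω (z ∷ Z) X N u le | no ¬le with pigeon ω Z (keep (λ x → not (E ω x z)) X) N (keep-unique _ u) le′
    where
    p : V → Bool
    p x = E ω x z
    le′ : 2 ^ length Z * N ≤ length (keep (not ∘ p) X)
    le′ = +-cancelˡ-≤ (2 ^ length Z * N) _ _ (begin
      2 ^ length Z * N + 2 ^ length Z * N ≡⟨ lem (2 ^ length Z) N ⟩
      2 ^ suc (length Z) * N              ≤⟨ le ⟩
      length X                            ≡⟨ ≡-trans (sym (cnt-split p X)) (sym (cong₂ _+_ (length-keep p X) (length-keep (not ∘ p) X))) ⟩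
      length (keep p X) + length (keep (not ∘ p) X) ≤⟨ +-monoˡ-≤ _ (<⇒≤ (≰⇒> ¬le)) ⟩
      2 ^ length Z * N + length (keep (not ∘ p) X) ∎)
      where
      open ≤-Reasoning
      lem : ∀ a b → a * b + a * b ≡ 2 * a * b
      lem = solve-∀
  ...   | X′ , sub , u′ , len , same = X′ , (λ h → proj₁ (∈-keep⁻ _ (sub h))) , u′ , len ,
    λ { x∈ y∈ (here refl) → neg (proj₂ (∈-keep⁻ (λ x → not (E ω x z)) {X} (sub x∈))) (proj₂ (∈-keep⁻ (λ x → not (E ω x z)) {X} (sub y∈))) ; x∈ y∈ (there z∈) → same x∈ y∈ z∈ }
    where
    neg : ∀ {a b} → not a ≡ true → not b ≡ true → a ≡ b
    neg {false} {false} _ _ = refl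

  -- The vertices that are not low have at most 2^(ρs) different neighbourhoods in `A`, so `s′` of
  -- them share one. They become the new part, and the old parts shrink to `s′` vertices of this
  -- common neighbourhood.
  extend : ∀ {ρ ω S s} s′ (A : Vec (List V) ρ) R → 0 < s′ → Multi ω S s A → Unique R → (∀ {x} → x ∈ R → x ∈ S) →
    2 ^ (ρ * s) * s′ ≤ cnt (λ x → not (low s′ A ω x)) R → ∃ λ (A′ : Vec (List V) (suc ρ)) → Multi ω S s′ A′
  extend {ρ} {ω} {S} {s} s′ A R s′>0 M uR subR h
    with pigeon ω (flat A) (keep (λ x → not (low s′ A ω x)) R) s′ (keep-unique _ uR)
           (≤-trans (≤-reflexive (cong (λ t → 2 ^ t * s′) (length-flat s A (Multi.len M)))) (≤-trans h (≤-reflexive (sym (length-keep _ R)))))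
  ... | [] , _ , _ , le , _ = contradiction (≤-trans s′>0 le) λ ()
  ... | x₀ ∷ X , subX , uX , le , same = new ∷ A₀ , record { len = len′ ; uq = uq′ ; sub = sub′ ; cr = cr′ }
    where
    new = take s′ (x₀ ∷ X)
    A₀ = trim s′ (E ω x₀) A
    high : ∀ i → s′ ≤ deg ω x₀ (lookup A i)
    high i = low-false⁻ s′ A ω x₀ (notfalse (proj₂ (∈-keep⁻ (λ x → not (low s′ A ω x)) {R} (subX (here refl))))) i
      where
      notfalse : ∀ {b} → not b ≡ true → b ≡ false
      notfalse {false} _ = refl
    M₀ : Multi ω S s′ A₀
    M₀ = Multi-trim s′ (E ω x₀) M high (λ h _ → h)
    ∈X : ∀ {x} → x ∈ new → x ∈ x₀ ∷ X
    ∈X = ∈-take⁻ s′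
    edge : ∀ {x y} i → x ∈ new → y ∈ lookup A₀ i → E ω x y ≡ true
    edge i x∈ y∈ = let a , b = trim-∈ s′ (E ω x₀) A i y∈ in ≡-trans (same (∈X x∈) (here refl) (∈-flat⁺ A i a)) b
    len′ : ∀ i → length (lookup (new ∷ A₀) i) ≡ s′
    len′ zero    = length-take≤ s′ _ le
    len′ (suc i) = Multi.len M₀ i
    uq′ : ∀ i → Unique (lookup (new ∷ A₀) i)
    uq′ zero    = take-unique s′ uX
    uq′ (suc i) = Multi.uq M₀ i
    sub′ : ∀ i {x} → x ∈ lookup (new ∷ A₀) i → x ∈ S
    sub′ zero    x∈ = subR (proj₁ (∈-keep⁻ _ (subX (∈X x∈))))
    sub′ (suc i) x∈ = Multi.sub M₀ i x∈
    cr′ : Cross ω (lookup (new ∷ A₀))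
    cr′ zero    zero    ne _  _  = contradiction refl ne
    cr′ zero    (suc j) ne x∈ y∈ = edge j x∈ y∈
    cr′ (suc i) zero    ne x∈ y∈ = ≡-trans (E-sym ω _ _) (edge i y∈ x∈)
    cr′ (suc i) (suc j) ne x∈ y∈ = Multi.cr M₀ i j (ne ∘ cong suc) x∈ y∈

  module Free {r : ℕ} (crit : Critical r F) (i₀ : Fin r) where

    -- The degree into every part at which `star-copy` applies.
    q : ℕ
    q = suc k

    class : ∀ {ω S s} {A : Vec (List V) r} → ¬ Contains ω S → Multi ω S s A → ∀ {x} → x ∈ S →
      ∃ λ i → deg ω x (lookup A i) < q
    class {ω} {S} {s} {A} free M {x} x∈ with Fin.any? (λ i → deg ω x (lookup A i) <? q)
    ... | yes p = p
    ... | no ¬p = ⊥-elim (free (star-copy crit i₀ D x∈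
        (λ j → ≤-trans (≮⇒≥ λ h → ¬p (j , h)) (≤-reflexive (sym (length-keep (E ω x) (lookup A j)))))
        (λ j → keep-unique _ (Multi.uq M j)) (λ j d∈ → Multi.sub M j (proj₁ (∈-keep⁻ _ d∈)))
        (λ i j ne a∈ b∈ → Multi.cr M i j ne (proj₁ (∈-keep⁻ _ a∈)) (proj₁ (∈-keep⁻ _ b∈)))
        (λ j d∈ → proj₂ (∈-keep⁻ (E ω x) {lookup A j} d∈))))
      where
      D : Fin r → List V
      D j = keep (E ω x) (lookup A j)

    both : Ω → V → V → V → Bool
    both ω u v z = E ω u z ∧ E ω v z

    -- D i is only required to be large; the neighbourhood condition concerns the other parts.
    inside-edge : ∀ {ω S} (D : Fin r → List V) i {u v} → ¬ Contains ω S → u ∈ S → v ∈ S → E ω u v ≡ true →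
      (∀ j → Unique (D j)) → (∀ j {d} → d ∈ D j → d ∈ S) → Cross ω D →
      2 + k ≤ length (D i) → ¬ (∀ j → j ≢ i → q ≤ cnt (both ω u v) (D j))
    inside-edge {ω} {S} D i {u} {v} free u∈ v∈ u~v uq sub cr big h =
      free (edge-copy crit i D′ u∈ v∈ u~v len′ uq′ (λ j d∈ → sub j (sub′ j d∈))
        (λ a b ne x∈ y∈ → cr a b ne (sub′ a x∈) (sub′ b y∈)) nb av)
      where
      D′ : Fin r → List V
      D′ j with j Fin.≟ i
      ... | yes _ = keep (off₂ u v) (D j)
      ... | no  _ = keep (both ω u v) (D j)
      sub′ : ∀ j {d} → d ∈ D′ j → d ∈ D j
      sub′ j d∈ with j Fin.≟ i
      ... | yes _ = proj₁ (∈-keep⁻ _ d∈)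
      ... | no  _ = proj₁ (∈-keep⁻ _ d∈)
      len′ : ∀ j → k ≤ length (D′ j)
      len′ j with j Fin.≟ i
      ... | yes refl = ≤-trans (+-cancelˡ-≤ 2 k _ (≤-trans big (cnt-off₂ u v (uq i)))) (≤-reflexive (sym (length-keep (off₂ u v) (D i))))
      ... | no ne = ≤-trans (≤-trans (n≤1+n k) (h j ne)) (≤-reflexive (sym (length-keep (both ω u v) (D j))))
      uq′ : ∀ j → Unique (D′ j)
      uq′ j with j Fin.≟ i
      ... | yes _ = keep-unique _ (uq j)
      ... | no  _ = keep-unique _ (uq j)
      nb : ∀ j → j ≢ i → ∀ {d} → d ∈ D′ j → E ω u d ≡ true × E ω v d ≡ true
      nb j ne d∈ with j Fin.≟ i
      ... | yes e = contradiction e ne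
      ... | no  _ = ∧-true (proj₂ (∈-keep⁻ (both ω u v) {D j} d∈))
      av : ∀ {d} → d ∈ D′ i → d ≢ u × d ≢ v
      av d∈ with i Fin.≟ i
      ... | no ne = contradiction refl ne
      ... | yes _ = off₂⁻ (proj₂ (∈-keep⁻ (off₂ u v) {D i} d∈))

    few-common : ∀ {ω S s} {A : Vec (List V) r} → ¬ Contains ω S → Multi ω S s A → 2 + k ≤ s → ∀ i {u v} →
      u ∈ S → v ∈ S → E ω u v ≡ true → ∃ λ j → j ≢ i × cnt (both ω u v) (lookup A j) < q
    few-common {ω} {S} {s} {A} free M big i {u} {v} u∈ v∈ u~v
      with Fin.any? (λ j → ¬? (j Fin.≟ i) ×-dec (cnt (both ω u v) (lookup A j) <? q))
    ... | yes p = p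
    ... | no ¬p = ⊥-elim (inside-edge (lookup A) i free u∈ v∈ u~v (Multi.uq M) (Multi.sub M) (Multi.cr M)
      (≤-trans big (≤-reflexive (sym (Multi.len M i)))) λ j ne → ≮⇒≥ λ h → ¬p (j , ne , h))

    -- The second condition is stated for all `b`-subsets of a part because in `inside-few` the set
    -- depends on a vertex `u`. Their number does not depend on `m`, so a union bound over them is
    -- cheap.
    NotRare : Ω → ℕ → ℕ → ℕ → Vec (List V) r → List V → Set
    NotRare ω m e b A R = ∀ i j → i ≢ j → (e * cnt (rare q A i (lookup A j) b ω) R ≤ m) ×
      (∀ B → B ∈ combs b (lookup A j) → e * cnt (rare q A i B q ω) R ≤ m)

    Compatible : Ω → Vec (List V) r → List V → (V → Fin r) → Set
    Compatible ω A S c = ∀ x → x ∈ S → deg ω x (lookup A (c x)) < q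

    inside : Ω → (V → Fin r) → V → V → Bool
    inside ω c u v = E ω u v ∧ (c u == c v)

    -- With `b` replaced by `q` these are the vertices whose part is ambiguous; with the larger `b`
    -- they are the vertices whose neighbourhoods in the other parts are too small for the argument
    -- of `inside-few`.
    weak : ℕ → Vec (List V) r → Ω → V → Bool
    weak b A ω x = does (Fin.any? λ i → Fin.any? λ j → ¬? (i Fin.≟ j) ×-dec
      (deg ω x (lookup A i) <? q) ×-dec (deg ω x (lookup A j) <? b))

    weak⁻ : ∀ b A ω x → weak b A ω x ≡ true →
      ∃ λ i → ∃ λ j → i ≢ j × deg ω x (lookup A i) < q × deg ω x (lookup A j) < b
    weak⁻ b A ω x h with Fin.any? (λ i → Fin.any? λ j → ¬? (i Fin.≟ j) ×-dec
      (deg ω x (lookup A i) <? q) ×-dec (deg ω x (lookup A j) <? b))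
    ... | yes p = p

    weak⁺ : ∀ b A ω x i j → i ≢ j → deg ω x (lookup A i) < q → deg ω x (lookup A j) < b → weak b A ω x ≡ true
    weak⁺ b A ω x i j ne p p′ = dec-true (Fin.any? λ i → Fin.any? λ j → ¬? (i Fin.≟ j) ×-dec
      (deg ω x (lookup A i) <? q) ×-dec (deg ω x (lookup A j) <? b)) (i , j , ne , p , p′)

    ∑∑-bound : ∀ (f : Fin r → Fin r → ℕ) e m → (∀ i j → e * f i j ≤ m) →
      e * ∑ (allFin r) (λ i → ∑ (allFin r) (f i)) ≤ r * r * m
    ∑∑-bound f e m h = begin
      e * ∑ (allFin r) (λ i → ∑ (allFin r) (f i))             ≡⟨ ∑-*ˡ (allFin r) e _ ⟨
      ∑ (allFin r) (λ i → e * ∑ (allFin r) (f i))             ≤⟨ ∑-bound (allFin r) (r * m) (λ i _ → begin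
          e * ∑ (allFin r) (f i)            ≡⟨ ∑-*ˡ (allFin r) e _ ⟨
          ∑ (allFin r) (λ j → e * f i j)    ≤⟨ ∑-bound (allFin r) m (λ j _ → h i j) ⟩
          length (allFin r) * m             ≡⟨ cong (_* m) (length-tabulate {n = r} id) ⟩
          r * m ∎) ⟩
      length (allFin r) * (r * m)                             ≡⟨ cong (_* (r * m)) (length-tabulate {n = r} id) ⟩
      r * (r * m)                                             ≡⟨ *-assoc r r m ⟨
      r * r * m ∎
      where open ≤-Reasoning

    rare-off : ∀ b A ω → Fin r → Fin r → V → Bool
    rare-off b A ω i j x = not (i == j) ∧ rare q A i (lookup A j) b ω x

    weak-few : ∀ {ω m e b A R} → NotRare ω m e b A R → e * cnt (weak b A ω) R ≤ r * r * m
    weak-few {ω} {m} {e} {b} {A} {R} nr = begin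
      e * cnt (weak b A ω) R
        ≤⟨ *-monoʳ-≤ e (∑-mono R pt) ⟩
      e * ∑ R (λ x → ∑ (allFin r) λ i → ∑ (allFin r) λ j → 𝟙 (rare-off b A ω i j x))
        ≡⟨ cong (e *_) (≡-trans (∑-swap R (allFin r) _) (∑-cong (allFin r) λ i → ∑-swap R (allFin r) _)) ⟩
      e * ∑ (allFin r) (λ i → ∑ (allFin r) λ j → cnt (rare-off b A ω i j) R)
        ≤⟨ ∑∑-bound (λ i j → cnt (rare-off b A ω i j) R) e m each ⟩
      r * r * m ∎
      where
      open ≤-Reasoning
      pt : ∀ x → 𝟙 (weak b A ω x) ≤ ∑ (allFin r) λ i → ∑ (allFin r) λ j → 𝟙 (rare-off b A ω i j x)
      pt x with weak b A ω x in eq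
      ... | false = z≤n
      ... | true  = let i , j , ne , p , p′ = weak⁻ b A ω x eq in begin
        1 ≡⟨ cong 𝟙 (sym (true-∧ (cong not (==-false ne)) (true-∧ (<ᵇ-true p) (<ᵇ-true p′)))) ⟩
        𝟙 (rare-off b A ω i j x) ≤⟨ ∑-∈ (λ j → 𝟙 (rare-off b A ω i j x)) (∈-allFin j) ⟩
        ∑ (allFin r) (λ j → 𝟙 (rare-off b A ω i j x)) ≤⟨ ∑-∈ (λ i → ∑ (allFin r) (λ j → 𝟙 (rare-off b A ω i j x))) (∈-allFin i) ⟩
        _ ∎
      each : ∀ i j → e * cnt (rare-off b A ω i j) R ≤ m
      each i j with i Fin.≟ j
      ... | yes refl = ≤-trans (≤-reflexive (≡-trans (cong (e *_) (∑-zero R)) (*-zeroʳ e))) z≤n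
      ... | no ne = proj₁ (nr i j ne)

    -- A vertex `u` that is not weak has `b` neighbours in each part other than its own. If `v` is
    -- joined to `u` inside the class, then by `few-common` some other part contains few common
    -- neighbours, so `v` is rare with respect to those `b` neighbours; there are at most m/e such
    -- `v` per part. Weak vertices and the vertices of `A` are counted trivially.
    inside-few : ∀ {ω S s m e b A R} c → ¬ Contains ω S → Multi ω S s A → 2 + k ≤ s → Compatible ω A S c →
      NotRare ω m e b A R → S ↭ flat A ++ R → length S ≡ m →
      e * ∑ S (λ u → cnt (inside ω c u) S) ≤ 2 * (e * (r * s)) * m + (r * r + r) * (m * m)
    inside-few {ω} {S} {s} {m} {e} {b} {A} {R} c free M big comp nr p lenS = begin
      e * ∑ S (λ u → cnt (inside ω c u) S)
        ≡⟨ cong (e *_) (≡-trans (∑-↭ _ p) (∑-++ (flat A) R _)) ⟩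
      e * (∑ (flat A) (λ u → cnt (inside ω c u) S) + ∑ R (λ u → cnt (inside ω c u) S))
        ≤⟨ *-monoʳ-≤ e (+-monoˡ-≤ _ (≤-trans (∑-bound (flat A) m (λ u _ → ≤-trans (cnt≤length _ S) (≤-reflexive lenS)))
             (≤-reflexive (cong (_* m) lenZ)))) ⟩
      e * (r * s * m + ∑ R (λ u → cnt (inside ω c u) S))
        ≡⟨ *-distribˡ-+ e _ _ ⟩
      e * (r * s * m) + e * ∑ R (λ u → cnt (inside ω c u) S)
        ≡⟨ cong (e * (r * s * m) +_) (∑-*ˡ R e _) ⟨
      e * (r * s * m) + ∑ R (λ u → e * cnt (inside ω c u) S)
        ≤⟨ +-monoʳ-≤ (e * (r * s * m)) (∑-mono∈ R λ u u∈ → each u (R⊆S u∈)) ⟩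
      e * (r * s * m) + ∑ R (λ u → e * m * 𝟙 (weak b A ω u) + (e * (r * s) + r * m))
        ≡⟨ cong (e * (r * s * m) +_) (≡-trans (∑-+ R _ _) (cong₂ _+_ (∑-*ˡ R (e * m) _) (∑-const R _))) ⟩
      e * (r * s * m) + (e * m * cnt (weak b A ω) R + length R * (e * (r * s) + r * m))
        ≤⟨ +-monoʳ-≤ (e * (r * s * m)) (+-mono-≤ weak-part (*-monoˡ-≤ (e * (r * s) + r * m) lenR)) ⟩
      e * (r * s * m) + (m * (r * r * m) + m * (e * (r * s) + r * m))
        ≡⟨ final e r s m ⟩
      2 * (e * (r * s)) * m + (r * r + r) * (m * m) ∎
      where
      open ≤-Reasoning
      final : ∀ e r s m → e * (r * s * m) + (m * (r * r * m) + m * (e * (r * s) + r * m)) ≡ 2 * (e * (r * s)) * m + (r * r + r) * (m * m)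
      final = solve-∀
      lenZ : length (flat A) ≡ r * s
      lenZ = length-flat s A (Multi.len M)
      R⊆S : ∀ {x} → x ∈ R → x ∈ S
      R⊆S x∈ = Perm.∈-resp-↭ (↭-sym p) (∈-++⁺ʳ (flat A) x∈)
      lenR : length R ≤ m
      lenR = ≤-trans (m≤n+m (length R) (length (flat A))) (≤-reflexive (≡-trans (sym (length-++ (flat A))) (≡-trans (sym (Perm.↭-length p)) lenS)))
      weak-part : e * m * cnt (weak b A ω) R ≤ m * (r * r * m)
      weak-part = begin
        e * m * cnt (weak b A ω) R   ≡⟨ lem e m _ ⟩
        m * (e * cnt (weak b A ω) R) ≤⟨ *-monoʳ-≤ m (weak-few {ω} {m} {e} {b} {A} {R} nr) ⟩
        m * (r * r * m) ∎
        where
        lem : ∀ a b c → a * b * c ≡ b * (a * c)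
        lem = solve-∀
      each : ∀ u → u ∈ S → e * cnt (inside ω c u) S ≤ e * m * 𝟙 (weak b A ω u) + (e * (r * s) + r * m)
      each u u∈ with weak b A ω u in eq
      ... | true = begin
        e * cnt (inside ω c u) S ≤⟨ *-monoʳ-≤ e (≤-trans (cnt≤length _ S) (≤-reflexive lenS)) ⟩
        e * m                    ≡⟨ *-identityʳ (e * m) ⟨
        e * m * 1                ≤⟨ m≤m+n (e * m * 1) _ ⟩
        e * m * 1 + (e * (r * s) + r * m) ∎
      ... | false = begin
        e * cnt (inside ω c u) S
          ≡⟨ cong (e *_) (≡-trans (∑-↭ _ p) (∑-++ (flat A) R _)) ⟩
        e * (cnt (inside ω c u) (flat A) + cnt (inside ω c u) R)
          ≤⟨ *-monoʳ-≤ e (+-mono-≤ (≤-trans (cnt≤length _ (flat A)) (≤-reflexive lenZ)) (∑-mono∈ R pt)) ⟩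
        e * (r * s + ∑ R (λ v → ∑ (allFin r) λ j → 𝟙 (g j v)))
          ≡⟨ *-distribˡ-+ e (r * s) _ ⟩
        e * (r * s) + e * ∑ R (λ v → ∑ (allFin r) λ j → 𝟙 (g j v))
          ≡⟨ cong (λ t → e * (r * s) + e * t) (∑-swap R (allFin r) _) ⟩
        e * (r * s) + e * ∑ (allFin r) (λ j → cnt (g j) R)
          ≡⟨ cong (e * (r * s) +_) (∑-*ˡ (allFin r) e _) ⟨
        e * (r * s) + ∑ (allFin r) (λ j → e * cnt (g j) R)
          ≤⟨ +-monoʳ-≤ (e * (r * s)) (≤-trans (∑-bound (allFin r) m (λ j _ → gj j)) (≤-reflexive (cong (_* m) (length-tabulate {n = r} id)))) ⟩
        e * (r * s) + r * m
          ≤⟨ m≤n+m _ (e * m * 0) ⟩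
        e * m * 0 + (e * (r * s) + r * m) ∎
        where
        i = c u
        -- Exactly `b` neighbours are kept, so that `B j` is one of the sets covered by `NotRare`.
        B : Fin r → List V
        B j = take b (keep (E ω u) (lookup A j))
        g : Fin r → V → Bool
        g j v = not (i == j) ∧ rare q A i (B j) q ω v
        high : ∀ j → i ≢ j → b ≤ deg ω u (lookup A j)
        high j ne with b ≤? deg ω u (lookup A j)
        ... | yes h = h
        ... | no ¬h with ≡-trans (sym eq) (weak⁺ b A ω u i j ne (comp u u∈) (≰⇒> ¬h))
        ...   | ()
        gj : ∀ j → e * cnt (g j) R ≤ m
        gj j with i Fin.≟ j
        ... | yes _ = ≤-trans (≤-reflexive (≡-trans (cong (e *_) (∑-zero R)) (*-zeroʳ e))) z≤n
        ... | no ne = proj₂ (nr i j ne) (B j) (take-keep-combs (E ω u) b (lookup A j) (≤-trans (high j ne) (≤-reflexive (sym (length-keep (E ω u) (lookup A j))))))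
        pt : ∀ v → v ∈ R → 𝟙 (inside ω c u v) ≤ ∑ (allFin r) (λ j → 𝟙 (g j v))
        pt v v∈ with inside ω c u v in eq′
        ... | false = z≤n
        ... | true  =
          let u~v , same = ∧-true {E ω u v} eq′
              j , ne , few = few-common free M big i u∈ (R⊆S v∈) u~v
              degB = ≤-<-trans (≤-trans (∑-take≤ _ b (keep (E ω u) (lookup A j))) (≤-reflexive (cnt-keep (E ω u) (E ω v) (lookup A j)))) few
              degA = subst (λ t → deg ω v (lookup A t) < q) (sym (==-true same)) (comp v (R⊆S v∈))
          in ≤-trans (≤-reflexive (cong 𝟙 (sym (true-∧ (cong not (==-false (ne ∘ sym))) (true-∧ (<ᵇ-true degA) (<ᵇ-true degB))))))
                     (∑-∈ (λ j → 𝟙 (g j v)) (∈-allFin j))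

-- Colour classes: cross pairs, monochromatic pairs, and the Turán bound.

∑-δ-zero : ∀ {n} (j : Fin n) (g : Fin n → ℕ) L → j ∉ L → ∑ L (λ i → 𝟙 (j == i) * g i) ≡ 0
∑-δ-zero j g []      j∉ = refl
∑-δ-zero j g (i ∷ L) j∉ rewrite ==-false {i = j} {i} (λ e → j∉ (here e)) = ∑-δ-zero j g L (j∉ ∘ there)

∑-δ : ∀ {n} (j : Fin n) (g : Fin n → ℕ) {L} → Unique L → j ∈ L → ∑ L (λ i → 𝟙 (j == i) * g i) ≡ g j
∑-δ j g {i ∷ L} (a ∷ u) (here refl) rewrite ==-refl j | ∑-δ-zero j g L (All≢⇒∉ a) = ≡-trans (+-identityʳ _) (+-identityʳ _)
∑-δ j g {i ∷ L} (a ∷ u) (there j∈) rewrite ==-false {i = j} {i} (λ e → All≢⇒∉ a (subst (_∈ L) e j∈)) = ∑-δ j g u j∈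

allFin-unique : ∀ r → Unique (allFin r)
allFin-unique r = Data.List.Relation.Unary.Unique.Propositional.Properties.allFin⁺ r

2ab≤a²+b² : ∀ a b → 2 * (a * b) ≤ a * a + b * b
2ab≤a²+b² a b with ≤-total a b
... | inj₁ le = subst (λ b → 2 * (a * b) ≤ a * a + b * b) (m+[n∸m]≡n le) (lem a (b ∸ a))
  where
  eq : ∀ a d → a * a + (a + d) * (a + d) ≡ 2 * (a * (a + d)) + d * d
  eq = solve-∀
  lem : ∀ a d → 2 * (a * (a + d)) ≤ a * a + (a + d) * (a + d)
  lem a d = ≤-trans (m≤m+n _ (d * d)) (≤-reflexive (sym (eq a d)))
... | inj₂ le = subst (λ a → 2 * (a * b) ≤ a * a + b * b) (m+[n∸m]≡n le) (lem b (a ∸ b))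
  where
  eq : ∀ b d → (b + d) * (b + d) + b * b ≡ 2 * ((b + d) * b) + d * d
  eq = solve-∀
  lem : ∀ b d → 2 * ((b + d) * b) ≤ (b + d) * (b + d) + b * b
  lem b d = ≤-trans (m≤m+n _ (d * d)) (≤-reflexive (sym (eq b d)))

cauchy-schwarz : ∀ {A : Set} (L : List A) f → ∑ L f * ∑ L f ≤ length L * ∑ L (λ x → f x * f x)
cauchy-schwarz []      f = z≤n
cauchy-schwarz (x ∷ L) f = begin
  (a + s) * (a + s)                   ≡⟨ e₁ a s ⟩
  a * a + 2 * (a * s) + s * s         ≤⟨ +-mono-≤ (+-monoʳ-≤ (a * a) cross-term) (cauchy-schwarz L f) ⟩
  a * a + (l * (a * a) + t) + l * t   ≡⟨ e₂ a l t ⟩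
  suc l * (a * a + t) ∎
  where
  open ≤-Reasoning
  a = f x
  s = ∑ L f
  l = length L
  t = ∑ L (λ x → f x * f x)
  e₁ : ∀ a s → (a + s) * (a + s) ≡ a * a + 2 * (a * s) + s * s
  e₁ = solve-∀
  e₂ : ∀ a l t → a * a + (l * (a * a) + t) + l * t ≡ suc l * (a * a + t)
  e₂ = solve-∀
  cross-term : 2 * (a * s) ≤ l * (a * a) + t
  cross-term = begin
    2 * (a * s)                              ≡⟨ cong (2 *_) (∑-*ˡ L a f) ⟨
    2 * ∑ L (λ y → a * f y)                  ≡⟨ ∑-*ˡ L 2 _ ⟨
    ∑ L (λ y → 2 * (a * f y))                ≤⟨ ∑-mono L (λ y → 2ab≤a²+b² a (f y)) ⟩
    ∑ L (λ y → a * a + f y * f y)            ≡⟨ ≡-trans (∑-+ L _ _) (cong (_+ t) (∑-const L (a * a))) ⟩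
    l * (a * a) + t ∎

module Classes {n r′ : ℕ} where

  private
    r = suc r′
    V = Fin n

  vp : List V → List (V × V)
  vp []      = []
  vp (x ∷ L) = map (x ,_) L ++ vp L

  mono : (V → Fin r) → V × V → Bool
  mono c (u , v) = c u == c v

  In Cr : (V → Fin r) → List V → List (V × V)
  In c S = keep (mono c) (vp S)
  Cr c S = keep (not ∘ mono c) (vp S)

  size : (V → Fin r) → List V → Fin r → ℕ
  size c S i = cnt (λ x → c x == i) S

  ∑-size : ∀ c S → ∑ (allFin r) (size c S) ≡ length S
  ∑-size c S = begin
    ∑ (allFin r) (λ i → ∑ S (λ x → 𝟙 (c x == i)))   ≡⟨ ∑-swap (allFin r) S _ ⟩
    ∑ S (λ x → ∑ (allFin r) (λ i → 𝟙 (c x == i)))   ≡⟨ ∑-cong S (λ x → ≡-trans (∑-cong (allFin r) λ i → sym (*-identityʳ _))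
                                                         (∑-δ (c x) (λ _ → 1) (allFin-unique r) (∈-allFin (c x)))) ⟩
    ∑ S (λ x → 1)                                    ≡⟨ ≡-trans (∑-const S 1) (*-identityʳ _) ⟩
    length S ∎
    where open ≡-Reasoning

  cross-count : ∀ c S → 2 * length (Cr c S) + ∑ (allFin r) (λ i → size c S i * size c S i) ≡ length S * length S
  cross-count c []      = ∑-zero (allFin r)
  cross-count c (x ∷ S) = begin
    2 * length (Cr c (x ∷ S)) + ∑ (allFin r) (λ i → size c (x ∷ S) i * size c (x ∷ S) i)
      ≡⟨ cong₂ (λ a b → 2 * a + b) lenCr sq ⟩
    2 * (o + C) + (Q + 2 * d + 1)
      ≡⟨ lem o C Q d ⟩
    (2 * C + Q) + (2 * (d + o) + 1)
      ≡⟨ cong₂ (λ a b → a + (2 * b + 1)) (cross-count c S) splitS ⟩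
    m * m + (2 * m + 1)
      ≡⟨ lem₂ m ⟩
    suc m * suc m ∎
    where
    open ≡-Reasoning
    m = length S
    C = length (Cr c S)
    Q = ∑ (allFin r) (λ i → size c S i * size c S i)
    d = cnt (λ y → c x == c y) S
    o = cnt (λ y → not (c x == c y)) S
    lem : ∀ o C Q d → 2 * (o + C) + (Q + 2 * d + 1) ≡ (2 * C + Q) + (2 * (d + o) + 1)
    lem = solve-∀
    lem₂ : ∀ m → m * m + (2 * m + 1) ≡ suc m * suc m
    lem₂ = solve-∀
    splitS : d + o ≡ m
    splitS = cnt-split (λ y → c x == c y) S
    lenCr : length (Cr c (x ∷ S)) ≡ o + C
    lenCr = begin
      length (keep (not ∘ mono c) (map (x ,_) S ++ vp S))       ≡⟨ length-keep (not ∘ mono c) (map (x ,_) S ++ vp S) ⟩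
      cnt (not ∘ mono c) (map (x ,_) S ++ vp S)                 ≡⟨ ∑-++ (map (x ,_) S) (vp S) _ ⟩
      cnt (not ∘ mono c) (map (x ,_) S) + cnt (not ∘ mono c) (vp S)
        ≡⟨ cong₂ _+_ (∑-map (x ,_) S _) (sym (length-keep (not ∘ mono c) (vp S))) ⟩
      o + C ∎
    dsize : size c S (c x) ≡ d
    dsize = ∑-cong S λ y → cong 𝟙 (==-comm (c y) (c x))
      where
      ==-comm : ∀ (i j : Fin r) → (i == j) ≡ (j == i)
      ==-comm i j with i Fin.≟ j
      ... | yes refl = sym (==-refl i)
      ... | no ne = sym (==-false (ne ∘ sym))
    sq : ∑ (allFin r) (λ i → size c (x ∷ S) i * size c (x ∷ S) i) ≡ Q + 2 * d + 1
    sq = begin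
      ∑ (allFin r) (λ i → (𝟙 (c x == i) + size c S i) * (𝟙 (c x == i) + size c S i))
        ≡⟨ ∑-cong (allFin r) (λ i → expand (c x == i) (size c S i)) ⟩
      ∑ (allFin r) (λ i → size c S i * size c S i + 𝟙 (c x == i) * (2 * size c S i + 1))
        ≡⟨ ∑-+ (allFin r) (λ i → size c S i * size c S i) (λ i → 𝟙 (c x == i) * (2 * size c S i + 1)) ⟩
      Q + ∑ (allFin r) (λ i → 𝟙 (c x == i) * (2 * size c S i + 1))
        ≡⟨ cong (Q +_) (∑-δ (c x) (λ i → 2 * size c S i + 1) (allFin-unique r) (∈-allFin (c x))) ⟩
      Q + (2 * size c S (c x) + 1)
        ≡⟨ cong (λ t → Q + (2 * t + 1)) dsize ⟩
      Q + (2 * d + 1)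
        ≡⟨ +-assoc Q (2 * d) 1 ⟨
      Q + 2 * d + 1 ∎
      where
      expand : ∀ b s → (𝟙 b + s) * (𝟙 b + s) ≡ s * s + 𝟙 b * (2 * s + 1)
      expand true  s = e s
        where
        e : ∀ s → (1 + s) * (1 + s) ≡ s * s + 1 * (2 * s + 1)
        e = solve-∀
      expand false s = sym (+-identityʳ _)

  turán : ∀ c S → 2 * r * length (Cr c S) ≤ r′ * (length S * length S)
  turán c S = +-cancelʳ-≤ (m * m) _ _ (begin
    2 * r * C + m * m      ≤⟨ +-monoʳ-≤ (2 * r * C) (≤-trans (≤-reflexive (cong₂ _*_ (sym (∑-size c S)) (sym (∑-size c S))))
                               (≤-trans (cauchy-schwarz (allFin r) (size c S)) (≤-reflexive (cong (_* Q) (length-tabulate {n = r} id))))) ⟩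
    2 * r * C + r * Q      ≡⟨ lem r C Q ⟩
    r * (2 * C + Q)        ≡⟨ cong (r *_) (cross-count c S) ⟩
    r * (m * m)            ≡⟨ +-comm (m * m) _ ⟩
    r′ * (m * m) + m * m   ∎)
    where
    open ≤-Reasoning
    m = length S
    C = length (Cr c S)
    Q = ∑ (allFin r) (λ i → size c S i * size c S i)
    lem : ∀ r C Q → 2 * r * C + r * Q ≡ r * (2 * C + Q)
    lem = solve-∀

  -- Cauchy-Schwarz is applied only to the other `r′` classes, while the size of class `j` stays
  -- exact. After rearranging, the square of the deficit `d` is left over.
  turán-unbalanced : ∀ c S j u → r * size c S j + u ≤ length S →
    2 * r * r′ * length (Cr c S) + u * u ≤ r′ * r′ * (length S * length S)
  turán-unbalanced c S j u h with pick {L = allFin r} (∈-allFin j)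
  ... | L , p = +-cancelʳ-≤ (r′ * (m * m)) _ _ (begin
    2 * r * r′ * C + u * u + r′ * (m * m)
      ≡⟨ +-assoc (2 * r * r′ * C) (u * u) _ ⟩
    2 * r * r′ * C + (u * u + r′ * (m * m))
      ≤⟨ +-monoʳ-≤ (2 * r * r′ * C) (begin
           u * u + r′ * (m * m)                                ≤⟨ +-monoˡ-≤ _ (*-mono-≤ u≤d u≤d) ⟩
           d * d + r′ * (m * m)                                ≡⟨ cong (λ m → d * d + r′ * (m * m)) m≡ ⟩
           d * d + r′ * ((r * x + d) * (r * x + d))            ≡⟨ ring r′ x d ⟩
           r′ * r * (x * x) + r * ((r′ * x + d) * (r′ * x + d)) ≤⟨ +-monoʳ-≤ (r′ * r * (x * x)) (*-monoʳ-≤ r cs) ⟩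
           r′ * r * (x * x) + r * (r′ * Q′)                    ≡⟨ ring₂ r r′ x Q′ ⟩
           r * r′ * (x * x + Q′)                               ≡⟨ cong (r * r′ *_) (∑-↭ (λ i → size c S i * size c S i) p) ⟨
           r * r′ * Q ∎) ⟩
    2 * r * r′ * C + r * r′ * Q
      ≡⟨ ring₃ r r′ C Q ⟩
    r * r′ * (2 * C + Q)
      ≡⟨ cong (r * r′ *_) (cross-count c S) ⟩
    r * r′ * (m * m)
      ≡⟨ ring₄ r′ (m * m) ⟩
    r′ * r′ * (m * m) + r′ * (m * m) ∎)
    where
    open ≤-Reasoning
    m = length S
    C = length (Cr c S)
    x = size c S j
    Q = ∑ (allFin r) (λ i → size c S i * size c S i)
    Q′ = ∑ L (λ i → size c S i * size c S i)
    d = m ∸ r * x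
    m≡ : m ≡ r * x + d
    m≡ = sym (m+[n∸m]≡n (≤-trans (m≤m+n (r * x) u) h))
    u≤d : u ≤ d
    u≤d = +-cancelˡ-≤ (r * x) u d (≤-trans h (≤-reflexive m≡))
    lenL : length L ≡ r′
    lenL = suc-injective (≡-trans (sym (Perm.↭-length p)) (length-tabulate {n = r} id))
    sumL : ∑ L (size c S) ≡ r′ * x + d
    sumL = +-cancelˡ-≡ x _ _ (≡-trans (sym (∑-↭ (size c S) p)) (≡-trans (∑-size c S) (≡-trans m≡ (+-assoc x (r′ * x) d))))
    cs : (r′ * x + d) * (r′ * x + d) ≤ r′ * Q′
    cs = subst₂ (λ s l → s * s ≤ l * Q′) sumL lenL (cauchy-schwarz L (size c S))
    ring : ∀ r′ x d → d * d + r′ * ((suc r′ * x + d) * (suc r′ * x + d)) ≡ r′ * suc r′ * (x * x) + suc r′ * ((r′ * x + d) * (r′ * x + d))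
    ring = solve-∀
    ring₂ : ∀ r r′ x Q → r′ * r * (x * x) + r * (r′ * Q) ≡ r * r′ * (x * x + Q)
    ring₂ = solve-∀
    ring₃ : ∀ r r′ C Q → 2 * r * r′ * C + r * r′ * Q ≡ r * r′ * (2 * C + Q)
    ring₃ = solve-∀
    ring₄ : ∀ r′ M → suc r′ * r′ * M ≡ r′ * r′ * M + r′ * M
    ring₄ = solve-∀

-- Sums over the bits of all pairs, split into monochromatic and cross pairs.

module Colour (n : ℕ) (r′ : ℕ) where

  open Edges n
  open Classes {n} {r′}

  private
    r = suc r′

  key² : V × V → Key
  key² (u , v) = key u v

  E² : Ω → V × V → Bool
  E² ω (u , v) = E ω u v

  pairs-vp : ∀ S → pairs S ≡ map key² (vp S)
  pairs-vp []      = refl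
  pairs-vp (x ∷ S) = ≡-trans (cong₂ _++_ (map-∘ S) (pairs-vp S)) (sym (map-++ key² (map (x ,_) S) (vp S)))

  vp-≢ : ∀ {S p} → Unique S → p ∈ vp S → proj₁ p ∈ S × proj₂ p ∈ S × proj₁ p ≢ proj₂ p
  vp-≢ {x ∷ S} (a ∷ u) p∈ with ∈-++⁻ (map (x ,_) S) p∈
  ... | inj₁ h with ∈-map⁻ (x ,_) h
  ...   | y , y∈ , refl = here refl , there y∈ , All.lookup a y∈
  vp-≢ {x ∷ S} (a ∷ u) p∈ | inj₂ h = let p , q , ne = vp-≢ u h in there p , there q , ne

  InK CrK : (V → Fin r) → List V → List Key
  InK c S = map key² (In c S)
  CrK c S = map key² (Cr c S)

  pairs-split : ∀ c S → pairs S ↭ InK c S ++ CrK c S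
  pairs-split c S = ↭-trans (↭-reflexive (pairs-vp S))
    (↭-trans (Perm.map⁺ key² (keep-split (mono c) (vp S))) (↭-reflexive (map-++ key² (In c S) (Cr c S))))

  length-InK+CrK : ∀ c S → length (In c S) + length (Cr c S) ≡ length (pairs S)
  length-InK+CrK c S = ≡-trans (cong₂ _+_ (sym (length-map key² (In c S))) (sym (length-map key² (Cr c S))))
    (≡-trans (sym (length-++ (InK c S))) (sym (Perm.↭-length (pairs-split c S))))

  CrK-∈ : ∀ {c S u v} → u ∈ S → v ∈ S → c u ≢ c v → key u v ∈ CrK c S
  CrK-∈ {c} {S} {u} {v} u∈ v∈ ne = go S u∈ v∈
    where
    sw : ∀ {x y} L → c x ≢ c y → (x , y) ∈ L → (x , y) ∈ keep (not ∘ mono c) L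
    sw L ne h = ∈-keep⁺ (not ∘ mono c) h (cong not (==-false ne))
    go : ∀ S → u ∈ S → v ∈ S → key u v ∈ CrK c S
    go S u∈ v∈ with find-pair S u∈ v∈
      where
      find-pair : ∀ S → u ∈ S → v ∈ S → ((u , v) ∈ vp S) ⊎ ((v , u) ∈ vp S)
      find-pair (x ∷ S) (here refl) (here refl) = contradiction refl ne
      find-pair (x ∷ S) (here refl) (there v∈)  = inj₁ (∈-++⁺ˡ (∈-map⁺ (x ,_) v∈))
      find-pair (x ∷ S) (there u∈)  (here refl) = inj₂ (∈-++⁺ˡ (∈-map⁺ (x ,_) u∈))
      find-pair (x ∷ S) (there u∈)  (there v∈) with find-pair S u∈ v∈
      ... | inj₁ h = inj₁ (∈-++⁺ʳ (map (x ,_) S) h)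
      ... | inj₂ h = inj₂ (∈-++⁺ʳ (map (x ,_) S) h)
    ... | inj₁ h = ∈-map⁺ key² (sw (vp S) ne h)
    ... | inj₂ h = subst (_∈ CrK c S) (key-sym v u) (∈-map⁺ key² (sw (vp S) (ne ∘ sym) h))

  private
    𝔼-single : ∀ {u v} → u ≢ v → ∀ (g : Bool → ℕ) ω → 𝔼 (key u v ∷ []) ω (λ ω → g (E ω u v)) ≤ g false + g true
    𝔼-single {u} {v} ne g ω = ≤-reflexive (cong₂ _+_ (cong g (val false)) (≡-trans (+-identityʳ _) (cong g (val true))))
      where
      val : ∀ b → E (ω [ key u v ]≔ b) u v ≡ b
      val b = ≡-trans (E-≢ _ ne) (lookup∘update (key u v) ω b)

  -- Bits inside the classes and bits across them are disjoint, so the weight of the inside bits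
  -- comes out of the sum over the cross bits. The cross sum is bounded at every setting, and the
  -- weight factors over single bits.
  𝔼-coloured : ∀ {S} c → Unique S → (g : Bool → ℕ) (Y : Ω → ℕ) (M D : ℕ) →
    (∀ ω → M * 𝔼 (CrK c S) ω Y ≤ D) →
    ∀ ω → M * 𝔼 (pairs S) ω (λ ω → ∏ (In c S) (λ p → g (E² ω p)) * Y ω) ≤ (g false + g true) ^ length (In c S) * D
  𝔼-coloured {S} c u g Y M D hY ω = begin
    M * 𝔼 (pairs S) ω (λ ω → W ω * Y ω)
      ≡⟨ cong (M *_) (≡-trans (𝔼-↭ (pairs-split c S) ω _) (𝔼-++ (InK c S) (CrK c S) ω _)) ⟩
    M * 𝔼 (InK c S) ω (λ ω → 𝔼 (CrK c S) ω (λ ω → W ω * Y ω))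
      ≡⟨ cong (M *_) (𝔼-cong (InK c S) ω λ ω → 𝔼-pull (CrK c S) ω Y W W⟂) ⟩
    M * 𝔼 (InK c S) ω (λ ω → W ω * 𝔼 (CrK c S) ω Y)
      ≡⟨ ∑-*ˡ (enum (InK c S) ω) M _ ⟨
    𝔼 (InK c S) ω (λ ω → M * (W ω * 𝔼 (CrK c S) ω Y))
      ≤⟨ 𝔼-mono (InK c S) ω (λ ω → ≤-trans (≤-reflexive (lem M (W ω) _)) (*-monoʳ-≤ (W ω) (hY ω))) ⟩
    𝔼 (InK c S) ω (λ ω → W ω * D)
      ≡⟨ ∑-*ʳ (enum (InK c S) ω) D W ⟩
    𝔼 (InK c S) ω W * D
      ≡⟨ cong (_* D) (cong (λ Q → 𝔼 Q ω W) (singles (In c S))) ⟩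
    𝔼 (concatMap (λ p → key² p ∷ []) (In c S)) ω W * D
      ≤⟨ *-monoˡ-≤ D (𝔼-∏ (In c S) (λ p → key² p ∷ []) (λ p ω → g (E² ω p)) (λ _ → g false + g true) indep
           (λ p p∈ → 𝔼-single (ne p∈) g) ω) ⟩
    ∏ (In c S) (λ _ → g false + g true) * D
      ≡⟨ cong (_* D) (∏-const (In c S) _) ⟩
    (g false + g true) ^ length (In c S) * D ∎
    where
    open ≤-Reasoning
    lem : ∀ a b c → a * (b * c) ≡ b * (a * c)
    lem = solve-∀
    W : Ω → ℕ
    W ω = ∏ (In c S) (λ p → g (E² ω p))
    singles : ∀ L → map key² L ≡ concatMap (λ p → key² p ∷ []) L
    singles []      = refl
    singles (p ∷ L) = cong (key² p ∷_) (singles L)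
    ne : ∀ {p} → p ∈ In c S → proj₁ p ≢ proj₂ p
    ne p∈ = proj₂ (proj₂ (vp-≢ u (proj₁ (∈-keep⁻ (mono c) p∈))))
    uK : Unique (InK c S ++ CrK c S)
    uK = unique-↭ (pairs-split c S) (unique-pairs u)
    off : ∀ {p e} → e ≢ key² p → ∀ ω b → g (E² (ω [ e ]≔ b) p) ≡ g (E² ω p)
    off {p} {e} e≢ ω b = cong g (E-upd ω e b _ _ e≢)
    W⟂ : W ⟂ CrK c S
    W⟂ = ⟂-∏ (In c S) (λ p ω → g (E² ω p)) λ p p∈ ω e b e∈ →
      off {p} (λ { refl → unique-disj (InK c S) uK (∈-map⁺ key² p∈) e∈ }) ω b
    indep : AllPairs (λ p p′ → (λ ω → g (E² ω p)) ⟂ (key² p′ ∷ [])) (In c S)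
    indep = go (In c S) (unique-++ˡ (InK c S) uK)
      where
      go : ∀ L → Unique (map key² L) → AllPairs (λ p p′ → (λ ω → g (E² ω p)) ⟂ (key² p′ ∷ [])) L
      go []      _ = []
      go (p ∷ L) (a ∷ uL) = All.tabulate (λ p′∈ → λ { ω e b (here refl) → off {p} (λ eq → All.lookup a (∈-map⁺ key² p′∈) (sym eq)) ω b }) ∷ go L uL

  𝔼-proper : ∀ {S} c → Unique S → ∀ ω →
    𝔼 (pairs S) ω (λ ω → ∏ (In c S) (λ p → 𝟙 (not (E² ω p)))) ≤ 2 ^ length (Cr c S)
  𝔼-proper {S} c u ω = begin
    𝔼 (pairs S) ω (λ ω → ∏ (In c S) (λ p → 𝟙 (not (E² ω p))))
      ≡⟨ ≡-trans (𝔼-cong (pairs S) ω λ ω → sym (*-identityʳ _)) (sym (*-identityˡ _)) ⟩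
    1 * 𝔼 (pairs S) ω (λ ω → ∏ (In c S) (λ p → 𝟙 (not (E² ω p))) * 1)
      ≤⟨ 𝔼-coloured c u (λ b → 𝟙 (not b)) (λ _ → 1) 1 (2 ^ length (Cr c S))
           (λ ω → ≤-reflexive (≡-trans (*-identityˡ _) (≡-trans (𝔼-const (CrK c S) ω 1)
             (≡-trans (*-identityʳ _) (cong (2 ^_) (length-map key² (Cr c S))))))) ω ⟩
    1 ^ length (In c S) * 2 ^ length (Cr c S)
      ≡⟨ ≡-trans (cong (_* 2 ^ length (Cr c S)) (^-zeroˡ (length (In c S)))) (*-identityˡ _) ⟩
    2 ^ length (Cr c S) ∎
    where open ≤-Reasoning

  monoEdges : Ω → (V → Fin r) → List V → ℕ
  monoEdges ω c S = cnt (E² ω) (In c S)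

  -- A missing inside edge weighs `Λ` and a present one weighs 1. With N inside pairs, a graph with
  -- at most `y` inside edges has weight at least Λ^(N-y), and each inside bit sums to Λ + 1.
  𝔼-few-mono : ∀ {S} c → Unique S → (Y : Ω → ℕ) (M D Λ y : ℕ) → .{{NonZero Λ}} →
    (∀ ω → M * 𝔼 (CrK c S) ω Y ≤ D) →
    ∀ ω → Λ ^ length (In c S) * (M * 𝔼 (pairs S) ω (λ ω → 𝟙 (monoEdges ω c S <ᵇ suc y) * Y ω)) ≤
      Λ ^ y * (suc Λ ^ length (In c S) * D)
  𝔼-few-mono {S} c u Y M D Λ y hY ω = begin
    Λ ^ N * (M * 𝔼 (pairs S) ω (λ ω → 𝟙 (monoEdges ω c S <ᵇ suc y) * Y ω))
      ≡⟨ lem (Λ ^ N) M _ ⟩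
    M * (Λ ^ N * 𝔼 (pairs S) ω (λ ω → 𝟙 (monoEdges ω c S <ᵇ suc y) * Y ω))
      ≡⟨ cong (M *_) (∑-*ˡ (enum (pairs S) ω) (Λ ^ N) _) ⟨
    M * 𝔼 (pairs S) ω (λ ω → Λ ^ N * (𝟙 (monoEdges ω c S <ᵇ suc y) * Y ω))
      ≤⟨ *-monoʳ-≤ M (𝔼-mono (pairs S) ω pt) ⟩
    M * 𝔼 (pairs S) ω (λ ω → Λ ^ y * (∏ (In c S) (λ p → g (E² ω p)) * Y ω))
      ≡⟨ cong (M *_) (∑-*ˡ (enum (pairs S) ω) (Λ ^ y) _) ⟩
    M * (Λ ^ y * 𝔼 (pairs S) ω (λ ω → ∏ (In c S) (λ p → g (E² ω p)) * Y ω))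
      ≡⟨ lem M (Λ ^ y) _ ⟩
    Λ ^ y * (M * 𝔼 (pairs S) ω (λ ω → ∏ (In c S) (λ p → g (E² ω p)) * Y ω))
      ≤⟨ *-monoʳ-≤ (Λ ^ y) (𝔼-coloured c u g Y M D hY ω) ⟩
    Λ ^ y * ((Λ ^ 1 + 1) ^ N * D)
      ≡⟨ cong (λ t → Λ ^ y * (t ^ N * D)) (≡-trans (+-comm (Λ ^ 1) 1) (cong suc (*-identityʳ Λ))) ⟩
    Λ ^ y * (suc Λ ^ N * D) ∎
    where
    open ≤-Reasoning
    N = length (In c S)
    g : Bool → ℕ
    g b = Λ ^ 𝟙 (not b)
    lem : ∀ a b c → a * (b * c) ≡ b * (a * c)
    lem = solve-∀
    pt : ∀ ω → Λ ^ N * (𝟙 (monoEdges ω c S <ᵇ suc y) * Y ω) ≤ Λ ^ y * (∏ (In c S) (λ p → g (E² ω p)) * Y ω)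
    pt ω with monoEdges ω c S <ᵇ suc y in eq
    ... | false = ≤-trans (≤-reflexive (*-zeroʳ (Λ ^ N))) z≤n
    ... | true  = begin
      Λ ^ N * (1 * Y ω)            ≡⟨ cong (Λ ^ N *_) (*-identityˡ (Y ω)) ⟩
      Λ ^ N * Y ω                  ≤⟨ *-monoˡ-≤ (Y ω) (begin
        Λ ^ N                                                        ≡⟨ cong (Λ ^_) (cnt-split (E² ω) (In c S)) ⟨
        Λ ^ (monoEdges ω c S + cnt (not ∘ E² ω) (In c S))            ≤⟨ ^-monoʳ-≤ Λ (+-monoˡ-≤ _ (s≤s⁻¹ (<ᵇ-true⁻ {monoEdges ω c S} eq))) ⟩
        Λ ^ (y + cnt (not ∘ E² ω) (In c S))                          ≡⟨ ^-distribˡ-+-* Λ y (cnt (not ∘ E² ω) (In c S)) ⟩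
        Λ ^ y * Λ ^ cnt (not ∘ E² ω) (In c S)                        ≡⟨ cong (Λ ^ y *_) (∏-pow (In c S) Λ _) ⟨
        Λ ^ y * ∏ (In c S) (λ p → g (E² ω p)) ∎) ⟩
      Λ ^ y * ∏ (In c S) (λ p → g (E² ω p)) * Y ω ≡⟨ *-assoc (Λ ^ y) _ _ ⟩
      Λ ^ y * (∏ (In c S) (λ p → g (E² ω p)) * Y ω) ∎

  monoEdges≤ : ∀ ω c S → monoEdges ω c S ≤ ∑ S (λ u → cnt (λ v → E ω u v ∧ (c u == c v)) S)
  monoEdges≤ ω c S = ≤-trans (≤-reflexive (≡-trans (cnt-keep (mono c) (E² ω) (vp S)) (∑-cong (vp S) λ p → cong 𝟙 (Bool.∧-comm (mono c p) _)))) (go S)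
    where
    h : V → V → ℕ
    h u v = 𝟙 (E ω u v ∧ (c u == c v))
    go : ∀ S → ∑ (vp S) (λ p → 𝟙 (E² ω p ∧ mono c p)) ≤ ∑ S (λ u → ∑ S (h u))
    go []      = z≤n
    go (x ∷ S) = begin
      ∑ (map (x ,_) S ++ vp S) (λ p → 𝟙 (E² ω p ∧ mono c p))
        ≡⟨ ≡-trans (∑-++ (map (x ,_) S) (vp S) _) (cong (_+ ∑ (vp S) _) (∑-map (x ,_) S _)) ⟩
      ∑ S (h x) + ∑ (vp S) (λ p → 𝟙 (E² ω p ∧ mono c p))
        ≤⟨ +-mono-≤ (m≤n+m (∑ S (h x)) (h x x)) (≤-trans (go S) (∑-mono S λ u → m≤n+m (∑ S (h u)) (h u x))) ⟩
      ∑ (x ∷ S) (λ u → ∑ (x ∷ S) (h u)) ∎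
      where open ≤-Reasoning

-- Edge-disjoint r-tuples of blocks.

∏-zero : ∀ {A : Set} (L : List A) f → ∏ L f ≡ 0 → ∃ λ x → x ∈ L × f x ≡ 0
∏-zero (x ∷ L) f h with m*n≡0⇒m≡0∨n≡0 (f x) h
... | inj₁ e = x , here refl , e
... | inj₂ e = let y , y∈ , e′ = ∏-zero L f e in y , there y∈ , e′

-- Integer forms of Bernoulli's inequality.

bernoulli : ∀ a k → a ^ k * (a + k) ≤ suc a ^ k * a
bernoulli a zero    = ≤-reflexive (cong (1 *_) (+-identityʳ a))
bernoulli a (suc k) = begin
  a * a ^ k * (a + suc k)              ≤⟨ m≤m+n _ (a ^ k * k) ⟩
  a * a ^ k * (a + suc k) + a ^ k * k  ≡⟨ lem a (a ^ k) k ⟩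
  suc a * (a ^ k * (a + k))            ≤⟨ *-monoʳ-≤ (suc a) (bernoulli a k) ⟩
  suc a * (suc a ^ k * a)              ≡⟨ *-assoc (suc a) (suc a ^ k) a ⟨
  suc a ^ suc k * a ∎
  where
  open ≤-Reasoning
  lem : ∀ a p k → a * p * (a + suc k) + p * k ≡ suc a * (p * (a + k))
  lem = solve-∀

-- (1 - 1/G)^G ≤ 1/2 for G = a + 1: of `G` independent trials with success probability 1/G all fail
-- with probability at most one half.
2*a^G≤G^G : ∀ a → 2 * a ^ suc a ≤ suc a ^ suc a
2*a^G≤G^G zero    = z≤n
2*a^G≤G^G a@(suc _) = *-cancelʳ-≤ (2 * a ^ suc a) (suc a ^ suc a) a (begin
  2 * a ^ suc a * a          ≤⟨ m≤m+n _ (a ^ suc a) ⟩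
  2 * a ^ suc a * a + a ^ suc a ≡⟨ lem a (a ^ suc a) ⟩
  a ^ suc a * (a + suc a)    ≤⟨ bernoulli a (suc a) ⟩
  suc a ^ suc a * a ∎)
  where
  open ≤-Reasoning
  lem : ∀ a p → 2 * p * a + p ≡ p * (a + suc a)
  lem = solve-∀

-- Every `g` factors b/a halve the product, so `t` of them gain 2^v.
pow-gap : ∀ {a b} g v t → b ≤ a → 2 * b ^ g ≤ a ^ g → g * v ≤ t → 2 ^ v * b ^ t ≤ a ^ t
pow-gap {a} {b} g v t b≤a h le = begin
  2 ^ v * b ^ t                  ≡⟨ cong (λ t → 2 ^ v * b ^ t) (sym eq) ⟩
  2 ^ v * b ^ (g * v + d)        ≡⟨ cong (2 ^ v *_) (≡-trans (^-distribˡ-+-* b (g * v) d) (cong (_* b ^ d) (sym (^-*-assoc b g v)))) ⟩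
  2 ^ v * ((b ^ g) ^ v * b ^ d)  ≡⟨ *-assoc (2 ^ v) _ _ ⟨
  2 ^ v * (b ^ g) ^ v * b ^ d    ≡⟨ cong (_* b ^ d) (sym (^-distribʳ-* v 2 (b ^ g))) ⟩
  (2 * b ^ g) ^ v * b ^ d        ≤⟨ *-mono-≤ (^-monoˡ-≤ v h) (^-monoˡ-≤ d b≤a) ⟩
  (a ^ g) ^ v * a ^ d            ≡⟨ cong (_* a ^ d) (^-*-assoc a g v) ⟩
  a ^ (g * v) * a ^ d            ≡⟨ ^-distribˡ-+-* a (g * v) d ⟨
  a ^ (g * v + d)                ≡⟨ cong (a ^_) eq ⟩
  a ^ t ∎
  where
  open ≤-Reasoning
  d = t ∸ g * v
  eq : g * v + d ≡ t
  eq = m+[n∸m]≡n le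

-- The counterpart of `pow-gap`: `μ` factors b/a at most double the product, so `t` of them cost at
-- most 2^v.
pow-near : ∀ {a b} μ v t → .{{NonZero a}} → a ≤ b → b ^ μ ≤ 2 * a ^ μ → t ≤ μ * v → b ^ t ≤ 2 ^ v * a ^ t
pow-near {a} {b} μ v t a≤b h le = *-cancelʳ-≤ (b ^ t) (2 ^ v * a ^ t) (a ^ d) {{m^n≢0 a d}} (begin
  b ^ t * a ^ d            ≤⟨ *-monoʳ-≤ (b ^ t) (^-monoˡ-≤ d a≤b) ⟩
  b ^ t * b ^ d            ≡⟨ ^-distribˡ-+-* b t d ⟨
  b ^ (t + d)              ≡⟨ cong (b ^_) eq ⟩
  b ^ (μ * v)              ≡⟨ ^-*-assoc b μ v ⟨
  (b ^ μ) ^ v              ≤⟨ ^-monoˡ-≤ v h ⟩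
  (2 * a ^ μ) ^ v          ≡⟨ ≡-trans (^-distribʳ-* v 2 (a ^ μ)) (cong (2 ^ v *_) (^-*-assoc a μ v)) ⟩
  2 ^ v * a ^ (μ * v)      ≡⟨ cong (λ t → 2 ^ v * a ^ t) eq ⟨
  2 ^ v * a ^ (t + d)      ≡⟨ cong (2 ^ v *_) (^-distribˡ-+-* a t d) ⟩
  2 ^ v * (a ^ t * a ^ d)  ≡⟨ *-assoc (2 ^ v) _ _ ⟨
  2 ^ v * a ^ t * a ^ d ∎)
  where
  open ≤-Reasoning
  d = μ * v ∸ t
  eq : t + d ≡ μ * v
  eq = m+[n∸m]≡n le

bernoulli′ : ∀ a k d → suc a ≡ k + d → suc a ^ k * d ≤ a ^ k * suc a
bernoulli′ a zero    d e = ≤-reflexive (cong (1 *_) (sym e))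
bernoulli′ a (suc k) d e = begin
  suc a * suc a ^ k * d       ≡⟨ lem (suc a) (suc a ^ k) d ⟩
  suc a ^ k * (suc a * d)     ≤⟨ *-monoʳ-≤ (suc a ^ k) (begin
    suc a * d                   ≤⟨ +-monoˡ-≤ (a * d) d≤a ⟩
    a + a * d                   ≡⟨ *-suc a d ⟨
    a * suc d ∎) ⟩
  suc a ^ k * (a * suc d)     ≡⟨ lem₂ (suc a ^ k) a (suc d) ⟩
  a * (suc a ^ k * suc d)     ≤⟨ *-monoʳ-≤ a (bernoulli′ a k (suc d) (≡-trans e (sym (+-suc k d)))) ⟩
  a * (a ^ k * suc a)         ≡⟨ *-assoc a (a ^ k) (suc a) ⟨
  a * a ^ k * suc a ∎
  where
  open ≤-Reasoning
  d≤a : d ≤ a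
  d≤a = ≤-trans (m≤n+m d k) (≤-reflexive (suc-injective (sym e)))
  lem : ∀ a b c → a * b * c ≡ b * (a * c)
  lem = solve-∀
  lem₂ : ∀ a b c → a * (b * c) ≡ b * (a * c)
  lem₂ = solve-∀

-- (1 + 1/2μ)^μ is at most (2μ+1)/(μ+1), by Bernoulli's inequality for its reciprocal.
near-2μ : ∀ μ → suc (2 * μ) ^ μ ≤ 2 * (2 * μ) ^ μ
near-2μ μ = *-cancelʳ-≤ (suc (2 * μ) ^ μ) (2 * (2 * μ) ^ μ) (suc μ) (begin
  suc (2 * μ) ^ μ * suc μ     ≤⟨ bernoulli′ (2 * μ) μ (suc μ) (lem μ) ⟩
  (2 * μ) ^ μ * suc (2 * μ)   ≤⟨ m≤m+n _ ((2 * μ) ^ μ) ⟩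
  (2 * μ) ^ μ * suc (2 * μ) + (2 * μ) ^ μ ≡⟨ lem₂ ((2 * μ) ^ μ) μ ⟩
  2 * (2 * μ) ^ μ * suc μ ∎)
  where
  open ≤-Reasoning
  lem : ∀ μ → suc (2 * μ) ≡ μ + suc μ
  lem = solve-∀
  lem₂ : ∀ p μ → p * suc (2 * μ) + p ≡ 2 * p * suc μ
  lem₂ = solve-∀

-- Blocks of consecutive entries, and lines through the blocks.

blk : ∀ {A : Set} → ℕ → ℕ → List A → List A
blk q t L = take q (drop (t * q) L)

blk-⊆ : ∀ {A : Set} q t {L : List A} {x} → x ∈ blk q t L → x ∈ L
blk-⊆ q t {L} x∈ = ∈-drop⁻ (t * q) (∈-take⁻ q x∈)

drop-unique : ∀ {A : Set} k {L : List A} → Unique L → Unique (drop k L)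
drop-unique zero    u       = u
drop-unique (suc k) []      = []
drop-unique (suc k) (a ∷ u) = drop-unique k u

length-blk : ∀ {A : Set} q t (L : List A) → t * q + q ≤ length L → length (blk q t L) ≡ q
length-blk q t L le = length-take≤ q (drop (t * q) L) (+-cancelˡ-≤ (t * q) q _ (≤-trans le (go (t * q) L)))
  where
  go : ∀ {A : Set} k (L : List A) → length L ≤ k + length (drop k L)
  go zero    L       = ≤-refl
  go (suc k) []      = z≤n
  go (suc k) (x ∷ L) = s≤s (go k L)

blk-disj< : ∀ {A : Set} q {t t′} {L : List A} {x} → Unique L → t < t′ → x ∈ blk q t L → x ∈ blk q t′ L → ⊥
blk-disj< q {t} {t′} {L} {x} u lt x∈ x∈′ =
  unique-disj (take q M) (subst Unique (sym (take++drop≡id q M)) (drop-unique (t * q) u)) x∈ inDrop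
  where
  M = drop (t * q) L
  d = t′ ∸ suc t
  eq : t′ * q ≡ t * q + q + d * q
  eq = ≡-trans (cong (_* q) (sym (m+[n∸m]≡n lt))) (lem t d q)
    where
    lem : ∀ t d q → (suc t + d) * q ≡ t * q + q + d * q
    lem = solve-∀
  inDrop : x ∈ drop q M
  inDrop = ∈-drop⁻ (d * q) (subst (x ∈_)
    (≡-trans (cong (λ s → drop s L) eq) (≡-trans (sym (drop-drop (t * q + q) (d * q) L)) (cong (drop (d * q)) (sym (drop-drop (t * q) q L)))))
    (∈-take⁻ q x∈′))

blk-disj : ∀ {A : Set} q {t t′} {L : List A} {x} → Unique L → x ∈ blk q t L → x ∈ blk q t′ L → t ≡ t′
blk-disj q {t} {t′} u x∈ x∈′ with <-cmp t t′
... | tri< lt _ _ = ⊥-elim (blk-disj< q u lt x∈ x∈′)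
... | tri≈ _ e _  = e
... | tri> _ _ gt = ⊥-elim (blk-disj< q u gt x∈′ x∈)

unique-concatMap : ∀ {A B : Set} (f : A → List B) {L} → Unique L → (∀ x → x ∈ L → Unique (f x)) →
  (∀ x y → x ∈ L → y ∈ L → x ≢ y → ∀ {z} → z ∈ f x → z ∈ f y → ⊥) → Unique (concatMap f L)
unique-concatMap f []      h d = []
unique-concatMap f {x ∷ L} (a ∷ u) h d = unique-++ (h x (here refl))
  (unique-concatMap f u (λ y y∈ → h y (there y∈)) λ y z y∈ z∈ → d y z (there y∈) (there z∈))
  λ z∈ z∈′ → let y , y∈ , h′ = ∈-concatMap⁻′ f L z∈′ in d x y (here refl) (there y∈) (All.lookup a y∈) z∈ h′

lines-meet< : ∀ i j a b a′ b′ → i < j → a + i * b ≡ a′ + i * b′ → a + j * b ≡ a′ + j * b′ → a ≡ a′ × b ≡ b′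
lines-meet< i j a b a′ b′ lt e₁ e₂ = +-cancelʳ-≡ (i * b) a a′ (≡-trans e₁ (cong (λ t → a′ + i * t) (sym b≡))) , b≡
  where
  d = j ∸ suc i
  split : ∀ x y → x + j * y ≡ (x + i * y) + suc d * y
  split x y = ≡-trans (cong (λ t → x + t * y) (sym (m+[n∸m]≡n lt))) (lem x y i d)
    where
    lem : ∀ x y i d → x + (suc i + d) * y ≡ (x + i * y) + suc d * y
    lem = solve-∀
  b≡ : b ≡ b′
  b≡ = *-cancelˡ-≡ b b′ (suc d) (+-cancelˡ-≡ (a + i * b) _ _
    (≡-trans (sym (split a b)) (≡-trans e₂ (≡-trans (split a′ b′) (cong (_+ suc d * b′) (sym e₁))))))

-- Two different lines share at most one point. With classes as abscissas and block numbers as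
-- ordinates, two different tuples of blocks share at most one block, hence no cross pair.
lines-meet : ∀ i j a b a′ b′ → i ≢ j → a + i * b ≡ a′ + i * b′ → a + j * b ≡ a′ + j * b′ → a ≡ a′ × b ≡ b′
lines-meet i j a b a′ b′ i≢j e₁ e₂ with <-cmp i j
... | tri< lt _ _ = lines-meet< i j a b a′ b′ lt e₁ e₂
... | tri≈ _ e _  = contradiction e i≢j
... | tri> _ _ gt = lines-meet< j i a b a′ b′ gt e₂ e₁

length-cartesianProduct : ∀ {A B : Set} (L : List A) (M : List B) → length (cartesianProduct L M) ≡ length L * length M
length-cartesianProduct []      M = refl
length-cartesianProduct (x ∷ L) M = ≡-trans (length-++ (map (x ,_) M)) (cong₂ _+_ (length-map (x ,_) M) (length-cartesianProduct L M))

mlen : ℕ → ℕ → ℕ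
mlen zero    q = 0
mlen (suc ρ) q = ρ * q * q + mlen ρ q

module Tuples (n : ℕ) (r′ : ℕ) where

  open Edges n
  open Rows n using (enum-off; 𝔼-cong∈)
  open Classes {n} {r′}
  open Colour n r′

  private
    r = suc r′

  mkeys : ∀ {ρ} → Vec (List V) ρ → List Key
  mkeys []      = []
  mkeys (Z ∷ A) = cross Z (flat A) ++ mkeys A

  ∈-mkeys⁻ : ∀ {ρ} (A : Vec (List V) ρ) {e} → e ∈ mkeys A →
    ∃ λ i → ∃ λ j → ∃ λ u → ∃ λ v → i ≢ j × u ∈ lookup A i × v ∈ lookup A j × e ≡ key u v
  ∈-mkeys⁻ (Z ∷ A) e∈ with ∈-++⁻ (cross Z (flat A)) e∈
  ... | inj₁ h = let z , x , z∈ , x∈ , eq = ∈-cross Z (flat A) h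
                     j , x∈j = ∈-flat⁻ A x∈
                 in suc j , zero , x , z , (λ ()) , x∈j , z∈ , eq
  ... | inj₂ h = let i , j , u , v , ne , u∈ , v∈ , eq = ∈-mkeys⁻ A h
                 in suc i , suc j , u , v , ne ∘ Fin.suc-injective , u∈ , v∈ , eq

  ∈-cross⁺ : ∀ Z R {z x} → z ∈ Z → x ∈ R → key x z ∈ cross Z R
  ∈-cross⁺ Z R {z} {x} z∈ x∈ = ∈-concatMap⁺′ (λ x → map (key x) Z) x∈ (∈-map⁺ (key x) z∈)

  ∈-mkeys⁺ : ∀ {ρ} (A : Vec (List V) ρ) i j → i ≢ j → ∀ {u v} → u ∈ lookup A i → v ∈ lookup A j → key u v ∈ mkeys A
  ∈-mkeys⁺ (Z ∷ A) zero    zero    ne u∈ v∈ = contradiction refl ne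
  ∈-mkeys⁺ (Z ∷ A) zero    (suc j) ne {u} {v} u∈ v∈ =
    ∈-++⁺ˡ (subst (_∈ cross Z (flat A)) (key-sym v u) (∈-cross⁺ Z (flat A) u∈ (∈-flat⁺ A j v∈)))
  ∈-mkeys⁺ (Z ∷ A) (suc i) zero    ne u∈ v∈ = ∈-++⁺ˡ (∈-cross⁺ Z (flat A) v∈ (∈-flat⁺ A i u∈))
  ∈-mkeys⁺ (Z ∷ A) (suc i) (suc j) ne u∈ v∈ = ∈-++⁺ʳ (cross Z (flat A)) (∈-mkeys⁺ A i j (ne ∘ cong suc) u∈ v∈)

  mkeys-unique : ∀ {ρ} (A : Vec (List V) ρ) → Unique (flat A) → Unique (mkeys A)
  mkeys-unique []      u = []
  mkeys-unique (Z ∷ A) u = unique-++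
    (unique-++ʳ (pairs (flat A)) (unique-++ʳ (pairs Z) (unique-↭ (pairs-++ Z (flat A)) (unique-pairs u))))
    (mkeys-unique A (unique-++ʳ Z u))
    λ e∈ e∈′ → let i , j , x , y , _ , x∈ , y∈ , eq = ∈-mkeys⁻ A e∈′ in
      cross-off u e∈ (∈-flat⁺ A i x∈) (∈-flat⁺ A j y∈) eq

  length-cross : ∀ Z R → length (cross Z R) ≡ length R * length Z
  length-cross Z []      = refl
  length-cross Z (x ∷ R) = ≡-trans (length-++ (map (key x) Z)) (cong₂ _+_ (length-map (key x) Z) (length-cross Z R))

  length-mkeys : ∀ {ρ} q (A : Vec (List V) ρ) → (∀ i → length (lookup A i) ≡ q) → length (mkeys A) ≡ mlen ρ q
  length-mkeys q []      h = refl
  length-mkeys {suc ρ} q (Z ∷ A) h = ≡-trans (length-++ (cross Z (flat A))) (cong₂ _+_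
    (≡-trans (length-cross Z (flat A)) (cong₂ _*_ (length-flat q A λ i → h (suc i)) (h zero))) (length-mkeys q A λ i → h (suc i)))

  allT : Ω → List Key → Bool
  allT ω []      = true
  allT ω (e ∷ Q) = lookup ω e ∧ allT ω Q

  allT-upd : ∀ Q {ω e b} → e ∉ Q → allT (ω [ e ]≔ b) Q ≡ allT ω Q
  allT-upd []      e∉ = refl
  allT-upd (f ∷ Q) {ω} {e} {b} e∉ = cong₂ _∧_ (lookup∘update′ (λ eq → e∉ (here (sym eq))) ω b) (allT-upd Q (e∉ ∘ there))

  allT-∈ : ∀ Q {ω e} → allT ω Q ≡ true → e ∈ Q → lookup ω e ≡ true
  allT-∈ (f ∷ Q) {ω} h (here refl) = proj₁ (∧-true {lookup ω f} h)
  allT-∈ (f ∷ Q) {ω} h (there e∈)  = allT-∈ Q (proj₂ (∧-true {lookup ω f} h)) e∈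

  -- The setting with all bits on is never counted.
  fail-bound : ∀ Q ω → Unique Q → suc (𝔼 Q ω (λ ω → 𝟙 (not (allT ω Q)))) ≤ 2 ^ length Q
  fail-bound []      ω u = ≤-refl
  fail-bound (e ∷ Q) ω (a ∷ u) = begin
    suc (𝔼 (e ∷ Q) ω f)                                       ≡⟨ cong suc (𝔼-∷ e Q ω f) ⟩
    suc (𝔼 Q (ω [ e ]≔ false) f + 𝔼 Q (ω [ e ]≔ true) f)      ≡⟨ +-suc _ _ ⟨
    𝔼 Q (ω [ e ]≔ false) f + suc (𝔼 Q (ω [ e ]≔ true) f)      ≤⟨ +-mono-≤ (𝔼-bound Q _ 1 (λ ω → 𝟙≤1 _)) (≤-trans (≤-reflexive (cong suc (𝔼-cong∈ Q _ on))) (fail-bound Q _ u)) ⟩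
    2 ^ length Q * 1 + 2 ^ length Q                           ≡⟨ lem (2 ^ length Q) ⟩
    2 ^ suc (length Q) ∎
    where
    open ≤-Reasoning
    lem : ∀ p → p * 1 + p ≡ 2 * p
    lem = solve-∀
    f : Ω → ℕ
    f ω = 𝟙 (not (lookup ω e ∧ allT ω Q))
    on : ∀ ω′ → ω′ ∈ enum Q (ω [ e ]≔ true) → f ω′ ≡ 𝟙 (not (allT ω′ Q))
    on ω′ h rewrite enum-off Q (ω [ e ]≔ true) (All≢⇒∉ a) h | lookup∘update e ω true = refl

  module Family (q y : ℕ) (X : Vec (List V) r) where

    -- The tuple (a, b) takes block a + i b from class `i`, a line in the sense of `lines-meet`.
    -- Thus r y blocks per class give y² tuples without a common cross pair: quadratically many
    -- independent trials for a complete multipartite subgraph.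
    D : Fin y × Fin y → Vec (List V) r
    D (a , b) = tabulate λ i → blk q (toℕ a + toℕ i * toℕ b) (lookup X i)

    D-at : ∀ τ i → lookup (D τ) i ≡ blk q (toℕ (proj₁ τ) + toℕ i * toℕ (proj₂ τ)) (lookup X i)
    D-at (a , b) i = lookup∘tabulate (λ i → blk q (toℕ a + toℕ i * toℕ b) (lookup X i)) i

    D-∈ : ∀ τ i {x} → x ∈ lookup (D τ) i → x ∈ blk q (toℕ (proj₁ τ) + toℕ i * toℕ (proj₂ τ)) (lookup X i)
    D-∈ τ i = subst (_ ∈_) (D-at τ i)

    D-⊆ : ∀ τ i {x} → x ∈ lookup (D τ) i → x ∈ lookup X i
    D-⊆ τ i x∈ = blk-⊆ q (toℕ (proj₁ τ) + toℕ i * toℕ (proj₂ τ)) (D-∈ τ i x∈)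

    family : List (Fin y × Fin y)
    family = cartesianProduct (allFin y) (allFin y)

    length-family : length family ≡ y * y
    length-family = ≡-trans (length-cartesianProduct (allFin y) (allFin y)) (cong₂ _*_ (length-tabulate {n = y} id) (length-tabulate {n = y} id))

    Fl : Ω → ℕ
    Fl ω = ∏ family (λ τ → 𝟙 (not (allT ω (mkeys (D τ)))))

    Fl-zero : ∀ ω → Fl ω ≡ 0 → ∃ λ τ → ∀ i j → i ≢ j → ∀ {u v} → u ∈ lookup (D τ) i → v ∈ lookup (D τ) j → lookup ω (key u v) ≡ true
    Fl-zero ω h with ∏-zero family _ h
    ... | τ , _ , e = τ , λ i j ne u∈ v∈ → allT-∈ (mkeys (D τ)) (on (allT ω (mkeys (D τ))) e) (∈-mkeys⁺ (D τ) i j ne u∈ v∈)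
      where
      on : ∀ b → 𝟙 (not b) ≡ 0 → b ≡ true
      on true _ = refl

    module _ (uX : ∀ i → Unique (lookup X i)) (lenX : ∀ i → r * y * q ≤ length (lookup X i)) where

      D-length : ∀ τ i → length (lookup (D τ) i) ≡ q
      D-length (a , b) i = ≡-trans (cong length (D-at (a , b) i)) (length-blk q (toℕ a + toℕ i * toℕ b) (lookup X i) (begin
        (toℕ a + toℕ i * toℕ b) * q + q ≡⟨ +-comm _ q ⟩
        suc (toℕ a + toℕ i * toℕ b) * q ≤⟨ *-monoˡ-≤ q (+-mono-≤ (Fin.toℕ<n a) (*-mono-≤ (s≤s⁻¹ (Fin.toℕ<n i)) (<⇒≤ (Fin.toℕ<n b)))) ⟩
        r * y * q                       ≤⟨ lenX i ⟩
        length (lookup X i) ∎))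
        where open ≤-Reasoning

      D-unique : ∀ τ i → Unique (lookup (D τ) i)
      D-unique τ i = subst Unique (sym (D-at τ i)) (take-unique q (drop-unique ((toℕ (proj₁ τ) + toℕ i * toℕ (proj₂ τ)) * q) (uX i)))

      module _ {S : List V} (uS : Unique S) (c : V → Fin r) (X⊆S : ∀ i {x} → x ∈ lookup X i → x ∈ S) (Xc : ∀ i {x} → x ∈ lookup X i → c x ≡ i) where

        flatD-unique : ∀ τ → Unique (flat (D τ))
        flatD-unique τ = flat-unique (D τ) (D-unique τ) λ i j ne x∈ x∈′ → ne (≡-trans (sym (Xc i (D-⊆ τ i x∈))) (Xc j (D-⊆ τ j x∈′)))

        meet : ∀ τ σ → ∀ {e} → e ∈ mkeys (D τ) → e ∈ mkeys (D σ) → τ ≡ σ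
        meet τ@(a , b) σ@(a′ , b′) e∈ e∈′ with ∈-mkeys⁻ (D τ) e∈ | ∈-mkeys⁻ (D σ) e∈′
        ... | i , j , u , v , ne , u∈ , v∈ , refl | i′ , j′ , u′ , v′ , ne′ , u∈′ , v∈′ , eq = go (key-inj eq)
          where
          same : ∀ i j → i ≢ j → ∀ {u v} → u ∈ lookup (D τ) i → v ∈ lookup (D τ) j → u ∈ lookup (D σ) i → v ∈ lookup (D σ) j → τ ≡ σ
          same i j ne u∈ v∈ u∈′ v∈′ =
            let p , p′ = lines-meet (toℕ i) (toℕ j) (toℕ a) (toℕ b) (toℕ a′) (toℕ b′) (ne ∘ Fin.toℕ-injective)
                      (blk-disj q (uX i) (D-∈ τ i u∈) (D-∈ σ i u∈′)) (blk-disj q (uX j) (D-∈ τ j v∈) (D-∈ σ j v∈′))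
            in cong₂ _,_ (Fin.toℕ-injective p) (Fin.toℕ-injective p′)
          align : ∀ {x} i i′ → x ∈ lookup (D τ) i → x ∈ lookup (D σ) i′ → x ∈ lookup (D σ) i
          align i i′ x∈ x∈′ = subst (λ t → _ ∈ lookup (D σ) t) (≡-trans (sym (Xc i′ (D-⊆ σ i′ x∈′))) (Xc i (D-⊆ τ i x∈))) x∈′
          go : (u ≡ u′ × v ≡ v′) ⊎ (u ≡ v′ × v ≡ u′) → τ ≡ σ
          go (inj₁ (refl , refl)) = same i j ne u∈ v∈ (align i i′ u∈ u∈′) (align j j′ v∈ v∈′)
          go (inj₂ (refl , refl)) = same i j ne u∈ v∈ (align i j′ u∈ v∈′) (align j i′ v∈ u∈′)

        family-unique : Unique family
        family-unique = Data.List.Relation.Unary.Unique.Propositional.Properties.cartesianProduct⁺ (allFin-unique y) (allFin-unique y)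

        -- A tuple is complete with probability 1/G, where G = 2^(mlen r q), and the y² tuples read
        -- disjoint sets of cross bits. So all of them fail with probability at most (1 - 1/G)^(y²),
        -- which is at most 2^(-v).
        Fl-bound : ∀ v → v * 2 ^ mlen r q ≤ y * y → ∀ ω → 2 ^ v * 𝔼 (CrK c S) ω Fl ≤ 2 ^ length (Cr c S)
        Fl-bound v hv ω with sub-↭ {L = CrK c S} {M = concatMap (λ τ → mkeys (D τ)) family}
            (unique-concatMap _ family-unique (λ τ _ → mkeys-unique (D τ) (flatD-unique τ)) (λ τ σ _ _ ne e∈ e∈′ → ne (meet τ σ e∈ e∈′))) inCr
          where
          inCr : ∀ {e} → e ∈ concatMap (λ τ → mkeys (D τ)) family → e ∈ CrK c S
          inCr e∈ with ∈-concatMap⁻′ (λ τ → mkeys (D τ)) family e∈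
          ... | τ , _ , h with ∈-mkeys⁻ (D τ) h
          ...   | i , j , u , v , ne , u∈ , v∈ , refl = CrK-∈ (X⊆S i (D-⊆ τ i u∈)) (X⊆S j (D-⊆ τ j v∈))
                  λ eq → ne (≡-trans (sym (Xc i (D-⊆ τ i u∈))) (≡-trans eq (Xc j (D-⊆ τ j v∈))))
        ... | rest , p = begin
          2 ^ v * 𝔼 (CrK c S) ω Fl
            ≡⟨ cong (2 ^ v *_) (≡-trans (𝔼-↭ (↭-trans p (Perm.++-comm K rest)) ω Fl) (𝔼-++ rest K ω Fl)) ⟩
          2 ^ v * 𝔼 rest ω (λ ω → 𝔼 K ω Fl)
            ≤⟨ *-monoʳ-≤ (2 ^ v) (𝔼-bound rest ω (a ^ (y * y)) inner) ⟩
          2 ^ v * (2 ^ length rest * a ^ (y * y))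
            ≡⟨ lem (2 ^ v) (2 ^ length rest) _ ⟩
          2 ^ length rest * (2 ^ v * a ^ (y * y))
            ≤⟨ *-monoʳ-≤ (2 ^ length rest) (pow-gap (suc a) v (y * y) (n≤1+n a) (2*a^G≤G^G a) (≤-trans (≤-reflexive (≡-trans (*-comm (suc a) v) (cong (v *_) (sym G≡)))) hv)) ⟩
          2 ^ length rest * suc a ^ (y * y)
            ≡⟨ cong (λ t → 2 ^ length rest * t ^ (y * y)) (sym G≡) ⟩
          2 ^ length rest * G ^ (y * y)
            ≡⟨ cong (2 ^ length rest *_) (^-*-assoc 2 (mlen r q) (y * y)) ⟩
          2 ^ length rest * 2 ^ (mlen r q * (y * y))
            ≡⟨ ^-distribˡ-+-* 2 (length rest) _ ⟨
          2 ^ (length rest + mlen r q * (y * y))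
            ≡⟨ cong (2 ^_) (≡-trans (+-comm (length rest) _) (sym lens)) ⟩
          2 ^ length (Cr c S) ∎
          where
          open ≤-Reasoning
          lem : ∀ a b c → a * (b * c) ≡ b * (a * c)
          lem = solve-∀
          K = concatMap (λ τ → mkeys (D τ)) family
          G = 2 ^ mlen r q
          a = pred G
          G≡ : G ≡ suc a
          G≡ = sym (suc-pred G {{m^n≢0 2 (mlen r q)}})
          lens : length (Cr c S) ≡ mlen r q * (y * y) + length rest
          lens = begin-equality
            length (Cr c S)   ≡⟨ length-map key² (Cr c S) ⟨
            length (CrK c S)  ≡⟨ ≡-trans (Perm.↭-length p) (length-++ K) ⟩
            length K + length rest ≡⟨ cong (_+ length rest) (begin-equality
              length K ≡⟨ length-concatMap _ family ⟩
              ∑ family (λ τ → length (mkeys (D τ))) ≡⟨ ∑-cong family (λ τ → length-mkeys q (D τ) (D-length τ)) ⟩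
              ∑ family (λ _ → mlen r q) ≡⟨ ∑-const family _ ⟩
              length family * mlen r q ≡⟨ ≡-trans (cong (_* mlen r q) length-family) (*-comm (y * y) _) ⟩
              mlen r q * (y * y) ∎) ⟩
            mlen r q * (y * y) + length rest ∎
          inner : ∀ ω → 𝔼 K ω Fl ≤ a ^ (y * y)
          inner ω = begin
            𝔼 K ω Fl ≤⟨ 𝔼-∏ family _ (λ τ ω → 𝟙 (not (allT ω (mkeys (D τ))))) (λ _ → a) indep each ω ⟩
            ∏ family (λ _ → a) ≡⟨ ≡-trans (∏-const family a) (cong (a ^_) length-family) ⟩
            a ^ (y * y) ∎
            where
            each : ∀ τ → τ ∈ family → ∀ ω → 𝔼 (mkeys (D τ)) ω (λ ω → 𝟙 (not (allT ω (mkeys (D τ))))) ≤ a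
            each τ _ ω = s≤s⁻¹ (≤-trans (fail-bound (mkeys (D τ)) ω (mkeys-unique (D τ) (flatD-unique τ)))
              (≤-reflexive (≡-trans (cong (2 ^_) (length-mkeys q (D τ) (D-length τ))) G≡)))
            indep : AllPairs (λ τ σ → (λ ω → 𝟙 (not (allT ω (mkeys (D τ))))) ⟂ mkeys (D σ)) family
            indep = AllPairs.map (λ {τ} {σ} ne ω e b e∈ → cong (λ t → 𝟙 (not t)) (allT-upd (mkeys (D τ)) λ e∈′ → ne (meet τ σ e∈′ e∈))) family-unique

-- Two vertices with a common sparse class.

module PairEvents (n : ℕ) {r′ : ℕ} (u v : Fin n) (R : List (Fin n)) (c : Fin n → Fin (suc r′)) (i j : Fin (suc r′)) where

  open Edges n

  dense₁ : Ω → V → V → Bool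
  dense₁ ω z y = E ω y z ∧ (c y == i)

  dense₂ : Ω → V → Bool
  dense₂ ω y = E ω y u ∧ E ω y v ∧ (c y == j)

  ev₄ : ℕ → Ω → ℕ
  ev₄ x ω = 𝟙 (cnt (dense₁ ω u) R <ᵇ x) * 𝟙 (cnt (dense₁ ω v) R <ᵇ x) * 𝟙 (cnt (dense₂ ω) R <ᵇ x)

module Pair (n : ℕ) {r′ : ℕ} (u v : Fin n) (R : List (Fin n)) (uq : Unique (u ∷ v ∷ R)) (c : Fin n → Fin (suc r′)) (i j : Fin (suc r′)) (i≢j : i ≢ j) where

  open Edges n
  open Rows n
  open Row (u ∷ v ∷ []) R uq
  open Classes {n} {r′} using (size)
  open PairEvents n u v R c i j

  private
    Z : List V
    Z = u ∷ v ∷ []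

  exc : Bool → Bool → Bool → Bool → Bool
  exc a b inI inJ = (inI ∧ (a ∨ b)) ∨ (inJ ∧ (a ∧ b))

  excAt : Ω → V → Bool
  excAt ω y = exc (E ω y u) (E ω y v) (c y == i) (c y == j)

  exc≤ : ∀ a b d e → 𝟙 (exc a b d e) ≤ 𝟙 (a ∧ d) + 𝟙 (b ∧ d) + 𝟙 (a ∧ b ∧ e)
  exc≤ true  b     true  e     = s≤s z≤n
  exc≤ false true  true  e     = s≤s z≤n
  exc≤ false false true  false = z≤n
  exc≤ false false true  true  = z≤n
  exc≤ true  true  false true  = s≤s z≤n
  exc≤ true  true  false false = z≤n
  exc≤ true  false false true  = z≤n
  exc≤ true  false false false = z≤n
  exc≤ false b     false true  = z≤n
  exc≤ false b     false false = z≤n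

  -- The sum over the four rows of a vertex when a row weighs `Λ` unless it is exceptional: there is
  -- one unexceptional row in class `i`, three in class `j`, four elsewhere.
  weight : ℕ → Bool → Bool → ℕ
  weight Λ true  _     = Λ + 3
  weight Λ false true  = 3 * Λ + 1
  weight Λ false false = 4 * Λ

  private
    𝔼-two : ∀ y → y ≢ u → y ≢ v → ∀ (g : Bool → Bool → ℕ) ω →
      𝔼 (key y u ∷ key y v ∷ []) ω (λ ω → g (E ω y u) (E ω y v)) ≡ (g false false + g false true) + (g true false + g true true)
    𝔼-two y y≢u y≢v g ω = ≡-trans (𝔼-∷ (key y u) (key y v ∷ []) ω (λ ω → g (E ω y u) (E ω y v))) (cong₂ _+_ (at false) (at true))
      where
      u≢v : u ≢ v
      u≢v = All.head (AllPairs.head uq)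
      ne : key y u ≢ key y v
      ne e with key-inj e
      ... | inj₁ (_ , e′) = u≢v e′
      ... | inj₂ (e′ , _) = y≢v e′
      val : ∀ a b → g (E ((ω [ key y u ]≔ a) [ key y v ]≔ b) y u) (E ((ω [ key y u ]≔ a) [ key y v ]≔ b) y v) ≡ g a b
      val a b = cong₂ g (≡-trans (E-≢ _ y≢u) (≡-trans (lookup∘update′ ne (ω [ key y u ]≔ a) b) (lookup∘update (key y u) ω a)))
                        (≡-trans (E-≢ _ y≢v) (lookup∘update (key y v) (ω [ key y u ]≔ a) b))
      at : ∀ a → 𝔼 (key y v ∷ []) (ω [ key y u ]≔ a) (λ ω → g (E ω y u) (E ω y v)) ≡ g a false + g a true
      at a = cong₂ _+_ (val a false) (≡-trans (+-identityʳ _) (val a true))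

  rowsum : ∀ {x} Λ → .{{NonZero Λ}} → ∀ ω →
    Λ ^ length R * 𝔼 (cross Z R) ω (ev₄ x) ≤ Λ ^ (3 * x) * ∏ R (λ y → weight Λ (c y == i) (c y == j))
  rowsum {x} Λ = markov w (λ y → weight Λ (c y == i) (c y == j)) (ev₄ x) (Λ ^ length R) (Λ ^ (3 * x)) wloc wb wev
    where
    w : V → Ω → ℕ
    w y ω = Λ ^ 𝟙 (not (excAt ω y))
    wloc : RowLocal w
    wloc y ω ω′ h = cong₂ (λ a b → Λ ^ 𝟙 (not (exc a b (c y == i) (c y == j)))) (h u (here refl)) (h v (there (here refl)))
    wb : ∀ y → y ∈ R → ∀ ω → 𝔼 (map (key y) Z) ω (w y) ≤ weight Λ (c y == i) (c y == j)
    wb y y∈ ω = ≤-trans (≤-reflexive (𝔼-two y (λ { refl → row-∉ y∈ (here refl) }) (λ { refl → row-∉ y∈ (there (here refl)) })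
      (λ a b → Λ ^ 𝟙 (not (exc a b (c y == i) (c y == j)))) ω)) (sum (c y Fin.≟ i) (c y Fin.≟ j))
      where
      g : Bool → Bool → Bool → Bool → ℕ
      g d e a b = Λ ^ 𝟙 (not (exc a b d e))
      l₁ : ∀ Λ → (Λ * 1 + 1) + (1 + 1) ≡ Λ + 3
      l₁ = solve-∀
      l₂ : ∀ Λ → (Λ * 1 + Λ * 1) + (Λ * 1 + 1) ≡ 3 * Λ + 1
      l₂ = solve-∀
      l₃ : ∀ Λ → (Λ * 1 + Λ * 1) + (Λ * 1 + Λ * 1) ≡ 4 * Λ
      l₃ = solve-∀
      sum : (di : Dec (c y ≡ i)) (dj : Dec (c y ≡ j)) →
        (g (does di) (does dj) false false + g (does di) (does dj) false true) + (g (does di) (does dj) true false + g (does di) (does dj) true true)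
          ≤ weight Λ (does di) (does dj)
      sum (yes e) (yes e′) = contradiction (≡-trans (sym e) e′) i≢j
      sum (yes _) (no _)   = ≤-reflexive (l₁ Λ)
      sum (no _)  (yes _)  = ≤-reflexive (l₂ Λ)
      sum (no _)  (no _)   = ≤-reflexive (l₃ Λ)
    wev : ∀ ω → Λ ^ length R * ev₄ x ω ≤ Λ ^ (3 * x) * ∏ R (λ y → w y ω)
    wev ω with cnt (dense₁ ω u) R <ᵇ x in e₁ | cnt (dense₁ ω v) R <ᵇ x in e₂ | cnt (dense₂ ω) R <ᵇ x in e₃
    ... | false | _     | _     = ≤-trans (≤-reflexive (*-zeroʳ (Λ ^ length R))) z≤n
    ... | true  | false | _     = ≤-trans (≤-reflexive (*-zeroʳ (Λ ^ length R))) z≤n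
    ... | true  | true  | false = ≤-trans (≤-reflexive (*-zeroʳ (Λ ^ length R))) z≤n
    ... | true  | true  | true  = begin
      Λ ^ length R * 1                              ≡⟨ *-identityʳ _ ⟩
      Λ ^ length R                                  ≡⟨ cong (Λ ^_) (cnt-split (excAt ω) R) ⟨
      Λ ^ (cnt (excAt ω) R + cnt (not ∘ excAt ω) R) ≤⟨ ^-monoʳ-≤ Λ (+-monoˡ-≤ _ few) ⟩
      Λ ^ (3 * x + cnt (not ∘ excAt ω) R)           ≡⟨ ^-distribˡ-+-* Λ (3 * x) (cnt (not ∘ excAt ω) R) ⟩
      Λ ^ (3 * x) * Λ ^ cnt (not ∘ excAt ω) R       ≡⟨ cong (Λ ^ (3 * x) *_) (∏-pow R Λ _) ⟨
      Λ ^ (3 * x) * ∏ R (λ y → w y ω) ∎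
      where
      open ≤-Reasoning
      few : cnt (excAt ω) R ≤ 3 * x
      few = begin
        cnt (excAt ω) R
          ≤⟨ ∑-mono R (λ y → exc≤ (E ω y u) (E ω y v) (c y == i) (c y == j)) ⟩
        ∑ R (λ y → 𝟙 (dense₁ ω u y) + 𝟙 (dense₁ ω v y) + 𝟙 (dense₂ ω y))
          ≡⟨ ≡-trans (∑-+ R _ _) (cong (_+ cnt (dense₂ ω) R) (∑-+ R _ _)) ⟩
        cnt (dense₁ ω u) R + cnt (dense₁ ω v) R + cnt (dense₂ ω) R
          ≤⟨ +-mono-≤ (+-mono-≤ (<⇒≤ (<ᵇ-true⁻ {cnt (dense₁ ω u) R} {x} e₁)) (<⇒≤ (<ᵇ-true⁻ {cnt (dense₁ ω v) R} {x} e₂))) (<⇒≤ (<ᵇ-true⁻ {cnt (dense₂ ω) R} {x} e₃)) ⟩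
        x + x + x ≡⟨ lem x ⟩
        3 * x ∎
        where
        lem : ∀ x → x + x + x ≡ 3 * x
        lem = solve-∀

  -- With Λ = 6μ the class of i costs (1 + 1/2μ) per vertex and each vertex in the class of j saves a factor (3Λ+1)/4Λ.
  pair-bound : ∀ μ x v₁ v₂ → .{{NonZero μ}} → length R ≤ μ * v₁ → 4 * v₂ ≤ size c R j → ∀ ω →
    4 ^ size c R i * 2 ^ v₂ * 𝔼 (cross Z R) ω (ev₄ x) ≤ (6 * μ) ^ (3 * x) * (2 ^ v₁ * 4 ^ length R)
  pair-bound μ x v₁ v₂ h₁ h₂ ω = *-cancelˡ-≤ (Λ ^ m) {{m^n≢0 Λ m}} (begin
    Λ ^ m * (4 ^ mᵢ * 2 ^ v₂ * 𝔼 (cross Z R) ω (ev₄ x))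
      ≡⟨ lem₁ (Λ ^ m) (4 ^ mᵢ * 2 ^ v₂) _ ⟩
    4 ^ mᵢ * 2 ^ v₂ * (Λ ^ m * 𝔼 (cross Z R) ω (ev₄ x))
      ≤⟨ *-monoʳ-≤ (4 ^ mᵢ * 2 ^ v₂) (rowsum {x} Λ ω) ⟩
    4 ^ mᵢ * 2 ^ v₂ * (Λ ^ (3 * x) * ∏ R (λ y → weight Λ (c y == i) (c y == j)))
      ≡⟨ cong (λ t → 4 ^ mᵢ * 2 ^ v₂ * (Λ ^ (3 * x) * t)) prod ⟩
    4 ^ mᵢ * 2 ^ v₂ * (Λ ^ (3 * x) * ((Λ + 3) ^ mᵢ * (3 * Λ + 1) ^ mⱼ * (4 * Λ) ^ mₒ))
      ≡⟨ lem₂ (4 ^ mᵢ) (2 ^ v₂) (Λ ^ (3 * x)) ((Λ + 3) ^ mᵢ) ((3 * Λ + 1) ^ mⱼ) ((4 * Λ) ^ mₒ) ⟩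
    Λ ^ (3 * x) * (4 ^ mᵢ * (Λ + 3) ^ mᵢ * (2 ^ v₂ * (3 * Λ + 1) ^ mⱼ) * (4 * Λ) ^ mₒ)
      ≤⟨ *-monoʳ-≤ (Λ ^ (3 * x)) (*-monoˡ-≤ ((4 * Λ) ^ mₒ) (*-mono-≤
           (*-monoʳ-≤ (4 ^ mᵢ) (pow-near μ v₁ mᵢ (m≤m+n Λ 3) near (≤-trans (cnt≤length _ R) h₁)))
           (pow-gap 4 v₂ mⱼ b≤a gap h₂))) ⟩
    Λ ^ (3 * x) * (4 ^ mᵢ * (2 ^ v₁ * Λ ^ mᵢ) * (4 * Λ) ^ mⱼ * (4 * Λ) ^ mₒ)
      ≡⟨ cong (Λ ^ (3 * x) *_) (lem₃ (4 ^ mᵢ) (2 ^ v₁) (Λ ^ mᵢ) ((4 * Λ) ^ mⱼ) ((4 * Λ) ^ mₒ)) ⟩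
    Λ ^ (3 * x) * (2 ^ v₁ * (4 ^ mᵢ * Λ ^ mᵢ * (4 * Λ) ^ mⱼ * (4 * Λ) ^ mₒ))
      ≡⟨ cong (λ t → Λ ^ (3 * x) * (2 ^ v₁ * t)) total ⟩
    Λ ^ (3 * x) * (2 ^ v₁ * (4 ^ m * Λ ^ m))
      ≡⟨ lem₄ (Λ ^ (3 * x)) (2 ^ v₁) (4 ^ m) (Λ ^ m) ⟩
    Λ ^ m * (Λ ^ (3 * x) * (2 ^ v₁ * 4 ^ m)) ∎)
    where
    open ≤-Reasoning
    Λ = 6 * μ
    instance
      Λ≢0 : NonZero Λ
      Λ≢0 = m*n≢0 6 μ
    m = length R
    mᵢ = size c R i
    mⱼ = size c R j
    other : V → Bool
    other y = not (c y == i) ∧ not (c y == j)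
    mₒ = cnt other R
    lem₁ : ∀ a b c → a * (b * c) ≡ b * (a * c)
    lem₁ = solve-∀
    lem₂ : ∀ a b c d e f → a * b * (c * (d * e * f)) ≡ c * (a * d * (b * e) * f)
    lem₂ = solve-∀
    lem₃ : ∀ a b c d e → a * (b * c) * d * e ≡ b * (a * c * d * e)
    lem₃ = solve-∀
    lem₄ : ∀ a b c d → a * (b * (c * d)) ≡ d * (a * (b * c))
    lem₄ = solve-∀
    split : ∀ y (di : Dec (c y ≡ i)) (dj : Dec (c y ≡ j)) → (f : ℕ → ℕ → ℕ → ℕ) →
      f 1 0 0 ≡ weight Λ true false → f 0 1 0 ≡ weight Λ false true → f 0 0 1 ≡ weight Λ false false →
      f (𝟙 (does di)) (𝟙 (does dj)) (𝟙 (not (does di) ∧ not (does dj))) ≡ weight Λ (does di) (does dj)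
    split y (yes e) (yes e′) f a b c = contradiction (≡-trans (sym e) e′) i≢j
    split y (yes _) (no _)   f a b c = a
    split y (no _)  (yes _)  f a b c = b
    split y (no _)  (no _)   f a b c = c
    prod : ∏ R (λ y → weight Λ (c y == i) (c y == j)) ≡ (Λ + 3) ^ mᵢ * (3 * Λ + 1) ^ mⱼ * (4 * Λ) ^ mₒ
    prod = begin-equality
      ∏ R (λ y → weight Λ (c y == i) (c y == j))
        ≡⟨ ∏-cong∈ R (λ y _ → sym (split y (c y Fin.≟ i) (c y Fin.≟ j)
             (λ a b d → (Λ + 3) ^ a * (3 * Λ + 1) ^ b * (4 * Λ) ^ d) (e₁ (Λ + 3)) (e₂ (3 * Λ + 1)) (e₃ (4 * Λ)))) ⟩
      ∏ R (λ y → (Λ + 3) ^ 𝟙 (c y == i) * (3 * Λ + 1) ^ 𝟙 (c y == j) * (4 * Λ) ^ 𝟙 (other y))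
        ≡⟨ ≡-trans (∏-* R _ _) (cong₂ _*_ (≡-trans (∏-* R _ _) (cong₂ _*_ (∏-pow R (Λ + 3) _) (∏-pow R (3 * Λ + 1) _))) (∏-pow R (4 * Λ) _)) ⟩
      (Λ + 3) ^ mᵢ * (3 * Λ + 1) ^ mⱼ * (4 * Λ) ^ mₒ ∎
      where
      e₁ : ∀ a → a * 1 * 1 * 1 ≡ a
      e₁ = solve-∀
      e₂ : ∀ a → 1 * (a * 1) * 1 ≡ a
      e₂ = solve-∀
      e₃ : ∀ a → 1 * 1 * (a * 1) ≡ a
      e₃ = solve-∀
    -- Λ = 6μ is chosen so that Λ + 3 = 3(2μ + 1) and Λ = 3(2μ); the common factor 3 drops out.
    near : (Λ + 3) ^ μ ≤ 2 * Λ ^ μ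
    near = begin
      (Λ + 3) ^ μ               ≡⟨ cong (_^ μ) (e μ) ⟩
      (3 * suc (2 * μ)) ^ μ     ≡⟨ ^-distribʳ-* μ 3 _ ⟩
      3 ^ μ * suc (2 * μ) ^ μ   ≤⟨ *-monoʳ-≤ (3 ^ μ) (near-2μ μ) ⟩
      3 ^ μ * (2 * (2 * μ) ^ μ) ≡⟨ lem₁ (3 ^ μ) 2 _ ⟩
      2 * (3 ^ μ * (2 * μ) ^ μ) ≡⟨ cong (2 *_) (≡-trans (sym (^-distribʳ-* μ 3 (2 * μ))) (cong (_^ μ) (sym (*-assoc 3 2 μ)))) ⟩
      2 * Λ ^ μ ∎
      where
      e : ∀ μ → 6 * μ + 3 ≡ 3 * suc (2 * μ)
      e = solve-∀
    4≤Λ : 4 ≤ Λ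
    4≤Λ = ≤-trans (m≤m+n 4 2) (m≤m*n 6 μ)
    13Λ : 4 * (3 * Λ + 1) ≤ 13 * Λ
    13Λ = ≤-trans (≤-reflexive (e Λ)) (≤-trans (+-monoʳ-≤ (12 * Λ) 4≤Λ) (≤-reflexive (e₂ Λ)))
      where
      e : ∀ Λ → 4 * (3 * Λ + 1) ≡ 12 * Λ + 4
      e = solve-∀
      e₂ : ∀ Λ → 12 * Λ + Λ ≡ 13 * Λ
      e₂ = solve-∀
    b≤a : 3 * Λ + 1 ≤ 4 * Λ
    b≤a = ≤-trans (+-monoʳ-≤ (3 * Λ) (≤-trans (s≤s z≤n) 4≤Λ)) (≤-reflexive (e Λ))
      where
      e : ∀ Λ → 3 * Λ + Λ ≡ 4 * Λ
      e = solve-∀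
    -- For Λ ≥ 4 the ratio (3Λ + 1)/4Λ is at most 13/16, and 2·13^4 = 57122 is below 16^4 = 65536.
    gap : 2 * (3 * Λ + 1) ^ 4 ≤ (4 * Λ) ^ 4
    gap = *-cancelˡ-≤ (4 ^ 4) (begin
      4 ^ 4 * (2 * (3 * Λ + 1) ^ 4)  ≡⟨ lem₁ (4 ^ 4) 2 ((3 * Λ + 1) ^ 4) ⟩
      2 * (4 ^ 4 * (3 * Λ + 1) ^ 4)  ≡⟨ cong (2 *_) (sym (^-distribʳ-* 4 4 (3 * Λ + 1))) ⟩
      2 * (4 * (3 * Λ + 1)) ^ 4      ≤⟨ *-monoʳ-≤ 2 (^-monoˡ-≤ 4 13Λ) ⟩
      2 * (13 * Λ) ^ 4               ≡⟨ cong (2 *_) (^-distribʳ-* 4 13 Λ) ⟩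
      2 * (13 ^ 4 * Λ ^ 4)           ≡⟨ *-assoc 2 (13 ^ 4) (Λ ^ 4) ⟨
      2 * 13 ^ 4 * Λ ^ 4             ≤⟨ *-monoˡ-≤ (Λ ^ 4) (≤ᵇ⇒≤ (2 * 13 ^ 4) (4 ^ 4 * 4 ^ 4) _) ⟩
      4 ^ 4 * 4 ^ 4 * Λ ^ 4          ≡⟨ *-assoc (4 ^ 4) (4 ^ 4) (Λ ^ 4) ⟩
      4 ^ 4 * (4 ^ 4 * Λ ^ 4)        ≡⟨ cong (4 ^ 4 *_) (sym (^-distribʳ-* 4 4 Λ)) ⟩
      4 ^ 4 * (4 * Λ) ^ 4 ∎)
    sizes : mᵢ + mⱼ + mₒ ≡ m
    sizes = ≡-trans (sym (≡-trans (∑-+ R _ _) (cong (_+ mₒ) (∑-+ R _ _))))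
      (≡-trans (∑-cong R λ y → one y (c y Fin.≟ i) (c y Fin.≟ j)) (≡-trans (∑-const R 1) (*-identityʳ m)))
      where
      one : ∀ y (di : Dec (c y ≡ i)) (dj : Dec (c y ≡ j)) → 𝟙 (does di) + 𝟙 (does dj) + 𝟙 (not (does di) ∧ not (does dj)) ≡ 1
      one y (yes e) (yes e′) = contradiction (≡-trans (sym e) e′) i≢j
      one y (yes _) (no _)   = refl
      one y (no _)  (yes _)  = refl
      one y (no _)  (no _)   = refl
    total : 4 ^ mᵢ * Λ ^ mᵢ * (4 * Λ) ^ mⱼ * (4 * Λ) ^ mₒ ≡ 4 ^ m * Λ ^ m
    total = begin-equality
      4 ^ mᵢ * Λ ^ mᵢ * (4 * Λ) ^ mⱼ * (4 * Λ) ^ mₒ ≡⟨ cong (λ t → t * (4 * Λ) ^ mⱼ * (4 * Λ) ^ mₒ) (sym (^-distribʳ-* mᵢ 4 Λ)) ⟩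
      (4 * Λ) ^ mᵢ * (4 * Λ) ^ mⱼ * (4 * Λ) ^ mₒ    ≡⟨ cong (_* (4 * Λ) ^ mₒ) (sym (^-distribˡ-+-* (4 * Λ) mᵢ mⱼ)) ⟩
      (4 * Λ) ^ (mᵢ + mⱼ) * (4 * Λ) ^ mₒ            ≡⟨ ^-distribˡ-+-* (4 * Λ) (mᵢ + mⱼ) mₒ ⟨
      (4 * Λ) ^ (mᵢ + mⱼ + mₒ)                      ≡⟨ cong ((4 * Λ) ^_) sizes ⟩
      (4 * Λ) ^ m                                   ≡⟨ ^-distribʳ-* m 4 Λ ⟩
      4 ^ m * Λ ^ m ∎

-- An F-free graph is r-colourable or contains one of the rare configurations.

∑≡0 : ∀ {A : Set} {L : List A} (f : A → ℕ) → ∑ L f ≡ 0 → ∀ {x} → x ∈ L → f x ≡ 0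
∑≡0 f h x∈ = n≤0⇒n≡0 (≤-trans (∑-∈ f x∈) (≤-reflexive h))

∑-sub≤ : ∀ {A : Set} {L R : List A} Z f → L ↭ Z ++ R → ∑ R f ≤ ∑ L f
∑-sub≤ {R = R} Z f p = ≤-trans (m≤n+m (∑ R f) (∑ Z f)) (≤-reflexive (sym (≡-trans (∑-↭ f p) (∑-++ Z R f))))

rest-⊆ : ∀ {A : Set} {L R : List A} Z → L ↭ Z ++ R → ∀ {x} → x ∈ R → x ∈ L
rest-⊆ Z p x∈ = Perm.∈-resp-↭ (↭-sym p) (∈-++⁺ʳ Z x∈)

𝟙≡0 : ∀ {b} → 𝟙 b ≡ 0 → b ≡ false
𝟙≡0 {false} _ = refl

𝟙-not≡0 : ∀ {b} → 𝟙 (not b) ≡ 0 → b ≡ true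
𝟙-not≡0 {true} _ = refl

*≡0ˡ : ∀ {a b} → a ≡ 1 → a * b ≡ 0 → b ≡ 0
*≡0ˡ {b = b} refl h = ≡-trans (sym (+-identityʳ b)) h

-- `s` and `b` are the constant sizes of the parts and of their subsets, `σ` gives the part sizes in
-- the successive stages, and m/`e` is the tolerated number of rare vertices. `δ` bounds the
-- imbalance, `t` the number of weak vertices, `y₃` the number of inside edges. The derived size `x`
-- is the one from which subsets of the classes contain the y² tuples of blocks.
module Cover (n : ℕ) {k : ℕ} (F : Graph k) {r′ : ℕ} (crit : Critical (suc r′) F)
             (s b e : ℕ) (σ : ℕ → ℕ) (m y δ t y₃ : ℕ) where

  open Copies n F public
  open Rows n public
  open Multipartite n F public
  open Free crit zero public
  open Classes {n} {r′} public
  open Colour n r′ public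
  open Tuples n r′ public
  open Colourings {n} {suc r′} zero public
  open PairEvents n using (ev₄; dense₁; dense₂) public

  r Q x : ℕ
  r = suc r′
  Q = 2 + k
  x = r * y * Q

  -- Restricts `T₄` to the partitions of `R` that the small subgraph `A` allows, with at most `t`
  -- weak vertices. This keeps the number of partitions in the last count small.
  comp : Vec (List V) r → List V → (V → Fin r) → Ω → ℕ
  comp A R c ω = ∏ R (λ z → 𝟙 (deg ω z (lookup A (c z)) <ᵇ q)) * 𝟙 (cnt (weak q A ω) R <ᵇ suc t)

  guard : (V → Fin r) → Vec (List V) r → Bool
  guard c X = does (Fin.all? λ i → All.all? (λ z → c z Fin.≟ i) (lookup X i))

  unbal : (V → Fin r) → List V → Fin r → Bool
  unbal c S i = does (r * size c S i + δ ≤? m)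

  -- The additional slack 2r accounts for `u` and `v`, which belong to `S` but not to `R`.
  bal : (V → Fin r) → List V → Bool
  bal c R = does (Fin.all? λ i → m ≤? r * size c R i + (δ + 2 * r))

  -- The number of vertices that `extend` needs for its pigeonhole step.
  N₁ : ℕ → ℕ
  N₁ ρ′ = 2 ^ (suc ρ′ * σ ρ′) * σ (suc ρ′)

  T₁ : ∀ ρ′ → Vec (List V) (suc ρ′) × List V → Ω → ℕ
  T₁ ρ′ (A , R) ω = ff R ω * ev₁ (σ (suc ρ′)) A R (N₁ ρ′) ω

  T₂ : Vec (List V) r → List V → Fin r → Fin r → Ω → ℕ
  T₂ A R i j ω = ff R ω * ev₂ q A R m e i (lookup A j) b ω + ∑ (combs b (lookup A j)) (λ B → ff R ω * ev₂ q A R m e i B q ω)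

  few : (V → Fin r) → List V → Ω → ℕ
  few c S ω = 𝟙 (monoEdges ω c S <ᵇ suc y₃)

  T₃ : List V → (V → Fin r) → Vec (List V) r → Ω → ℕ
  T₃ S c X ω = 𝟙 (guard c X) * (few c S ω * Family.Fl Q y X ω)

  T₃′ : List V → (V → Fin r) → Fin r → Ω → ℕ
  T₃′ S c i ω = 𝟙 (unbal c S i) * (few c S ω * 1)

  T₄ : V → V → List V → Vec (List V) r → (V → Fin r) → Fin r → Fin r → Ω → ℕ
  T₄ u v R A c i j ω = 𝟙 (not (i == j)) * 𝟙 (bal c R) * (ff R ω * comp A R c ω * ev₄ u v R c i j x ω)

  U₁ : ℕ → List V → Ω → ℕ
  U₁ ρ′ S ω = ∑ (sels (suc ρ′) (σ ρ′) S) (λ z → T₁ ρ′ z ω)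

  U₂ : Vec (List V) r × List V → Ω → ℕ
  U₂ (A , R) ω = ∑ (allFin r) λ i → ∑ (allFin r) λ j → 𝟙 (not (i == j)) * T₂ A R i j ω

  U₃ : List V → (V → Fin r) → Ω → ℕ
  U₃ S c ω = ∑ (vecs r (combs x S)) (λ X → T₃ S c X ω) + ∑ (allFin r) (λ i → T₃′ S c i ω)

  U₄ : V → V → List V → Vec (List V) r → Ω → ℕ
  U₄ u v R A ω = ∑ (cols R) λ c → ∑ (allFin r) λ i → ∑ (allFin r) λ j → T₄ u v R A c i j ω

  -- Each sum counts descriptions of a configuration, not configurations; what matters is that it is
  -- positive whenever the configuration occurs.
  Y₀ Y₁ Y₂ Y₃ Y₄ : List V → Ω → ℕ
  Y₀ S ω = ∑ (cols S) λ c → ∏ (In c S) λ p → 𝟙 (not (E² ω p))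
  Y₁ S ω = ∑ (upTo r′) λ ρ′ → U₁ ρ′ S ω
  Y₂ S ω = ∑ (sels r s S) λ z → U₂ z ω
  Y₃ S ω = ∑ (cols S) λ c → U₃ S c ω
  Y₄ S ω = ∑ (picks S) λ (u , R₀) → ∑ (picks R₀) λ (v , R) → ∑ (sels r s R) λ (A , _) → U₄ u v R A ω

  module _ (2+k≤s : 2 + k ≤ s) (q≤b : q ≤ b) (σ-top : σ r′ ≡ 2 + s) (σ-pos : ∀ ρ′ → 0 < σ ρ′) (σ₀≤m : σ 0 ≤ m)
           (few₃ : ∀ I → e * I ≤ 2 * (e * (r * s)) * m + (r * r + r) * (m * m) → I ≤ y₃)
           (room : r * x + δ ≤ m) (few₄ : ∀ w → e * w ≤ r * r * m → r * s + w ≤ t)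
           {S : List V} (uS : Unique S) (lenS : length S ≡ m) where

    private
      module Contra (ω : Ω) (free : ¬ Contains ω S)
        (z₀ : Y₀ S ω ≡ 0) (z₁ : Y₁ S ω ≡ 0) (z₂ : Y₂ S ω ≡ 0) (z₃ : Y₃ S ω ≡ 0) (z₄ : Y₄ S ω ≡ 0) where

        free-sub : ∀ {R} → (∀ {z} → z ∈ R → z ∈ S) → ff R ω ≡ 1
        free-sub h = ff-one (free ∘ Contains-⊆ h)

        -- When `Y₁` vanishes, a subgraph with at most `r′` parts leaves `N₁ ρ′` vertices that have
        -- `σ (suc ρ′)` neighbours in each part, so `extend` adds another part.
        multi : ∀ ρ′ → ρ′ ≤ r′ → ∃ λ (A : Vec (List V) (suc ρ′)) → Multi ω S (σ ρ′) A
        multi zero _ = take (σ 0) S ∷ [] , record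
          { len = λ { zero → length-take≤ (σ 0) S (≤-trans σ₀≤m (≤-reflexive (sym lenS))) }
          ; uq  = λ { zero → take-unique (σ 0) uS }
          ; sub = λ { zero z∈ → ∈-take⁻ (σ 0) z∈ }
          ; cr  = λ { zero zero ne → contradiction refl ne }
          }
        multi (suc ρ′) le = step (multi ρ′ (<⇒≤ le))
          where
          s′ = σ (suc ρ′)
          next : ∀ A → Multi ω S (σ ρ′) A → ∀ R → (A , R) ∈ sels (suc ρ′) (σ ρ′) S → S ↭ flat A ++ R →
            ∃ λ (A : Vec (List V) (suc (suc ρ′))) → Multi ω S s′ A
          next A M R h p = extend s′ A R (σ-pos (suc ρ′)) M (unique-++ʳ (flat A) (unique-↭ p uS)) (rest-⊆ (flat A) p)
            (<ᵇ-false⁻ {cnt (λ x → not (low s′ A ω x)) R} {N₁ ρ′} (𝟙≡0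
              (*≡0ˡ {ff R ω} (free-sub (rest-⊆ (flat A) p)) (∑≡0 (λ z → T₁ ρ′ z ω) (∑≡0 (λ ρ′ → U₁ ρ′ S ω) z₁ (∈-upTo⁺ le)) h))))
          step : (∃ λ A → Multi ω S (σ ρ′) A) → ∃ λ (A : Vec (List V) (suc (suc ρ′))) → Multi ω S s′ A
          step (A , M) = let R , h = ∈-sels (σ ρ′) A (Multi.len M) (Multi.flat-uq M) (Multi.flat-sub M) in
            next A M R h (sels-↭ (suc ρ′) (σ ρ′) S h)

        -- `c` sends each vertex to a part of `A⋆` in which it has few neighbours. The parts have
        -- two vertices more than `s`, so that `u` and `v` can be left out later.
        module Given (A⋆ : Vec (List V) r) (M⋆ : Multi ω S (σ r′) A⋆)
                     (c : V → Fin r) (c∈ : c ∈ cols S) (hc : ∀ z → z ∈ S → deg ω z (lookup A⋆ (c z)) < q) where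

          len⋆ : ∀ i → length (lookup A⋆ i) ≡ 2 + s
          len⋆ i = ≡-trans (Multi.len M⋆ i) σ-top

          deg-trim≤ : ∀ p i z → deg ω z (lookup (trim s p A⋆) i) ≤ deg ω z (lookup A⋆ i)
          deg-trim≤ p i z = begin
            deg ω z (lookup (trim s p A⋆) i)        ≡⟨ cong (deg ω z) (trim-at s p A⋆ i) ⟩
            deg ω z (take s (keep p (lookup A⋆ i))) ≤⟨ ∑-take≤ _ s (keep p (lookup A⋆ i)) ⟩
            deg ω z (keep p (lookup A⋆ i))          ≡⟨ cnt-keep p (E ω z) (lookup A⋆ i) ⟩
            cnt (λ w → p w ∧ E ω z w) (lookup A⋆ i) ≤⟨ cnt-mono (lookup A⋆ i) (λ w _ h → proj₂ (∧-true {p w} h)) ⟩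
            deg ω z (lookup A⋆ i) ∎
            where open ≤-Reasoning

          compat : ∀ p → Compatible ω (trim s p A⋆) S c
          compat p z z∈ = ≤-<-trans (deg-trim≤ p (c z) z) (hc z z∈)

          notRare : ∀ {A} → Multi ω S s A → ∃ λ R → S ↭ flat A ++ R × NotRare ω m e b A R
          notRare {A} M = let R , h = ∈-sels s A (Multi.len M) (Multi.flat-uq M) (Multi.flat-sub M) in
              R , sels-↭ r s S h , rare-free R h (sels-↭ r s S h)
            where
            module _ (R : List V) (h : (A , R) ∈ sels r s S) (p : S ↭ flat A ++ R) where
              allLow : ∏ R (λ z → 𝟙 (low q A ω z)) ≡ 1
              allLow = ∏-one R λ z z∈ → let i , h = class free M (rest-⊆ (flat A) p z∈) in cong 𝟙 (low⁺ q A ω z i h)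
              conclude : ∀ i B θ → ff R ω * ev₂ q A R m e i B θ ω ≡ 0 → e * cnt (rare q A i B θ ω) R ≤ m
              conclude i B θ z = <⇒≤ (<ᵇ-false⁻ {m} {suc (e * cnt (rare q A i B θ ω) R)} (𝟙≡0
                (*≡0ˡ {∏ R (λ z → 𝟙 (low q A ω z))} allLow (*≡0ˡ {ff R ω} (free-sub (rest-⊆ (flat A) p)) z))))
              cell : ∀ i j → i ≢ j → T₂ A R i j ω ≡ 0
              cell i j ne = *≡0ˡ {𝟙 (not (i == j))} (cong (𝟙 ∘ not) (==-false ne))
                (∑≡0 (λ j → 𝟙 (not (i == j)) * T₂ A R i j ω) (∑≡0 (λ i → ∑ (allFin r) λ j → 𝟙 (not (i == j)) * T₂ A R i j ω)
                  (∑≡0 (λ z → U₂ z ω) z₂ h) (∈-allFin i)) (∈-allFin j))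
              rare-free : NotRare ω m e b A R
              rare-free i j ne =
                conclude i (lookup A j) b (m+n≡0⇒m≡0 (ff R ω * ev₂ q A R m e i (lookup A j) b ω) (cell i j ne)) ,
                λ B B∈ → conclude i B q (∑≡0 (λ B → ff R ω * ev₂ q A R m e i B q ω)
                  (m+n≡0⇒n≡0 (ff R ω * ev₂ q A R m e i (lookup A j) b ω) (cell i j ne)) B∈)

          all-true : ∀ L → cnt (λ (_ : V) → true) L ≡ length L
          all-true L = ≡-trans (∑-const L 1) (*-identityʳ _)

          mono-few : monoEdges ω c S ≤ y₃
          mono-few = ≤-trans (monoEdges≤ ω c S) (few₃ _ (inside-few {ω} {S} {s} {m} {e} {b} {trim s (λ _ → true) A⋆} {proj₁ nr} c free M₁ 2+k≤s (compat (λ _ → true)) (proj₂ (proj₂ nr)) (proj₁ (proj₂ nr)) lenS))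
            where
            M₁ : Multi ω S s (trim s (λ _ → true) A⋆)
            M₁ = Multi-trim s (λ _ → true) M⋆ (λ i → ≤-trans (m≤n+m s 2) (≤-reflexive (sym (≡-trans (all-true (lookup A⋆ i)) (len⋆ i))))) (λ h _ → h)
            nr = notRare M₁

          few-one : few c S ω ≡ 1
          few-one = cong 𝟙 (<ᵇ-true (s≤s mono-few))

          colour-zero : U₃ S c ω ≡ 0
          colour-zero = ∑≡0 (λ c → U₃ S c ω) z₃ c∈

          balanced : ∀ i → m < r * size c S i + δ
          balanced i = go (r * size c S i + δ ≤? m)
            where
            zero-i : T₃′ S c i ω ≡ 0
            zero-i = ∑≡0 (λ i → T₃′ S c i ω) (m+n≡0⇒n≡0 (∑ (vecs r (combs x S)) (λ X → T₃ S c X ω)) colour-zero) (∈-allFin i)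
            go : Dec (r * size c S i + δ ≤ m) → m < r * size c S i + δ
            go (no h)  = ≰⇒> h
            go (yes h) = contradiction (≡-trans (sym (cong₂ (λ a f → a * (f * 1)) (cong 𝟙 (dec-true (r * size c S i + δ ≤? m) h)) few-one)) zero-i) λ ()

          Regular : (Fin r → V → Bool) → Set
          Regular p = ∃ λ (D : Fin r → List V) → (∀ i → length (D i) ≡ Q) × (∀ i → Unique (D i)) ×
            (∀ i {d} → d ∈ D i → d ∈ S × p i d ≡ true) × Cross ω D

          -- There are few inside edges, so the vanishing of `Y₃` forces `Fl` to vanish for the
          -- chosen subsets of the classes: one of the y² tuples of blocks is complete. This is the
          -- only regularity of the partition that is used.
          regular : (p : Fin r → V → Bool) → (∀ i → x ≤ cnt (p i) S) → (∀ i z → p i z ≡ true → c z ≡ i) → Regular p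
          regular p big cl = build (Fl-zero ω Fl≡0)
            where
            X : Vec (List V) r
            X = tabulate λ i → take x (keep (p i) S)
            open Family Q y X
            X-at : ∀ i → lookup X i ≡ take x (keep (p i) S)
            X-at i = lookup∘tabulate (λ i → take x (keep (p i) S)) i
            big′ : ∀ i → x ≤ length (keep (p i) S)
            big′ i = ≤-trans (big i) (≤-reflexive (sym (length-keep (p i) S)))
            X∈ : X ∈ vecs r (combs x S)
            X∈ = ∈-vecs⁺ X λ i → subst (_∈ combs x S) (sym (X-at i)) (take-keep-combs (p i) x S (big′ i))
            X-mem : ∀ i {z} → z ∈ lookup X i → z ∈ S × p i z ≡ true
            X-mem i {z} z∈ = ∈-keep⁻ (p i) {S} (∈-take⁻ x (subst (z ∈_) (X-at i) z∈))
            guarded : guard c X ≡ true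
            guarded = dec-true (Fin.all? λ i → All.all? (λ z → c z Fin.≟ i) (lookup X i)) λ i → All.tabulate λ {z} z∈ → cl i z (proj₂ (X-mem i z∈))
            Fl≡0 : Fl ω ≡ 0
            Fl≡0 = *≡0ˡ {few c S ω} few-one (*≡0ˡ {𝟙 (guard c X)} (cong 𝟙 guarded)
              (∑≡0 (λ X → T₃ S c X ω) (m+n≡0⇒m≡0 (∑ (vecs r (combs x S)) (λ X → T₃ S c X ω)) colour-zero) X∈))
            uX : ∀ i → Unique (lookup X i)
            uX i = subst Unique (sym (X-at i)) (take-unique x (keep-unique (p i) uS))
            lenX : ∀ i → r * y * Q ≤ length (lookup X i)
            lenX i = ≤-reflexive (sym (≡-trans (cong length (X-at i)) (length-take≤ x _ (big′ i))))
            build : (∃ λ τ → ∀ i j → i ≢ j → ∀ {u v} → u ∈ lookup (D τ) i → v ∈ lookup (D τ) j → lookup ω (key u v) ≡ true) → Regular p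
            build (τ , on) = lookup (D τ) , D-length uX lenX τ , D-unique uX lenX τ , mem , cr
              where
              mem : ∀ i {d} → d ∈ lookup (D τ) i → d ∈ S × p i d ≡ true
              mem i d∈ = X-mem i (D-⊆ τ i d∈)
              cr : Cross ω (lookup (D τ))
              cr i j ne {a} {b} a∈ b∈ = ≡-trans (E-≢ ω λ { refl → ne (≡-trans (sym (cl i a (proj₂ (mem i a∈)))) (cl j a (proj₂ (mem j b∈)))) }) (on i j ne a∈ b∈)

          lowdeg : V → Fin r → ℕ
          lowdeg z i = cnt (λ w → E ω w z ∧ (c w == i)) S

          -- If `z` had `x` neighbours in every class, these neighbourhoods would span a complete
          -- multipartite subgraph joined to `z`, against `star-copy`.
          low-class : ∀ z → z ∈ S → ∃ λ i → lowdeg z i < x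
          low-class z z∈ = go (Fin.any? (λ i → lowdeg z i <? x))
            where
            star : Regular (λ i w → E ω w z ∧ (c w == i)) → ⊥
            star (D , len , uq , mem , cr) = free (star-copy crit zero D z∈ (λ j → ≤-trans (n≤1+n (suc k)) (≤-reflexive (sym (len j)))) uq
                (λ j d∈ → proj₁ (mem j d∈)) cr λ j {d} d∈ → ≡-trans (E-sym ω z d) (proj₁ (∧-true {E ω d z} (proj₂ (mem j d∈)))))
            go : Dec (∃ λ i → lowdeg z i < x) → ∃ λ i → lowdeg z i < x
            go (yes h) = h
            go (no ¬h) = ⊥-elim (star (regular _ (λ i → ≮⇒≥ λ h → ¬h (i , h)) (λ i w h → ==-true (proj₂ (∧-true {E ω w z} h)))))

          common : V → V → Fin r → V → Bool
          common u v j w = E ω w u ∧ E ω w v ∧ (c w == j)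

          -- The complete multipartite subgraph is sought in the common neighbourhoods of `u` and
          -- `v` in the classes other than `i`, and in the whole of class `i`, which is large enough
          -- because the partition is balanced.
          second : ∀ {u v} i → u ∈ S → v ∈ S → E ω u v ≡ true → ∃ λ j → j ≢ i × cnt (common u v j) S < x
          second {u} {v} i u∈S v∈S u~v = go (Fin.any? (λ j → ¬? (j Fin.≟ i) ×-dec (cnt (common u v j) S <? x)))
            where
            p : Fin r → V → Bool
            p j w = if j == i then c w == i else common u v j w
            cl : ∀ j z → p j z ≡ true → c z ≡ j
            cl j z h with j Fin.≟ i
            ... | yes refl = ==-true h
            ... | no ne = ==-true (proj₂ (∧-true {E ω z v} (proj₂ (∧-true {E ω z u} h))))
            p-both : ∀ j → j ≢ i → ∀ {d} → p j d ≡ true → both ω u v d ≡ true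
            p-both j ne {d} h with j Fin.≟ i
            ... | yes e = contradiction e ne
            ... | no _  = let a , h′ = ∧-true {E ω d u} h in
              true-∧ (≡-trans (E-sym ω u d) a) (≡-trans (E-sym ω v d) (proj₁ (∧-true {E ω d v} h′)))
            clash : Regular p → ⊥
            clash (D , len , uq , mem , cr) = inside-edge D i free u∈S v∈S u~v uq (λ j d∈ → proj₁ (mem j d∈)) cr
                (≤-reflexive (sym (len i))) λ j ne → ≤-trans (n≤1+n (suc k)) (≤-reflexive (sym (≡-trans (allboth j ne) (len j))))
              where
              allboth : ∀ j → j ≢ i → cnt (both ω u v) (D j) ≡ length (D j)
              allboth j ne = ≡-trans (∑-cong∈ (D j) λ d d∈ → cong 𝟙 (p-both j ne (proj₂ (mem j d∈)))) (≡-trans (∑-const (D j) 1) (*-identityʳ _))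
            big : ¬ (∃ λ j → j ≢ i × cnt (common u v j) S < x) → ∀ j → x ≤ cnt (p j) S
            big ¬h j with j Fin.≟ i
            ... | no ne = ≮⇒≥ λ h → ¬h (j , ne , h)
            ... | yes refl = *-cancelˡ-≤ r (+-cancelʳ-≤ δ _ _ (≤-trans room (<⇒≤ (balanced i))))
            go : Dec (∃ λ j → j ≢ i × cnt (common u v j) S < x) → ∃ λ j → j ≢ i × cnt (common u v j) S < x
            go (yes h) = h
            go (no ¬h) = ⊥-elim (clash (regular p (big ¬h) cl))

          -- Shows that the configuration is recorded in `Y₄`. For this `A⋆` is trimmed to a
          -- subgraph `A″` avoiding `u` and `v`, and `c` is replaced by a colouring `c″` from the
          -- list `cols R` that agrees with it on `R`.
          module Clash (u v : V) (i j : Fin r) (u∈S : u ∈ S) (v∈S : v ∈ S) (u≢v : u ≢ v) (i≢j : i ≢ j)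
                       (low-u : lowdeg u i < x) (low-v : lowdeg v i < x) (low-uv : cnt (common u v j) S < x)
                       (R₀ R : List V) (h₁ : (u , R₀) ∈ picks S) (h₂ : (v , R) ∈ picks R₀) where
            perm : S ↭ (u ∷ v ∷ []) ++ R
            perm = ↭-trans (picks-↭ S h₁) (prep u (picks-↭ R₀ h₂))
            uR : Unique R
            uR = unique-++ʳ (u ∷ v ∷ []) (unique-↭ perm uS)
            R⊆S : ∀ {z} → z ∈ R → z ∈ S
            R⊆S = rest-⊆ (u ∷ v ∷ []) perm
            inR : ∀ {z} → z ∈ S → off₂ u v z ≡ true → z ∈ R
            inR {z} z∈ h = strip (Perm.∈-resp-↭ perm z∈) (off₂⁻ {u = u} {v} {z} h)
              where
              strip : z ∈ u ∷ v ∷ R → z ≢ u × z ≢ v → z ∈ R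
              strip (here e)            (p , _) = contradiction e p
              strip (there (here e))    (_ , p) = contradiction e p
              strip (there (there z∈R)) _       = z∈R
            enough : ∀ i → s ≤ cnt (off₂ u v) (lookup A⋆ i)
            enough i = +-cancelˡ-≤ 2 s _ (≤-trans (≤-reflexive (sym (len⋆ i))) (cnt-off₂ u v (Multi.uq M⋆ i)))
            A″ : Vec (List V) r
            A″ = trim s (off₂ u v) A⋆
            MS : Multi ω S s A″
            MS = Multi-trim s (off₂ u v) M⋆ enough (λ h _ → h)
            MR : Multi ω R s A″
            MR = Multi-trim s (off₂ u v) M⋆ enough inR
            few-weak : (∃ λ R‴ → S ↭ flat A″ ++ R‴ × NotRare ω m e b A″ R‴) → cnt (weak q A″ ω) R ≤ t
            few-weak (R‴ , p , nr) = begin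
              cnt (weak q A″ ω) R
                ≤⟨ ∑-sub≤ (u ∷ v ∷ []) _ perm ⟩
              cnt (weak q A″ ω) S
                ≡⟨ ≡-trans (∑-↭ _ p) (∑-++ (flat A″) R‴ _) ⟩
              cnt (weak q A″ ω) (flat A″) + cnt (weak q A″ ω) R‴
                ≤⟨ +-mono-≤ (≤-trans (cnt≤length _ (flat A″)) (≤-reflexive (length-flat s A″ (Multi.len MS))))
                     (cnt-mono R‴ λ z _ h → let a , a′ , ne , p , p′ = weak⁻ q A″ ω z h in weak⁺ b A″ ω z a a′ ne p (<-≤-trans p′ q≤b)) ⟩
              r * s + cnt (weak b A″ ω) R‴
                ≤⟨ few₄ _ (weak-few {ω} {m} {e} {b} {A″} {R‴} nr) ⟩
              t ∎
              where open ≤-Reasoning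
            module _ (c″ : V → Fin r) (c″≡ : ∀ z → z ∈ R → c″ z ≡ c z) where
              comp≡1 : comp A″ R c″ ω ≡ 1
              comp≡1 = cong₂ _*_ (∏-one R λ z z∈ → cong 𝟙 (<ᵇ-true (subst (λ i → deg ω z (lookup A″ i) < q) (sym (c″≡ z z∈)) (compat (off₂ u v) z (R⊆S z∈)))))
                                 (cong 𝟙 (<ᵇ-true (s≤s (few-weak (notRare MS)))))
              bal≡ : bal c″ R ≡ true
              bal≡ = dec-true (Fin.all? (λ i → m ≤? r * size c″ R i + (δ + 2 * r))) λ i → begin
                m                                    ≤⟨ <⇒≤ (balanced i) ⟩
                r * size c S i + δ                   ≤⟨ +-monoˡ-≤ δ (*-monoʳ-≤ r (begin
                  size c S i                           ≡⟨ ∑-↭ _ perm ⟩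
                  𝟙 (c u == i) + (𝟙 (c v == i) + size c R i) ≤⟨ +-mono-≤ (𝟙≤1 (c u == i)) (+-monoˡ-≤ (size c R i) (𝟙≤1 (c v == i))) ⟩
                  2 + size c R i                       ≡⟨ cong (2 +_) (∑-cong∈ R λ z z∈ → cong (λ t → 𝟙 (t == i)) (sym (c″≡ z z∈))) ⟩
                  2 + size c″ R i ∎)) ⟩
                r * (2 + size c″ R i) + δ            ≡⟨ lem r (size c″ R i) δ ⟩
                r * size c″ R i + (δ + 2 * r) ∎
                where
                open ≤-Reasoning
                lem : ∀ r z δ → r * (2 + z) + δ ≡ r * z + (δ + 2 * r)
                lem = solve-∀
              transfer : ∀ (f g : V → Bool) → (∀ w → w ∈ R → g w ≡ f w) → cnt f S < x → 𝟙 (cnt g R <ᵇ x) ≡ 1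
              transfer f g h lt = cong 𝟙 (<ᵇ-true (≤-<-trans (≤-trans (≤-reflexive (∑-cong∈ R λ w w∈ → cong 𝟙 (h w w∈))) (∑-sub≤ (u ∷ v ∷ []) _ perm)) lt))
              ev≡1 : ev₄ u v R c″ i j x ω ≡ 1
              ev≡1 = cong₂ _*_ (cong₂ _*_
                (transfer (λ w → E ω w u ∧ (c w == i)) (λ w → E ω w u ∧ (c″ w == i)) (λ w w∈ → cong (λ t → E ω w u ∧ (t == i)) (c″≡ w w∈)) low-u)
                (transfer (λ w → E ω w v ∧ (c w == i)) (λ w → E ω w v ∧ (c″ w == i)) (λ w w∈ → cong (λ t → E ω w v ∧ (t == i)) (c″≡ w w∈)) low-v))
                (transfer (λ w → E ω w u ∧ E ω w v ∧ (c w == j)) (λ w → E ω w u ∧ E ω w v ∧ (c″ w == j))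
                  (λ w w∈ → cong (λ t → E ω w u ∧ E ω w v ∧ (t == j)) (c″≡ w w∈)) low-uv)
              one : T₄ u v R A″ c″ i j ω ≡ 1
              one = cong₂ _*_ (cong₂ _*_ (cong (𝟙 ∘ not) (==-false i≢j)) (cong 𝟙 bal≡)) (cong₂ _*_ (cong₂ _*_ (free-sub R⊆S) comp≡1) ev≡1)

            contra : ⊥
            contra = final (∈-sels s A″ (Multi.len MR) (Multi.flat-uq MR) (Multi.flat-sub MR))
                           (cols-choice uR (λ z i → i ≡ c z) λ z _ → c z , refl)
              where
              final : (∃ λ R′ → (A″ , R′) ∈ sels r s R) → (∃ λ c″ → c″ ∈ cols R × (∀ z → z ∈ R → c″ z ≡ c z)) → ⊥
              final (R′ , hA) (c″ , c∈′ , c″≡) = contradiction (≡-trans (sym (one c″ c″≡))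
                (∑≡0 (λ j → T₄ u v R A″ c″ i j ω) (∑≡0 (λ i → ∑ (allFin r) λ j → T₄ u v R A″ c″ i j ω)
                  (∑≡0 (λ c → ∑ (allFin r) λ i → ∑ (allFin r) λ j → T₄ u v R A″ c i j ω)
                    (∑≡0 (λ (A , _) → U₄ u v R A ω) (∑≡0 (λ (v , R) → ∑ (sels r s R) λ (A , _) → U₄ u v R A ω)
                      (∑≡0 (λ (u , R₀) → ∑ (picks R₀) λ (v , R) → ∑ (sels r s R) λ (A , _) → U₄ u v R A ω) z₄ h₁) h₂) hA)
                    c∈′) (∈-allFin i)) (∈-allFin j))) λ ()

          -- `c′` sends a vertex to a class of `c` in which it has few neighbours; this need not be
          -- its own class under `c`. As `Y₀` vanishes, some edge `u` `v` lies inside a class of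
          -- `c′`. Its ends both have few neighbours in one class of `c`, and by `second` few common
          -- neighbours in another.
          recolour : (∃ λ c′ → c′ ∈ cols S × (∀ z → z ∈ S → lowdeg z (c′ z) < x)) → ⊥
          recolour (c′ , c′∈ , lows) = go (∏-zero (In c′ S) (λ p → 𝟙 (not (E² ω p))) (∑≡0 (λ c → ∏ (In c S) λ p → 𝟙 (not (E² ω p))) z₀ c′∈))
            where
            go : (∃ λ p → p ∈ In c′ S × 𝟙 (not (E² ω p)) ≡ 0) → ⊥
            go ((u , v) , p∈ , e≡0) = pair (second (c′ u) u∈S v∈S (𝟙-not≡0 e≡0)) (∈-picks u∈S)
              where
              uv : (u , v) ∈ vp S × mono c′ (u , v) ≡ true
              uv = ∈-keep⁻ (mono c′) {vp S} p∈
              u∈S : u ∈ S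
              u∈S = proj₁ (vp-≢ uS (proj₁ uv))
              v∈S : v ∈ S
              v∈S = proj₁ (proj₂ (vp-≢ uS (proj₁ uv)))
              u≢v : u ≢ v
              u≢v = proj₂ (proj₂ (vp-≢ uS (proj₁ uv)))
              pair : (∃ λ j → j ≢ c′ u × cnt (common u v j) S < x) → (∃ λ R₀ → (u , R₀) ∈ picks S) → ⊥
              pair (j , ne , low-uv) (R₀ , h₁) = let R , h₂ = ∈-picks (strip (Perm.∈-resp-↭ (picks-↭ S h₁) v∈S)) in
                Clash.contra u v (c′ u) j u∈S v∈S u≢v (ne ∘ sym) (lows u u∈S)
                  (subst (λ i → lowdeg v i < x) (sym (==-true (proj₂ uv))) (lows v v∈S)) low-uv R₀ R h₁ h₂
                where
                strip : v ∈ u ∷ R₀ → v ∈ R₀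
                strip (here e)  = contradiction (sym e) u≢v
                strip (there h) = h

          absurd : ⊥
          absurd = recolour (cols-choice uS (λ z i → lowdeg z i < x) low-class)

        absurd : ⊥
        absurd = go (multi r′ ≤-refl)
          where
          go : (∃ λ (A : Vec (List V) r) → Multi ω S (σ r′) A) → ⊥
          go (A⋆ , M⋆) = let c , c∈ , hc = cols-choice uS (λ z i → deg ω z (lookup A⋆ i) < q) (λ z z∈ → class free M⋆ z∈) in
            Given.absurd A⋆ M⋆ c c∈ hc

    cover : ∀ ω → ff S ω ≤ Y₀ S ω + Y₁ S ω + Y₂ S ω + Y₃ S ω + Y₄ S ω
    cover ω = go (contains? ω S)
      where
      a₀ a₁ a₂ a₃ total : ℕ
      a₀ = Y₀ S ω
      a₁ = a₀ + Y₁ S ω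
      a₂ = a₁ + Y₂ S ω
      a₃ = a₂ + Y₃ S ω
      total = a₃ + Y₄ S ω
      nonzero : ¬ Contains ω S → total ≡ 0 → ⊥
      nonzero free z = Contra.absurd ω free
          (m+n≡0⇒m≡0 a₀ z₁) (m+n≡0⇒n≡0 a₀ z₁) (m+n≡0⇒n≡0 a₁ z₂) (m+n≡0⇒n≡0 a₂ z₃) (m+n≡0⇒n≡0 a₃ z)
        where
        z₃ : a₃ ≡ 0
        z₃ = m+n≡0⇒m≡0 a₃ z
        z₂ : a₂ ≡ 0
        z₂ = m+n≡0⇒m≡0 a₂ z₃
        z₁ : a₁ ≡ 0
        z₁ = m+n≡0⇒m≡0 a₁ z₂
      go : Dec (Contains ω S) → ff S ω ≤ total
      go (yes h)   = ≤-trans (≤-reflexive (ff-zero h)) z≤n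
      go (no free) = ≤-trans (ff≤1 S ω) (n≢0⇒n>0 (nonzero free))

-- Counting the configurations of the cover.

module Growth (r′ : ℕ) where

  private
    r = suc r′

  -- Turán's bound for the number of cross pairs of an `r`-partition, rounded down.
  β : ℕ → ℕ
  β m = r′ * (m * m) / (2 * r)

  B : ℕ → ℕ
  B m = r ^ m * 2 ^ β m

  ≤β : ∀ {a m} c → 2 * r * a ≤ r′ * (m * m) + 2 * r * c → a ≤ β m + c
  ≤β {a} {m} c h = begin
    a                                          ≡⟨ m*n/n≡m a (2 * r) ⟨
    a * (2 * r) / (2 * r)                      ≤⟨ /-monoˡ-≤ (2 * r) (≤-trans (≤-reflexive (*-comm a (2 * r))) h) ⟩
    (r′ * (m * m) + 2 * r * c) / (2 * r)       ≡⟨ +-distrib-/-∣ʳ (r′ * (m * m)) {2 * r * c} {2 * r} (m∣m*n c) ⟩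
    β m + 2 * r * c / (2 * r)                  ≡⟨ cong (β m +_) (≡-trans (cong (_/ (2 * r)) (*-comm (2 * r) c)) (m*n/n≡m c (2 * r))) ⟩
    β m + c ∎
    where open ≤-Reasoning

  2rβ≤ : ∀ m → 2 * r * β m ≤ r′ * (m * m)
  2rβ≤ m = ≤-trans (≤-reflexive (*-comm (2 * r) (β m))) (m/n*n≤m (r′ * (m * m)) (2 * r))

  -- Putting back `j` vertices raises Turán's bound by (r′/r) m j, for m = d + j, up to an error
  -- depending on `j` and `r` only. So a configuration may use, per removed vertex, a fraction r′/r
  -- of the bits towards the rest.
  β-growth : ∀ d j W → r * W ≤ r′ * ((d + j) * j) → β d + W ≤ β (d + j) + j * j
  β-growth d j W h = ≤β {m = d + j} (j * j) (begin
    2 * r * (β d + W)                          ≡⟨ lem₁ r (β d) W ⟩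
    2 * r * β d + 2 * (r * W)                  ≤⟨ +-mono-≤ (2rβ≤ d) (*-monoʳ-≤ 2 h) ⟩
    r′ * (d * d) + 2 * (r′ * ((d + j) * j))    ≡⟨ lem₂ r′ d j ⟩
    r′ * ((d + j) * (d + j)) + r′ * (j * j)    ≤⟨ +-monoʳ-≤ (r′ * ((d + j) * (d + j))) (*-monoˡ-≤ (j * j) r′≤2r) ⟩
    r′ * ((d + j) * (d + j)) + 2 * r * (j * j) ∎)
    where
    open ≤-Reasoning
    lem₁ : ∀ r a W → 2 * r * (a + W) ≡ 2 * r * a + 2 * (r * W)
    lem₁ = solve-∀
    lem₂ : ∀ r d j → r * (d * d) + 2 * (r * ((d + j) * j)) ≡ r * ((d + j) * (d + j)) + r * (j * j)
    lem₂ = solve-∀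
    r′≤2r : r′ ≤ 2 * r
    r′≤2r = ≤-trans (n≤1+n r′) (m≤m+n r (r + 0))

  B-growth : ∀ d j W → r * W ≤ r′ * ((d + j) * j) → B d * 2 ^ W ≤ 2 ^ (j * j) * B (d + j)
  B-growth d j W h = begin
    r ^ d * 2 ^ β d * 2 ^ W            ≡⟨ ≡-trans (*-assoc (r ^ d) _ _) (cong (r ^ d *_) (sym (^-distribˡ-+-* 2 (β d) W))) ⟩
    r ^ d * 2 ^ (β d + W)              ≤⟨ *-mono-≤ (^-monoʳ-≤ r (m≤m+n d j)) (^-monoʳ-≤ 2 (β-growth d j W h)) ⟩
    r ^ (d + j) * 2 ^ (β (d + j) + j * j) ≡⟨ cong (r ^ (d + j) *_) (^-distribˡ-+-* 2 (β (d + j)) (j * j)) ⟩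
    r ^ (d + j) * (2 ^ β (d + j) * 2 ^ (j * j)) ≡⟨ lem (r ^ (d + j)) (2 ^ β (d + j)) (2 ^ (j * j)) ⟩
    2 ^ (j * j) * B (d + j) ∎
    where
    open ≤-Reasoning
    lem : ∀ a b c → a * (b * c) ≡ c * (a * b)
    lem = solve-∀

does-true : ∀ {P : Set} (d : Dec P) → does d ≡ true → P
does-true (yes p) _ = p

cnt≤1 : ∀ {A : Set} (p : A → Bool) {L} → Unique L → (∀ x y → x ≢ y → p x ≡ true → p y ≡ true → ⊥) → cnt p L ≤ 1
cnt≤1 p []      h = z≤n
cnt≤1 p {x ∷ L} (a ∷ u) h with p x in eq
... | false = cnt≤1 p u h
... | true  = s≤s (≤-trans (∑-mono∈ L {g = λ _ → 0} others) (≤-reflexive (∑-zero L)))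
  where
  others : ∀ y → y ∈ L → 𝟙 (p y) ≤ 0
  others y y∈ with p y in eq′
  ... | false = z≤n
  ... | true  = ⊥-elim (h x y (λ e → All≢⇒∉ a (subst (_∈ L) (sym e) y∈)) eq eq′)

module Bounds (n : ℕ) {k : ℕ} (F : Graph k) {r′ : ℕ} (crit : Critical (suc r′) F)
              (s b e : ℕ) (σ : ℕ → ℕ) (m y δ t y₃ : ℕ) where

  open Cover n F crit s b e σ m y δ t y₃ public
  open Growth r′ public

  𝔼∑-bound : ∀ {I : Set} (L : List I) Q ω (f : I → Ω → ℕ) M K → (∀ z → z ∈ L → M * 𝔼 Q ω (f z) ≤ K) →
    M * 𝔼 Q ω (λ ω → ∑ L (λ z → f z ω)) ≤ length L * K
  𝔼∑-bound L Q ω f M K h = begin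
    M * 𝔼 Q ω (λ ω → ∑ L (λ z → f z ω))   ≡⟨ cong (M *_) (∑-swap (enum Q ω) L (λ ω z → f z ω)) ⟩
    M * ∑ L (λ z → 𝔼 Q ω (f z))           ≡⟨ ∑-*ˡ L M _ ⟨
    ∑ L (λ z → M * 𝔼 Q ω (f z))           ≤⟨ ∑-bound L K h ⟩
    length L * K ∎
    where open ≤-Reasoning

  𝔼-guard : ∀ g Q ω (X : Ω → ℕ) M K → (g ≡ true → M * 𝔼 Q ω X ≤ K) → M * 𝔼 Q ω (λ ω → 𝟙 g * X ω) ≤ K
  𝔼-guard true  Q ω X M K h = ≤-trans (≤-reflexive (cong (M *_) (𝔼-cong Q ω λ ω → +-identityʳ (X ω)))) (h refl)
  𝔼-guard false Q ω X M K h = ≤-trans (≤-reflexive (≡-trans (cong (M *_) (∑-zero (enum Q ω))) (*-zeroʳ M))) z≤n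

  𝔼-+ : ∀ Q ω (X X′ : Ω → ℕ) M K K′ → M * 𝔼 Q ω X ≤ K → M * 𝔼 Q ω X′ ≤ K′ → M * 𝔼 Q ω (λ ω → X ω + X′ ω) ≤ K + K′
  𝔼-+ Q ω X X′ M K K′ h h′ = ≤-trans (≤-reflexive (≡-trans (cong (M *_) (∑-+ (enum Q ω) X X′)) (*-distribˡ-+ M _ _))) (+-mono-≤ h h′)

  Cr≤β : ∀ c S → length (Cr c S) ≤ β (length S)
  Cr≤β c S = ≤-trans (≤β {m = length S} 0 (≤-trans (turán c S) (m≤m+n _ _))) (≤-reflexive (+-identityʳ _))

  length-allFin : length (allFin r) ≡ r
  length-allFin = length-tabulate {n = r} id

  Y₀-bound : ∀ {S} → Unique S → ∀ ω → 𝔼 (pairs S) ω (Y₀ S) ≤ B (length S)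
  Y₀-bound {S} uS ω = begin
    𝔼 (pairs S) ω (Y₀ S)           ≡⟨ *-identityˡ _ ⟨
    1 * 𝔼 (pairs S) ω (Y₀ S)       ≤⟨ 𝔼∑-bound (cols S) (pairs S) ω _ 1 (2 ^ β (length S)) (λ c _ →
                                        ≤-trans (≤-reflexive (*-identityˡ _)) (≤-trans (𝔼-proper c uS ω) (^-monoʳ-≤ 2 (Cr≤β c S)))) ⟩
    length (cols S) * 2 ^ β (length S) ≡⟨ cong (_* 2 ^ β (length S)) (length-cols uS) ⟩
    B (length S) ∎
    where open ≤-Reasoning

  module Inductive (C : ℕ) {S : List V} (uS : Unique S) (lenS : length S ≡ m)
                   (IH : ∀ R → Unique R → length R < m → ∀ ω → 𝔼 (pairs R) ω (ff R) ≤ C * B (length R)) where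

    remove : ∀ Z R j → 0 < j → S ↭ Z ++ R → length Z ≡ j → length R + j ≡ m × length R < m × Unique R × Unique (Z ++ R)
    remove Z R j 0<j p lenZ = eq , ≤-trans (m<m+n (length R) 0<j) (≤-reflexive eq) , unique-++ʳ Z (unique-↭ p uS) , unique-↭ p uS
      where
      eq : length R + j ≡ m
      eq = ≡-trans (+-comm (length R) j) (≡-trans (cong (_+ length R) (sym lenZ)) (≡-trans (sym (length-++ Z)) (≡-trans (sym (Perm.↭-length p)) lenS)))

    pay : ∀ d j W → d + j ≡ m → r * W ≤ r′ * (m * j) → ∀ M D →  M * D ≤ 2 ^ W →
      M * (2 ^ (j * j) * (D * (C * B d))) ≤ 2 ^ (2 * (j * j)) * (C * B m)
    pay d j W refl hW M D hD = begin
      M * (2 ^ (j * j) * (D * (C * B d)))    ≡⟨ lem M (2 ^ (j * j)) D C (B d) ⟩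
      M * D * (2 ^ (j * j) * C * B d)        ≤⟨ *-monoˡ-≤ _ hD ⟩
      2 ^ W * (2 ^ (j * j) * C * B d)        ≡⟨ lem₂ (2 ^ W) (2 ^ (j * j)) C (B d) ⟩
      2 ^ (j * j) * C * (B d * 2 ^ W)        ≤⟨ *-monoʳ-≤ (2 ^ (j * j) * C) (B-growth d j W hW) ⟩
      2 ^ (j * j) * C * (2 ^ (j * j) * B (d + j)) ≡⟨ lem₃ (2 ^ (j * j)) C (B (d + j)) ⟩
      2 ^ (j * j) * 2 ^ (j * j) * (C * B (d + j)) ≡⟨ cong (_* (C * B (d + j))) (≡-trans (sym (^-distribˡ-+-* 2 (j * j) (j * j))) (cong (2 ^_) (cong (j * j +_) (sym (+-identityʳ _))))) ⟩
      2 ^ (2 * (j * j)) * (C * B (d + j)) ∎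
      where
      open ≤-Reasoning
      lem : ∀ M p D C b → M * (p * (D * (C * b))) ≡ M * D * (p * C * b)
      lem = solve-∀
      lem₂ : ∀ w p C b → w * (p * C * b) ≡ p * C * (b * w)
      lem₂ = solve-∀
      lem₃ : ∀ p C b → p * C * (p * b) ≡ p * p * (C * b)
      lem₃ = solve-∀

    cst₁ : ℕ → ℕ
    cst₁ ρ′ = m ^ j * (2 ^ (2 * (j * j)) * 2 ^ (j * N₁ ρ′))
      where j = suc ρ′ * σ ρ′

    -- With ρ < r parts a low vertex uses about (ρ-1)/ρ of its bits, less than the permitted
    -- fraction (r-1)/r. The difference leaves a spare bit for each vertex, the `suc` in
    -- `suc (w ρ′)`, and hence the gain 2^m.
    Y₁-bound : (w : ℕ → ℕ) → (∀ ρ′ → 0 < σ ρ′) →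
      (∀ ρ′ → ρ′ < r′ → suc (suc ρ′ * (suc (σ ρ′) ^ σ (suc ρ′) * 2 ^ (ρ′ * σ ρ′))) ≤ 2 ^ w ρ′) →
      (∀ ρ′ → ρ′ < r′ → r * suc (w ρ′) ≤ r′ * (suc ρ′ * σ ρ′)) →
      ∀ ω → 2 ^ m * 𝔼 (pairs S) ω (Y₁ S) ≤ ∑ (upTo r′) cst₁ * (C * B m)
    Y₁-bound w σ>0 hw hr ω = begin
      2 ^ m * 𝔼 (pairs S) ω (Y₁ S)
        ≡⟨ cong (2 ^ m *_) (∑-swap (enum (pairs S) ω) (upTo r′) _) ⟩
      2 ^ m * ∑ (upTo r′) (λ ρ′ → 𝔼 (pairs S) ω (U₁ ρ′ S))
        ≡⟨ ∑-*ˡ (upTo r′) (2 ^ m) _ ⟨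
      ∑ (upTo r′) (λ ρ′ → 2 ^ m * 𝔼 (pairs S) ω (U₁ ρ′ S))
        ≤⟨ ∑-mono∈ (upTo r′) (λ ρ′ ρ∈ → stage ρ′ (∈-upTo⁻ ρ∈)) ⟩
      ∑ (upTo r′) (λ ρ′ → cst₁ ρ′ * (C * B m))
        ≡⟨ ∑-*ʳ (upTo r′) (C * B m) cst₁ ⟩
      ∑ (upTo r′) cst₁ * (C * B m) ∎
      where
      open ≤-Reasoning
      stage : ∀ ρ′ → ρ′ < r′ → 2 ^ m * 𝔼 (pairs S) ω (U₁ ρ′ S) ≤ cst₁ ρ′ * (C * B m)
      stage ρ′ lt = begin
        2 ^ m * 𝔼 (pairs S) ω (U₁ ρ′ S)
          ≤⟨ 𝔼∑-bound (sels (suc ρ′) (σ ρ′) S) (pairs S) ω (T₁ ρ′) (2 ^ m) (2 ^ (2 * (j * j)) * 2 ^ (j * N) * (C * B m)) each ⟩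
        length (sels (suc ρ′) (σ ρ′) S) * (2 ^ (2 * (j * j)) * 2 ^ (j * N) * (C * B m))
          ≤⟨ *-monoˡ-≤ _ (≤-trans (length-sels (suc ρ′) (σ ρ′) S) (≤-reflexive (cong (_^ j) lenS))) ⟩
        m ^ j * (2 ^ (2 * (j * j)) * 2 ^ (j * N) * (C * B m))
          ≡⟨ *-assoc (m ^ j) (2 ^ (2 * (j * j)) * 2 ^ (j * N)) (C * B m) ⟨
        cst₁ ρ′ * (C * B m) ∎
        where
        j = suc ρ′ * σ ρ′
        N = N₁ ρ′
        0<j : 0 < j
        0<j = ≤-trans (σ>0 ρ′) (m≤m+n (σ ρ′) (ρ′ * σ ρ′))
        lem : ∀ a b c d e → a * (b * (c * d * e)) ≡ c * (a * (b * (d * e)))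
        lem = solve-∀
        lem₂ : ∀ a b c → a * (b * c) ≡ b * a * c
        lem₂ = solve-∀
        lem₃ : ∀ r w m → r * (w * m) ≡ r * w * m
        lem₃ = solve-∀
        lem₄ : ∀ r j m → r * j * m ≡ r * (m * j)
        lem₄ = solve-∀
        hW : r * (suc (w ρ′) * m) ≤ r′ * (m * j)
        hW = ≤-trans (≤-reflexive (lem₃ r (suc (w ρ′)) m)) (≤-trans (*-monoˡ-≤ m (hr ρ′ lt)) (≤-reflexive (lem₄ r′ j m)))
        one : ∀ A R → S ↭ flat A ++ R → (∀ i → length (lookup A i) ≡ σ ρ′) → length (flat A) ≡ j →
          length R + j ≡ m → length R < m → Unique R → Unique (flat A ++ R) →
          2 ^ m * 𝔼 (pairs S) ω (T₁ ρ′ (A , R)) ≤ 2 ^ (2 * (j * j)) * 2 ^ (j * N) * (C * B m)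
        one A R p lenA lenZ lenR lt′ uR uAR = begin
          2 ^ m * 𝔼 (pairs S) ω (T₁ ρ′ (A , R))
            ≤⟨ *-monoʳ-≤ (2 ^ m) (≤-trans (≤-reflexive (sym (*-identityˡ _)))
                 (piece (flat A) R p (T₁ ρ′ (A , R)) (ff R) 1 (2 ^ (j * N) * (2 ^ w ρ′) ^ length R) (C * B (length R))
                   (pulled (cross (flat A) R) (ff R) (ev₁ (σ (suc ρ′)) A R N) 1 (2 ^ (j * N) * (2 ^ w ρ′) ^ length R) (ff-⟂ R _ (cross-off uAR)) inner)
                   (IH R uR lt′) ω)) ⟩
          2 ^ m * (2 ^ (length (flat A) * length (flat A)) * (2 ^ (j * N) * (2 ^ w ρ′) ^ length R * (C * B (length R))))
            ≡⟨ cong (λ z → 2 ^ m * (2 ^ (z * z) * (2 ^ (j * N) * (2 ^ w ρ′) ^ length R * (C * B (length R))))) lenZ ⟩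
          2 ^ m * (2 ^ (j * j) * (2 ^ (j * N) * (2 ^ w ρ′) ^ length R * (C * B (length R))))
            ≡⟨ lem (2 ^ m) (2 ^ (j * j)) (2 ^ (j * N)) ((2 ^ w ρ′) ^ length R) (C * B (length R)) ⟩
          2 ^ (j * N) * (2 ^ m * (2 ^ (j * j) * ((2 ^ w ρ′) ^ length R * (C * B (length R)))))
            ≤⟨ *-monoʳ-≤ (2 ^ (j * N)) (pay (length R) j (suc (w ρ′) * m) lenR hW (2 ^ m) ((2 ^ w ρ′) ^ length R) hD) ⟩
          2 ^ (j * N) * (2 ^ (2 * (j * j)) * (C * B m))
            ≡⟨ lem₂ (2 ^ (j * N)) (2 ^ (2 * (j * j))) (C * B m) ⟩
          2 ^ (2 * (j * j)) * 2 ^ (j * N) * (C * B m) ∎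
          where
          inner : ∀ ω → 1 * 𝔼 (cross (flat A) R) ω (ev₁ (σ (suc ρ′)) A R N) ≤ 2 ^ (j * N) * (2 ^ w ρ′) ^ length R
          inner ω = ≤-trans (≤-reflexive (*-identityˡ _))
            (≤-trans (Piece.ev₁-bound A R uAR lenA (σ (suc ρ′)) N ω) (*-monoʳ-≤ (2 ^ (j * N)) (^-monoˡ-≤ (length R) (hw ρ′ lt))))
          hD : 2 ^ m * (2 ^ w ρ′) ^ length R ≤ 2 ^ (suc (w ρ′) * m)
          hD = begin
            2 ^ m * (2 ^ w ρ′) ^ length R   ≡⟨ cong (2 ^ m *_) (^-*-assoc 2 (w ρ′) (length R)) ⟩
            2 ^ m * 2 ^ (w ρ′ * length R)   ≤⟨ *-monoʳ-≤ (2 ^ m) (^-monoʳ-≤ 2 (*-monoʳ-≤ (w ρ′) (<⇒≤ lt′))) ⟩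
            2 ^ m * 2 ^ (w ρ′ * m)          ≡⟨ ^-distribˡ-+-* 2 m (w ρ′ * m) ⟨
            2 ^ (suc (w ρ′) * m) ∎
        each : ∀ z → z ∈ sels (suc ρ′) (σ ρ′) S → 2 ^ m * 𝔼 (pairs S) ω (T₁ ρ′ z) ≤ 2 ^ (2 * (j * j)) * 2 ^ (j * N) * (C * B m)
        each (A , R) h =
          let lenA = sels-length (suc ρ′) (σ ρ′) S h
              lenZ = length-flat (σ ρ′) A lenA
              lenR , lt′ , uR , uAR = remove (flat A) R j 0<j (sels-↭ (suc ρ′) (σ ρ′) S h) lenZ
          in one A R (sels-↭ (suc ρ′) (σ ρ′) S h) lenA lenZ lenR lt′ uR uAR

    -- With `r` parts the low rows alone exhaust the permitted fraction of the bits, so the gain 2^m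
    -- has to come from the rare rows. The choices of `A`, `B` and the indices are polynomial in
    -- `m`.
    Y₂-bound : ∀ D → 0 < r′ → 0 < s → b ≤ s → r * suc s ^ q ≤ 2 ^ D →
      suc s ^ b * 2 ^ (e * (D + 2)) ≤ 2 ^ s → suc b ^ q * 2 ^ (e * (D + 2)) ≤ 2 ^ b →
      ∀ ω → 2 ^ m * 𝔼 (pairs S) ω (Y₂ S) ≤ m ^ (r * s) * (r * (r * (suc (suc s ^ b) * 2 ^ (2 * (r * s * (r * s)))))) * (C * B m)
    Y₂-bound D 0<r′ 0<s b≤s hD h₁ h₂ ω = begin
      2 ^ m * 𝔼 (pairs S) ω (Y₂ S)
        ≤⟨ 𝔼∑-bound (sels r s S) (pairs S) ω U₂ (2 ^ m) (r * (r * (suc (suc s ^ b) * K))) each ⟩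
      length (sels r s S) * (r * (r * (suc (suc s ^ b) * K)))
        ≤⟨ *-monoˡ-≤ _ (≤-trans (length-sels r s S) (≤-reflexive (cong (_^ j) lenS))) ⟩
      m ^ j * (r * (r * (suc (suc s ^ b) * K)))
        ≡⟨ lem (m ^ j) r (suc (suc s ^ b)) (2 ^ (2 * (j * j))) (C * B m) ⟩
      m ^ j * (r * (r * (suc (suc s ^ b) * 2 ^ (2 * (j * j))))) * (C * B m) ∎
      where
      open ≤-Reasoning
      j = r * s
      K = 2 ^ (2 * (j * j)) * (C * B m)
      lem : ∀ a r c d e → a * (r * (r * (c * (d * e)))) ≡ a * (r * (r * (c * d))) * e
      lem = solve-∀
      s≤r′s : s ≤ r′ * s
      s≤r′s = ≤-trans (≤-reflexive (sym (*-identityˡ s))) (*-monoˡ-≤ s 0<r′)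
      0<j : 0 < j
      0<j = ≤-trans 0<s (m≤m+n s (r′ * s))
      lem₂ : ∀ r r′ s m → r * (r′ * s * m) ≡ r′ * (m * (r * s))
      lem₂ = solve-∀
      neq : ∀ {i j : Fin r} → not (i == j) ≡ true → i ≢ j
      neq {i} h refl = contradiction (≡-trans (sym (cong not (==-refl i))) h) λ ()
      module _ (A : Vec (List V) r) (R : List V) (p : S ↭ flat A ++ R) (lenA : ∀ i → length (lookup A i) ≡ s) (lenR : length R + j ≡ m)
               (lt : length R < m) (uR : Unique R) (uAR : Unique (flat A ++ R)) where
        uA : Unique (flat A)
        uA = unique-++ˡ (flat A) uAR
        one : ∀ i j′ B′ θ → i ≢ j′ → Unique B′ → (∀ {z} → z ∈ B′ → z ∈ lookup A j′) → length B′ ≤ r′ * s →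
          suc (length B′) ^ θ * 2 ^ (e * (D + 2)) ≤ 2 ^ length B′ → 2 ^ m * 𝔼 (pairs S) ω (λ ω → ff R ω * ev₂ q A R m e i B′ θ ω) ≤ K
        one i j′ B′ θ ne uB sub lenB hB = begin
          2 ^ m * 𝔼 (pairs S) ω (λ ω → ff R ω * ev₂ q A R m e i B′ θ ω)
            ≤⟨ piece (flat A) R p (λ ω → ff R ω * ev₂ q A R m e i B′ θ ω) (ff R) (2 ^ m) (2 ^ (r′ * s * m)) (C * B (length R))
                 (pulled (cross (flat A) R) (ff R) (ev₂ q A R m e i B′ θ) (2 ^ m) (2 ^ (r′ * s * m)) (ff-⟂ R _ (cross-off uAR))
                   (Piece.ev₂-bound A R uAR lenA q m e D i j′ B′ θ ne uB sub lenB (<⇒≤ lt) hD hB))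
                 (IH R uR lt) ω ⟩
          2 ^ (length (flat A) * length (flat A)) * (2 ^ (r′ * s * m) * (C * B (length R)))
            ≡⟨ ≡-trans (cong (λ z → 2 ^ (z * z) * (2 ^ (r′ * s * m) * (C * B (length R)))) (length-flat s A lenA)) (sym (*-identityˡ _)) ⟩
          1 * (2 ^ (j * j) * (2 ^ (r′ * s * m) * (C * B (length R))))
            ≤⟨ pay (length R) j (r′ * s * m) lenR (≤-reflexive (lem₂ r r′ s m)) 1 (2 ^ (r′ * s * m)) (≤-reflexive (*-identityˡ _)) ⟩
          K ∎
        cell : ∀ i j′ → i ≢ j′ → 2 ^ m * 𝔼 (pairs S) ω (T₂ A R i j′) ≤ K + suc s ^ b * K
        cell i j′ ne = 𝔼-+ (pairs S) ω (λ ω → ff R ω * ev₂ q A R m e i (lookup A j′) b ω)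
          (λ ω → ∑ (combs b (lookup A j′)) (λ B → ff R ω * ev₂ q A R m e i B q ω)) (2 ^ m) K (suc s ^ b * K)
          (one i j′ (lookup A j′) b ne (flat-unique-at A uA j′) id
            (≤-trans (≤-reflexive (lenA j′)) s≤r′s) (subst (λ z → suc z ^ b * 2 ^ (e * (D + 2)) ≤ 2 ^ z) (sym (lenA j′)) h₁))
          (≤-trans (𝔼∑-bound (combs b (lookup A j′)) (pairs S) ω (λ B ω → ff R ω * ev₂ q A R m e i B q ω) (2 ^ m) K λ B′ B∈ →
              one i j′ B′ q ne (combs-unique b (flat-unique-at A uA j′) B∈) (combs-⊆ b (lookup A j′) B∈)
                (≤-trans (≤-reflexive (combs-length b (lookup A j′) B∈)) (≤-trans b≤s s≤r′s))
                (subst (λ z → suc z ^ q * 2 ^ (e * (D + 2)) ≤ 2 ^ z) (sym (combs-length b (lookup A j′) B∈)) h₂))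
            (*-monoˡ-≤ K (≤-trans (length-combs≤ b (lookup A j′)) (≤-reflexive (cong (λ z → suc z ^ b) (lenA j′))))))
        grid : 2 ^ m * 𝔼 (pairs S) ω (U₂ (A , R)) ≤ r * (r * (suc (suc s ^ b) * K))
        grid = ≤-trans (𝔼∑-bound (allFin r) (pairs S) ω (λ i ω → ∑ (allFin r) λ j → 𝟙 (not (i == j)) * T₂ A R i j ω) (2 ^ m) (r * (suc (suc s ^ b) * K)) λ i _ →
            ≤-trans (𝔼∑-bound (allFin r) (pairs S) ω (λ j ω → 𝟙 (not (i == j)) * T₂ A R i j ω) (2 ^ m) (suc (suc s ^ b) * K) λ j′ _ →
              𝔼-guard (not (i == j′)) (pairs S) ω (T₂ A R i j′) (2 ^ m) (suc (suc s ^ b) * K) λ ne → cell i j′ (neq ne))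
            (≤-reflexive (cong (_* (suc (suc s ^ b) * K)) length-allFin)))
          (≤-reflexive (cong (_* (r * (suc (suc s ^ b) * K))) length-allFin))
      each : ∀ z → z ∈ sels r s S → 2 ^ m * 𝔼 (pairs S) ω (U₂ z) ≤ r * (r * (suc (suc s ^ b) * K))
      each (A , R) h =
        let lenA = sels-length r s S h
            lenR , lt , uR , uAR = remove (flat A) R j 0<j (sels-↭ r s S h) (length-flat s A lenA)
        in grid A R (sels-↭ r s S h) lenA lenR lt uR uAR

    -- No vertices are removed here. Irregularity or imbalance makes the sum over the cross bits
    -- smaller than 2^(β m) by 2^v, and `v` will be quadratic in `m`; this pays for the list
    -- `vecs r (combs x S)` and for the inside bits. The number of colourings is the factor r^m of
    -- `B m` itself.
    Y₃-bound : ∀ l v v′ → 0 < r′ → v * 2 ^ mlen r Q ≤ y * y → 2 * r * r′ * v ≤ δ * δ → m * m ≤ 2 ^ l * v′ →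
      ∀ ω → 2 ^ v * 𝔼 (pairs S) ω (Y₃ S) ≤ (2 ^ (m * r) + r) * (2 ^ (suc l * y₃) * 2 ^ v′) * B m
    Y₃-bound l v v′ 0<r′ hv hδ hv′ ω = begin
      2 ^ v * 𝔼 (pairs S) ω (Y₃ S)
        ≤⟨ 𝔼∑-bound (cols S) (pairs S) ω (U₃ S) (2 ^ v) ((2 ^ (m * r) + r) * K) each ⟩
      length (cols S) * ((2 ^ (m * r) + r) * K)
        ≡⟨ cong (_* ((2 ^ (m * r) + r) * K)) (≡-trans (length-cols uS) (cong (r ^_) lenS)) ⟩
      r ^ m * ((2 ^ (m * r) + r) * (2 ^ (suc l * y₃) * 2 ^ v′ * 2 ^ β m))
        ≡⟨ lem (r ^ m) (2 ^ (m * r) + r) (2 ^ (suc l * y₃) * 2 ^ v′) (2 ^ β m) ⟩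
      (2 ^ (m * r) + r) * (2 ^ (suc l * y₃) * 2 ^ v′) * B m ∎
      where
      open ≤-Reasoning
      -- With Λ = 2μ the factor (1 + 1/Λ)^N is at most 2^v′, since N ≤ m² ≤ μ v′ for the number N of
      -- inside pairs.
      μ = 2 ^ l
      Λ = 2 * μ
      instance
        μ≢0 : NonZero μ
        μ≢0 = m^n≢0 2 l
        Λ≢0 : NonZero Λ
        Λ≢0 = m*n≢0 2 μ
      K = 2 ^ (suc l * y₃) * 2 ^ v′ * 2 ^ β m
      lem : ∀ a b c d → a * (b * (c * d)) ≡ b * c * (a * d)
      lem = solve-∀
      fewest : ∀ c (Y : Ω → ℕ) → (∀ ω → 2 ^ v * 𝔼 (CrK c S) ω Y ≤ 2 ^ β m) →
        2 ^ v * 𝔼 (pairs S) ω (λ ω → few c S ω * Y ω) ≤ K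
      fewest c Y hY = *-cancelˡ-≤ (Λ ^ N) {{m^n≢0 Λ N}} (begin
        Λ ^ N * (2 ^ v * 𝔼 (pairs S) ω (λ ω → 𝟙 (monoEdges ω c S <ᵇ suc y₃) * Y ω))
          ≤⟨ 𝔼-few-mono c uS Y (2 ^ v) (2 ^ β m) Λ y₃ hY ω ⟩
        Λ ^ y₃ * (suc Λ ^ N * 2 ^ β m)
          ≤⟨ *-monoʳ-≤ (Λ ^ y₃) (*-monoˡ-≤ (2 ^ β m) (pow-near μ v′ N (n≤1+n Λ) (near-2μ μ) N≤)) ⟩
        Λ ^ y₃ * (2 ^ v′ * Λ ^ N * 2 ^ β m)
          ≡⟨ lem₂ (Λ ^ y₃) (2 ^ v′) (Λ ^ N) (2 ^ β m) ⟩
        Λ ^ N * (Λ ^ y₃ * 2 ^ v′ * 2 ^ β m)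
          ≡⟨ cong (λ z → Λ ^ N * (z * 2 ^ v′ * 2 ^ β m)) (^-*-assoc 2 (suc l) y₃) ⟩
        Λ ^ N * K ∎)
        where
        N = length (In c S)
        lem₂ : ∀ a b c d → a * (b * c * d) ≡ c * (a * b * d)
        lem₂ = solve-∀
        N≤ : N ≤ μ * v′
        N≤ = begin
          N                                    ≤⟨ m≤m+n N (length (Cr c S)) ⟩
          N + length (Cr c S)                  ≡⟨ length-InK+CrK c S ⟩
          length (pairs S)                     ≤⟨ length-pairs≤ S ⟩
          length S * length S                  ≡⟨ cong₂ _*_ lenS lenS ⟩
          m * m                                ≤⟨ hv′ ⟩
          μ * v′ ∎
      Crβ : ∀ c → length (Cr c S) ≤ β m
      Crβ c = subst (λ z → length (Cr c S) ≤ β z) lenS (Cr≤β c S)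
      each : ∀ c → c ∈ cols S → 2 ^ v * 𝔼 (pairs S) ω (U₃ S c) ≤ (2 ^ (m * r) + r) * K
      each c _ = begin
        2 ^ v * 𝔼 (pairs S) ω (U₃ S c)
          ≤⟨ 𝔼-+ (pairs S) ω (λ ω → ∑ (vecs r (combs x S)) (λ X → T₃ S c X ω)) (λ ω → ∑ (allFin r) (λ i → T₃′ S c i ω)) (2 ^ v) (2 ^ (m * r) * K) (r * K)
               (≤-trans (𝔼∑-bound (vecs r (combs x S)) (pairs S) ω (T₃ S c) (2 ^ v) K λ X X∈ →
                   𝔼-guard (guard c X) (pairs S) ω (λ ω → few c S ω * Family.Fl Q y X ω) (2 ^ v) K λ g → fewest c (Family.Fl Q y X) (tuples X X∈ g))
                 (*-monoˡ-≤ K numX))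
               (≤-trans (𝔼∑-bound (allFin r) (pairs S) ω (T₃′ S c) (2 ^ v) K λ i _ →
                   𝔼-guard (unbal c S i) (pairs S) ω (λ ω → few c S ω * 1) (2 ^ v) K λ g → fewest c (λ _ → 1) (skew i g))
                 (≤-reflexive (cong (_* K) length-allFin))) ⟩
        2 ^ (m * r) * K + r * K ≡⟨ *-distribʳ-+ K (2 ^ (m * r)) r ⟨
        (2 ^ (m * r) + r) * K ∎
        where
        numX : length (vecs r (combs x S)) ≤ 2 ^ (m * r)
        numX = begin
          length (vecs r (combs x S))   ≡⟨ length-vecs r (combs x S) ⟩
          length (combs x S) ^ r        ≤⟨ ^-monoˡ-≤ r (≤-trans (length-combs≤2^ x S) (≤-reflexive (cong (2 ^_) lenS))) ⟩
          (2 ^ m) ^ r                   ≡⟨ ^-*-assoc 2 m r ⟩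
          2 ^ (m * r) ∎
        tuples : ∀ X → X ∈ vecs r (combs x S) → guard c X ≡ true → ∀ ω → 2 ^ v * 𝔼 (CrK c S) ω (Family.Fl Q y X) ≤ 2 ^ β m
        tuples X X∈ g ω = ≤-trans (Family.Fl-bound Q y X
            (λ i → combs-unique x uS (∈-vecs⁻ X∈ i)) (λ i → ≤-reflexive (sym (combs-length x S (∈-vecs⁻ X∈ i))))
            uS c (λ i z∈ → combs-⊆ x S (∈-vecs⁻ X∈ i) z∈) (λ i z∈ → All.lookup (ok i) z∈) v hv ω) (^-monoʳ-≤ 2 (Crβ c))
          where
          ok : ∀ i → All (λ z → c z ≡ i) (lookup X i)
          ok = does-true (Fin.all? (λ i → All.all? (λ z → c z Fin.≟ i) (lookup X i))) g
        skew : ∀ i → unbal c S i ≡ true → ∀ ω → 2 ^ v * 𝔼 (CrK c S) ω (λ _ → 1) ≤ 2 ^ β m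
        skew i g ω = begin
          2 ^ v * 𝔼 (CrK c S) ω (λ _ → 1)     ≡⟨ cong (2 ^ v *_) (≡-trans (𝔼-const (CrK c S) ω 1) (≡-trans (*-identityʳ _) (cong (2 ^_) (length-map key² (Cr c S))))) ⟩
          2 ^ v * 2 ^ length (Cr c S)         ≡⟨ ^-distribˡ-+-* 2 v (length (Cr c S)) ⟨
          2 ^ (v + length (Cr c S))           ≤⟨ ^-monoʳ-≤ 2 (≤-trans (≤β {m = m} 0 (≤-trans gap (m≤m+n _ _))) (≤-reflexive (+-identityʳ _))) ⟩
          2 ^ β m ∎
          where
          off : r * size c S i + δ ≤ m
          off = does-true (r * size c S i + δ ≤? m) g
          gap : 2 * r * (v + length (Cr c S)) ≤ r′ * (m * m)
          gap = *-cancelˡ-≤ r′ {{>-nonZero 0<r′}} (begin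
            r′ * (2 * r * (v + length (Cr c S)))        ≡⟨ lem₃ r r′ v (length (Cr c S)) ⟩
            2 * r * r′ * length (Cr c S) + 2 * r * r′ * v ≤⟨ +-monoʳ-≤ (2 * r * r′ * length (Cr c S)) hδ ⟩
            2 * r * r′ * length (Cr c S) + δ * δ        ≤⟨ turán-unbalanced c S i δ (≤-trans off (≤-reflexive (sym lenS))) ⟩
            r′ * r′ * (length S * length S)             ≡⟨ ≡-trans (cong (λ z → r′ * r′ * (z * z)) lenS) (*-assoc r′ r′ (m * m)) ⟩
            r′ * (r′ * (m * m)) ∎)
            where
            lem₃ : ∀ r r′ v c → r′ * (2 * r * (v + c)) ≡ 2 * r * r′ * c + 2 * r * r′ * v
            lem₃ = solve-∀

    classes≤ : ∀ A ω z → ∑ (allFin r) (λ i → 𝟙 (deg ω z (lookup A i) <ᵇ q)) ≤ r ^ 𝟙 (weak q A ω z)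
    classes≤ A ω z with weak q A ω z in eq
    ... | true  = ≤-trans (cnt≤length _ (allFin r)) (≤-reflexive (≡-trans length-allFin (sym (*-identityʳ r))))
    ... | false = cnt≤1 _ (allFin-unique r) λ i j ne p p′ → no-weak (≡-trans (sym eq) (weak⁺ q A ω z i j ne
        (<ᵇ-true⁻ {deg ω z (lookup A i)} {q} p) (<ᵇ-true⁻ {deg ω z (lookup A j)} {q} p′)))
      where
      no-weak : false ≡ true → ⊥
      no-weak ()

    -- A vertex that is not weak has few neighbours in at most one part, so its colour is forced;
    -- each of the at most `t` weak vertices has at most `r` choices.
    comp-sum : ∀ A {R} → Unique R → ∀ ω → ∑ (cols R) (λ c → comp A R c ω) ≤ r ^ t
    comp-sum A {R} uR ω = begin
      ∑ (cols R) (λ c → comp A R c ω)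
        ≡⟨ ≡-trans (∑-*ʳ (cols R) g _) (cong (_* g) (∑-cols uR λ z i → 𝟙 (deg ω z (lookup A i) <ᵇ q))) ⟩
      ∏ R (λ z → ∑ (allFin r) (λ i → 𝟙 (deg ω z (lookup A i) <ᵇ q))) * g
        ≤⟨ *-monoˡ-≤ g (∏-mono∈ R λ z _ → classes≤ A ω z) ⟩
      ∏ R (λ z → r ^ 𝟙 (weak q A ω z)) * g
        ≡⟨ cong (_* g) (∏-pow R r _) ⟩
      r ^ cnt (weak q A ω) R * g
        ≤⟨ capped ⟩
      r ^ t ∎
      where
      open ≤-Reasoning
      g = 𝟙 (cnt (weak q A ω) R <ᵇ suc t)
      capped : r ^ cnt (weak q A ω) R * 𝟙 (cnt (weak q A ω) R <ᵇ suc t) ≤ r ^ t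
      capped with cnt (weak q A ω) R <ᵇ suc t in eq
      ... | false = ≤-trans (≤-reflexive (*-zeroʳ (r ^ cnt (weak q A ω) R))) z≤n
      ... | true  = ≤-trans (≤-reflexive (*-identityʳ _)) (^-monoʳ-≤ r (s≤s⁻¹ (<ᵇ-true⁻ {cnt (weak q A ω) R} {suc t} eq)))

    weak-local : ∀ A {ω ω′ z} → (∀ i → deg ω z (lookup A i) ≡ deg ω′ z (lookup A i)) → weak q A ω z ≡ weak q A ω′ z
    weak-local A {ω} {ω′} {z} h with weak q A ω z in e | weak q A ω′ z in e′
    ... | true  | true  = refl
    ... | false | false = refl
    ... | true  | false = let i , j , ne , p , p′ = weak⁻ q A ω z e in
      ≡-trans (sym (weak⁺ q A ω′ z i j ne (subst (_< q) (h i) p) (subst (_< q) (h j) p′))) e′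
    ... | false | true  = let i , j , ne , p , p′ = weak⁻ q A ω′ z e′ in
      ≡-trans (sym e) (weak⁺ q A ω z i j ne (subst (_< q) (sym (h i)) p) (subst (_< q) (sym (h j)) p′))

    comp-⟂ : ∀ A c {Z R} → Unique (Z ++ R) → (∀ i {z} → z ∈ lookup A i → z ∈ R) → comp A R c ⟂ cross Z R
    comp-⟂ A c {Z} {R} uq A⊆R ω e′ b′ e∈ = cong₂ _*_
      (∏-cong∈ R λ z z∈ → cong (λ d → 𝟙 (d <ᵇ q)) (degs z z∈ (c z)))
      (cong (λ d → 𝟙 (d <ᵇ suc t)) (∑-cong∈ R λ z z∈ → cong 𝟙 (weak-local A {ω [ e′ ]≔ b′} {ω} {z} (degs z z∈))))
      where
      degs : ∀ z → z ∈ R → ∀ i → deg (ω [ e′ ]≔ b′) z (lookup A i) ≡ deg ω z (lookup A i)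
      degs z z∈ i = deg-local {ω [ e′ ]≔ b′} {ω} (lookup A i) λ w w∈ → E-upd ω e′ b′ z w (cross-off uq e∈ z∈ (A⊆R i w∈))

    -- In class `i` nearly all rows are empty and elsewhere the four rows are free, which makes
    -- about 2(m - m/r) bits: just the permitted number `W`. The saving 2^v₂ comes from class `j`,
    -- where one of the four rows is nearly excluded. It has to cover the imbalance `δ`, the errors
    -- 2^v₁ and `Φ`, and the r^t partitions. The number 2 of removed vertices is called `j` to keep
    -- its powers symbolic.
    Y₄-bound : ∀ j → j ≡ 2 → ∀ μ v₁ v₂ W → .{{NonZero μ}} → m ≤ μ * v₁ → 4 * v₂ * r + (δ + 2 * r) ≤ m →
      r * W ≤ r′ * (m * j) → r′ * (m * 2) ≤ r * suc W →
      ∀ ω → 2 ^ v₂ * 𝔼 (pairs S) ω (Y₄ S) ≤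
        m * (m * (m ^ (r * s) * (r * (r * (2 ^ (2 * (j * j)) * ((6 * μ) ^ (3 * x) * (2 ^ v₁ * 2 ^ (suc (2 * δ + 4 * r)) * r ^ t))))))) * (C * B m)
    Y₄-bound j j≡2 μ v₁ v₂ W hμ hv₂ hW hW′ ω = begin
      2 ^ v₂ * 𝔼 (pairs S) ω (Y₄ S)
        ≤⟨ 𝔼∑-bound (picks S) (pairs S) ω (λ (u , R₀) ω → ∑ (picks R₀) λ (v , R) → ∑ (sels r s R) λ (A , _) → U₄ u v R A ω) (2 ^ v₂) (m * (m ^ (r * s) * (r * (r * K)))) each₁ ⟩
      length (picks S) * (m * (m ^ (r * s) * (r * (r * K))))
        ≡⟨ cong (_* (m * (m ^ (r * s) * (r * (r * K))))) (≡-trans (length-picks S) lenS) ⟩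
      m * (m * (m ^ (r * s) * (r * (r * K))))
        ≡⟨ lem m (m ^ (r * s)) r (2 ^ (2 * (j * j))) Θ (C * B m) ⟩
      m * (m * (m ^ (r * s) * (r * (r * (2 ^ (2 * (j * j)) * Θ))))) * (C * B m) ∎
      where
      open ≤-Reasoning
      Φ Θ K W′ D₄ : ℕ
      Φ = (6 * μ) ^ (3 * x)
      Θ = Φ * (2 ^ v₁ * 2 ^ (suc (2 * δ + 4 * r)) * r ^ t)
      K = 2 ^ (2 * (j * j)) * Θ * (C * B m)
      W′ = W + suc (2 * δ + 4 * r)
      D₄ = Φ * (2 ^ v₁ * 2 ^ W′)
      lem : ∀ m p r a b c → m * (m * (p * (r * (r * (a * b * c))))) ≡ m * (m * (p * (r * (r * (a * b))))) * c
      lem = solve-∀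
      lem₁ : ∀ a b c d e f → a * (b * (c * d)) * (e * f) ≡ a * (b * d * e) * (c * f)
      lem₁ = solve-∀
      lem₂ : ∀ a b c → a * (b * c) ≡ b * (1 * (a * c))
      lem₂ = solve-∀
      lem₃ : ∀ a b c → a * (b * c) ≡ b * a * c
      lem₃ = solve-∀
      lem₄ : ∀ a b c d → a * (b * (c * d)) ≡ c * (a * (b * d))
      lem₄ = solve-∀
      l₁ : ∀ r′ m → suc r′ * (2 * m) ≡ 2 * m + r′ * (m * 2)
      l₁ = solve-∀
      l₂ : ∀ r′ z δ W → 2 * (suc r′ * z + (δ + 2 * suc r′)) + suc r′ * suc W + (2 * (r′ * δ) + 4 * (r′ * suc r′)) ≡
        suc r′ * (2 * z + (W + suc (2 * δ + 4 * suc r′)))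
      l₂ = solve-∀

      module _ (u v : V) (R : List V) (perm : S ↭ (u ∷ v ∷ []) ++ R) (lenR : length R + j ≡ m) (lt : length R < m)
               (uR : Unique R) (uq : Unique (u ∷ v ∷ R)) where

        Z : List V
        Z = u ∷ v ∷ []

        sparse : ∀ c i i′ → not (i == i′) ≡ true → bal c R ≡ true → ∀ ω → 2 ^ v₂ * 𝔼 (cross Z R) ω (ev₄ u v R c i i′ x) ≤ D₄
        sparse c i i′ g₁ g₂ ω = *-cancelˡ-≤ (4 ^ size c R i) {{m^n≢0 4 (size c R i)}} (begin
          4 ^ size c R i * (2 ^ v₂ * 𝔼 (cross Z R) ω (ev₄ u v R c i i′ x))
            ≡⟨ *-assoc (4 ^ size c R i) (2 ^ v₂) _ ⟨
          4 ^ size c R i * 2 ^ v₂ * 𝔼 (cross Z R) ω (ev₄ u v R c i i′ x)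
            ≤⟨ Pair.pair-bound n u v R uq c i i′ i≢i′ μ x v₁ v₂ (≤-trans (<⇒≤ lt) hμ) big ω ⟩
          Φ * (2 ^ v₁ * 4 ^ length R)
            ≤⟨ *-monoʳ-≤ Φ (*-monoʳ-≤ (2 ^ v₁) (begin
                 4 ^ length R                       ≡⟨ ^-*-assoc 2 2 (length R) ⟩
                 2 ^ (2 * length R)                 ≤⟨ ^-monoʳ-≤ 2 budget ⟩
                 2 ^ (2 * size c R i + W′)          ≡⟨ ^-distribˡ-+-* 2 (2 * size c R i) W′ ⟩
                 2 ^ (2 * size c R i) * 2 ^ W′      ≡⟨ cong (_* 2 ^ W′) (^-*-assoc 2 2 (size c R i)) ⟨
                 4 ^ size c R i * 2 ^ W′ ∎)) ⟩
          Φ * (2 ^ v₁ * (4 ^ size c R i * 2 ^ W′))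
            ≡⟨ lem₄ Φ (2 ^ v₁) (4 ^ size c R i) (2 ^ W′) ⟩
          4 ^ size c R i * D₄ ∎)
          where
          i≢i′ : i ≢ i′
          i≢i′ refl = contradiction (≡-trans (sym (cong not (==-refl i))) g₁) λ ()
          even : ∀ i → m ≤ r * size c R i + (δ + 2 * r)
          even = does-true (Fin.all? (λ i → m ≤? r * size c R i + (δ + 2 * r))) g₂
          big : 4 * v₂ ≤ size c R i′
          big = *-cancelʳ-≤ (4 * v₂) (size c R i′) r (+-cancelʳ-≤ (δ + 2 * r) _ _
            (≤-trans hv₂ (≤-trans (even i′) (≤-reflexive (cong (_+ (δ + 2 * r)) (*-comm r (size c R i′)))))))
          budget : 2 * length R ≤ 2 * size c R i + W′
          budget = *-cancelˡ-≤ r (begin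
            r * (2 * length R)        ≤⟨ *-monoʳ-≤ r (*-monoʳ-≤ 2 (<⇒≤ lt)) ⟩
            r * (2 * m)               ≡⟨ l₁ r′ m ⟩
            2 * m + r′ * (m * 2)      ≤⟨ +-mono-≤ (*-monoʳ-≤ 2 (even i)) hW′ ⟩
            2 * (r * size c R i + (δ + 2 * r)) + r * suc W
              ≤⟨ m≤m+n _ (2 * (r′ * δ) + 4 * (r′ * r)) ⟩
            2 * (r * size c R i + (δ + 2 * r)) + r * suc W + (2 * (r′ * δ) + 4 * (r′ * r))
              ≡⟨ l₂ r′ (size c R i) δ W ⟩
            r * (2 * size c R i + W′) ∎)

        module _ (A : Vec (List V) r) (A⊆R : ∀ i {z} → z ∈ lookup A i → z ∈ R) where

          single : ∀ c i i′ ω → 2 ^ v₂ * 𝔼 (cross Z R) ω (T₄ u v R A c i i′) ≤ D₄ * (ff R ω * comp A R c ω)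
          single c i i′ ω = ≤-trans (≤-reflexive (cong (2 ^ v₂ *_) (𝔼-cong (cross Z R) ω λ ω → *-assoc (𝟙 (not (i == i′))) (𝟙 (bal c R)) (G ω))))
            (𝔼-guard (not (i == i′)) (cross Z R) ω (λ ω → 𝟙 (bal c R) * G ω) (2 ^ v₂) _ λ g₁ →
              𝔼-guard (bal c R) (cross Z R) ω G (2 ^ v₂) _ λ g₂ →
                pulled (cross Z R) (λ ω → ff R ω * comp A R c ω) (ev₄ u v R c i i′ x) (2 ^ v₂) D₄
                  (⟂-* {ff R} {comp A R c} (ff-⟂ R _ (cross-off {Z} uq)) (comp-⟂ A c {Z} uq A⊆R)) (sparse c i i′ g₁ g₂) ω)
            where
            G : Ω → ℕ
            G ω = ff R ω * comp A R c ω * ev₄ u v R c i i′ x ω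

          crossed : ∀ i i′ ω → 2 ^ v₂ * 𝔼 (cross Z R) ω (λ ω → ∑ (cols R) λ c → T₄ u v R A c i i′ ω) ≤ D₄ * (r ^ t * ff R ω)
          crossed i i′ ω = begin
            2 ^ v₂ * 𝔼 (cross Z R) ω (λ ω → ∑ (cols R) λ c → T₄ u v R A c i i′ ω)
              ≡⟨ cong (2 ^ v₂ *_) (∑-swap (enum (cross Z R) ω) (cols R) (λ ω c → T₄ u v R A c i i′ ω)) ⟩
            2 ^ v₂ * ∑ (cols R) (λ c → 𝔼 (cross Z R) ω (T₄ u v R A c i i′))
              ≡⟨ ∑-*ˡ (cols R) (2 ^ v₂) (λ c → 𝔼 (cross Z R) ω (T₄ u v R A c i i′)) ⟨
            ∑ (cols R) (λ c → 2 ^ v₂ * 𝔼 (cross Z R) ω (T₄ u v R A c i i′))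
              ≤⟨ ∑-mono (cols R) (λ c → single c i i′ ω) ⟩
            ∑ (cols R) (λ c → D₄ * (ff R ω * comp A R c ω))
              ≡⟨ ≡-trans (∑-*ˡ (cols R) D₄ (λ c → ff R ω * comp A R c ω)) (cong (D₄ *_) (∑-*ˡ (cols R) (ff R ω) (λ c → comp A R c ω))) ⟩
            D₄ * (ff R ω * ∑ (cols R) (λ c → comp A R c ω))
              ≤⟨ *-monoʳ-≤ D₄ (≤-trans (*-monoʳ-≤ (ff R ω) (comp-sum A uR ω)) (≤-reflexive (*-comm (ff R ω) (r ^ t)))) ⟩
            D₄ * (r ^ t * ff R ω) ∎

          cell : ∀ i i′ → 2 ^ v₂ * 𝔼 (pairs S) ω (λ ω → ∑ (cols R) λ c → T₄ u v R A c i i′ ω) ≤ K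
          cell i i′ = begin
            2 ^ v₂ * 𝔼 (pairs S) ω (λ ω → ∑ (cols R) λ c → T₄ u v R A c i i′ ω)
              ≤⟨ piece Z R perm (λ ω → ∑ (cols R) λ c → T₄ u v R A c i i′ ω) (λ ω → r ^ t * ff R ω) (2 ^ v₂) D₄ (r ^ t * (C * B (length R))) (crossed i i′)
                   (λ ω → ≤-trans (≤-reflexive (∑-*ˡ (enum (pairs R) ω) (r ^ t) (ff R))) (*-monoʳ-≤ (r ^ t) (IH R uR lt ω))) ω ⟩
            2 ^ (length Z * length Z) * (D₄ * (r ^ t * (C * B (length R))))
              ≡⟨ cong (λ z → 2 ^ (z * z) * (D₄ * (r ^ t * (C * B (length R))))) (sym j≡2) ⟩
            2 ^ (j * j) * (D₄ * (r ^ t * (C * B (length R))))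
              ≡⟨ cong (λ z → 2 ^ (j * j) * (Φ * (2 ^ v₁ * z) * (r ^ t * (C * B (length R))))) (^-distribˡ-+-* 2 W (suc (2 * δ + 4 * r))) ⟩
            2 ^ (j * j) * (Φ * (2 ^ v₁ * (2 ^ W * 2 ^ (suc (2 * δ + 4 * r)))) * (r ^ t * (C * B (length R))))
              ≡⟨ cong (2 ^ (j * j) *_) (lem₁ Φ (2 ^ v₁) (2 ^ W) (2 ^ (suc (2 * δ + 4 * r))) (r ^ t) (C * B (length R))) ⟩
            2 ^ (j * j) * (Θ * (2 ^ W * (C * B (length R))))
              ≡⟨ lem₂ (2 ^ (j * j)) Θ (2 ^ W * (C * B (length R))) ⟩
            Θ * (1 * (2 ^ (j * j) * (2 ^ W * (C * B (length R)))))
              ≤⟨ *-monoʳ-≤ Θ (pay (length R) j W lenR hW 1 (2 ^ W) (≤-reflexive (*-identityˡ _))) ⟩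
            Θ * (2 ^ (2 * (j * j)) * (C * B m))
              ≡⟨ lem₃ Θ (2 ^ (2 * (j * j))) (C * B m) ⟩
            K ∎

          grid : 2 ^ v₂ * 𝔼 (pairs S) ω (U₄ u v R A) ≤ r * (r * K)
          grid = begin
            2 ^ v₂ * 𝔼 (pairs S) ω (U₄ u v R A)
              ≡⟨ cong (2 ^ v₂ *_) (𝔼-cong (pairs S) ω λ ω → ≡-trans (∑-swap (cols R) (allFin r) (λ c i → ∑ (allFin r) λ i′ → T₄ u v R A c i i′ ω))
                   (∑-cong (allFin r) λ i → ∑-swap (cols R) (allFin r) (λ c i′ → T₄ u v R A c i i′ ω))) ⟩
            2 ^ v₂ * 𝔼 (pairs S) ω (λ ω → ∑ (allFin r) λ i → ∑ (allFin r) λ i′ → ∑ (cols R) λ c → T₄ u v R A c i i′ ω)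
              ≤⟨ 𝔼∑-bound (allFin r) (pairs S) ω (λ i ω → ∑ (allFin r) λ i′ → ∑ (cols R) λ c → T₄ u v R A c i i′ ω) (2 ^ v₂) (r * K) (λ i _ → ≤-trans
                   (𝔼∑-bound (allFin r) (pairs S) ω (λ i′ ω → ∑ (cols R) λ c → T₄ u v R A c i i′ ω) (2 ^ v₂) K (λ i′ _ → cell i i′)) (≤-reflexive (cong (_* K) length-allFin))) ⟩
            length (allFin r) * (r * K)
              ≡⟨ cong (_* (r * K)) length-allFin ⟩
            r * (r * K) ∎

        each₃ : ∀ z → z ∈ sels r s R → 2 ^ v₂ * 𝔼 (pairs S) ω (U₄ u v R (proj₁ z)) ≤ r * (r * K)
        each₃ (A , R′) h = grid A λ i z∈ → Perm.∈-resp-↭ (↭-sym (sels-↭ r s R h)) (∈-++⁺ˡ (∈-flat⁺ A i z∈))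

      each₂ : ∀ u R₀ → (u , R₀) ∈ picks S → ∀ z → z ∈ picks R₀ →
        2 ^ v₂ * 𝔼 (pairs S) ω (λ ω → ∑ (sels r s (proj₂ z)) λ (A , _) → U₄ u (proj₁ z) (proj₂ z) A ω) ≤ m ^ (r * s) * (r * (r * K))
      each₂ u R₀ h₀ (v , R) h₁ =
        let perm = ↭-trans (picks-↭ S h₀) (prep u (picks-↭ R₀ h₁))
            lenR , lt , uR , uq = remove (u ∷ v ∷ []) R j (≤-trans (s≤s z≤n) (≤-reflexive (sym j≡2))) perm (sym j≡2)
        in ≤-trans (𝔼∑-bound (sels r s R) (pairs S) ω (λ (A , _) → U₄ u v R A) (2 ^ v₂) (r * (r * K)) (each₃ u v R perm lenR lt uR uq))
            (*-monoˡ-≤ (r * (r * K)) (≤-trans (length-sels r s R) (^-monoˡ-≤ (r * s) (<⇒≤ lt))))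

      each₁ : ∀ z → z ∈ picks S → 2 ^ v₂ * 𝔼 (pairs S) ω (λ ω → ∑ (picks (proj₂ z)) λ (v , R) → ∑ (sels r s R) λ (A , _) → U₄ (proj₁ z) v R A ω) ≤
        m * (m ^ (r * s) * (r * (r * K)))
      each₁ (u , R₀) h₀ = ≤-trans (𝔼∑-bound (picks R₀) (pairs S) ω (λ (v , R) ω → ∑ (sels r s R) λ (A , _) → U₄ u v R A ω) (2 ^ v₂) (m ^ (r * s) * (r * (r * K))) (each₂ u R₀ h₀))
          (*-monoˡ-≤ _ (≤-trans (≤-reflexive (length-picks R₀)) (≤-trans (n≤1+n _) (≤-reflexive (≡-trans (sym (Perm.↭-length (picks-↭ S h₀))) lenS)))))

-- Choice of the constants.

Ev : (ℕ → Set) → Set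
Ev P = ∃ λ M → ∀ m → M ≤ m → P m

Ev-× : ∀ {P P′ : ℕ → Set} → Ev P → Ev P′ → Ev (λ m → P m × P′ m)
Ev-× (M , h) (M′ , h′) = M + M′ , λ m le → h m (≤-trans (m≤m+n M M′) le) , h′ m (≤-trans (m≤n+m M′ M) le)

Ev-map : ∀ {P P′ : ℕ → Set} → (∀ m → P m → P′ m) → Ev P → Ev P′
Ev-map f (M , h) = M , λ m le → f m (h m le)

Ev-∀< : ∀ {P : ℕ → ℕ → Set} N → (∀ i → i < N → Ev (P i)) → Ev (λ m → ∀ i → i < N → P i m)
Ev-∀< zero    h = 0 , λ m _ i ()
Ev-∀< {P} (suc N) h = Ev-map combine-last (Ev-× (Ev-∀< {P} N λ i lt → h i (m<n⇒m<1+n lt)) (h N ≤-refl))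
  where
  combine-last : ∀ m → (∀ i → i < N → P i m) × P N m → ∀ i → i < suc N → P i m
  combine-last m (a , a′) i lt with m≤n⇒m<n∨m≡n (s≤s⁻¹ lt)
  ... | inj₁ i<N  = a i i<N
  ... | inj₂ refl = a′

n<2^n : ∀ n → n < 2 ^ n
n<2^n zero    = s≤s z≤n
n<2^n (suc n) = begin-strict
  suc n         ≤⟨ n<2^n n ⟩
  2 ^ n         <⟨ m<m+n (2 ^ n) (m^n>0 2 n) ⟩
  2 ^ n + 2 ^ n ≡⟨ cong (2 ^ n +_) (sym (+-identityʳ _)) ⟩
  2 ^ suc n     ∎
  where open ≤-Reasoning

≤/ : ∀ {x n c} .{{_ : NonZero c}} → n * c ≤ x → n ≤ x / c
≤/ {x} {n} {c} h = ≤-trans (≤-reflexive (sym (m*n/n≡m n c))) (/-monoˡ-≤ c h)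

<suc/ : ∀ x c .{{_ : NonZero c}} → x < c * suc (x / c)
<suc/ x c = begin-strict
  x                     ≡⟨ m≡m%n+[m/n]*n x c ⟩
  x % c + x / c * c     <⟨ +-monoˡ-< (x / c * c) (m%n<n x c) ⟩
  c + x / c * c         ≡⟨ *-comm (suc (x / c)) c ⟩
  c * suc (x / c)       ∎
  where open ≤-Reasoning

≤2c/ : ∀ x c .{{_ : NonZero c}} → 1 ≤ x / c → x ≤ 2 * c * (x / c)
≤2c/ x c h = begin
  x                         ≤⟨ <⇒≤ (<suc/ x c) ⟩
  c * suc (x / c)           ≤⟨ *-monoʳ-≤ c (+-monoˡ-≤ (x / c) h) ⟩
  c * (x / c + x / c)       ≡⟨ lem c (x / c) ⟩
  2 * c * (x / c)           ∎
  where
  open ≤-Reasoning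
  lem : ∀ c d → c * (d + d) ≡ 2 * c * d
  lem = solve-∀

/*≤ : ∀ x c .{{_ : NonZero c}} → c * (x / c) ≤ x
/*≤ x c = ≤-trans (≤-reflexive (*-comm c (x / c))) (m/n*n≤m x c)

-- With k = 2(b + 1), suc x is at most k 2^(x/k). Its `b`-th power uses up less than half of the
-- exponent `x`, and the other half absorbs the constant `N`.
exp-beats-poly : ∀ a b → Ev (λ x → a * suc x ^ b ≤ 2 ^ x)
exp-beats-poly a b = 2 * N , bound
  where
  open ≤-Reasoning
  k N : ℕ
  k = 2 * suc b
  N = a * k ^ b
  lem : ∀ d b → 2 * (d * b) ≡ 2 * b * d
  lem = solve-∀
  split : ∀ x → x / 2 + x / k * b ≤ x
  split x = *-cancelˡ-≤ 2 (begin
    2 * (x / 2 + x / k * b)          ≡⟨ *-distribˡ-+ 2 (x / 2) (x / k * b) ⟩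
    2 * (x / 2) + 2 * (x / k * b)    ≤⟨ +-mono-≤ (/*≤ x 2) (begin
      2 * (x / k * b)                  ≤⟨ *-monoʳ-≤ 2 (*-monoʳ-≤ (x / k) (n≤1+n b)) ⟩
      2 * (x / k * suc b)              ≡⟨ lem (x / k) (suc b) ⟩
      k * (x / k)                      ≤⟨ /*≤ x k ⟩
      x ∎) ⟩
    x + x                            ≡⟨ cong (x +_) (sym (+-identityʳ x)) ⟩
    2 * x ∎)
  bound : ∀ x → 2 * N ≤ x → a * suc x ^ b ≤ 2 ^ x
  bound x le = begin
    a * suc x ^ b                          ≤⟨ *-monoʳ-≤ a (^-monoˡ-≤ b (<suc/ x k)) ⟩
    a * (k * suc (x / k)) ^ b              ≤⟨ *-monoʳ-≤ a (^-monoˡ-≤ b (*-monoʳ-≤ k (n<2^n (x / k)))) ⟩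
    a * (k * 2 ^ (x / k)) ^ b              ≡⟨ cong (a *_) (≡-trans (^-distribʳ-* b k (2 ^ (x / k))) (cong (k ^ b *_) (^-*-assoc 2 (x / k) b))) ⟩
    a * (k ^ b * 2 ^ (x / k * b))          ≡⟨ *-assoc a (k ^ b) (2 ^ (x / k * b)) ⟨
    N * 2 ^ (x / k * b)                    ≤⟨ *-monoˡ-≤ (2 ^ (x / k * b)) (≤-trans (<⇒≤ (n<2^n N)) (^-monoʳ-≤ 2 N≤)) ⟩
    2 ^ (x / 2) * 2 ^ (x / k * b)          ≡⟨ ^-distribˡ-+-* 2 (x / 2) (x / k * b) ⟨
    2 ^ (x / 2 + x / k * b)                ≤⟨ ^-monoʳ-≤ 2 (split x) ⟩
    2 ^ x ∎
    where
    N≤ : N ≤ x / 2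
    N≤ = ≤/ {x} {N} {2} (≤-trans (≤-reflexive (*-comm N 2)) le)

Unbounded : (ℕ → ℕ) → Set
Unbounded f = ∀ N → Ev (λ m → N ≤ f m)

unbounded-/ : ∀ {f} c .{{_ : NonZero c}} → Unbounded f → Unbounded (λ m → f m / c)
unbounded-/ {f} c u N = Ev-map (λ m h → ≤/ {f m} {N} {c} h) (u (N * c))

unbounded-sq : ∀ {f} → Unbounded f → Unbounded (λ m → f m * f m)
unbounded-sq {f} u N = Ev-map (λ m h → ≤-trans (≤-trans (m≤n*m N (suc N)) (*-monoʳ-≤ (suc N) (n≤1+n N))) (*-mono-≤ h h)) (u (suc N))

exp-beats-poly/ : ∀ a b c .{{_ : NonZero c}} → Ev (λ m → a * suc m ^ b ≤ 2 ^ (m / c))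
exp-beats-poly/ a b c with exp-beats-poly (a * c ^ b) b
... | M , h = M * c , λ m le → begin
  a * suc m ^ b                    ≤⟨ *-monoʳ-≤ a (^-monoˡ-≤ b (<suc/ m c)) ⟩
  a * (c * suc (m / c)) ^ b        ≡⟨ cong (a *_) (^-distribʳ-* b c (suc (m / c))) ⟩
  a * (c ^ b * suc (m / c) ^ b)    ≡⟨ *-assoc a (c ^ b) (suc (m / c) ^ b) ⟨
  a * c ^ b * suc (m / c) ^ b      ≤⟨ h (m / c) (≤/ {m} {M} {c} le) ⟩
  2 ^ (m / c) ∎
  where open ≤-Reasoning

-- The hypotheses of `ev₂-bound` that do not involve `m`: `h₁` for a whole part as `B`, `h₂` for a
-- `b`-subset of a part.
record Sizes (r k e : ℕ) : Set where
  field
    s b D : ℕ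
    q≤b   : suc k ≤ b
    b≤s   : b ≤ s
    Q≤s   : 2 + k ≤ s
    hD    : r * suc s ^ suc k ≤ 2 ^ D
    h₁    : suc s ^ b * 2 ^ (e * (D + 2)) ≤ 2 ^ s
    h₂    : suc b ^ suc k * 2 ^ (e * (D + 2)) ≤ 2 ^ b

-- s = b² with b a power of two, so that the logarithmic D is far below b.
module SizeChoice (r k e h : ℕ) (1≤e : 1 ≤ e) (beats : (2 * suc k + e * (r + (2 * suc k + 2))) * suc h ≤ 2 ^ h) where

  open ≤-Reasoning

  q L b s D X : ℕ
  q = suc k
  L = suc (2 * h)
  b = 2 ^ h
  s = b * b
  D = r + q * L
  X = e * (D + 2)

  main : q * L + X ≤ b
  main = ≤-trans (≤-trans (m≤m+n (q * L + X) (q + e * (r * h + q + 2 * h))) (≤-reflexive (lem q e r h))) beats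
    where
    lem : ∀ q e r h → q * suc (2 * h) + e * (r + q * suc (2 * h) + 2) + (q + e * (r * h + q + 2 * h)) ≡ (2 * q + e * (r + (2 * q + 2))) * suc h
    lem = solve-∀

  b>0 : 0 < b
  b>0 = m^n>0 2 h

  b≤s : b ≤ s
  b≤s = m≤n*m b b {{>-nonZero b>0}}

  X≤b : X ≤ b
  X≤b = ≤-trans (m≤n+m X (q * L)) main

  1≤X : 1 ≤ X
  1≤X = *-mono-≤ 1≤e (≤-trans (s≤s z≤n) (m≤n+m 2 D))

  qL<b : q * L < b
  qL<b = ≤-trans (≤-trans (≤-reflexive (+-comm 1 (q * L))) (+-monoʳ-≤ (q * L) 1≤X)) main

  s≤2^L : suc s ≤ 2 ^ L
  s≤2^L = begin
    suc (b * b)               ≤⟨ +-monoˡ-≤ (b * b) (*-mono-≤ b>0 b>0) ⟩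
    b * b + b * b             ≡⟨ cong₂ _+_ bb (≡-trans bb (sym (+-identityʳ (2 ^ (2 * h))))) ⟩
    2 ^ L ∎
    where
    bb : b * b ≡ 2 ^ (2 * h)
    bb = ≡-trans (sym (^-distribˡ-+-* 2 h h)) (cong (λ z → 2 ^ (h + z)) (sym (+-identityʳ h)))

  [2^L]^q : (2 ^ L) ^ q ≡ 2 ^ (q * L)
  [2^L]^q = ≡-trans (^-*-assoc 2 L q) (cong (2 ^_) (*-comm L q))

  hD : r * suc s ^ q ≤ 2 ^ D
  hD = begin
    r * suc s ^ q           ≤⟨ *-mono-≤ (<⇒≤ (n<2^n r)) (^-monoˡ-≤ q s≤2^L) ⟩
    2 ^ r * (2 ^ L) ^ q     ≡⟨ cong (2 ^ r *_) [2^L]^q ⟩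
    2 ^ r * 2 ^ (q * L)     ≡⟨ ^-distribˡ-+-* 2 r (q * L) ⟨
    2 ^ D ∎

  h₁ : suc s ^ b * 2 ^ X ≤ 2 ^ s
  h₁ = begin
    suc s ^ b * 2 ^ X       ≤⟨ *-monoˡ-≤ (2 ^ X) (^-monoˡ-≤ b s≤2^L) ⟩
    (2 ^ L) ^ b * 2 ^ X     ≡⟨ cong (_* 2 ^ X) (^-*-assoc 2 L b) ⟩
    2 ^ (L * b) * 2 ^ X     ≡⟨ ^-distribˡ-+-* 2 (L * b) X ⟨
    2 ^ (L * b + X)         ≤⟨ ^-monoʳ-≤ 2 (≤-trans (+-monoʳ-≤ (L * b) X≤b) (≤-trans (≤-reflexive (+-comm (L * b) b)) (*-monoˡ-≤ b (≤-trans (s≤s (m≤n*m L q)) qL<b)))) ⟩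
    2 ^ s ∎

  h₂ : suc b ^ q * 2 ^ X ≤ 2 ^ b
  h₂ = begin
    suc b ^ q * 2 ^ X       ≤⟨ *-monoˡ-≤ (2 ^ X) (^-monoˡ-≤ q (≤-trans (s≤s b≤s) s≤2^L)) ⟩
    (2 ^ L) ^ q * 2 ^ X     ≡⟨ cong (_* 2 ^ X) [2^L]^q ⟩
    2 ^ (q * L) * 2 ^ X     ≡⟨ ^-distribˡ-+-* 2 (q * L) X ⟨
    2 ^ (q * L + X)         ≤⟨ ^-monoʳ-≤ 2 main ⟩
    2 ^ b ∎

  chosen : Sizes r k e
  chosen = record
    { s = s ; b = b ; D = D
    ; q≤b = ≤-trans (m≤m*n q L) (<⇒≤ qL<b) ; b≤s = b≤s ; Q≤s = ≤-trans (≤-trans (s≤s (m≤m*n q L)) qL<b) b≤s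
    ; hD = hD ; h₁ = h₁ ; h₂ = h₂ }

choose-sizes : ∀ r k e → 1 ≤ e → Sizes r k e
choose-sizes r k e 1≤e = build (exp-beats-poly a 1)
  where
  a = 2 * suc k + e * (r + (2 * suc k + 2))
  build : Ev (λ m → a * suc m ^ 1 ≤ 2 ^ m) → Sizes r k e
  build (M , beats) = SizeChoice.chosen r k e M 1≤e (≤-trans (≤-reflexive (cong (a *_) (sym (*-identityʳ (suc M))))) (beats M ≤-refl))

-- Part sizes are fixed from the last stage backwards. Given the size `s′` wanted next, the pattern
-- of a low row in one part costs `h` bits, logarithmic in `S`, so `S` can be taken larger than r(h
-- + 1).
next-size : ∀ r s′ → 0 < r → ∃ λ S → ∃ λ h → 0 < S × suc (r * suc S ^ s′) ≤ 2 ^ h × r * suc h ≤ S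
next-size r s′ r>0 with exp-beats-poly (suc (r * suc r ^ s′)) s′
... | M , beats = r * suc M , M , *-mono-≤ r>0 (s≤s z≤n) , (begin
  suc (r * suc (r * suc M) ^ s′)             ≤⟨ s≤s (*-monoʳ-≤ r (^-monoˡ-≤ s′ (+-monoˡ-≤ (r * suc M) (s≤s (z≤n {M}))))) ⟩
  suc (r * (suc r * suc M) ^ s′)             ≡⟨ cong (λ z → suc (r * z)) (^-distribʳ-* s′ (suc r) (suc M)) ⟩
  suc (r * (suc r ^ s′ * suc M ^ s′))        ≡⟨ cong suc (sym (*-assoc r (suc r ^ s′) (suc M ^ s′))) ⟩
  1 + r * suc r ^ s′ * suc M ^ s′            ≤⟨ +-monoˡ-≤ (r * suc r ^ s′ * suc M ^ s′) (m^n>0 (suc M) s′) ⟩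
  suc (r * suc r ^ s′) * suc M ^ s′          ≤⟨ beats M ≤-refl ⟩
  2 ^ M ∎) , ≤-refl
  where open ≤-Reasoning

module Constants (r′ k : ℕ) where

  r q Q : ℕ
  r = suc r′
  q = suc k
  Q = 2 + k

  -- `U` = 64r makes every class of a balanced partition at least 4·8w large, so that class `j`
  -- saves 2^(8w) in the last count. `Kᵧ` brings the factor (6U)^(3x) below 2^w. `G` is the number
  -- of settings of the cross bits of one tuple.
  U Kᵧ G : ℕ
  U = 64 * r
  Kᵧ = 3 * (6 * U) * (r * Q)
  G = 2 ^ mlen r Q

  instance
    G≢0 : NonZero G
    G≢0 = m^n≢0 2 (mlen r Q)

  -- `w` is the imbalance `δ` and the unit of all losses in the last count. In the third count y²
  -- tuples gain `v` bits, and the quarter `z` of it is the allowance for each kind of loss.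
  w y v z t : ℕ → ℕ
  w m = m / U
  y m = w m / Kᵧ
  v m = y m * y m / G
  z m = v m / 4
  t m = w m / r

  -- Constants with m² ≤ Z₄ z and m² ≤ Z₅ y₃ for large `m`. Taking `l` equal to `Z₄` gives m² ≤ 2^l
  -- z.
  Z₄ Z₅ l : ℕ
  Z₄ = (2 * U * (2 * Kᵧ)) * (2 * U * (2 * Kᵧ)) * (2 * G * 8)
  l = Z₄
  Z₅ = Z₄ * (2 * suc l)

  y₃ : ℕ → ℕ
  y₃ m = z m / suc l

  -- The two summands make m/e small enough for `few₃` and for `few₄`. Neither involves `s`, because
  -- the terms with `s` are of lower order in `m`; so `e` is fixed before `s` and `b`, which depend
  -- on it.
  e : ℕ
  e = 2 * (r * r + r) * Z₅ + 2 * (r * r * (2 * U * (2 * r)))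

  e₂≥1 : 1 ≤ 2 * (r * r * (2 * U * (2 * r)))
  e₂≥1 = s≤s z≤n

  w∞ : Unbounded w
  w∞ = unbounded-/ U λ N → N , λ m le → le
  y∞ : Unbounded y
  y∞ = unbounded-/ Kᵧ w∞
  v∞ : Unbounded v
  v∞ = unbounded-/ G (unbounded-sq y∞)
  z∞ : Unbounded z
  z∞ = unbounded-/ 4 v∞
  t∞ : Unbounded t
  t∞ = unbounded-/ r w∞
  y₃∞ : Unbounded y₃
  y₃∞ = unbounded-/ (suc l) z∞

  module Large (m : ℕ) (w≥1 : 1 ≤ w m) (y≥1 : 1 ≤ y m) (v≥1 : 1 ≤ v m) (z≥1 : 1 ≤ z m) (t≥1 : 1 ≤ t m) (y₃≥1 : 1 ≤ y₃ m) where

    m≤w : m ≤ 2 * U * w m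
    m≤w = ≤2c/ m U w≥1

    m≤y : m ≤ 2 * U * (2 * Kᵧ) * y m
    m≤y = ≤-trans m≤w (≤-trans (*-monoʳ-≤ (2 * U) (≤2c/ (w m) Kᵧ y≥1)) (≤-reflexive (sym (*-assoc (2 * U) (2 * Kᵧ) (y m)))))

    m²≤z : m * m ≤ Z₄ * z m
    m²≤z = begin
      m * m                                        ≤⟨ *-mono-≤ m≤y m≤y ⟩
      c * y m * (c * y m)                          ≡⟨ lem c (y m) ⟩
      c * c * (y m * y m)                          ≤⟨ *-monoʳ-≤ (c * c) (≤2c/ (y m * y m) G v≥1) ⟩
      c * c * (2 * G * v m)                        ≤⟨ *-monoʳ-≤ (c * c) (*-monoʳ-≤ (2 * G) (≤2c/ (v m) 4 z≥1)) ⟩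
      c * c * (2 * G * (8 * z m))                  ≡⟨ lem₂ (c * c) (2 * G) (z m) ⟩
      c * c * (2 * G * 8) * z m ∎
      where
      open ≤-Reasoning
      c = 2 * U * (2 * Kᵧ)
      lem : ∀ c y → c * y * (c * y) ≡ c * c * (y * y)
      lem = solve-∀
      lem₂ : ∀ c g z → c * (g * (8 * z)) ≡ c * (g * 8) * z
      lem₂ = solve-∀

    m²≤y₃ : m * m ≤ Z₅ * y₃ m
    m²≤y₃ = ≤-trans m²≤z (≤-trans (*-monoʳ-≤ Z₄ (≤2c/ (z m) (suc l) y₃≥1)) (≤-reflexive (sym (*-assoc Z₄ (2 * suc l) (y₃ m)))))

    few₃ : ∀ s → 4 * (r * s) * Z₅ ≤ m → ∀ I → e * I ≤ 2 * (e * (r * s)) * m + (r * r + r) * (m * m) → I ≤ y₃ m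
    few₃ s big I h = *-cancelˡ-≤ (2 * e) {{e≢0}} (begin
      2 * e * I                                                    ≡⟨ *-assoc 2 e I ⟩
      2 * (e * I)                                                  ≤⟨ *-monoʳ-≤ 2 h ⟩
      2 * (2 * (e * (r * s)) * m + (r * r + r) * (m * m))          ≡⟨ lem e (r * s) m (r * r + r) (m * m) ⟩
      e * (4 * (r * s) * m) + 2 * (r * r + r) * (m * m)            ≤⟨ +-mono-≤ (*-monoʳ-≤ e lin) (begin
        2 * (r * r + r) * (m * m)                                    ≤⟨ *-monoʳ-≤ (2 * (r * r + r)) m²≤y₃ ⟩
        2 * (r * r + r) * (Z₅ * y₃ m)                                ≡⟨ *-assoc (2 * (r * r + r)) Z₅ (y₃ m) ⟨
        2 * (r * r + r) * Z₅ * y₃ m                                  ≤⟨ *-monoˡ-≤ (y₃ m) (m≤m+n (2 * (r * r + r) * Z₅) (2 * (r * r * (2 * U * (2 * r))))) ⟩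
        e * y₃ m ∎) ⟩
      e * y₃ m + e * y₃ m                                          ≡⟨ lem₂ e (y₃ m) ⟩
      2 * e * y₃ m ∎)
      where
      open ≤-Reasoning
      e≢0 : NonZero (2 * e)
      e≢0 = >-nonZero (≤-trans (≤-trans e₂≥1 (m≤n+m (2 * (r * r * (2 * U * (2 * r)))) (2 * (r * r + r) * Z₅))) (m≤m+n e (e + 0)))
      lem : ∀ e a m b c → 2 * (2 * (e * a) * m + b * c) ≡ e * (4 * a * m) + 2 * b * c
      lem = solve-∀
      lem₂ : ∀ e y → e * y + e * y ≡ 2 * e * y
      lem₂ = solve-∀
      Z₅≢0 : NonZero Z₅
      Z₅≢0 = >-nonZero (n≢0⇒n>0 λ eq → contradiction (≤-trans m²≤y₃ (≤-reflexive (cong (_* y₃ m) eq))) (<⇒≱ (*-mono-≤ m≥1 m≥1)))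
        where
        m≥1 : 1 ≤ m
        m≥1 = ≤-trans (≤-trans w≥1 (m≤n*m (w m) U)) (/*≤ m U)
      lin : 4 * (r * s) * m ≤ y₃ m
      lin = *-cancelˡ-≤ Z₅ {{Z₅≢0}} (begin
        Z₅ * (4 * (r * s) * m)     ≡⟨ lem₃ Z₅ (4 * (r * s)) m ⟩
        4 * (r * s) * Z₅ * m       ≤⟨ *-monoˡ-≤ m big ⟩
        m * m                      ≤⟨ m²≤y₃ ⟩
        Z₅ * y₃ m ∎)
        where
        lem₃ : ∀ a b c → a * (b * c) ≡ b * a * c
        lem₃ = solve-∀

    few₄ : ∀ s → 2 * (r * s) ≤ t m → ∀ w′ → e * w′ ≤ r * r * m → r * s + w′ ≤ t m
    few₄ s big w′ h = *-cancelˡ-≤ 2 (begin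
      2 * (r * s + w′)           ≡⟨ *-distribˡ-+ 2 (r * s) w′ ⟩
      2 * (r * s) + 2 * w′       ≤⟨ +-mono-≤ big half ⟩
      t m + t m                  ≡⟨ cong (t m +_) (sym (+-identityʳ (t m))) ⟩
      2 * t m ∎)
      where
      open ≤-Reasoning
      R⁴ : ℕ
      R⁴ = r * r * (2 * U * (2 * r))
      half : 2 * w′ ≤ t m
      half = *-cancelˡ-≤ R⁴ (begin
        R⁴ * (2 * w′)                          ≡⟨ lem R⁴ w′ ⟩
        2 * R⁴ * w′                            ≤⟨ *-monoˡ-≤ w′ (m≤n+m (2 * R⁴) (2 * (r * r + r) * Z₅)) ⟩
        e * w′                                 ≤⟨ h ⟩
        r * r * m                              ≤⟨ *-monoʳ-≤ (r * r) (≤-trans m≤w (*-monoʳ-≤ (2 * U) (≤2c/ (w m) r t≥1))) ⟩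
        r * r * (2 * U * (2 * r * t m))        ≡⟨ lem₂ (r * r) (2 * U) (2 * r) (t m) ⟩
        R⁴ * t m ∎)
        where
        lem : ∀ a b → a * (2 * b) ≡ 2 * a * b
        lem = solve-∀
        lem₂ : ∀ a b c t → a * (b * (c * t)) ≡ a * (b * c) * t
        lem₂ = solve-∀

    x : ℕ
    x = r * y m * Q

    3κx≤w : 3 * (6 * U) * x ≤ w m
    3κx≤w = ≤-trans (≤-reflexive (lem (3 * (6 * U)) r (y m) Q)) (/*≤ (w m) Kᵧ)
      where
      lem : ∀ a r y Q → a * (r * y * Q) ≡ a * (r * Q) * y
      lem = solve-∀

    room : r * x + w m ≤ m
    room = begin
      r * x + w m           ≤⟨ +-monoˡ-≤ (w m) (≤-trans (*-monoˡ-≤ x r≤) 3κx≤w) ⟩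
      w m + w m             ≡⟨ cong (w m +_) (sym (+-identityʳ (w m))) ⟩
      2 * w m               ≤⟨ *-monoˡ-≤ (w m) (≤-trans (s≤s (s≤s z≤n)) (m≤m*n 64 r)) ⟩
      U * w m               ≤⟨ /*≤ m U ⟩
      m ∎
      where
      open ≤-Reasoning
      r≤ : r ≤ 3 * (6 * U)
      r≤ = ≤-trans (≤-trans (m≤n*m r 64) (m≤n*m U 6)) (m≤n*m (6 * U) 3)

    hv₂ : 4 * (8 * w m) * r + (w m + 2 * r) ≤ m
    hv₂ = begin
      4 * (8 * w m) * r + (w m + 2 * r)             ≤⟨ +-monoʳ-≤ (4 * (8 * w m) * r) (+-mono-≤ (m≤m*n (w m) r) (*-monoʳ-≤ 2 (m≤n*m r (w m) {{>-nonZero w≥1}}))) ⟩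
      4 * (8 * w m) * r + (w m * r + 2 * (w m * r)) ≤⟨ m≤m+n _ (29 * (r * w m)) ⟩
      4 * (8 * w m) * r + (w m * r + 2 * (w m * r)) + 29 * (r * w m) ≡⟨ lem (w m) r ⟩
      U * w m                                       ≤⟨ /*≤ m U ⟩
      m ∎
      where
      open ≤-Reasoning
      lem : ∀ w r → 4 * (8 * w) * r + (w * r + 2 * (w * r)) + 29 * (r * w) ≡ 64 * r * w
      lem = solve-∀

    hμ : m ≤ U * suc (w m)
    hμ = <⇒≤ (<suc/ m U)

    hv : v m * G ≤ y m * y m
    hv = ≤-trans (≤-reflexive (*-comm (v m) G)) (/*≤ (y m * y m) G)

    hδ : 2 * r * r′ * v m ≤ w m * w m
    hδ = begin
      2 * r * r′ * v m             ≤⟨ *-mono-≤ (*-mono-≤ 2r≤ (≤-trans (n≤1+n r′) (≤-trans (m≤n*m r 2) 2r≤))) v≤ ⟩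
      c * c * (y m * y m)          ≡⟨ lem c (y m) ⟩
      c * y m * (c * y m)          ≤⟨ *-mono-≤ ky ky ⟩
      w m * w m ∎
      where
      open ≤-Reasoning
      c : ℕ
      c = 3 * (6 * U)
      2r≤ : 2 * r ≤ c
      2r≤ = ≤-trans (*-monoˡ-≤ r (s≤s (s≤s (z≤n {62})))) (≤-trans (m≤n*m U 6) (m≤n*m (6 * U) 3))
      v≤ : v m ≤ y m * y m
      v≤ = ≤-trans (m≤m*n (v m) G) hv
      lem : ∀ a y → a * a * (y * y) ≡ a * y * (a * y)
      lem = solve-∀
      ky : c * y m ≤ w m
      ky = ≤-trans (*-monoˡ-≤ (y m) (m≤m*n c (r * Q))) (/*≤ (w m) Kᵧ)

    hv′ : m * m ≤ 2 ^ l * z m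
    hv′ = ≤-trans m²≤z (*-monoˡ-≤ (z m) (<⇒≤ (n<2^n Z₄)))

    exponents₃ : Z₄ * (2 * r + 3) ≤ m → (m * r + (r + 3)) + (suc l * y₃ m + z m) ≤ v m
    exponents₃ big = begin
      (m * r + (r + 3)) + (suc l * y₃ m + z m)   ≤⟨ +-mono-≤ lin (+-monoˡ-≤ (z m) (/*≤ (z m) (suc l))) ⟩
      z m + (z m + z m)                          ≤⟨ m≤n+m _ (z m) ⟩
      z m + (z m + (z m + z m))                  ≡⟨ lem (z m) ⟩
      4 * z m                                    ≤⟨ /*≤ (v m) 4 ⟩
      v m ∎
      where
      open ≤-Reasoning
      lem : ∀ z → z + (z + (z + z)) ≡ 4 * z
      lem = solve-∀
      m≥1 : 1 ≤ m
      m≥1 = ≤-trans (≤-trans w≥1 (m≤n*m (w m) U)) (/*≤ m U)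
      Z₄≢0 : NonZero Z₄
      Z₄≢0 = >-nonZero (n≢0⇒n>0 λ eq → contradiction (≤-trans m²≤z (≤-reflexive (cong (_* z m) eq))) (<⇒≱ (*-mono-≤ m≥1 m≥1)))
      lin : m * r + (r + 3) ≤ z m
      lin = *-cancelˡ-≤ Z₄ {{Z₄≢0}} (begin
        Z₄ * (m * r + (r + 3))               ≤⟨ *-monoʳ-≤ Z₄ (+-monoʳ-≤ (m * r) (m≤n*m (r + 3) m {{>-nonZero m≥1}})) ⟩
        Z₄ * (m * r + m * (r + 3))           ≡⟨ lem₂ Z₄ m r ⟩
        Z₄ * (2 * r + 3) * m                 ≤⟨ *-monoˡ-≤ m big ⟩
        m * m                                ≤⟨ m²≤z ⟩
        Z₄ * z m ∎)
        where
        lem₂ : ∀ a m r → a * (m * r + m * (r + 3)) ≡ a * (2 * r + 3) * m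
        lem₂ = solve-∀

  abstract
    sizes : Sizes r k e
    sizes = choose-sizes r k e (≤-trans e₂≥1 (m≤n+m (2 * (r * r * (2 * U * (2 * r)))) (2 * (r * r + r) * Z₅)))

    next : ∀ s′ → ∃ λ S → ∃ λ h → 0 < S × suc (r * suc S ^ s′) ≤ 2 ^ h × r * suc h ≤ S
    next s′ = next-size r s′ (s≤s z≤n)

  open Sizes sizes public

  -- Part sizes by the number of stages still to come, since `next` computes them from the last
  -- stage backwards.
  τ : ℕ → ℕ
  τ zero    = 2 + s
  τ (suc d) = proj₁ (next (τ d))

  σ : ℕ → ℕ
  σ ρ′ = τ (r′ ∸ ρ′)

  σ-top : σ r′ ≡ 2 + s
  σ-top = cong τ (n∸n≡0 r′)

  σ-pos : ∀ ρ′ → 0 < σ ρ′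
  σ-pos ρ′ = go (r′ ∸ ρ′)
    where
    go : ∀ d → 0 < τ d
    go zero    = s≤s z≤n
    go (suc d) = proj₁ (proj₂ (proj₂ (next (τ d))))

  h : ℕ → ℕ
  h ρ′ = proj₁ (proj₂ (next (σ (suc ρ′))))

  σ-next : ∀ ρ′ → ρ′ < r′ → suc (r * suc (σ ρ′) ^ σ (suc ρ′)) ≤ 2 ^ h ρ′ × r * suc (h ρ′) ≤ σ ρ′
  σ-next ρ′ lt = subst (λ S → suc (r * suc S ^ σ (suc ρ′)) ≤ 2 ^ h ρ′ × r * suc (h ρ′) ≤ S) (sym eq) (proj₂ (proj₂ (proj₂ (next (σ (suc ρ′))))))
    where
    eq : σ ρ′ ≡ proj₁ (next (σ (suc ρ′)))
    eq = cong τ (+-∸-assoc 1 lt)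

  wt : ℕ → ℕ
  wt ρ′ = ρ′ * σ ρ′ + h ρ′

  chain₁ : ∀ ρ′ → ρ′ < r′ → suc (suc ρ′ * (suc (σ ρ′) ^ σ (suc ρ′) * 2 ^ (ρ′ * σ ρ′))) ≤ 2 ^ wt ρ′
  chain₁ ρ′ lt = begin
    suc (suc ρ′ * (X * P))     ≤⟨ s≤s (*-monoˡ-≤ (X * P) (m≤n⇒m≤1+n lt)) ⟩
    suc (r * (X * P))          ≡⟨ cong suc (sym (*-assoc r X P)) ⟩
    1 + r * X * P              ≤⟨ +-monoˡ-≤ (r * X * P) (m^n>0 2 (ρ′ * σ ρ′)) ⟩
    suc (r * X) * P            ≤⟨ *-monoˡ-≤ P (proj₁ (σ-next ρ′ lt)) ⟩
    2 ^ h ρ′ * P               ≡⟨ ≡-trans (*-comm (2 ^ h ρ′) P) (sym (^-distribˡ-+-* 2 (ρ′ * σ ρ′) (h ρ′))) ⟩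
    2 ^ wt ρ′ ∎
    where
    open ≤-Reasoning
    X = suc (σ ρ′) ^ σ (suc ρ′)
    P = 2 ^ (ρ′ * σ ρ′)

  -- r′(ρ′ + 1) exceeds r ρ′ by r′ - ρ′, which is positive before the last stage. So one part size
  -- `σ ρ′` is left over, and it covers r(h + 1).
  chain₂ : ∀ ρ′ → ρ′ < r′ → r * suc (wt ρ′) ≤ r′ * (suc ρ′ * σ ρ′)
  chain₂ ρ′ lt = begin
    r * suc (ρ′ * σ ρ′ + h ρ′)             ≡⟨ lem r′ ρ′ (σ ρ′) (h ρ′) ⟩
    r′ * (ρ′ * σ ρ′) + (ρ′ * σ ρ′ + r * suc (h ρ′)) ≤⟨ +-monoʳ-≤ (r′ * (ρ′ * σ ρ′)) (+-monoʳ-≤ (ρ′ * σ ρ′) (proj₂ (σ-next ρ′ lt))) ⟩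
    r′ * (ρ′ * σ ρ′) + (ρ′ * σ ρ′ + σ ρ′)  ≡⟨ cong (r′ * (ρ′ * σ ρ′) +_) (+-comm (ρ′ * σ ρ′) (σ ρ′)) ⟩
    r′ * (ρ′ * σ ρ′) + suc ρ′ * σ ρ′       ≤⟨ +-monoʳ-≤ (r′ * (ρ′ * σ ρ′)) (*-monoˡ-≤ (σ ρ′) lt) ⟩
    r′ * (ρ′ * σ ρ′) + r′ * σ ρ′           ≡⟨ ≡-trans (+-comm _ (r′ * σ ρ′)) (sym (*-distribˡ-+ r′ (σ ρ′) (ρ′ * σ ρ′))) ⟩
    r′ * (suc ρ′ * σ ρ′) ∎
    where
    open ≤-Reasoning
    lem : ∀ r′ ρ S h → suc r′ * suc (ρ * S + h) ≡ r′ * (ρ * S) + (ρ * S + suc r′ * suc h)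
    lem = solve-∀

-- Counting F-free graphs.

shrink : ∀ {a} M K X g → .{{NonZero M}} → M * a ≤ K * X → g * K ≤ M → g * a ≤ X
shrink {a} M K X g h hK = *-cancelˡ-≤ M (begin
  M * (g * a)   ≡⟨ lem M g a ⟩
  g * (M * a)   ≤⟨ *-monoʳ-≤ g h ⟩
  g * (K * X)   ≡⟨ *-assoc g K X ⟨
  g * K * X     ≤⟨ *-monoˡ-≤ X hK ⟩
  M * X ∎)
  where
  open ≤-Reasoning
  lem : ∀ a b c → a * (b * c) ≡ b * (a * c)
  lem = solve-∀

poly≤ : ∀ a c b m → a * (c * m ^ b) ≤ a * c * suc m ^ b
poly≤ a c b m = ≤-trans (≤-reflexive (sym (*-assoc a c (m ^ b)))) (*-monoʳ-≤ (a * c) (^-monoˡ-≤ b (n≤1+n m)))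

module Exponents (U r x w t : ℕ) (hx : 3 * (6 * U) * x ≤ w) (ht : r * t ≤ w) where

  -- In units of `w` the losses are 1 for (6U)^(3x), 1 for 2^v₁, 2 for the imbalance, 1 for the
  -- partitions and 1 for the polynomial factors and constants: six of the eight units saved.
  total₄ : ∀ P → 8 * (P * 2 ^ (2 + 4 * r)) ≤ 2 ^ w →
    8 * (P * ((6 * U) ^ (3 * x) * (2 ^ suc w * 2 ^ (suc (2 * w + 4 * r)) * r ^ t))) ≤ 2 ^ (8 * w)
  total₄ P hP = begin
    8 * (P * ((6 * U) ^ (3 * x) * (2 ^ suc w * 2 ^ (suc (2 * w + 4 * r)) * r ^ t)))
      ≤⟨ *-monoʳ-≤ 8 (*-monoʳ-≤ P (*-mono-≤ Φ≤ (*-mono-≤ (≤-reflexive (sym (^-distribˡ-+-* 2 (suc w) (suc (2 * w + 4 * r))))) t≤))) ⟩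
    8 * (P * (2 ^ w * (2 ^ (suc w + suc (2 * w + 4 * r)) * 2 ^ w)))
      ≡⟨ cong (λ z → 8 * (P * z)) expo ⟩
    8 * (P * (2 ^ (2 + 4 * r) * 2 ^ (5 * w)))
      ≡⟨ lem P (2 ^ (2 + 4 * r)) (2 ^ (5 * w)) ⟩
    8 * (P * 2 ^ (2 + 4 * r)) * 2 ^ (5 * w)
      ≤⟨ *-monoˡ-≤ (2 ^ (5 * w)) hP ⟩
    2 ^ w * 2 ^ (5 * w)
      ≡⟨ ^-distribˡ-+-* 2 w (5 * w) ⟨
    2 ^ (6 * w)
      ≤⟨ ^-monoʳ-≤ 2 (*-monoˡ-≤ w (s≤s (s≤s (s≤s (s≤s (s≤s (s≤s (z≤n {2})))))))) ⟩
    2 ^ (8 * w) ∎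
    where
    open ≤-Reasoning
    lem : ∀ P a b → 8 * (P * (a * b)) ≡ 8 * (P * a) * b
    lem = solve-∀
    Φ≤ : (6 * U) ^ (3 * x) ≤ 2 ^ w
    Φ≤ = begin
      (6 * U) ^ (3 * x)         ≤⟨ ^-monoˡ-≤ (3 * x) (<⇒≤ (n<2^n (6 * U))) ⟩
      (2 ^ (6 * U)) ^ (3 * x)   ≡⟨ ^-*-assoc 2 (6 * U) (3 * x) ⟩
      2 ^ (6 * U * (3 * x))     ≡⟨ cong (2 ^_) (lem₂ (6 * U) x) ⟩
      2 ^ (3 * (6 * U) * x)     ≤⟨ ^-monoʳ-≤ 2 hx ⟩
      2 ^ w ∎
      where
      lem₂ : ∀ a x → a * (3 * x) ≡ 3 * a * x
      lem₂ = solve-∀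
    t≤ : r ^ t ≤ 2 ^ w
    t≤ = ≤-trans (^-monoˡ-≤ t (<⇒≤ (n<2^n r))) (≤-trans (≤-reflexive (^-*-assoc 2 r t)) (^-monoʳ-≤ 2 ht))
    lem₃ : ∀ w r → w + (suc w + suc (2 * w + 4 * r) + w) ≡ 2 + 4 * r + 5 * w
    lem₃ = solve-∀
    expo : 2 ^ w * (2 ^ (suc w + suc (2 * w + 4 * r)) * 2 ^ w) ≡ 2 ^ (2 + 4 * r) * 2 ^ (5 * w)
    expo = begin-equality
      2 ^ w * (2 ^ (suc w + suc (2 * w + 4 * r)) * 2 ^ w)   ≡⟨ cong (2 ^ w *_) (^-distribˡ-+-* 2 (suc w + suc (2 * w + 4 * r)) w) ⟨
      2 ^ w * 2 ^ (suc w + suc (2 * w + 4 * r) + w)         ≡⟨ ^-distribˡ-+-* 2 w _ ⟨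
      2 ^ (w + (suc w + suc (2 * w + 4 * r) + w))           ≡⟨ cong (2 ^_) (lem₃ w r) ⟩
      2 ^ (2 + 4 * r + 5 * w)                               ≡⟨ ^-distribˡ-+-* 2 (2 + 4 * r) (5 * w) ⟩
      2 ^ (2 + 4 * r) * 2 ^ (5 * w) ∎

total₃ : ∀ m r l y₃ z v → (m * r + (r + 3)) + (suc l * y₃ + z) ≤ v →
  8 * ((2 ^ (m * r) + r) * (2 ^ (suc l * y₃) * 2 ^ z)) ≤ 2 ^ v
total₃ m r l y₃ z v h = begin
  8 * ((2 ^ (m * r) + r) * (2 ^ (suc l * y₃) * 2 ^ z))
    ≤⟨ *-monoʳ-≤ 8 (*-mono-≤ first (≤-reflexive (sym (^-distribˡ-+-* 2 (suc l * y₃) z)))) ⟩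
  2 ^ 3 * (2 ^ (m * r + r) * 2 ^ (suc l * y₃ + z))
    ≡⟨ ≡-trans (cong (2 ^ 3 *_) (sym (^-distribˡ-+-* 2 (m * r + r) (suc l * y₃ + z)))) (sym (^-distribˡ-+-* 2 3 (m * r + r + (suc l * y₃ + z)))) ⟩
  2 ^ (3 + (m * r + r + (suc l * y₃ + z)))
    ≤⟨ ^-monoʳ-≤ 2 (≤-trans (≤-reflexive (lem (m * r) r (suc l * y₃ + z))) h) ⟩
  2 ^ v ∎
  where
  open ≤-Reasoning
  lem : ∀ a r b → 3 + (a + r + b) ≡ (a + (r + 3)) + b
  lem = solve-∀
  first : 2 ^ (m * r) + r ≤ 2 ^ (m * r + r)
  first = begin
    2 ^ (m * r) + r               ≤⟨ +-monoʳ-≤ (2 ^ (m * r)) (m≤n*m r (2 ^ (m * r)) {{m^n≢0 2 (m * r)}}) ⟩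
    2 ^ (m * r) + 2 ^ (m * r) * r ≡⟨ *-suc (2 ^ (m * r)) r ⟨
    2 ^ (m * r) * suc r           ≤⟨ *-monoʳ-≤ (2 ^ (m * r)) (n<2^n r) ⟩
    2 ^ (m * r) * 2 ^ r           ≡⟨ ^-distribˡ-+-* 2 (m * r) r ⟨
    2 ^ (m * r + r) ∎

module Counting {k : ℕ} (F : Graph k) {r′ : ℕ} (crit : Critical (suc r′) F) (0<r′ : 0 < r′) where

  open Constants r′ k
  open Growth r′ using (B)

  J₁ E₁ : ℕ → ℕ
  J₁ ρ′ = suc ρ′ * σ ρ′
  E₁ ρ′ = 2 ^ (2 * (J₁ ρ′ * J₁ ρ′)) * 2 ^ (J₁ ρ′ * (2 ^ (suc ρ′ * σ ρ′) * σ (suc ρ′)))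

  E₂ P₄ : ℕ
  E₂ = r * (r * (suc (suc s ^ b) * 2 ^ (2 * (r * s * (r * s)))))
  P₄ = r * (r * 2 ^ (2 * (2 * 2)))

  record LargeEnough (m : ℕ) : Set where
    field
      w≥1  : 1 ≤ w m
      y≥1  : 1 ≤ y m
      v≥1  : 1 ≤ v m
      z≥1  : 1 ≤ z m
      t≥1  : 1 ≤ t m
      y₃≥1 : 1 ≤ y₃ m
      m≥₃  : 4 * (r * s) * Z₅ ≤ m
      t≥   : 2 * (r * s) ≤ t m
      m≥₄  : Z₄ * (2 * r + 3) ≤ m
      σ₀≤m : σ 0 ≤ m
      c₁   : ∀ ρ′ → ρ′ < r′ → 8 * r′ * (m ^ J₁ ρ′ * E₁ ρ′) ≤ 2 ^ m
      c₂   : 8 * (m ^ (r * s) * E₂) ≤ 2 ^ m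
      c₄   : 8 * (m * (m * (m ^ (r * s) * P₄)) * 2 ^ (2 + 4 * r)) ≤ 2 ^ w m

  abstract
    large : Ev LargeEnough
    large = Ev-map (λ m ((a , b , c , d , e , f) , (g , h , i , j) , (k , l , n)) → record
        { w≥1 = a ; y≥1 = b ; v≥1 = c ; z≥1 = d ; t≥1 = e ; y₃≥1 = f ; m≥₃ = g ; t≥ = h ; m≥₄ = i ; σ₀≤m = j ; c₁ = k ; c₂ = l ; c₄ = n })
      (Ev-× (Ev-× (w∞ 1) (Ev-× (y∞ 1) (Ev-× (v∞ 1) (Ev-× (z∞ 1) (Ev-× (t∞ 1) (y₃∞ 1))))))
      (Ev-× (Ev-× (_ , λ m le → le) (Ev-× (t∞ (2 * (r * s))) (Ev-× (_ , λ m le → le) (_ , λ m le → le))))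
      (Ev-× (Ev-∀< r′ λ ρ′ _ → Ev-map (λ m h → ≤-trans (≤-reflexive (cong (8 * r′ *_) (*-comm (m ^ J₁ ρ′) (E₁ ρ′))))
                (≤-trans (poly≤ (8 * r′) (E₁ ρ′) (J₁ ρ′) m) h)) (exp-beats-poly (8 * r′ * E₁ ρ′) (J₁ ρ′)))
      (Ev-× (Ev-map (λ m h → ≤-trans (≤-reflexive (cong (8 *_) (*-comm (m ^ (r * s)) E₂))) (≤-trans (poly≤ 8 E₂ (r * s) m) h)) (exp-beats-poly (8 * E₂) (r * s)))
            (Ev-map (λ m h → ≤-trans (≤-reflexive (cong (8 *_) (lem m (m ^ (r * s)) P₄ (2 ^ (2 + 4 * r)))))
                (≤-trans (poly≤ 8 (P₄ * 2 ^ (2 + 4 * r)) (2 + r * s) m) h)) (exp-beats-poly/ (8 * (P₄ * 2 ^ (2 + 4 * r))) (2 + r * s) U))))))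
      where
      lem : ∀ m a p q → m * (m * (a * p)) * q ≡ p * q * (m * (m * a))
      lem = solve-∀

  -- The summand 8 makes the main term an eighth of the bound. The other summand bounds the number
  -- of all graphs on at most `M₀` vertices and starts the induction.
  M₀ C : ℕ
  M₀ = proj₁ large
  C = 8 + 2 ^ (M₀ * M₀)

  module _ (n : ℕ) where

    open Copies n F

    Claim : ℕ → Set
    Claim m = ∀ S → Unique S → length S ≡ m → ∀ ω → 𝔼 (pairs S) ω (ff S) ≤ C * B m

    private
      B≥1 : ∀ m → 1 ≤ B m
      B≥1 m = *-mono-≤ (m^n>0 r m) (m^n>0 2 (Growth.β r′ m))

    small : ∀ m → m ≤ M₀ → Claim m
    small m le S uS refl ω = begin
      𝔼 (pairs S) ω (ff S)              ≤⟨ 𝔼-bound (pairs S) ω 1 (λ ω → ff≤1 S ω) ⟩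
      2 ^ length (pairs S) * 1          ≡⟨ *-identityʳ _ ⟩
      2 ^ length (pairs S)              ≤⟨ ^-monoʳ-≤ 2 (≤-trans (length-pairs≤ S) (*-mono-≤ le le)) ⟩
      2 ^ (M₀ * M₀)                     ≤⟨ m≤n+m (2 ^ (M₀ * M₀)) 8 ⟩
      C                                 ≤⟨ m≤m*n C (B m) {{>-nonZero (B≥1 m)}} ⟩
      C * B m ∎
      where open ≤-Reasoning

    -- Five counts, each at most an eighth of the bound; so `C` is the same before and after the
    -- step.
    step : ∀ m → LargeEnough m → (∀ m′ → m′ < m → Claim m′) → Claim m
    step m big rec S uS lenS ω = *-cancelˡ-≤ 8 (begin
      8 * 𝔼 (pairs S) ω (ff S)
        ≤⟨ *-monoʳ-≤ 8 (𝔼-mono (pairs S) ω (cover Q≤s q≤b σ-top σ-pos σ₀≤m (few₃ s m≥₃) room (few₄ s t≥) uS lenS)) ⟩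
      8 * 𝔼 (pairs S) ω (λ ω → Y₀ S ω + Y₁ S ω + Y₂ S ω + Y₃ S ω + Y₄ S ω)
        ≡⟨ cong (8 *_) (≡-trans (∑-+ Ω′ _ (Y₄ S)) (cong (_+ a₄) (≡-trans (∑-+ Ω′ _ (Y₃ S)) (cong (_+ a₃)
             (≡-trans (∑-+ Ω′ _ (Y₂ S)) (cong (_+ a₂) (∑-+ Ω′ (Y₀ S) (Y₁ S)))))))) ⟩
      8 * (a₀ + a₁ + a₂ + a₃ + a₄)
        ≡⟨ lem a₀ a₁ a₂ a₃ a₄ ⟩
      8 * a₀ + 8 * a₁ + 8 * a₂ + 8 * a₃ + 8 * a₄
        ≤⟨ +-mono-≤ (+-mono-≤ (+-mono-≤ (+-mono-≤ b₀ b₁) b₂) b₃) b₄ ⟩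
      Tₘ + Tₘ + Tₘ + Tₘ + Tₘ
        ≤⟨ m≤m+n _ (3 * Tₘ) ⟩
      Tₘ + Tₘ + Tₘ + Tₘ + Tₘ + 3 * Tₘ
        ≡⟨ lem₂ Tₘ ⟩
      8 * Tₘ ∎)
      where
      open ≤-Reasoning
      open LargeEnough big
      open Large m w≥1 y≥1 v≥1 z≥1 t≥1 y₃≥1
      open Bounds n F crit s b e σ m (y m) (w m) (t m) (y₃ m) using (cover; Y₀; Y₁; Y₂; Y₃; Y₄; Y₀-bound; module Inductive)
      IH : ∀ R → Unique R → length R < m → ∀ ω → 𝔼 (pairs R) ω (ff R) ≤ C * B (length R)
      IH R uR lt = rec (length R) lt R uR refl
      open Inductive C uS lenS IH
      Ω′ = enum (pairs S) ω
      Tₘ a₀ a₁ a₂ a₃ a₄ : ℕ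
      Tₘ = C * B m
      a₀ = 𝔼 (pairs S) ω (Y₀ S)
      a₁ = 𝔼 (pairs S) ω (Y₁ S)
      a₂ = 𝔼 (pairs S) ω (Y₂ S)
      a₃ = 𝔼 (pairs S) ω (Y₃ S)
      a₄ = 𝔼 (pairs S) ω (Y₄ S)
      lem : ∀ a b c d e → 8 * (a + b + c + d + e) ≡ 8 * a + 8 * b + 8 * c + 8 * d + 8 * e
      lem = solve-∀
      lem₂ : ∀ Tₘ → Tₘ + Tₘ + Tₘ + Tₘ + Tₘ + 3 * Tₘ ≡ 8 * Tₘ
      lem₂ = solve-∀
      b₀ : 8 * a₀ ≤ Tₘ
      b₀ = *-mono-≤ (m≤m+n 8 (2 ^ (M₀ * M₀))) (subst (λ z → a₀ ≤ B z) lenS (Y₀-bound uS ω))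
      b₁ : 8 * a₁ ≤ Tₘ
      b₁ = shrink (2 ^ m) (∑ (upTo r′) cst₁) Tₘ 8 {{m^n≢0 2 m}} (Y₁-bound wt σ-pos chain₁ chain₂ ω) total₁
        where
        total₁ : 8 * ∑ (upTo r′) cst₁ ≤ 2 ^ m
        total₁ = *-cancelˡ-≤ r′ {{>-nonZero 0<r′}} (begin
          r′ * (8 * ∑ (upTo r′) cst₁)               ≡⟨ ≡-trans (sym (*-assoc r′ 8 _)) (cong (_* ∑ (upTo r′) cst₁) (*-comm r′ 8)) ⟩
          8 * r′ * ∑ (upTo r′) cst₁                 ≡⟨ ∑-*ˡ (upTo r′) (8 * r′) cst₁ ⟨
          ∑ (upTo r′) (λ ρ′ → 8 * r′ * cst₁ ρ′)     ≤⟨ ∑-bound (upTo r′) (2 ^ m) (λ ρ′ ρ∈ → c₁ ρ′ (∈-upTo⁻ ρ∈)) ⟩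
          length (upTo r′) * 2 ^ m                  ≡⟨ cong (_* 2 ^ m) (length-upTo r′) ⟩
          r′ * 2 ^ m ∎)
      b₂ : 8 * a₂ ≤ Tₘ
      b₂ = shrink (2 ^ m) (m ^ (r * s) * E₂) Tₘ 8 {{m^n≢0 2 m}}
        (Y₂-bound D 0<r′ (≤-trans (s≤s z≤n) Q≤s) b≤s hD h₁ h₂ ω) c₂
      b₃ : 8 * a₃ ≤ Tₘ
      b₃ = ≤-trans (shrink (2 ^ v m) ((2 ^ (m * r) + r) * (2 ^ (suc l * y₃ m) * 2 ^ z m)) (B m) 8 {{m^n≢0 2 (v m)}}
        (Y₃-bound l (v m) (z m) 0<r′ hv hδ hv′ ω) (total₃ m r l (y₃ m) (z m) (v m) (exponents₃ m≥₄)))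
        (m≤n*m (B m) C)
      b₄ : 8 * a₄ ≤ Tₘ
      b₄ = shrink (2 ^ (8 * w m)) (m * (m * (m ^ (r * s) * (r * (r * (2 ^ (2 * (2 * 2)) * Θ)))))) Tₘ 8 {{m^n≢0 2 (8 * w m)}}
        (Y₄-bound 2 refl U (suc (w m)) (8 * w m) (r′ * (m * 2) / r) {{m*n≢0 64 r}} hμ hv₂ (/*≤ (r′ * (m * 2)) r) (<⇒≤ (<suc/ (r′ * (m * 2)) r)) ω)
        (≤-trans (≤-reflexive (cong (8 *_) (rearr m (m ^ (r * s)) r (2 ^ (2 * (2 * 2))) Θ)))
          (Exponents.total₄ U r x (w m) (t m) 3κx≤w (/*≤ (w m) r) (m * (m * (m ^ (r * s) * P₄))) c₄))
        where
        Θ : ℕ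
        Θ = (6 * U) ^ (3 * x) * (2 ^ suc (w m) * 2 ^ (suc (2 * w m + 4 * r)) * r ^ t m)
        rearr : ∀ m a r c d → m * (m * (a * (r * (r * (c * d))))) ≡ m * (m * (a * (r * (r * c)))) * d
        rearr = solve-∀

    claim : ∀ m → Claim m
    claim = <-rec Claim λ m rec → go m rec (m ≤? M₀)
      where
      go : ∀ m → (∀ {m′} → m′ < m → Claim m′) → Dec (m ≤ M₀) → Claim m
      go m rec (yes le) = small m le
      go m rec (no  gt) = step m (proj₂ large m (<⇒≤ (≰⇒> gt))) λ m′ lt → rec lt

-- Binomial coefficients.

tri : ℕ → ℕ
tri zero    = 0
tri (suc l) = l + tri l

2tri : ∀ l → 2 * tri l + l ≡ l * l
2tri zero    = refl
2tri (suc l) = begin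
  2 * (l + tri l) + suc l         ≡⟨ lem l (tri l) ⟩
  2 * tri l + l + (l + suc l)     ≡⟨ cong (_+ (l + suc l)) (2tri l) ⟩
  l * l + (l + suc l)             ≡⟨ lem₂ l ⟩
  suc l * suc l ∎
  where
  open ≡-Reasoning
  lem : ∀ l t → 2 * (l + t) + suc l ≡ 2 * t + l + (l + suc l)
  lem = solve-∀
  lem₂ : ∀ l → l * l + (l + suc l) ≡ suc l * suc l
  lem₂ = solve-∀

bin : ℕ → ℕ → ℕ
bin n       zero    = 1
bin zero    (suc k) = 0
bin (suc n) (suc k) = bin n k + bin n (suc k)

length-combs : ∀ {A : Set} k (L : List A) → length (combs k L) ≡ bin (length L) k
length-combs zero    []      = refl
length-combs zero    (x ∷ L) = refl
length-combs (suc k) []      = refl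
length-combs (suc k) (x ∷ L) = ≡-trans (length-++ (map (x ∷_) (combs k L)))
  (cong₂ _+_ (≡-trans (length-map (x ∷_) (combs k L)) (length-combs k L)) (length-combs (suc k) L))

bin≤^ : ∀ n k → bin n k ≤ n ^ k
bin≤^ n       zero    = ≤-refl
bin≤^ zero    (suc k) = z≤n
bin≤^ (suc n) (suc k) = begin
  bin n k + bin n (suc k)   ≤⟨ +-mono-≤ (bin≤^ n k) (bin≤^ n (suc k)) ⟩
  suc n * n ^ k             ≤⟨ *-monoʳ-≤ (suc n) (^-monoˡ-≤ k (n≤1+n n)) ⟩
  suc n ^ suc k ∎
  where open ≤-Reasoning

bin-zero : ∀ {n k} → n < k → bin n k ≡ 0
bin-zero {zero}  {suc k} lt       = refl
bin-zero {suc n} {suc k} (s≤s lt) = cong₂ _+_ (bin-zero lt) (bin-zero (m<n⇒m<1+n lt))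

bin-monoˡ : ∀ {m n} k → m ≤ n → bin m k ≤ bin n k
bin-monoˡ zero    le = ≤-refl
bin-monoˡ {zero}  (suc k) le = z≤n
bin-monoˡ {suc m} {suc n} (suc k) (s≤s le) = +-mono-≤ (bin-monoˡ k le) (bin-monoˡ (suc k) le)

bin≤^-co : ∀ n l k → n ≤ l + k → bin n l ≤ suc n ^ k
bin≤^-co n       zero    k le = m^n>0 (suc n) k
bin≤^-co zero    (suc l) k le = z≤n
bin≤^-co (suc n) (suc l) zero (s≤s le) = ≤-trans (+-mono-≤ (bin≤^-co n l 0 le) (≤-reflexive (bin-zero (s≤s (≤-trans le (≤-reflexive (+-identityʳ l))))))) ≤-refl
bin≤^-co (suc n) (suc l) (suc k) (s≤s le) = begin
  bin n l + bin n (suc l)          ≤⟨ +-mono-≤ (bin≤^-co n l (suc k) le) (bin≤^-co n (suc l) k (≤-trans le (≤-reflexive (+-suc l k)))) ⟩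
  suc n ^ suc k + suc n ^ k        ≤⟨ tail-step n k ⟩
  suc (suc n) ^ suc k ∎
  where open ≤-Reasoning

absorb : ∀ n j → n * bin n j ≡ suc j * bin n (suc j) + j * bin n j
absorb zero    zero    = refl
absorb zero    (suc j) = sym (≡-trans (cong₂ _+_ (*-zeroʳ (suc (suc j))) (*-zeroʳ (suc j))) refl)
absorb (suc n) zero    = begin
  suc n * 1                    ≡⟨ cong suc (absorb n 0) ⟩
  suc (1 * bin n 1 + 0)        ≡⟨ lem (bin n 1) ⟩
  1 * (1 + bin n 1) + 0 ∎
  where
  open ≡-Reasoning
  lem : ∀ b → suc (1 * b + 0) ≡ 1 * (1 + b) + 0
  lem = solve-∀
absorb (suc n) (suc i) = begin
  suc n * (b₀ + b₁)                                                  ≡⟨ lem n b₀ b₁ ⟩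
  n * b₀ + n * b₁ + (b₀ + b₁)                                        ≡⟨ cong₂ (λ x y → x + y + (b₀ + b₁)) (absorb n i) (absorb n (suc i)) ⟩
  suc i * b₁ + i * b₀ + (suc (suc i) * b₂ + suc i * b₁) + (b₀ + b₁)  ≡⟨ lem₂ i b₀ b₁ b₂ ⟩
  suc (suc i) * (b₁ + b₂) + suc i * (b₀ + b₁) ∎
  where
  open ≡-Reasoning
  b₀ = bin n i
  b₁ = bin n (suc i)
  b₂ = bin n (suc (suc i))
  lem : ∀ n a b → suc n * (a + b) ≡ n * a + n * b + (a + b)
  lem = solve-∀
  lem₂ : ∀ i a b c → suc i * b + i * a + (suc (suc i) * c + suc i * b) + (a + b) ≡ suc (suc i) * (b + c) + suc i * (a + b)
  lem₂ = solve-∀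

bin-step : ∀ t d j → suc j ≤ t → d * bin (t + d) j ≤ suc j * bin (t + d) (suc j)
bin-step t d j lt = +-cancelʳ-≤ (t * b) _ _ (begin
  d * b + t * b               ≡⟨ lem d t b ⟩
  (t + d) * b                 ≡⟨ absorb (t + d) j ⟩
  suc j * b′ + j * b          ≤⟨ +-monoʳ-≤ (suc j * b′) (*-monoˡ-≤ b (<⇒≤ lt)) ⟩
  suc j * b′ + t * b ∎)
  where
  open ≤-Reasoning
  b = bin (t + d) j
  b′ = bin (t + d) (suc j)
  lem : ∀ d t b → d * b + t * b ≡ (t + d) * b
  lem = solve-∀

-- By `bin-step`, consecutive binomial coefficients up to index `t` grow by a factor of at least
-- d/t.
bin-down : ∀ t d j l → j + l ≡ t → d ^ l * bin (t + d) j ≤ t ^ l * bin (t + d) t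
bin-down t d j zero    e = ≤-reflexive (cong (λ j → 1 * bin (t + d) j) (≡-trans (sym (+-identityʳ j)) e))
bin-down t d j (suc l) e = begin
  d * d ^ l * bin (t + d) j               ≡⟨ lem d (d ^ l) _ ⟩
  d ^ l * (d * bin (t + d) j)             ≤⟨ *-monoʳ-≤ (d ^ l) (≤-trans (bin-step t d j j<t) (*-monoˡ-≤ (bin (t + d) (suc j)) j<t)) ⟩
  d ^ l * (t * bin (t + d) (suc j))       ≡⟨ lem₂ (d ^ l) t _ ⟩
  t * (d ^ l * bin (t + d) (suc j))       ≤⟨ *-monoʳ-≤ t (bin-down t d (suc j) l (≡-trans (sym (+-suc j l)) e)) ⟩
  t * (t ^ l * bin (t + d) t)             ≡⟨ *-assoc t (t ^ l) _ ⟨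
  t * t ^ l * bin (t + d) t ∎
  where
  open ≤-Reasoning
  j<t : suc j ≤ t
  j<t = ≤-trans (m≤m+n (suc j) l) (≤-reflexive (≡-trans (sym (+-suc j l)) e))
  lem : ∀ a b c → a * b * c ≡ b * (a * c)
  lem = solve-∀
  lem₂ : ∀ a b c → a * (b * c) ≡ b * (a * c)
  lem₂ = solve-∀

hits : ∀ {A : Set} (p : A → Bool) t l L → l ≤ t →
  ∑ (combs t L) (λ M → 𝟙 (cnt p M ≡ᵇ l)) ≤ bin (cnt p L) l * bin (cnt (not ∘ p) L) (t ∸ l)
hits p zero    zero    L       le = s≤s z≤n
hits p (suc t) l       []      le = z≤n
hits p (suc t) l       (x ∷ L) le = ≤-trans (≤-reflexive (≡-trans (∑-++ (map (x ∷_) (combs t L)) (combs (suc t) L) _)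
    (cong (_+ ∑ (combs (suc t) L) (λ M → 𝟙 (cnt p M ≡ᵇ l))) (∑-map (x ∷_) (combs t L) _)))) (split l le)
  where
  open ≤-Reasoning
  a = cnt p L
  b = cnt (not ∘ p) L
  absent : ∀ M → M ∈ combs t L → 𝟙 (cnt p M ≡ᵇ suc t) ≡ 0
  absent M M∈ with cnt p M ≡ᵇ suc t in eq
  ... | false = refl
  ... | true  = contradiction (≤-trans (≤-reflexive (sym (≡ᵇ⇒≡ (cnt p M) (suc t) (subst T (sym eq) _)))) (≤-trans (cnt≤length p M) (≤-reflexive (combs-length t L M∈)))) (<⇒≱ ≤-refl)
  split : ∀ l → l ≤ suc t → ∑ (combs t L) (λ M → 𝟙 (cnt p (x ∷ M) ≡ᵇ l)) + ∑ (combs (suc t) L) (λ M → 𝟙 (cnt p M ≡ᵇ l)) ≤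
    bin (cnt p (x ∷ L)) l * bin (cnt (not ∘ p) (x ∷ L)) (suc t ∸ l)
  split l le with p x
  split zero    le | true = ≤-trans (+-mono-≤ (≤-reflexive (∑-zero (combs t L))) (hits p (suc t) zero L z≤n)) ≤-refl
  split (suc l) le | true = begin
    _ ≤⟨ +-mono-≤ (hits p t l L (s≤s⁻¹ le)) (hits p (suc t) (suc l) L le) ⟩
    bin a l * bin b (t ∸ l) + bin a (suc l) * bin b (t ∸ l) ≡⟨ *-distribʳ-+ (bin b (t ∸ l)) (bin a l) (bin a (suc l)) ⟨
    (bin a l + bin a (suc l)) * bin b (t ∸ l) ∎
  split l le | false with m≤n⇒m<n∨m≡n le
  ... | inj₁ lt = begin
    _ ≤⟨ +-mono-≤ (hits p t l L (s≤s⁻¹ lt)) (hits p (suc t) l L le) ⟩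
    bin a l * bin b (t ∸ l) + bin a l * bin b (suc t ∸ l) ≡⟨ cong (λ z → bin a l * bin b (t ∸ l) + bin a l * bin b z) (+-∸-assoc 1 (s≤s⁻¹ lt)) ⟩
    bin a l * bin b (t ∸ l) + bin a l * bin b (suc (t ∸ l)) ≡⟨ *-distribˡ-+ (bin a l) (bin b (t ∸ l)) (bin b (suc (t ∸ l))) ⟨
    bin a l * bin (suc b) (suc (t ∸ l)) ≡⟨ cong (λ z → bin a l * bin (suc b) z) (sym (+-∸-assoc 1 (s≤s⁻¹ lt))) ⟩
    bin a l * bin (suc b) (suc t ∸ l) ∎
  ... | inj₂ refl = begin
    _ ≤⟨ +-mono-≤ (≤-reflexive (≡-trans (∑-cong∈ (combs t L) absent) (∑-zero (combs t L)))) (hits p (suc t) (suc t) L le) ⟩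
    bin a (suc t) * bin b (t ∸ t) ≡⟨ cong (λ z → bin a (suc t) * bin b z) (n∸n≡0 t) ⟩
    bin a (suc t) * 1 ≡⟨ cong (λ z → bin a (suc t) * bin (suc b) z) (sym (n∸n≡0 t)) ⟩
    bin a (suc t) * bin (suc b) (t ∸ t) ∎

-- The two ranges of the size l of an overlap: few common vertices, or few vertices outside.
module Overlap (t n g H : ℕ) (0<t : 0 < t) (0<H : 0 < H) (t≤ : t ≤ 4 * g + 3) (g≤ : suc g ≤ t)
               (c₁ : H * (t * t * 2 ^ g) + t ≤ n) (c₂ : H * (suc t * n) ≤ 2 ^ (t ∸ suc g)) (c₃ : H * 2 ^ tri t ≤ bin n t) where

  tri≤ : ∀ l → l ≤ 2 * g + 1 → tri l ≤ l * g
  tri≤ l le = *-cancelˡ-≤ 2 (+-cancelʳ-≤ l (2 * tri l) (2 * (l * g)) (begin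
    2 * tri l + l          ≡⟨ 2tri l ⟩
    l * l                  ≤⟨ *-monoʳ-≤ l le ⟩
    l * (2 * g + 1)        ≡⟨ lem l g ⟩
    2 * (l * g) + l ∎))
    where
    open ≤-Reasoning
    lem : ∀ l g → l * (2 * g + 1) ≡ 2 * (l * g) + l
    lem = solve-∀

  -- Each of the `k` vertices outside the overlap adds on average t - (k+1)/2 pairs to those of the
  -- overlap.
  tri-co : ∀ l k → l + k ≡ t → k ≤ 2 * g + 1 → tri l + k * (t ∸ suc g) ≤ tri t
  tri-co l k e le = *-cancelˡ-≤ 2 (+-cancelʳ-≤ (t + k * k + k) _ _ (begin
    2 * (tri l + k * h) + (t + k * k + k)               ≡⟨ cong (λ z → 2 * (tri l + k * h) + (z + k * k + k)) (sym e) ⟩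
    2 * (tri l + k * h) + (l + k + k * k + k)           ≡⟨ lem (tri l) k h l ⟩
    (2 * tri l + l) + (2 * (k * h) + k * (suc k) + k)   ≤⟨ +-mono-≤ (≤-reflexive (2tri l)) (+-monoˡ-≤ k (+-monoʳ-≤ (2 * (k * h)) (*-monoʳ-≤ k (s≤s le)))) ⟩
    l * l + (2 * (k * h) + k * (suc (2 * g + 1)) + k)   ≡⟨ lem₂ l k h g ⟩
    l * l + 2 * (k * (suc g + h)) + k                   ≡⟨ cong (λ z → l * l + 2 * (k * z) + k) (≡-trans (m+[n∸m]≡n g≤) (sym e)) ⟩
    l * l + 2 * (k * (l + k)) + k                       ≡⟨ lem₃ l k ⟩
    (l + k) * (l + k) + (k * k + k)                     ≡⟨ cong (λ z → z * z + (k * k + k)) e ⟩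
    t * t + (k * k + k)                                 ≡⟨ cong (_+ (k * k + k)) (sym (2tri t)) ⟩
    2 * tri t + t + (k * k + k)                         ≡⟨ lem₄ (tri t) t (k * k) k ⟩
    2 * tri t + (t + k * k + k) ∎))
    where
    open ≤-Reasoning
    h = t ∸ suc g
    lem : ∀ a k h l → 2 * (a + k * h) + (l + k + k * k + k) ≡ (2 * a + l) + (2 * (k * h) + k * (suc k) + k)
    lem = solve-∀
    lem₂ : ∀ l k h g → l * l + (2 * (k * h) + k * (suc (2 * g + 1)) + k) ≡ l * l + 2 * (k * (suc g + h)) + k
    lem₂ = solve-∀
    lem₃ : ∀ l k → l * l + 2 * (k * (l + k)) + k ≡ (l + k) * (l + k) + (k * k + k)
    lem₃ = solve-∀
    lem₄ : ∀ a t b k → 2 * a + t + (b + k) ≡ 2 * a + (t + b + k)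
    lem₄ = solve-∀

  H≤^ : ∀ l → 0 < l → H ≤ H ^ l
  H≤^ (suc l) _ = m≤m*n H (H ^ l) {{m^n≢0 H l {{>-nonZero 0<H}}}}

  -- Small overlaps are compared with disjoint sets: each common vertex costs a factor t² 2^g/(n -
  -- t), at most 1/H by `c₁`. Large overlaps are compared with the full overlap: each vertex outside
  -- costs (t+1) n/2^(t-g-1), at most 1 by `c₂`, and the full overlap has its factor 1/H from `c₃`.
  term : ∀ l k a b → 0 < l → l + k ≡ t → a ≤ t → b ≤ n → H * (bin a l * bin b k * 2 ^ tri l) ≤ bin n t
  term l k a b 0<l e a≤t b≤n with l ≤? 2 * g + 1
  ... | yes le = ≤-trans (*-monoˡ-≤ _ (H≤^ l 0<l)) (*-cancelˡ-≤ (z ^ l) {{m^n≢0 z l {{>-nonZero z>0}}}} (begin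
    z ^ l * (H ^ l * (bin a l * bin b k * 2 ^ tri l))
      ≤⟨ *-monoʳ-≤ (z ^ l) (*-monoʳ-≤ (H ^ l) (*-mono-≤ (*-mono-≤ (≤-trans (bin-monoˡ l a≤t) (bin≤^ t l)) (bin-monoˡ k b≤n))
           (≤-trans (^-monoʳ-≤ 2 (tri≤ l le)) (≤-reflexive (≡-trans (cong (2 ^_) (*-comm l g)) (sym (^-*-assoc 2 g l))))))) ⟩
    z ^ l * (H ^ l * (t ^ l * bin n k * (2 ^ g) ^ l))
      ≡⟨ lem (z ^ l) (H ^ l) (t ^ l) (bin n k) ((2 ^ g) ^ l) ⟩
    t ^ l * (2 ^ g) ^ l * (H ^ l * z ^ l * bin n k)
      ≡⟨ cong (λ y → t ^ l * (2 ^ g) ^ l * (y * bin n k)) (sym (^-distribʳ-* l H z)) ⟩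
    t ^ l * (2 ^ g) ^ l * ((H * z) ^ l * bin n k)
      ≤⟨ *-monoʳ-≤ (t ^ l * (2 ^ g) ^ l) (*-monoˡ-≤ (bin n k) (^-monoˡ-≤ l Hz≤d)) ⟩
    t ^ l * (2 ^ g) ^ l * (d ^ l * bin n k)
      ≤⟨ *-monoʳ-≤ (t ^ l * (2 ^ g) ^ l) (subst (λ n → d ^ l * bin n k ≤ t ^ l * bin n t) n≡ (bin-down t d k l (≡-trans (+-comm k l) e))) ⟩
    t ^ l * (2 ^ g) ^ l * (t ^ l * bin n t)
      ≡⟨ lem₂ (t ^ l) ((2 ^ g) ^ l) (bin n t) ⟩
    t ^ l * t ^ l * (2 ^ g) ^ l * bin n t
      ≡⟨ cong (_* bin n t) (≡-trans (cong (_* (2 ^ g) ^ l) (sym (^-distribʳ-* l t t))) (sym (^-distribʳ-* l (t * t) (2 ^ g)))) ⟩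
    z ^ l * bin n t ∎))
    where
    open ≤-Reasoning
    z = t * t * 2 ^ g
    z>0 : 0 < z
    z>0 = *-mono-≤ (*-mono-≤ 0<t 0<t) (m^n>0 2 g)
    d = n ∸ t
    n≡ : t + d ≡ n
    n≡ = m+[n∸m]≡n (≤-trans (m≤n+m t (H * z)) c₁)
    Hz≤d : H * z ≤ d
    Hz≤d = +-cancelʳ-≤ t _ _ (≤-trans c₁ (≤-reflexive (≡-trans (sym n≡) (+-comm t d))))
    lem : ∀ a b c d e → a * (b * (c * d * e)) ≡ c * e * (b * a * d)
    lem = solve-∀
    lem₂ : ∀ a b c → a * b * (a * c) ≡ a * a * b * c
    lem₂ = solve-∀
  ... | no gt = begin
    H * (bin a l * bin b k * 2 ^ tri l)
      ≤⟨ *-monoʳ-≤ H (*-cancelˡ-≤ (z ^ k) {{m^n≢0 z k {{m^n≢0 2 (t ∸ suc g)}}}} (begin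
           z ^ k * (bin a l * bin b k * 2 ^ tri l)
             ≤⟨ *-monoʳ-≤ (z ^ k) (*-monoˡ-≤ (2 ^ tri l) (≤-trans (*-mono-≤ (≤-trans (bin-monoˡ l a≤t) (bin≤^-co t l k (≤-reflexive (sym e)))) (≤-trans (bin-monoˡ k b≤n) (bin≤^ n k)))
                  (≤-reflexive (sym (^-distribʳ-* k (suc t) n))))) ⟩
           z ^ k * ((suc t * n) ^ k * 2 ^ tri l)
             ≤⟨ *-monoʳ-≤ (z ^ k) (*-monoˡ-≤ (2 ^ tri l) (^-monoˡ-≤ k (≤-trans (m≤n*m (suc t * n) H {{>-nonZero 0<H}}) c₂))) ⟩
           z ^ k * (z ^ k * 2 ^ tri l)
             ≡⟨ cong (z ^ k *_) (≡-trans (*-comm (z ^ k) (2 ^ tri l)) (cong (2 ^ tri l *_) (≡-trans (^-*-assoc 2 (t ∸ suc g) k) (cong (2 ^_) (*-comm (t ∸ suc g) k))))) ⟩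
           z ^ k * (2 ^ tri l * 2 ^ (k * (t ∸ suc g)))
             ≡⟨ cong (z ^ k *_) (sym (^-distribˡ-+-* 2 (tri l) _)) ⟩
           z ^ k * 2 ^ (tri l + k * (t ∸ suc g))
             ≤⟨ *-monoʳ-≤ (z ^ k) (^-monoʳ-≤ 2 (tri-co l k e k≤)) ⟩
           z ^ k * 2 ^ tri t ∎)) ⟩
    H * 2 ^ tri t
      ≤⟨ c₃ ⟩
    bin n t ∎
    where
    open ≤-Reasoning
    z = 2 ^ (t ∸ suc g)
    k≤ : k ≤ 2 * g + 1
    k≤ = +-cancelˡ-≤ (2 * g + 2) _ _ (begin
      2 * g + 2 + k          ≤⟨ +-monoˡ-≤ k (≤-trans (≤-reflexive (lem g)) (≰⇒> gt)) ⟩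
      l + k                  ≡⟨ e ⟩
      t                      ≤⟨ t≤ ⟩
      4 * g + 3              ≡⟨ lem₂ g ⟩
      2 * g + 2 + (2 * g + 1) ∎)
      where
      lem : ∀ g → 2 * g + 2 ≡ suc (2 * g + 1)
      lem = solve-∀
      lem₂ : ∀ g → 4 * g + 3 ≡ 2 * g + 2 + (2 * g + 1)
      lem₂ = solve-∀

-- Second moment of the number of independent t-sets.

∑-keep : ∀ {A : Set} (p : A → Bool) L f → ∑ (keep p L) f ≡ ∑ L (λ x → 𝟙 (p x) * f x)
∑-keep p []      f = refl
∑-keep p (x ∷ L) f with p x
... | true  = cong₂ _+_ (sym (+-identityʳ (f x))) (∑-keep p L f)
... | false = ∑-keep p L f

∑-*-∑ : ∀ {A B : Set} (L : List A) (M : List B) f g → ∑ L f * ∑ M g ≡ ∑ L (λ x → ∑ M λ y → f x * g y)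
∑-*-∑ L M f g = ≡-trans (sym (∑-*ʳ L (∑ M g) f)) (∑-cong L λ x → sym (∑-*ˡ M (f x) g))

-- Sets meeting fewer than X/r others can be chosen greedily.
module Greedy {A : Set} (meet : A → A → Bool) (r : ℕ) where

  -- A choice deletes the sets it meets, fewer than X/r. The invariant says that more than (j-1)X/r
  -- sets remain while `j` are to be chosen. The hypothesis is phrased through counts so that it
  -- passes on to the remaining list.
  pick-disjoint : ∀ X j (𝓖 : List A) → (∀ S → S ∈ 𝓖 → ∀ 𝓖′ → (∀ p → cnt p 𝓖′ ≤ cnt p 𝓖) → r * cnt (meet S) 𝓖′ < X) →
    j * X < r * length 𝓖 + X →
    ∃ λ (Ss : Vec A j) → (∀ i → lookup Ss i ∈ 𝓖) × (∀ i i′ → i ≢ i′ → meet (lookup Ss i) (lookup Ss i′) ≡ false ⊎ meet (lookup Ss i′) (lookup Ss i) ≡ false)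
  pick-disjoint X zero    𝓖 hd lt = [] , (λ ()) , λ ()
  pick-disjoint X (suc j) [] hd lt = contradiction (+-cancelˡ-< X _ _ (<-≤-trans lt (≤-reflexive (≡-trans (cong (_+ X) (*-zeroʳ r)) (sym (+-identityʳ X)))))) λ ()
  pick-disjoint X (suc j) 𝓖@(S ∷ _) hd lt = extend-by (pick-disjoint X j 𝓖′ hd′ lt′)
    where
    far : A → Bool
    far S′ = not (meet S S′)
    𝓖′ = keep far 𝓖
    sub-cnt : ∀ p → cnt p 𝓖′ ≤ cnt p 𝓖
    sub-cnt p = ≤-trans (≤-reflexive (cnt-keep far p 𝓖)) (cnt-mono 𝓖 λ x _ h → proj₂ (∧-true {far x} h))
    hd′ : ∀ S′ → S′ ∈ 𝓖′ → ∀ 𝓖″ → (∀ p → cnt p 𝓖″ ≤ cnt p 𝓖′) → r * cnt (meet S′) 𝓖″ < X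
    hd′ S′ S′∈ 𝓖″ h = hd S′ (proj₁ (∈-keep⁻ far S′∈)) 𝓖″ λ p → ≤-trans (h p) (sub-cnt p)
    removed : r * cnt (meet S) 𝓖 < X
    removed = hd S (here refl) 𝓖 λ p → ≤-refl
    lt′ : j * X < r * length 𝓖′ + X
    lt′ = begin-strict
      j * X                                    <⟨ +-cancelˡ-< X _ _ (<-≤-trans lt (≤-reflexive (+-comm (r * length 𝓖) X))) ⟩
      r * length 𝓖                             ≡⟨ cong (r *_) (cnt-split (meet S) 𝓖) ⟨
      r * (cnt (meet S) 𝓖 + cnt far 𝓖)         ≡⟨ *-distribˡ-+ r (cnt (meet S) 𝓖) (cnt far 𝓖) ⟩
      r * cnt (meet S) 𝓖 + r * cnt far 𝓖       ≤⟨ +-monoˡ-≤ (r * cnt far 𝓖) (<⇒≤ removed) ⟩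
      X + r * cnt far 𝓖                        ≡⟨ ≡-trans (cong (λ z → X + r * z) (sym (length-keep far 𝓖))) (+-comm X (r * length 𝓖′)) ⟩
      r * length 𝓖′ + X ∎
      where open ≤-Reasoning
    unnot : ∀ {b} → not b ≡ true → b ≡ false
    unnot {false} _ = refl
    extend-by : (∃ λ (Ss : Vec A j) → (∀ i → lookup Ss i ∈ 𝓖′) × (∀ i i′ → i ≢ i′ → meet (lookup Ss i) (lookup Ss i′) ≡ false ⊎ meet (lookup Ss i′) (lookup Ss i) ≡ false)) →
      ∃ λ (Ss : Vec A (suc j)) → (∀ i → lookup Ss i ∈ 𝓖) × (∀ i i′ → i ≢ i′ → meet (lookup Ss i) (lookup Ss i′) ≡ false ⊎ meet (lookup Ss i′) (lookup Ss i) ≡ false)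
    extend-by (Ss , mem , dis) = S ∷ Ss , mem′ , dis′
      where
      mem′ : ∀ i → lookup (S ∷ Ss) i ∈ 𝓖
      mem′ zero    = here refl
      mem′ (suc i) = proj₁ (∈-keep⁻ far (mem i))
      dis′ : ∀ i i′ → i ≢ i′ → meet (lookup (S ∷ Ss) i) (lookup (S ∷ Ss) i′) ≡ false ⊎ meet (lookup (S ∷ Ss) i′) (lookup (S ∷ Ss) i) ≡ false
      dis′ zero    zero     ne = contradiction refl ne
      dis′ zero    (suc i′) ne = inj₁ (unnot (proj₂ (∈-keep⁻ far {𝓖} (mem i′))))
      dis′ (suc i) zero     ne = inj₂ (unnot (proj₂ (∈-keep⁻ far {𝓖} (mem i))))
      dis′ (suc i) (suc i′) ne = dis i i′ (ne ∘ cong suc)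

  -- By double counting, fewer than X/r sets meet X/r or more of the sets. These are dropped before
  -- the greedy choice.
  disjoint-family : ∀ (𝓘 : List A) → r * r * ∑ 𝓘 (λ S → cnt (meet S) 𝓘) < length 𝓘 * length 𝓘 →
    ∃ λ (Ss : Vec A r) → (∀ i → lookup Ss i ∈ 𝓘) × (∀ i i′ → i ≢ i′ → meet (lookup Ss i) (lookup Ss i′) ≡ false ⊎ meet (lookup Ss i′) (lookup Ss i) ≡ false)
  disjoint-family 𝓘 h = let Ss , mem , dis = pick-disjoint X r 𝓖 hd enough in Ss , (λ i → proj₁ (∈-keep⁻ light (mem i))) , dis
    where
    open ≤-Reasoning
    X I Bd : ℕ
    X = length 𝓘
    I = ∑ 𝓘 (λ S → cnt (meet S) 𝓘)
    light : A → Bool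
    light S = r * cnt (meet S) 𝓘 <ᵇ X
    𝓖 = keep light 𝓘
    Bd = cnt (not ∘ light) 𝓘
    hd : ∀ S → S ∈ 𝓖 → ∀ 𝓖′ → (∀ p → cnt p 𝓖′ ≤ cnt p 𝓖) → r * cnt (meet S) 𝓖′ < X
    hd S S∈ 𝓖′ sub = ≤-<-trans (*-monoʳ-≤ r (≤-trans (sub (meet S)) (≤-trans (≤-reflexive (cnt-keep light (meet S) 𝓘)) (cnt-mono 𝓘 λ x _ h → proj₂ (∧-true {light x} h)))))
      (<ᵇ-true⁻ {r * cnt (meet S) 𝓘} {X} (proj₂ (∈-keep⁻ light {𝓘} S∈)))
    heavy : Bd * X ≤ r * I
    heavy = begin
      Bd * X                                         ≡⟨ ∑-*ʳ 𝓘 X _ ⟨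
      ∑ 𝓘 (λ S → 𝟙 (not (light S)) * X)              ≤⟨ ∑-mono 𝓘 pt ⟩
      ∑ 𝓘 (λ S → r * cnt (meet S) 𝓘)                 ≡⟨ ∑-*ˡ 𝓘 r _ ⟩
      r * I ∎
      where
      pt : ∀ S → 𝟙 (not (light S)) * X ≤ r * cnt (meet S) 𝓘
      pt S with r * cnt (meet S) 𝓘 <ᵇ X in eq
      ... | true  = z≤n
      ... | false = ≤-trans (≤-reflexive (+-identityʳ X)) (<ᵇ-false⁻ {r * cnt (meet S) 𝓘} {X} eq)
    few : r * Bd < X
    few = *-cancelʳ-< X (r * Bd) X (begin-strict
      r * Bd * X        ≡⟨ *-assoc r Bd X ⟩
      r * (Bd * X)      ≤⟨ *-monoʳ-≤ r heavy ⟩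
      r * (r * I)       ≡⟨ *-assoc r r I ⟨
      r * r * I         <⟨ h ⟩
      X * X ∎)
    enough : r * X < r * length 𝓖 + X
    enough = begin-strict
      r * X                           ≡⟨ cong (r *_) (cnt-split light 𝓘) ⟨
      r * (cnt light 𝓘 + Bd)          ≡⟨ *-distribˡ-+ r (cnt light 𝓘) Bd ⟩
      r * cnt light 𝓘 + r * Bd        <⟨ +-monoʳ-< (r * cnt light 𝓘) few ⟩
      r * cnt light 𝓘 + X             ≡⟨ cong (λ z → r * z + X) (sym (length-keep light 𝓘)) ⟩
      r * length 𝓖 + X ∎

module Independent (n : ℕ) where

  open Edges n
  open Rows n using (enum-off; 𝔼-cong∈)

  allF : Ω → List Key → Bool
  allF ω []      = true
  allF ω (e ∷ Q) = not (lookup ω e) ∧ allF ω Q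

  allF-∈ : ∀ Q {ω e} → allF ω Q ≡ true → e ∈ Q → lookup ω e ≡ false
  allF-∈ (f ∷ Q) {ω} h (here refl) with lookup ω f | h
  ... | false | _ = refl
  allF-∈ (f ∷ Q) {ω} h (there e∈) = allF-∈ Q (proj₂ (∧-true {not (lookup ω f)} h)) e∈

  ∈-allF : ∀ Q {ω} → (∀ {e} → e ∈ Q → lookup ω e ≡ false) → allF ω Q ≡ true
  ∈-allF []      h = refl
  ∈-allF (e ∷ Q) h = true-∧ (cong not (h (here refl))) (∈-allF Q (h ∘ there))

  allF-one : ∀ U ω → Unique U → 𝔼 U ω (λ ω → 𝟙 (allF ω U)) ≡ 1
  allF-one []      ω u = refl
  allF-one (e ∷ U) ω (a ∷ u) = begin
    𝔼 (e ∷ U) ω f                                          ≡⟨ 𝔼-∷ e U ω f ⟩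
    𝔼 U (ω [ e ]≔ false) f + 𝔼 U (ω [ e ]≔ true) f         ≡⟨ cong₂ _+_ (𝔼-cong∈ U _ λ ω′ h → cong (λ b → 𝟙 (not b ∧ allF ω′ U)) (val false h))
                                                                       (𝔼-cong∈ U _ λ ω′ h → cong (λ b → 𝟙 (not b ∧ allF ω′ U)) (val true h)) ⟩
    𝔼 U (ω [ e ]≔ false) (λ ω → 𝟙 (allF ω U)) + 𝔼 U (ω [ e ]≔ true) (λ _ → 0) ≡⟨ cong₂ _+_ (allF-one U _ u) (∑-zero (enum U (ω [ e ]≔ true))) ⟩
    1 ∎
    where
    open ≡-Reasoning
    f : Ω → ℕ
    f ω = 𝟙 (not (lookup ω e) ∧ allF ω U)
    val : ∀ b {ω′} → ω′ ∈ enum U (ω [ e ]≔ b) → lookup ω′ e ≡ b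
    val b h = ≡-trans (enum-off U (ω [ e ]≔ b) (All≢⇒∉ a) h) (lookup∘update e ω b)

  allF-prob : ∀ Q U ω → Unique U → (∀ {e} → e ∈ U → e ∈ Q) → 2 ^ length U * 𝔼 Q ω (λ ω → 𝟙 (allF ω U)) ≡ 2 ^ length Q
  allF-prob Q U ω u sub with sub-↭ {L = Q} {M = U} u sub
  ... | rest , p = begin
    2 ^ length U * 𝔼 Q ω f                      ≡⟨ cong (2 ^ length U *_) (≡-trans (𝔼-↭ (↭-trans p (Perm.++-comm U rest)) ω f) (𝔼-++ rest U ω f)) ⟩
    2 ^ length U * 𝔼 rest ω (λ ω → 𝔼 U ω f)     ≡⟨ cong (2 ^ length U *_) (≡-trans (𝔼-cong rest ω λ ω → allF-one U ω u) (≡-trans (𝔼-const rest ω 1) (*-identityʳ _))) ⟩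
    2 ^ length U * 2 ^ length rest              ≡⟨ ^-distribˡ-+-* 2 (length U) (length rest) ⟨
    2 ^ (length U + length rest)                ≡⟨ cong (2 ^_) (≡-trans (sym (length-++ U)) (sym (Perm.↭-length p))) ⟩
    2 ^ length Q ∎
    where
    open ≡-Reasoning
    f : Ω → ℕ
    f ω = 𝟙 (allF ω U)

  length-pairs-tri : ∀ L → length (pairs L) ≡ tri (length L)
  length-pairs-tri []      = refl
  length-pairs-tri (x ∷ L) = ≡-trans (length-++ (map (key x) L)) (cong₂ _+_ (length-map (key x) L) (length-pairs-tri L))

  inS : List V → V → Bool
  inS S x = does (x ∈? S)

  inS⁻ : ∀ {S x} → inS S x ≡ true → x ∈ S
  inS⁻ {S} {x} h = does-true (x ∈? S) h

  inS⁺ : ∀ {S x} → x ∈ S → inS S x ≡ true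
  inS⁺ {S} {x} h = dec-true (x ∈? S) h

  shared : List V → List V → ℕ
  shared S S′ = cnt (inS S) S′

  meet : List V → List V → Bool
  meet S S′ = 0 <ᵇ shared S S′

  meet-false : ∀ {S S′} → meet S S′ ≡ false → ∀ {x} → x ∈ S → x ∈ S′ → ⊥
  meet-false {S} {S′} h {x} x∈ x∈′ = contradiction (≤-trans (≤-trans (≤-reflexive (cong 𝟙 (sym (inS⁺ x∈)))) (∑-∈ (λ y → 𝟙 (inS S y)) x∈′)) (<ᵇ-false⁻ {0} {shared S S′} h)) λ ()

  module Moments (t : ℕ) where

    Vs : List V
    Vs = allFin n

    Qs : List Key
    Qs = pairs Vs

    𝓢 : List (List V)
    𝓢 = combs t Vs

    M P N₂ : ℕ
    M = length 𝓢
    P = 2 ^ tri t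
    N₂ = 2 ^ length Qs

    ind : Ω → List V → Bool
    ind ω S = allF ω (pairs S)

    X I : Ω → ℕ
    X ω = cnt (ind ω) 𝓢
    I ω = ∑ 𝓢 λ S → ∑ 𝓢 λ S′ → 𝟙 (meet S S′) * (𝟙 (ind ω S) * 𝟙 (ind ω S′))

    uV : Unique Vs
    uV = allFin-unique n

    module _ {S : List V} (S∈ : S ∈ 𝓢) where

      uS : Unique S
      uS = combs-unique t uV S∈

      lenS : length S ≡ t
      lenS = combs-length t Vs S∈

      first : ∀ ω → P * 𝔼 Qs ω (λ ω → 𝟙 (ind ω S)) ≡ N₂
      first ω = ≡-trans (cong (λ z → 2 ^ z * 𝔼 Qs ω (λ ω → 𝟙 (ind ω S))) (sym (≡-trans (length-pairs-tri S) (cong tri lenS))))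
        (allF-prob Qs (pairs S) ω (unique-pairs uS) sub)
        where
        sub : ∀ {e} → e ∈ pairs S → e ∈ Qs
        sub e∈ = let u , v , _ , _ , ne , eq = ∈-pairs S uS e∈ in subst (_∈ Qs) (sym eq) (pairs-∈ Vs (∈-allFin u) (∈-allFin v) ne)

    module _ {S S′ : List V} (S∈ : S ∈ 𝓢) (S′∈ : S′ ∈ 𝓢) where

      private
        D O : List V
        D = keep (inS S) S′
        O = keep (not ∘ inS S) S′
        new old : List Key
        new = pairs O ++ cross D O
        old = pairs S
        p : pairs S′ ↭ pairs D ++ new
        p = ↭-trans (pairs-↭ (keep-split (inS S) S′)) (pairs-++ D O)
        uS′ : Unique S′
        uS′ = uS S′∈
        uNew : Unique new
        uNew = unique-++ʳ (pairs D) (unique-↭ p (unique-pairs uS′))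
        O∉ : ∀ {x} → x ∈ O → x ∉ S
        O∉ {x} x∈ x∈S with inS S x | inS⁺ x∈S | proj₂ (∈-keep⁻ (not ∘ inS S) {S′} x∈)
        ... | true | _ | ()
        touches : ∀ {e} → e ∈ new → ∃ λ u → ∃ λ v → u ∈ O × e ≡ key u v
        touches e∈ with ∈-++⁻ (pairs O) e∈
        ... | inj₁ h = let u , v , u∈ , _ , _ , eq = ∈-pairs O (keep-unique (not ∘ inS S) uS′) h in u , v , u∈ , eq
        ... | inj₂ h = let z , x , z∈ , x∈ , eq = ∈-cross D O h in x , z , x∈ , eq
        uU : Unique (old ++ new)
        uU = unique-++ (unique-pairs (uS S∈)) uNew λ e∈ e∈′ →
          let a , b , a∈ , b∈ , _ , eq = ∈-pairs S (uS S∈) e∈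
              u , v , u∈ , eq′ = touches e∈′
          in clash a∈ b∈ u∈ (key-inj (≡-trans (sym eq) eq′))
          where
          clash : ∀ {a b u v} → a ∈ S → b ∈ S → u ∈ O → (a ≡ u × b ≡ v) ⊎ (a ≡ v × b ≡ u) → ⊥
          clash a∈ b∈ u∈ (inj₁ (refl , _)) = O∉ u∈ a∈
          clash a∈ b∈ u∈ (inj₂ (_ , refl)) = O∉ u∈ b∈
        inQ : ∀ {T e} → T ∈ 𝓢 → e ∈ pairs T → e ∈ Qs
        inQ {T} T∈ e∈ = let u , v , _ , _ , ne , eq = ∈-pairs T (uS T∈) e∈ in subst (_∈ Qs) (sym eq) (pairs-∈ Vs (∈-allFin u) (∈-allFin v) ne)
        subU : ∀ {e} → e ∈ old ++ new → e ∈ Qs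
        subU e∈ with ∈-++⁻ old e∈
        ... | inj₁ h = inQ S∈ h
        ... | inj₂ h = inQ S′∈ (Perm.∈-resp-↭ (↭-sym p) (∈-++⁺ʳ (pairs D) h))
        both-off : ∀ ω → 𝟙 (ind ω S) * 𝟙 (ind ω S′) ≤ 𝟙 (allF ω (old ++ new))
        both-off ω with ind ω S in e₁ | ind ω S′ in e₂
        ... | false | _     = z≤n
        ... | true  | false = z≤n
        ... | true  | true  = ≤-reflexive (cong 𝟙 (sym (∈-allF (old ++ new) {ω} off)))
          where
          off : ∀ {e} → e ∈ old ++ new → lookup ω e ≡ false
          off e∈ with ∈-++⁻ old e∈
          ... | inj₁ h = allF-∈ (pairs S) e₁ h
          ... | inj₂ h = allF-∈ (pairs S′) e₂ (Perm.∈-resp-↭ (↭-sym p) (∈-++⁺ʳ (pairs D) h))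
        lens : length (old ++ new) + tri (shared S S′) ≡ tri t + tri t
        lens = begin
          length (old ++ new) + tri (shared S S′)    ≡⟨ cong₂ _+_ (length-++ old) (cong tri (sym (length-keep (inS S) S′))) ⟩
          length old + length new + tri (length D)    ≡⟨ cong (length old + length new +_) (sym (length-pairs-tri D)) ⟩
          length old + length new + length (pairs D)  ≡⟨ ≡-trans (+-assoc (length old) _ _) (cong (length old +_) (+-comm (length new) (length (pairs D)))) ⟩
          length old + (length (pairs D) + length new) ≡⟨ cong (length old +_) (≡-trans (sym (length-++ (pairs D))) (sym (Perm.↭-length p))) ⟩
          length (pairs S) + length (pairs S′)        ≡⟨ cong₂ _+_ (≡-trans (length-pairs-tri S) (cong tri (lenS S∈))) (≡-trans (length-pairs-tri S′) (cong tri (lenS S′∈))) ⟩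
          tri t + tri t ∎
          where open ≡-Reasoning

      -- The bits inside the overlap are required to vanish by both sets but are paid for once.
      joint : ∀ ω → P * P * 𝔼 Qs ω (λ ω → 𝟙 (ind ω S) * 𝟙 (ind ω S′)) ≤ N₂ * 2 ^ tri (shared S S′)
      joint ω = begin
        P * P * 𝔼 Qs ω (λ ω → 𝟙 (ind ω S) * 𝟙 (ind ω S′))
          ≤⟨ *-monoʳ-≤ (P * P) (𝔼-mono Qs ω both-off) ⟩
        P * P * 𝔼 Qs ω (λ ω → 𝟙 (allF ω (old ++ new)))
          ≡⟨ cong (_* 𝔼 Qs ω (λ ω → 𝟙 (allF ω (old ++ new)))) (≡-trans (sym (^-distribˡ-+-* 2 (tri t) (tri t))) (≡-trans (cong (2 ^_) (sym lens)) (^-distribˡ-+-* 2 (length (old ++ new)) (tri (shared S S′))))) ⟩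
        2 ^ length (old ++ new) * 2 ^ tri (shared S S′) * 𝔼 Qs ω (λ ω → 𝟙 (allF ω (old ++ new)))
          ≡⟨ lem (2 ^ length (old ++ new)) (2 ^ tri (shared S S′)) _ ⟩
        2 ^ length (old ++ new) * 𝔼 Qs ω (λ ω → 𝟙 (allF ω (old ++ new))) * 2 ^ tri (shared S S′)
          ≡⟨ cong (_* 2 ^ tri (shared S S′)) (allF-prob Qs (old ++ new) ω uU subU) ⟩
        N₂ * 2 ^ tri (shared S S′) ∎
        where
        open ≤-Reasoning
        lem : ∀ a b c → a * b * c ≡ a * c * b
        lem = solve-∀

    mean : ∀ ω → P * 𝔼 Qs ω X ≡ M * N₂
    mean ω = begin
      P * 𝔼 Qs ω X                                           ≡⟨ cong (P *_) (∑-swap (enum Qs ω) 𝓢 (λ ω S → 𝟙 (ind ω S))) ⟩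
      P * ∑ 𝓢 (λ S → 𝔼 Qs ω (λ ω → 𝟙 (ind ω S)))             ≡⟨ ∑-*ˡ 𝓢 P _ ⟨
      ∑ 𝓢 (λ S → P * 𝔼 Qs ω (λ ω → 𝟙 (ind ω S)))             ≡⟨ ∑-cong∈ 𝓢 (λ S S∈ → first S∈ ω) ⟩
      ∑ 𝓢 (λ _ → N₂)                                         ≡⟨ ∑-const 𝓢 N₂ ⟩
      M * N₂ ∎
      where open ≡-Reasoning

    module Bounded (W : ℕ) (hW : ∀ S → S ∈ 𝓢 → ∑ 𝓢 (λ S′ → 𝟙 (meet S S′) * 2 ^ tri (shared S S′)) ≤ W) where

      intersecting : ∀ ω → P * P * 𝔼 Qs ω I ≤ M * (N₂ * W)
      intersecting ω = begin
        P * P * 𝔼 Qs ω I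
          ≡⟨ cong (P * P *_) (≡-trans (∑-swap (enum Qs ω) 𝓢 _) (∑-cong 𝓢 λ S → ∑-swap (enum Qs ω) 𝓢 _)) ⟩
        P * P * ∑ 𝓢 (λ S → ∑ 𝓢 λ S′ → 𝔼 Qs ω (λ ω → 𝟙 (meet S S′) * (𝟙 (ind ω S) * 𝟙 (ind ω S′))))
          ≡⟨ cong (P * P *_) (∑-cong 𝓢 λ S → ∑-cong 𝓢 λ S′ → ∑-*ˡ (enum Qs ω) (𝟙 (meet S S′)) _) ⟩
        P * P * ∑ 𝓢 (λ S → ∑ 𝓢 λ S′ → 𝟙 (meet S S′) * 𝔼 Qs ω (λ ω → 𝟙 (ind ω S) * 𝟙 (ind ω S′)))
          ≡⟨ ≡-trans (sym (∑-*ˡ 𝓢 (P * P) _)) (∑-cong 𝓢 λ S → sym (∑-*ˡ 𝓢 (P * P) _)) ⟩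
        ∑ 𝓢 (λ S → ∑ 𝓢 λ S′ → P * P * (𝟙 (meet S S′) * 𝔼 Qs ω (λ ω → 𝟙 (ind ω S) * 𝟙 (ind ω S′))))
          ≤⟨ ∑-mono∈ 𝓢 (λ S S∈ → ∑-mono∈ 𝓢 λ S′ S′∈ → ≤-trans (≤-reflexive (lem (P * P) (𝟙 (meet S S′)) _))
               (≤-trans (*-monoʳ-≤ (𝟙 (meet S S′)) (joint S∈ S′∈ ω)) (≤-reflexive (lem (𝟙 (meet S S′)) N₂ _)))) ⟩
        ∑ 𝓢 (λ S → ∑ 𝓢 λ S′ → N₂ * (𝟙 (meet S S′) * 2 ^ tri (shared S S′)))
          ≤⟨ ∑-bound 𝓢 (N₂ * W) (λ S S∈ → ≤-trans (≤-reflexive (∑-*ˡ 𝓢 N₂ _)) (*-monoʳ-≤ N₂ (hW S S∈))) ⟩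
        M * (N₂ * W) ∎
        where
        open ≤-Reasoning
        lem : ∀ a b c → a * (b * c) ≡ b * (a * c)
        lem = solve-∀

      second : ∀ ω → P * P * 𝔼 Qs ω (λ ω → X ω * X ω) ≤ M * (N₂ * (M + W))
      second ω = begin
        P * P * 𝔼 Qs ω (λ ω → X ω * X ω)
          ≡⟨ cong (P * P *_) (𝔼-cong Qs ω λ ω → ∑-*-∑ 𝓢 𝓢 (λ S → 𝟙 (ind ω S)) (λ S → 𝟙 (ind ω S))) ⟩
        P * P * 𝔼 Qs ω (λ ω → ∑ 𝓢 λ S → ∑ 𝓢 λ S′ → 𝟙 (ind ω S) * 𝟙 (ind ω S′))
          ≡⟨ cong (P * P *_) (≡-trans (∑-swap (enum Qs ω) 𝓢 _) (∑-cong 𝓢 λ S → ∑-swap (enum Qs ω) 𝓢 _)) ⟩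
        P * P * ∑ 𝓢 (λ S → ∑ 𝓢 λ S′ → 𝔼 Qs ω (λ ω → 𝟙 (ind ω S) * 𝟙 (ind ω S′)))
          ≡⟨ ≡-trans (sym (∑-*ˡ 𝓢 (P * P) _)) (∑-cong 𝓢 λ S → sym (∑-*ˡ 𝓢 (P * P) _)) ⟩
        ∑ 𝓢 (λ S → ∑ 𝓢 λ S′ → P * P * 𝔼 Qs ω (λ ω → 𝟙 (ind ω S) * 𝟙 (ind ω S′)))
          ≤⟨ ∑-mono∈ 𝓢 (λ S S∈ → ∑-mono∈ 𝓢 λ S′ S′∈ → ≤-trans (joint S∈ S′∈ ω) (*-monoʳ-≤ N₂ (split S S′))) ⟩
        ∑ 𝓢 (λ S → ∑ 𝓢 λ S′ → N₂ * (1 + 𝟙 (meet S S′) * 2 ^ tri (shared S S′)))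
          ≤⟨ ∑-bound 𝓢 (N₂ * (M + W)) (λ S S∈ → ≤-trans (≤-reflexive (∑-*ˡ 𝓢 N₂ _))
               (*-monoʳ-≤ N₂ (≤-trans (≤-reflexive (≡-trans (∑-+ 𝓢 _ _) (cong (_+ ∑ 𝓢 (λ S′ → 𝟙 (meet S S′) * 2 ^ tri (shared S S′))) (≡-trans (∑-const 𝓢 1) (*-identityʳ M))))) (+-monoʳ-≤ M (hW S S∈))))) ⟩
        M * (N₂ * (M + W)) ∎
        where
        open ≤-Reasoning
        split : ∀ S S′ → 2 ^ tri (shared S S′) ≤ 1 + 𝟙 (meet S S′) * 2 ^ tri (shared S S′)
        split S S′ with shared S S′
        ... | zero  = s≤s z≤n
        ... | suc l = ≤-trans (≤-reflexive (sym (+-identityʳ _))) (n≤1+n _)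

      bad : ℕ → Ω → ℕ
      bad r ω = 𝟙 (X ω * X ω <ᵇ suc (r * r * I ω))

      -- This is bad M² ≤ 4(PX - M)² + 4r²P²I with the square expanded to avoid subtraction. If PX ≥
      -- M/2, badness gives M² ≤ 4P²X² ≤ 4r²P²I; otherwise PX differs from its mean `M` by at least
      -- M/2.
      chebyshev : ∀ r ω → bad r ω * (M * M) + 8 * (M * (P * X ω)) ≤ 4 * (P * P * (X ω * X ω)) + 4 * (M * M) + 4 * (r * r * (P * P * I ω))
      chebyshev r ω with X ω * X ω <ᵇ suc (r * r * I ω) in eq
      ... | false = begin
        8 * (M * (P * X ω))                              ≡⟨ lem M (P * X ω) ⟩
        4 * (2 * (P * X ω * M))                          ≤⟨ *-monoʳ-≤ 4 (2ab≤a²+b² (P * X ω) M) ⟩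
        4 * (P * X ω * (P * X ω) + M * M)                ≡⟨ lem₂ P (X ω) M ⟩
        4 * (P * P * (X ω * X ω)) + 4 * (M * M)          ≤⟨ m≤m+n _ _ ⟩
        4 * (P * P * (X ω * X ω)) + 4 * (M * M) + 4 * (r * r * (P * P * I ω)) ∎
        where
        open ≤-Reasoning
        lem : ∀ m a → 8 * (m * a) ≡ 4 * (2 * (a * m))
        lem = solve-∀
        lem₂ : ∀ p x m → 4 * (p * x * (p * x) + m * m) ≡ 4 * (p * p * (x * x)) + 4 * (m * m)
        lem₂ = solve-∀
      ... | true with ≤-total M (2 * (P * X ω))
      ...   | inj₁ le = begin
        1 * (M * M) + 8 * (M * (P * X ω))
          ≤⟨ +-mono-≤ (begin
               1 * (M * M)                          ≡⟨ *-identityˡ (M * M) ⟩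
               M * M                                ≤⟨ *-mono-≤ le le ⟩
               2 * (P * X ω) * (2 * (P * X ω))      ≡⟨ lem₃ P (X ω) ⟩
               4 * (P * P * (X ω * X ω))            ≤⟨ *-monoʳ-≤ 4 (*-monoʳ-≤ (P * P) (s≤s⁻¹ (<ᵇ-true⁻ {X ω * X ω} eq))) ⟩
               4 * (P * P * (r * r * I ω))          ≡⟨ cong (4 *_) (lem₄ (P * P) (r * r) (I ω)) ⟩
               4 * (r * r * (P * P * I ω)) ∎)
             (begin
               8 * (M * (P * X ω))                  ≡⟨ lem M (P * X ω) ⟩
               4 * (2 * (P * X ω * M))              ≤⟨ *-monoʳ-≤ 4 (2ab≤a²+b² (P * X ω) M) ⟩
               4 * (P * X ω * (P * X ω) + M * M)    ≡⟨ lem₂ P (X ω) M ⟩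
               4 * (P * P * (X ω * X ω)) + 4 * (M * M) ∎) ⟩
        4 * (r * r * (P * P * I ω)) + (4 * (P * P * (X ω * X ω)) + 4 * (M * M))
          ≡⟨ +-comm (4 * (r * r * (P * P * I ω))) _ ⟩
        4 * (P * P * (X ω * X ω)) + 4 * (M * M) + 4 * (r * r * (P * P * I ω)) ∎
        where
        open ≤-Reasoning
        lem : ∀ m a → 8 * (m * a) ≡ 4 * (2 * (a * m))
        lem = solve-∀
        lem₂ : ∀ p x m → 4 * (p * x * (p * x) + m * m) ≡ 4 * (p * p * (x * x)) + 4 * (m * m)
        lem₂ = solve-∀
        lem₃ : ∀ p x → 2 * (p * x) * (2 * (p * x)) ≡ 4 * (p * p * (x * x))
        lem₃ = solve-∀
        lem₄ : ∀ a b c → a * (b * c) ≡ b * (a * c)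
        lem₄ = solve-∀
      ...   | inj₂ ge = ≤-trans (small (P * X ω) M ge) (≤-trans (≤-reflexive (lem₅ P (X ω) M)) (m≤m+n _ _))
        where
        lem₅ : ∀ p x m → 4 * (p * x * (p * x)) + 4 * (m * m) ≡ 4 * (p * p * (x * x)) + 4 * (m * m)
        lem₅ = solve-∀
        small : ∀ a m → 2 * a ≤ m → 1 * (m * m) + 8 * (m * a) ≤ 4 * (a * a) + 4 * (m * m)
        small a m le = subst (λ m → 1 * (m * m) + 8 * (m * a) ≤ 4 * (a * a) + 4 * (m * m)) (m+[n∸m]≡n le) (go a (m ∸ 2 * a))
          where
          id₁ : ∀ a d → 4 * (a * a) + 4 * ((2 * a + d) * (2 * a + d)) ≡ 1 * ((2 * a + d) * (2 * a + d)) + 8 * ((2 * a + d) * a) + (4 * (a * d) + 3 * (d * d))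
          id₁ = solve-∀
          go : ∀ a d → 1 * ((2 * a + d) * (2 * a + d)) + 8 * ((2 * a + d) * a) ≤ 4 * (a * a) + 4 * ((2 * a + d) * (2 * a + d))
          go a d = ≤-trans (m≤m+n _ (4 * (a * d) + 3 * (d * d))) (≤-reflexive (sym (id₁ a d)))

      few-bad : ∀ r h → 0 < M → h * W ≤ M → ∀ ω → h * 𝔼 Qs ω (bad r) ≤ 4 * suc (r * r) * N₂
      few-bad r h 0<M hM ω = *-cancelʳ-≤ _ _ (M * M) {{m*n≢0 M M {{>-nonZero 0<M}} {{>-nonZero 0<M}}}} (begin
        h * b * (M * M)                       ≡⟨ *-assoc h b (M * M) ⟩
        h * (b * (M * M))                     ≤⟨ *-monoʳ-≤ h main ⟩
        h * (4 * suc (r * r) * (M * (N₂ * W))) ≡⟨ lem₁ h (4 * suc (r * r)) M N₂ W ⟩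
        4 * suc (r * r) * N₂ * (M * (h * W))  ≤⟨ *-monoʳ-≤ (4 * suc (r * r) * N₂) (*-monoʳ-≤ M hM) ⟩
        4 * suc (r * r) * N₂ * (M * M) ∎)
        where
        open ≤-Reasoning
        b = 𝔼 Qs ω (bad r)
        lem₁ : ∀ h c m n w → h * (c * (m * (n * w))) ≡ c * n * (m * (h * w))
        lem₁ = solve-∀
        lem₂ : ∀ r m n w → 4 * (m * (n * (m + w))) + 4 * (m * m) * n + 4 * (r * (m * (n * w))) ≡ 4 * suc r * (m * (n * w)) + 8 * (m * (m * n))
        lem₂ = solve-∀
        summed : b * (M * M) + 8 * (M * (M * N₂)) ≤ 4 * (M * (N₂ * (M + W))) + 4 * (M * M) * N₂ + 4 * (r * r * (M * (N₂ * W)))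
        summed = begin
          b * (M * M) + 8 * (M * (M * N₂))
            ≡⟨ cong (λ z → b * (M * M) + 8 * (M * z)) (sym (mean ω)) ⟩
          b * (M * M) + 8 * (M * (P * 𝔼 Qs ω X))
            ≡⟨ cong₂ _+_ (sym (∑-*ʳ Ωs (M * M) (bad r))) (≡-trans (cong (8 *_) (≡-trans (cong (M *_) (sym (∑-*ˡ Ωs P X))) (sym (∑-*ˡ Ωs M _)))) (sym (∑-*ˡ Ωs 8 _))) ⟩
          𝔼 Qs ω (λ ω → bad r ω * (M * M)) + 𝔼 Qs ω (λ ω → 8 * (M * (P * X ω)))
            ≡⟨ ∑-+ Ωs _ _ ⟨
          𝔼 Qs ω (λ ω → bad r ω * (M * M) + 8 * (M * (P * X ω)))
            ≤⟨ 𝔼-mono Qs ω (chebyshev r) ⟩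
          𝔼 Qs ω (λ ω → 4 * (P * P * (X ω * X ω)) + 4 * (M * M) + 4 * (r * r * (P * P * I ω)))
            ≡⟨ ≡-trans (∑-+ Ωs _ _) (cong₂ _+_ (≡-trans (∑-+ Ωs _ _) (cong₂ _+_ (≡-trans (∑-*ˡ Ωs 4 _) (cong (4 *_) (∑-*ˡ Ωs (P * P) _)))
                 (≡-trans (𝔼-const Qs ω (4 * (M * M))) (*-comm N₂ _)))) (≡-trans (∑-*ˡ Ωs 4 _) (cong (4 *_) (≡-trans (∑-*ˡ Ωs (r * r) _) (cong (r * r *_) (∑-*ˡ Ωs (P * P) I)))))) ⟩
          4 * (P * P * 𝔼 Qs ω (λ ω → X ω * X ω)) + 4 * (M * M) * N₂ + 4 * (r * r * (P * P * 𝔼 Qs ω I))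
            ≤⟨ +-mono-≤ (+-monoˡ-≤ (4 * (M * M) * N₂) (*-monoʳ-≤ 4 (second ω))) (*-monoʳ-≤ 4 (*-monoʳ-≤ (r * r) (intersecting ω))) ⟩
          4 * (M * (N₂ * (M + W))) + 4 * (M * M) * N₂ + 4 * (r * r * (M * (N₂ * W))) ∎
          where Ωs = enum Qs ω
        main : b * (M * M) ≤ 4 * suc (r * r) * (M * (N₂ * W))
        main = +-cancelʳ-≤ (8 * (M * (M * N₂))) _ _ (≤-trans summed (≤-reflexive (lem₂ (r * r) M N₂ W)))

    good-family : ∀ r ω → r * r * I ω < X ω * X ω → ∃ λ (Ss : Vec (List V) r) →
      (∀ i → lookup Ss i ∈ 𝓢 × ind ω (lookup Ss i) ≡ true) × (∀ i i′ → i ≢ i′ → ∀ {x} → x ∈ lookup Ss i → x ∈ lookup Ss i′ → ⊥)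
    good-family r ω h = let Ss , mem , dis = Greedy.disjoint-family meet r 𝓘 h′ in
        Ss , (λ i → ∈-keep⁻ (ind ω) (mem i)) , λ i i′ ne x∈ x∈′ → apart (dis i i′ ne) x∈ x∈′
      where
      𝓘 = keep (ind ω) 𝓢
      apart : ∀ {S S′} → meet S S′ ≡ false ⊎ meet S′ S ≡ false → ∀ {x} → x ∈ S → x ∈ S′ → ⊥
      apart (inj₁ e) x∈ x∈′ = meet-false e x∈ x∈′
      apart (inj₂ e) x∈ x∈′ = meet-false e x∈′ x∈
      lem : ∀ a b c → a * (b * c) ≡ c * (a * b)
      lem = solve-∀
      I≡ : ∑ 𝓘 (λ S → cnt (meet S) 𝓘) ≡ I ω
      I≡ = ≡-trans (∑-keep (ind ω) 𝓢 _) (∑-cong 𝓢 λ S → ≡-trans (cong (𝟙 (ind ω S) *_) (∑-keep (ind ω) 𝓢 _))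
        (≡-trans (sym (∑-*ˡ 𝓢 (𝟙 (ind ω S)) _)) (∑-cong 𝓢 λ S′ → lem (𝟙 (ind ω S)) (𝟙 (ind ω S′)) (𝟙 (meet S S′)))))
      h′ : r * r * ∑ 𝓘 (λ S → cnt (meet S) 𝓘) < length 𝓘 * length 𝓘
      h′ = subst₂ _<_ (cong (r * r *_) (sym I≡)) (cong₂ _*_ (sym (length-keep (ind ω) 𝓢)) (sym (length-keep (ind ω) 𝓢))) h

    -- Sorts the sets by the size of the overlap; each of the `t` levels contributes at most M/H by
    -- `Overlap.term`.
    shared-sum : ∀ g H → 0 < t → 0 < H → t ≤ 4 * g + 3 → suc g ≤ t → H * (t * t * 2 ^ g) + t ≤ n → H * (suc t * n) ≤ 2 ^ (t ∸ suc g) → H * 2 ^ tri t ≤ bin n t →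
      ∀ S → S ∈ 𝓢 → H * ∑ 𝓢 (λ S′ → 𝟙 (meet S S′) * 2 ^ tri (shared S S′)) ≤ t * M
    shared-sum g H 0<t 0<H t≤ g≤ c₁ c₂ c₃ S S∈ = begin
      H * ∑ 𝓢 (λ S′ → 𝟙 (meet S S′) * 2 ^ tri (shared S S′))
        ≤⟨ *-monoʳ-≤ H (∑-mono∈ 𝓢 λ S′ S′∈ → byl S′ (≤-trans (cnt≤length (inS S) S′) (≤-reflexive (lenS S′∈)))) ⟩
      H * ∑ 𝓢 (λ S′ → ∑ (upTo t) λ l → 𝟙 (shared S S′ ≡ᵇ suc l) * 2 ^ tri (suc l))
        ≡⟨ cong (H *_) (≡-trans (∑-swap 𝓢 (upTo t) _) (∑-cong (upTo t) λ l → ∑-*ʳ 𝓢 (2 ^ tri (suc l)) _)) ⟩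
      H * ∑ (upTo t) (λ l → ∑ 𝓢 (λ S′ → 𝟙 (shared S S′ ≡ᵇ suc l)) * 2 ^ tri (suc l))
        ≡⟨ ∑-*ˡ (upTo t) H _ ⟨
      ∑ (upTo t) (λ l → H * (∑ 𝓢 (λ S′ → 𝟙 (shared S S′ ≡ᵇ suc l)) * 2 ^ tri (suc l)))
        ≤⟨ ∑-bound (upTo t) M (λ l l∈ → level l (∈-upTo⁻ l∈)) ⟩
      length (upTo t) * M
        ≡⟨ cong (_* M) (length-upTo t) ⟩
      t * M ∎
      where
      open ≤-Reasoning
      byl : ∀ S′ → shared S S′ ≤ t → 𝟙 (meet S S′) * 2 ^ tri (shared S S′) ≤ ∑ (upTo t) (λ l → 𝟙 (shared S S′ ≡ᵇ suc l) * 2 ^ tri (suc l))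
      byl S′ le with shared S S′
      ... | zero  = z≤n
      ... | suc l = ≤-trans (≤-reflexive (cong (λ b → 𝟙 b * 2 ^ tri (suc l)) (sym (refl-≡ᵇ l)))) (∑-∈ (λ l′ → 𝟙 (l ≡ᵇ l′) * 2 ^ tri (suc l′)) (∈-upTo⁺ le))
        where
        refl-≡ᵇ : ∀ l → (l ≡ᵇ l) ≡ true
        refl-≡ᵇ zero    = refl
        refl-≡ᵇ (suc l) = refl-≡ᵇ l
      M≡ : M ≡ bin n t
      M≡ = ≡-trans (length-combs t Vs) (cong (λ z → bin z t) (length-tabulate {n = n} id))
      a≤ : cnt (inS S) Vs ≤ t
      a≤ = begin
        cnt (inS S) Vs              ≡⟨ length-keep (inS S) Vs ⟨
        length (keep (inS S) Vs)    ≤⟨ sub-length {L = S} (keep-unique (inS S) uV) (λ x∈ → inS⁻ {S} (proj₂ (∈-keep⁻ (inS S) {Vs} x∈))) ⟩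
        length S                    ≡⟨ lenS S∈ ⟩
        t ∎
      b≤ : cnt (not ∘ inS S) Vs ≤ n
      b≤ = ≤-trans (cnt≤length _ Vs) (≤-reflexive (length-tabulate {n = n} id))
      level : ∀ l → l < t → H * (∑ 𝓢 (λ S′ → 𝟙 (shared S S′ ≡ᵇ suc l)) * 2 ^ tri (suc l)) ≤ M
      level l lt = begin
        H * (∑ 𝓢 (λ S′ → 𝟙 (shared S S′ ≡ᵇ suc l)) * 2 ^ tri (suc l))
          ≤⟨ *-monoʳ-≤ H (*-monoˡ-≤ (2 ^ tri (suc l)) (hits (inS S) t (suc l) Vs lt)) ⟩
        H * (bin (cnt (inS S) Vs) (suc l) * bin (cnt (not ∘ inS S) Vs) (t ∸ suc l) * 2 ^ tri (suc l))
          ≤⟨ Overlap.term t n g H 0<t 0<H t≤ g≤ c₁ c₂ c₃ (suc l) (t ∸ suc l) (cnt (inS S) Vs) (cnt (not ∘ inS S) Vs) (s≤s z≤n) (m+[n∸m]≡n lt) a≤ b≤ ⟩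
        bin n t
          ≡⟨ M≡ ⟨
        M ∎

-- The size t of the independent sets.

pow-cancel-≤ : ∀ K {a b} → 0 < K → a ^ K ≤ b ^ K → a ≤ b
pow-cancel-≤ K 0<K h = ≮⇒≥ λ lt → <⇒≱ (^-monoˡ-< K {{>-nonZero 0<K}} lt) h

-- The premise on `a` says a ≤ 2 log n + 2 in base 2. Comparing squares, a large `a` satisfies
-- 4(c(a+1)^d)² ≤ 2^a ≤ 4n²; for small `a` the left side is below a constant.
polylog : ∀ c d → Ev (λ n → ∀ a → 2 ^ a ≤ 4 * (n * n) → c * suc a ^ d ≤ n)
polylog c d = c * suc A ^ d , λ n le a h → go n le a h (A ≤? a)
  where
  open ≤-Reasoning
  Abeats = exp-beats-poly (4 * (c * c)) (d * 2)
  A = proj₁ Abeats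
  beats = proj₂ Abeats
  go : ∀ n → c * suc A ^ d ≤ n → ∀ a → 2 ^ a ≤ 4 * (n * n) → Dec (A ≤ a) → c * suc a ^ d ≤ n
  go n le a h (no gt) = ≤-trans (*-monoʳ-≤ c (^-monoˡ-≤ d (s≤s (<⇒≤ (≰⇒> gt))))) le
  go n le a h (yes A≤a) = pow-cancel-≤ 2 (s≤s z≤n) (*-cancelˡ-≤ 4 (begin
    4 * (c * suc a ^ d) ^ 2           ≡⟨ cong (4 *_) (^-distribʳ-* 2 c (suc a ^ d)) ⟩
    4 * (c ^ 2 * (suc a ^ d) ^ 2)     ≡⟨ cong₂ (λ x y → 4 * (x * y)) (cong (c *_) (*-identityʳ c)) (^-*-assoc (suc a) d 2) ⟩
    4 * (c * c * suc a ^ (d * 2))     ≡⟨ *-assoc 4 (c * c) (suc a ^ (d * 2)) ⟨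
    4 * (c * c) * suc a ^ (d * 2)     ≤⟨ beats a A≤a ⟩
    2 ^ a                             ≤⟨ h ⟩
    4 * (n * n)                       ≡⟨ cong (λ x → 4 * (n * x)) (*-identityʳ n) ⟨
    4 * n ^ 2 ∎))

-- Factorials, binomial and multinomial coefficients.

!≤^ : ∀ n → n ! ≤ n ^ n
!≤^ zero    = ≤-refl
!≤^ (suc n) = *-monoʳ-≤ (suc n) (≤-trans (!≤^ n) (^-monoˡ-≤ n (n≤1+n n)))

!>0 : ∀ n → 0 < n !
!>0 zero    = s≤s z≤n
!>0 (suc n) = *-mono-≤ (s≤s (z≤n {n})) (!>0 n)

falling : ∀ t d j → j ≤ t → d ^ j ≤ j ! * bin (t + d) j
falling t d zero    le = ≤-refl
falling t d (suc j) le = begin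
  d * d ^ j                                ≤⟨ *-monoʳ-≤ d (falling t d j (<⇒≤ le)) ⟩
  d * (j ! * bin (t + d) j)                ≡⟨ lem d (j !) _ ⟩
  j ! * (d * bin (t + d) j)                ≤⟨ *-monoʳ-≤ (j !) (bin-step t d j le) ⟩
  j ! * (suc j * bin (t + d) (suc j))      ≡⟨ lem₂ (j !) (suc j) _ ⟩
  suc j * j ! * bin (t + d) (suc j) ∎
  where
  open ≤-Reasoning
  lem : ∀ a b c → a * (b * c) ≡ b * (a * c)
  lem = solve-∀
  lem₂ : ∀ a b c → a * (b * c) ≡ b * a * c
  lem₂ = solve-∀

bin*!≤^ : ∀ n k → bin n k * k ! ≤ n ^ k
bin*!≤^ n zero    = ≤-refl
bin*!≤^ n (suc k) = begin
  bin n (suc k) * (suc k * k !)    ≡⟨ lem (bin n (suc k)) (suc k) (k !) ⟩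
  suc k * bin n (suc k) * k !      ≤⟨ *-monoˡ-≤ (k !) (≤-trans (m≤m+n _ (k * bin n k)) (≤-reflexive (sym (absorb n k)))) ⟩
  n * bin n k * k !                ≡⟨ *-assoc n (bin n k) (k !) ⟩
  n * (bin n k * k !)              ≤⟨ *-monoʳ-≤ n (bin*!≤^ n k) ⟩
  n * n ^ k ∎
  where
  open ≤-Reasoning
  lem : ∀ a b c → a * (b * c) ≡ b * a * c
  lem = solve-∀

near-pow : ∀ t d k → (t + d) ^ k * (t + d) ≤ d ^ k * (t + d) + k * t * (t + d) ^ k
near-pow t d zero    = m≤m+n _ _
near-pow t d (suc k) = begin
  n * n ^ k * n                                    ≡⟨ *-assoc n (n ^ k) n ⟩
  n * (n ^ k * n)                                  ≤⟨ *-monoʳ-≤ n (near-pow t d k) ⟩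
  n * (d ^ k * n + k * t * n ^ k)                  ≡⟨ lem t d (d ^ k) (k * t) (n ^ k) ⟩
  d * d ^ k * n + (t * (d ^ k * n) + k * t * (n * n ^ k)) ≤⟨ +-monoʳ-≤ (d * d ^ k * n) (+-monoˡ-≤ _ (*-monoʳ-≤ t (*-monoˡ-≤ n (^-monoˡ-≤ k (m≤n+m d t))))) ⟩
  d * d ^ k * n + (t * (n ^ k * n) + k * t * (n * n ^ k)) ≡⟨ cong (d * d ^ k * n +_) (lem₂ t (n ^ k) n k) ⟩
  d * d ^ k * n + suc k * t * (n * n ^ k) ∎
  where
  open ≤-Reasoning
  n = t + d
  lem : ∀ t d a b c → (t + d) * (a * (t + d) + b * c) ≡ d * a * (t + d) + (t * (a * (t + d)) + b * ((t + d) * c))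
  lem = solve-∀
  lem₂ : ∀ t a n k → t * (a * n) + k * t * (n * a) ≡ suc k * t * (n * a)
  lem₂ = solve-∀

-- The falling factorial of length `t` differs from n^t by a factor of at least 1 - t²/n, which is
-- at least one half here.
^≤2!bin : ∀ n t → 0 < n → t ≤ n → 2 * (t * t) ≤ n → n ^ t ≤ 2 * (t ! * bin n t)
^≤2!bin n t 0<n t≤n h = subst (λ n → n ^ t ≤ 2 * (t ! * bin n t)) n≡ (≤-trans half (*-monoʳ-≤ 2 (falling t d t ≤-refl)))
  where
  open ≤-Reasoning
  d = n ∸ t
  n≡ : t + d ≡ n
  n≡ = m+[n∸m]≡n t≤n
  N = t + d
  half : N ^ t ≤ 2 * d ^ t
  half = *-cancelʳ-≤ (N ^ t) (2 * d ^ t) N {{>-nonZero (≤-trans 0<n (≤-reflexive (sym n≡)))}} (+-cancelʳ-≤ (N ^ t * N) _ _ (begin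
    N ^ t * N + N ^ t * N                                    ≡⟨ lem (N ^ t * N) ⟩
    2 * (N ^ t * N)                                          ≤⟨ *-monoʳ-≤ 2 (near-pow t d t) ⟩
    2 * (d ^ t * N + t * t * N ^ t)                          ≡⟨ lem₂ (d ^ t) N (t * t) (N ^ t) ⟩
    2 * d ^ t * N + 2 * (t * t) * N ^ t                      ≤⟨ +-monoʳ-≤ (2 * d ^ t * N) (*-monoˡ-≤ (N ^ t) (≤-trans h (≤-reflexive (sym n≡)))) ⟩
    2 * d ^ t * N + N * N ^ t                                ≡⟨ cong (2 * d ^ t * N +_) (*-comm N (N ^ t)) ⟩
    2 * d ^ t * N + N ^ t * N ∎))
    where
    lem : ∀ a → a + a ≡ 2 * a
    lem = solve-∀
    lem₂ : ∀ a n b c → 2 * (a * n + b * c) ≡ 2 * a * n + 2 * b * c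
    lem₂ = solve-∀

rising : ∀ N r → N ^ r * N ! ≤ (r + N) !
rising N zero    = ≤-reflexive (+-identityʳ (N !))
rising N (suc r) = begin
  N * N ^ r * N !          ≡⟨ *-assoc N (N ^ r) (N !) ⟩
  N * (N ^ r * N !)        ≤⟨ *-mono-≤ (≤-trans (m≤n+m N r) (n≤1+n (r + N))) (rising N r) ⟩
  suc (r + N) * (r + N) ! ∎
  where open ≤-Reasoning

multinomial : ∀ r u → r ^ (r * u) * (u !) ^ r ≤ (r + r * u) !
multinomial r zero    = begin
  r ^ (r * 0) * 1 ^ r   ≡⟨ cong₂ _*_ (cong (r ^_) (*-zeroʳ r)) (^-zeroˡ r) ⟩
  1                     ≤⟨ !>0 (r + r * 0) ⟩
  (r + r * 0) ! ∎
  where open ≤-Reasoning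
multinomial r (suc u) = begin
  r ^ (r * suc u) * (suc u * u !) ^ r              ≡⟨ cong₂ _*_ (≡-trans (cong (r ^_) (*-suc r u)) (^-distribˡ-+-* r r (r * u))) (^-distribʳ-* r (suc u) (u !)) ⟩
  r ^ r * r ^ (r * u) * (suc u ^ r * (u !) ^ r)    ≡⟨ lem (r ^ r) (r ^ (r * u)) (suc u ^ r) ((u !) ^ r) ⟩
  r ^ r * suc u ^ r * (r ^ (r * u) * (u !) ^ r)    ≤⟨ *-mono-≤ (≤-reflexive (≡-trans (sym (^-distribʳ-* r r (suc u))) (cong (_^ r) (*-suc r u)))) (multinomial r u) ⟩
  (r + r * u) ^ r * (r + r * u) !                  ≤⟨ rising (r + r * u) r ⟩
  (r + (r + r * u)) !                              ≡⟨ cong (λ z → (r + z) !) (sym (*-suc r u)) ⟩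
  (r + r * suc u) ! ∎
  where
  open ≤-Reasoning
  lem : ∀ a b c d → a * b * (c * d) ≡ a * c * (b * d)
  lem = solve-∀

-- For a = u + 1 the multinomial coefficient (ra)!/(a!)^r is at least r^(ra)/(ra)^r. So choosing an
-- `r`-coloured set of ra vertices costs no more than choosing `r` separate `a`-sets, up to a
-- polynomial factor in `a`.
multinomial′ : ∀ r u → r ^ (r * suc u) * (suc u !) ^ r ≤ (r * suc u) ! * (r * suc u) ^ r
multinomial′ r u = begin
  r ^ (r * suc u) * (suc u * u !) ^ r              ≡⟨ cong₂ _*_ (≡-trans (cong (r ^_) (*-suc r u)) (^-distribˡ-+-* r r (r * u))) (^-distribʳ-* r (suc u) (u !)) ⟩
  r ^ r * r ^ (r * u) * (suc u ^ r * (u !) ^ r)    ≡⟨ lem (r ^ r) (r ^ (r * u)) (suc u ^ r) ((u !) ^ r) ⟩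
  r ^ (r * u) * (u !) ^ r * (r ^ r * suc u ^ r)    ≤⟨ *-mono-≤ (≤-trans (multinomial r u) (≤-reflexive (cong _! (sym (*-suc r u))))) (≤-reflexive (sym (^-distribʳ-* r r (suc u)))) ⟩
  (r * suc u) ! * (r * suc u) ^ r ∎
  where
  open ≤-Reasoning
  lem : ∀ a b c d → a * b * (c * d) ≡ b * d * (a * c)
  lem = solve-∀

-- The threshold size and its position between powers of n.

module Threshold (K : ℕ) (2≤K : 2 ≤ K) where

  0<K : 0 < K
  0<K = ≤-trans (s≤s z≤n) 2≤K

  Thr : ℕ → ℕ
  Thr t = 2 ^ tri t * t !

  -- The expected number of independent t-sets is at least about n^(1/K).
  Many : ℕ → ℕ → Set
  Many n t = n * Thr t ^ K ≤ (n ^ t) ^ K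

  abstract
    many? : ∀ n t → Dec (Many n t)
    many? n t = n * Thr t ^ K ≤? (n ^ t) ^ K

  -- An upward search with fuel `f` that stops when `Many` fails at the next size; the proof relies
  -- on `Many` at `t` and its failure at `t + 1`.
  cut : ℕ → ℕ → ℕ → ℕ
  cut n zero    t = t
  cut n (suc f) t = if does (many? n (suc t)) then cut n f (suc t) else t

  cut-spec : ∀ n f t → Many n t → ¬ Many n (f + t) → t ≤ cut n f t × Many n (cut n f t) × ¬ Many n (suc (cut n f t))
  cut-spec n zero    t h ¬h = contradiction h ¬h
  cut-spec n (suc f) t h ¬h with many? n (suc t)
  ... | no ¬p = ≤-refl , h , ¬p
  ... | yes p = let a , b , c = cut-spec n f (suc t) p (λ q → ¬h (subst (Many n) (+-suc f t) q)) in ≤-trans (n≤1+n t) a , b , c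

  thr : ℕ → ℕ
  thr n = cut n n 1

  -- For t = u + 1, `Many` implies 2^(t(t-1)/2) ≤ n^t; square both sides and take the `t`-th root.
  many⇒≤ : ∀ n u → 0 < n → Many n (suc u) → 2 ^ u ≤ n * n
  many⇒≤ n u 0<n h = pow-cancel-≤ (suc u) (s≤s z≤n) (begin
    (2 ^ u) ^ suc u                ≡⟨ ^-*-assoc 2 u (suc u) ⟩
    2 ^ (u * suc u)                ≡⟨ cong (2 ^_) (+-cancelʳ-≡ (suc u) _ _ (≡-trans (+-comm (u * suc u) (suc u)) (sym (2tri (suc u))))) ⟩
    2 ^ (2 * tri (suc u))          ≡⟨ cong (2 ^_) (cong (tri (suc u) +_) (+-identityʳ (tri (suc u)))) ⟩
    2 ^ (tri (suc u) + tri (suc u)) ≡⟨ ^-distribˡ-+-* 2 (tri (suc u)) (tri (suc u)) ⟩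
    2 ^ tri (suc u) * 2 ^ tri (suc u) ≤⟨ *-mono-≤ root root ⟩
    n ^ suc u * n ^ suc u          ≡⟨ ^-distribʳ-* (suc u) n n ⟨
    (n * n) ^ suc u ∎)
    where
    open ≤-Reasoning
    root : 2 ^ tri (suc u) ≤ n ^ suc u
    root = pow-cancel-≤ K 0<K (begin
      (2 ^ tri (suc u)) ^ K        ≤⟨ ^-monoˡ-≤ K (m≤m*n (2 ^ tri (suc u)) (suc u !) {{>-nonZero (!>0 (suc u))}}) ⟩
      Thr (suc u) ^ K              ≤⟨ m≤n*m (Thr (suc u) ^ K) n {{>-nonZero 0<n}} ⟩
      n * Thr (suc u) ^ K          ≤⟨ h ⟩
      (n ^ suc u) ^ K ∎)

  -- By contraposition: if 2^(4a) ≤ n^7 and a^8 ≤ n, the eighth power of `Thr a` is at most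
  -- n^(8a-7). The seven missing factors occur `K` ≥ 2 times and so outweigh the eighth power of the
  -- factor `n` in `Many`. The exponent 7/4 in 2^a ≥ n^(7/4) exceeds the 3/2 needed for the upper
  -- bound.
  few⇒≥ : ∀ n u → 0 < n → suc u ^ 8 ≤ n → ¬ Many n (suc u) → n ^ 7 ≤ 2 ^ (4 * suc u)
  few⇒≥ n u 0<n log ¬h = ≮⇒≥ λ lt → <⇒≱ (raise (≰⇒> ¬h)) (power (<⇒≤ lt))
    where
    open ≤-Reasoning
    a = suc u
    -- The exponents are variables so that no numeral is unfolded.
    bound : ∀ p q s → p ≡ 8 → q ≡ 7 → s ≡ 4 → 2 ^ (s * a) ≤ n ^ q → a ^ p ≤ n → (n * Thr a ^ K) ^ p ≤ ((n ^ a) ^ K) ^ p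
    bound p q s p≡ q≡ s≡ lt lg = begin
      (n * Thr a ^ K) ^ p
        ≡⟨ ≡-trans (^-distribʳ-* p n (Thr a ^ K)) (cong (n ^ p *_) (comm (Thr a) K p)) ⟩
      n ^ p * (Thr a ^ p) ^ K
        ≤⟨ *-monoʳ-≤ (n ^ p) (^-monoˡ-≤ K (begin
             Thr a ^ p                            ≡⟨ ^-distribʳ-* p (2 ^ tri a) (a !) ⟩
             (2 ^ tri a) ^ p * (a !) ^ p          ≤⟨ *-mono-≤ (≤-reflexive (≡-trans (^-*-assoc 2 (tri a) p) (cong (2 ^_) expo))) (≤-trans (^-monoˡ-≤ p (!≤^ a)) (≤-reflexive (comm a a p))) ⟩
             2 ^ (s * a * u) * (a ^ p) ^ a        ≤⟨ *-mono-≤ (≤-trans (≤-reflexive (sym (^-*-assoc 2 (s * a) u))) (^-monoˡ-≤ u lt)) (^-monoˡ-≤ a lg) ⟩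
             (n ^ q) ^ u * n ^ a                  ≡⟨ ≡-trans (cong (_* n ^ a) (^-*-assoc n q u)) (sym (^-distribˡ-+-* n (q * u) a)) ⟩
             n ^ (q * u + a) ∎)) ⟩
      n ^ p * (n ^ (q * u + a)) ^ K
        ≡⟨ ≡-trans (cong (n ^ p *_) (^-*-assoc n (q * u + a) K)) (sym (^-distribˡ-+-* n p ((q * u + a) * K))) ⟩
      n ^ (p + (q * u + a) * K)
        ≤⟨ ^-monoʳ-≤ n {{>-nonZero 0<n}} exps ⟩
      n ^ (a * (K * p))
        ≡⟨ ≡-trans (sym (^-*-assoc n a (K * p))) (sym (^-*-assoc (n ^ a) K p)) ⟩
      ((n ^ a) ^ K) ^ p ∎
      where
      comm : ∀ x i j → (x ^ i) ^ j ≡ (x ^ j) ^ i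
      comm x i j = ≡-trans (^-*-assoc x i j) (≡-trans (cong (x ^_) (*-comm i j)) (sym (^-*-assoc x j i)))
      expo : tri a * p ≡ s * a * u
      expo = begin-equality
        tri a * p          ≡⟨ cong (tri a *_) p≡ ⟩
        tri a * 8          ≡⟨ lem (tri a) ⟩
        4 * (2 * tri a)    ≡⟨ cong (4 *_) (+-cancelʳ-≡ a (2 * tri a) (u * a) (≡-trans (2tri a) (+-comm a (u * a)))) ⟩
        4 * (u * a)        ≡⟨ lem₂ u a ⟩
        4 * a * u          ≡⟨ cong (λ s → s * a * u) (sym s≡) ⟩
        s * a * u ∎
        where
        lem : ∀ t → t * 8 ≡ 4 * (2 * t)
        lem = solve-∀
        lem₂ : ∀ u a → 4 * (u * a) ≡ 4 * a * u
        lem₂ = solve-∀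
      exps : p + (q * u + a) * K ≤ a * (K * p)
      exps = begin
        p + (q * u + a) * K              ≡⟨ cong₂ (λ p q → p + (q * u + a) * K) p≡ q≡ ⟩
        8 + (7 * u + a) * K              ≤⟨ +-monoˡ-≤ _ (≤-trans (m≤m+n 8 6) (*-monoʳ-≤ 7 2≤K)) ⟩
        7 * K + (7 * u + a) * K          ≡⟨ lem K u ⟩
        suc u * (K * 8)                  ≡⟨ cong (λ p → a * (K * p)) (sym p≡) ⟩
        a * (K * p) ∎
        where
        lem : ∀ K u → 7 * K + (7 * u + suc u) * K ≡ suc u * (K * 8)
        lem = solve-∀
    power : 2 ^ (4 * a) ≤ n ^ 7 → (n * Thr a ^ K) ^ 8 ≤ ((n ^ a) ^ K) ^ 8
    power lt = bound 8 7 4 refl refl refl lt log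
    raise : (n ^ a) ^ K < n * Thr a ^ K → ((n ^ a) ^ K) ^ 8 < (n * Thr a ^ K) ^ 8
    raise lt = ^-monoˡ-< 8 lt

  record Window (n : ℕ) : Set where
    field
      1≤n  : 1 ≤ n
      1≤t  : 1 ≤ thr n
      many : Many n (thr n)
      few  : ¬ Many n (suc (thr n))
      top  : 2 ^ suc (thr n) ≤ 4 * (n * n)
    t : ℕ
    t = thr n

  window : Ev Window
  window = Ev-map (λ n (beats , 0<n) → make n 0<n beats) (Ev-× (exp-beats-poly 1 2) (1 , λ _ le → le))
    where
    open ≤-Reasoning
    make : ∀ n → 0 < n → 1 * suc n ^ 2 ≤ 2 ^ n → Window n
    make n 0<n beats = record { 1≤n = 0<n ; 1≤t = proj₁ spec ; many = proj₁ (proj₂ spec) ; few = proj₂ (proj₂ spec) ; top = top′ (thr n) (proj₁ spec) (proj₁ (proj₂ spec)) }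
      where
      initial : Many n 1
      initial = begin
        n * 1 ^ K         ≡⟨ ≡-trans (cong (n *_) (^-zeroˡ K)) (*-identityʳ n) ⟩
        n                 ≡⟨ *-identityʳ n ⟨
        n ^ 1             ≤⟨ ^-monoʳ-≤ n {{>-nonZero 0<n}} 0<K ⟩
        n ^ K             ≡⟨ cong (_^ K) (sym (*-identityʳ n)) ⟩
        (n ^ 1) ^ K ∎
      final : ¬ Many n (n + 1)
      final h = <⇒≱ (begin-strict
        n * n                  <⟨ *-mono-< {n} {suc n} {n} {suc n} ≤-refl ≤-refl ⟩
        suc n * suc n          ≡⟨ ≡-trans (cong (suc n *_) (sym (*-identityʳ (suc n)))) (sym (*-identityˡ _)) ⟩
        1 * suc n ^ 2          ≤⟨ beats ⟩
        2 ^ n ∎) (many⇒≤ n n 0<n (subst (Many n) (+-comm n 1) h))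
      spec = cut-spec n n 1 initial final
      top′ : ∀ t → 1 ≤ t → Many n t → 2 ^ suc t ≤ 4 * (n * n)
      top′ (suc u) _ h = ≤-trans (≤-reflexive (sym (*-assoc 2 2 (2 ^ u)))) (*-monoʳ-≤ 4 (many⇒≤ n u 0<n h))

  -- The conditions of the second moment computation, with g = ⌊t/4⌋ and H = h t.
  module LowerConditions (h : ℕ) where

    record Lower (n : ℕ) : Set where
      field
        4≤t : 4 ≤ thr n
        c₁ : h * thr n * (thr n * thr n * 2 ^ (thr n / 4)) + thr n ≤ n
        c₂ : h * thr n * (suc (thr n) * n) ≤ 2 ^ (thr n ∸ suc (thr n / 4))
        c₃ : h * thr n * 2 ^ tri (thr n) ≤ bin n (thr n)

    lower : Ev Lower
    lower = Ev-map (λ n (W , (p₁ , p₂ , p₃ , p₄ , p₅) , n≥) → build n W n≥ (p₁ (suc (thr n)) (Window.top W)) (p₂ (suc (thr n)) (Window.top W)) (p₃ (suc (thr n)) (Window.top W)) (p₄ (suc (thr n)) (Window.top W)) (p₅ (suc (thr n)) (Window.top W)))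
      (Ev-× window (Ev-× (Ev-× (polylog 1 8) (Ev-× (polylog (8 * (h * h)) 6) (Ev-× (polylog 2 2) (Ev-× (polylog (h ^ 4 * 2 ^ 7) 8) (polylog ((2 * h) ^ K) K))))) (2 ^ 5 , λ n le → le)))
      where
      open ≤-Reasoning
      build : ∀ n → Window n → 2 ^ 5 ≤ n → 1 * suc (suc (thr n)) ^ 8 ≤ n → 8 * (h * h) * suc (suc (thr n)) ^ 6 ≤ n → 2 * suc (suc (thr n)) ^ 2 ≤ n →
        h ^ 4 * 2 ^ 7 * suc (suc (thr n)) ^ 8 ≤ n → (2 * h) ^ K * suc (suc (thr n)) ^ K ≤ n → Lower n
      build n W n≥ p₁ p₂ p₃ p₄ p₅ = record { 4≤t = 4≤t ; c₁ = c₁ ; c₂ = c₂ ; c₃ = c₃ }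
        where
        open Window W
        a g : ℕ
        a = suc t
        g = t / 4
        t≤ : t ≤ suc a
        t≤ = ≤-trans (n≤1+n t) (n≤1+n a)
        big : n ^ 7 ≤ 2 ^ (4 * a)
        big = few⇒≥ n t 1≤n (≤-trans (^-monoˡ-≤ 8 (n≤1+n a)) (≤-trans (≤-reflexive (sym (*-identityˡ _))) p₁)) few
        n⁵≤ : n ^ 5 ≤ 2 ^ (3 * a)
        n⁵≤ = pow-cancel-≤ 4 (s≤s z≤n) (begin
          (n ^ 5) ^ 4          ≡⟨ ^-*-assoc n 5 4 ⟩
          n ^ 20               ≤⟨ ^-monoʳ-≤ n {{>-nonZero 1≤n}} (n≤1+n 20) ⟩
          n ^ 21               ≡⟨ ^-*-assoc n 7 3 ⟨
          (n ^ 7) ^ 3          ≤⟨ ^-monoˡ-≤ 3 big ⟩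
          (2 ^ (4 * a)) ^ 3    ≡⟨ ≡-trans (^-*-assoc 2 (4 * a) 3) (cong (2 ^_) (lem a)) ⟩
          2 ^ (3 * a * 4)      ≡⟨ ^-*-assoc 2 (3 * a) 4 ⟨
          (2 ^ (3 * a)) ^ 4 ∎)
          where
          lem : ∀ a → 4 * a * 3 ≡ 3 * a * 4
          lem = solve-∀
        -- If t ≤ 3 then n^7 ≤ 2^16, against n ≥ 2^5.
        4≤t : 4 ≤ t
        4≤t = ≮⇒≥ λ lt → <⇒≱ (begin-strict
          2 ^ (4 * a)            ≤⟨ ^-monoʳ-≤ 2 (*-monoʳ-≤ 4 lt) ⟩
          2 ^ 16                 <⟨ ^-monoʳ-< 2 (s≤s (s≤s z≤n)) (m≤m+n 17 18) ⟩
          2 ^ 35                 ≡⟨ ^-*-assoc 2 5 7 ⟨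
          (2 ^ 5) ^ 7            ≤⟨ ^-monoˡ-≤ 7 n≥ ⟩
          n ^ 7 ∎) big
        4g≤t : 4 * g ≤ t
        4g≤t = /*≤ t 4
        g<t : suc g ≤ t
        g<t = *-cancelˡ-≤ 4 (begin
          4 * suc g       ≡⟨ *-suc 4 g ⟩
          4 + 4 * g       ≤⟨ +-mono-≤ 4≤t 4g≤t ⟩
          t + t           ≤⟨ m≤m+n (t + t) (t + t) ⟩
          t + t + (t + t) ≡⟨ lem t ⟩
          4 * t ∎)
          where
          lem : ∀ t → t + t + (t + t) ≡ 4 * t
          lem = solve-∀
        -- Since 4g ≤ t and 2^t is at most about n², the factor 2^g is about the square root of `n`
        -- at most.
        c₁ : h * t * (t * t * 2 ^ g) + t ≤ n
        c₁ = *-cancelˡ-≤ 2 (begin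
          2 * (h * t * (t * t * 2 ^ g) + t)                ≡⟨ lem h t (2 ^ g) ⟩
          2 * (h * (t * t * t)) * 2 ^ g + 2 * t            ≤⟨ +-mono-≤ first second ⟩
          n + n                                            ≡⟨ cong (n +_) (sym (+-identityʳ n)) ⟩
          2 * n ∎)
          where
          lem : ∀ h t p → 2 * (h * t * (t * t * p) + t) ≡ 2 * (h * (t * t * t)) * p + 2 * t
          lem = solve-∀
          second : 2 * t ≤ n
          second = ≤-trans (*-monoʳ-≤ 2 (≤-trans t≤ (≤-trans (≤-reflexive (sym (*-identityʳ (suc a)))) (^-monoʳ-≤ (suc a) (s≤s (z≤n {1})))))) p₃
          z : ℕ
          z = 2 * (h * (t * t * t))
          2z²≤n : 2 * (z * z) ≤ n
          2z²≤n = begin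
            2 * (z * z)                             ≡⟨ lem₂ h t ⟩
            8 * (h * h) * t ^ 6                     ≤⟨ *-monoʳ-≤ (8 * (h * h)) (^-monoˡ-≤ 6 t≤) ⟩
            8 * (h * h) * suc a ^ 6                 ≤⟨ p₂ ⟩
            n ∎
            where
            lem₂ : ∀ h t → 2 * (2 * (h * (t * t * t)) * (2 * (h * (t * t * t)))) ≡ 8 * (h * h) * (t * (t * (t * (t * (t * (t * 1))))))
            lem₂ = solve-∀
          first : z * 2 ^ g ≤ n
          first = pow-cancel-≤ 4 (s≤s z≤n) (begin
            (z * 2 ^ g) ^ 4                ≡⟨ ≡-trans (^-distribʳ-* 4 z (2 ^ g)) (cong (z ^ 4 *_) (≡-trans (^-*-assoc 2 g 4) (cong (2 ^_) (*-comm g 4)))) ⟩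
            z ^ 4 * 2 ^ (4 * g)            ≤⟨ *-monoʳ-≤ (z ^ 4) (≤-trans (^-monoʳ-≤ 2 (≤-trans 4g≤t (n≤1+n t))) top) ⟩
            z ^ 4 * (4 * (n * n))          ≡⟨ lem₃ z n ⟩
            2 * (z * z) * (2 * (z * z)) * (n * n) ≤⟨ *-monoˡ-≤ (n * n) (*-mono-≤ 2z²≤n 2z²≤n) ⟩
            n * n * (n * n)                ≡⟨ lem₄ n ⟩
            n ^ 4 ∎)
            where
            lem₃ : ∀ z n → z * (z * (z * (z * 1))) * (4 * (n * n)) ≡ 2 * (z * z) * (2 * (z * z)) * (n * n)
            lem₃ = solve-∀
            lem₄ : ∀ n → n * n * (n * n) ≡ n * (n * (n * (n * 1)))
            lem₄ = solve-∀
        c₂ : h * t * (suc t * n) ≤ 2 ^ (t ∸ suc g)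
        c₂ = pow-cancel-≤ 4 (s≤s z≤n) (*-cancelʳ-≤ _ _ (2 ^ 7) (begin
          (h * t * (suc t * n)) ^ 4 * 2 ^ 7            ≤⟨ *-monoˡ-≤ (2 ^ 7) (^-monoˡ-≤ 4 (≤-trans (*-mono-≤ (*-monoʳ-≤ h t≤) (*-monoˡ-≤ n (n≤1+n a))) (≤-reflexive (lem h (suc a) n)))) ⟩
          (h * (suc a * suc a) * n) ^ 4 * 2 ^ 7        ≡⟨ cong (_* 2 ^ 7) (≡-trans (^-distribʳ-* 4 (h * (suc a * suc a)) n) (cong (_* n ^ 4) (^-distribʳ-* 4 h (suc a * suc a)))) ⟩
          h ^ 4 * (suc a * suc a) ^ 4 * n ^ 4 * 2 ^ 7  ≡⟨ cong (λ z → h ^ 4 * z * n ^ 4 * 2 ^ 7) (≡-trans (^-distribʳ-* 4 (suc a) (suc a)) (sym (^-distribˡ-+-* (suc a) 4 4))) ⟩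
          h ^ 4 * suc a ^ 8 * n ^ 4 * 2 ^ 7            ≡⟨ lem₂ (h ^ 4) (suc a ^ 8) (n ^ 4) (2 ^ 7) ⟩
          h ^ 4 * 2 ^ 7 * suc a ^ 8 * n ^ 4            ≤⟨ *-monoˡ-≤ (n ^ 4) p₄ ⟩
          n ^ 5                                        ≤⟨ n⁵≤ ⟩
          2 ^ (3 * a)                                  ≤⟨ ^-monoʳ-≤ 2 expo ⟩
          2 ^ (x * 4 + 7)                              ≡⟨ ≡-trans (^-distribˡ-+-* 2 (x * 4) 7) (cong (_* 2 ^ 7) (sym (^-*-assoc 2 x 4))) ⟩
          (2 ^ x) ^ 4 * 2 ^ 7 ∎))
          where
          x : ℕ
          x = t ∸ suc g
          lem : ∀ h a n → h * a * (a * n) ≡ h * (a * a) * n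
          lem = solve-∀
          lem₂ : ∀ a b c d → a * b * c * d ≡ a * d * b * c
          lem₂ = solve-∀
          expo : 3 * a ≤ x * 4 + 7
          expo = +-cancelʳ-≤ (4 * g + t) _ _ (begin
            3 * suc t + (4 * g + t)      ≡⟨ lem₃ t g ⟩
            4 * t + (4 * g + 3)          ≡⟨ cong (λ z → 4 * z + (4 * g + 3)) (sym (m+[n∸m]≡n g<t)) ⟩
            4 * (suc g + x) + (4 * g + 3) ≡⟨ lem₄ g x ⟩
            x * 4 + 7 + (4 * g + 4 * g)  ≤⟨ +-monoʳ-≤ (x * 4 + 7) (+-monoʳ-≤ (4 * g) 4g≤t) ⟩
            x * 4 + 7 + (4 * g + t) ∎)
            where
            lem₃ : ∀ t g → 3 * suc t + (4 * g + t) ≡ 4 * t + (4 * g + 3)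
            lem₃ = solve-∀
            lem₄ : ∀ g x → 4 * (suc g + x) + (4 * g + 3) ≡ x * 4 + 7 + (4 * g + 4 * g)
            lem₄ = solve-∀
        -- Here the threshold matters: `Many` leaves a factor `n` against (2ht)^K, which is
        -- polylogarithmic.
        c₃ : h * t * 2 ^ tri t ≤ bin n t
        c₃ = *-cancelˡ-≤ 2 (pow-cancel-≤ K 0<K (*-cancelʳ-≤ _ _ ((t !) ^ K) {{m^n≢0 (t !) K {{>-nonZero (!>0 t)}}}} (begin
          (2 * (h * t * 2 ^ tri t)) ^ K * (t !) ^ K      ≡⟨ cong (_* (t !) ^ K) (≡-trans (cong (_^ K) (lem h t (2 ^ tri t))) (^-distribʳ-* K (2 * h * t) (2 ^ tri t))) ⟩
          (2 * h * t) ^ K * (2 ^ tri t) ^ K * (t !) ^ K  ≡⟨ ≡-trans (*-assoc ((2 * h * t) ^ K) _ _) (cong ((2 * h * t) ^ K *_) (sym (^-distribʳ-* K (2 ^ tri t) (t !)))) ⟩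
          (2 * h * t) ^ K * Thr t ^ K                    ≤⟨ *-monoˡ-≤ (Thr t ^ K) (≤-trans (≤-reflexive (^-distribʳ-* K (2 * h) t)) (≤-trans (*-monoʳ-≤ ((2 * h) ^ K) (^-monoˡ-≤ K t≤)) p₅)) ⟩
          n * Thr t ^ K                                  ≤⟨ many ⟩
          (n ^ t) ^ K                                    ≤⟨ ^-monoˡ-≤ K (^≤2!bin n t 1≤n t≤n 2t²≤n) ⟩
          (2 * (t ! * bin n t)) ^ K                      ≡⟨ ≡-trans (cong (_^ K) (lem₂ (t !) (bin n t))) (^-distribʳ-* K (2 * bin n t) (t !)) ⟩
          (2 * bin n t) ^ K * (t !) ^ K ∎)))
          where
          lem : ∀ h t p → 2 * (h * t * p) ≡ 2 * h * t * p
          lem = solve-∀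
          lem₂ : ∀ a b → 2 * (a * b) ≡ 2 * b * a
          lem₂ = solve-∀
          2t²≤n : 2 * (t * t) ≤ n
          2t²≤n = ≤-trans (*-monoʳ-≤ 2 (≤-trans (*-mono-≤ t≤ t≤) (≤-reflexive (cong (suc a *_) (sym (*-identityʳ (suc a))))))) p₃
          t≤n : t ≤ n
          t≤n = ≤-trans (≤-trans (m≤n*m t t {{>-nonZero 1≤t}}) (m≤n*m (t * t) 2)) 2t²≤n

-- The expected number of F-free sets above the threshold.

module UpperConditions (r′ : ℕ) (h C : ℕ) where

  open Growth r′ using (β; B; 2rβ≤)

  private
    r = suc r′

  2≤2r : 2 ≤ 2 * r
  2≤2r = *-monoʳ-≤ 2 (s≤s z≤n)

  open Threshold (2 * r) 2≤2r

  k : ℕ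
  k = h * C

  -- Each factor is a perfect r-th power up to the last one, so the r-th root is compared directly.
  square-bound : ∀ n A D f M x y q → A ^ (2 * r) ≤ n * (D * f) ^ (2 * r) → x * f ^ r ≤ M * y → 2 * (k * k * (r * r)) * (y * y) * (n * n * n) ≤ q →
    2 * (k * (n * A ^ r) * (r * x)) ^ 2 ≤ M ^ 2 * (D ^ (2 * r) * q)
  square-bound n A D f M x y q h₁ h₂ h₃ = begin
    2 * (k * (n * A ^ r) * (r * x)) ^ 2
      ≡⟨ lem k n (A ^ r) r x ⟩
    2 * (k * k * (r * r)) * (n * n) * (x * x) * (A ^ r * A ^ r)
      ≡⟨ cong (2 * (k * k * (r * r)) * (n * n) * (x * x) *_) (double A) ⟩
    2 * (k * k * (r * r)) * (n * n) * (x * x) * A ^ (2 * r)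
      ≤⟨ *-monoʳ-≤ (2 * (k * k * (r * r)) * (n * n) * (x * x)) (≤-trans h₁ (≤-reflexive (cong (n *_) (≡-trans (^-distribʳ-* (2 * r) D f) (cong (D ^ (2 * r) *_) (sym (double f))))))) ⟩
    2 * (k * k * (r * r)) * (n * n) * (x * x) * (n * (D ^ (2 * r) * (f ^ r * f ^ r)))
      ≡⟨ lem₂ (2 * (k * k * (r * r))) n x (D ^ (2 * r)) (f ^ r) ⟩
    2 * (k * k * (r * r)) * (n * n * n) * D ^ (2 * r) * (x * f ^ r * (x * f ^ r))
      ≤⟨ *-monoʳ-≤ (2 * (k * k * (r * r)) * (n * n * n) * D ^ (2 * r)) (*-mono-≤ h₂ h₂) ⟩
    2 * (k * k * (r * r)) * (n * n * n) * D ^ (2 * r) * (M * y * (M * y))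
      ≡⟨ lem₃ (2 * (k * k * (r * r))) (n * n * n) (D ^ (2 * r)) M y ⟩
    M ^ 2 * (D ^ (2 * r) * (2 * (k * k * (r * r)) * (y * y) * (n * n * n)))
      ≤⟨ *-monoʳ-≤ (M ^ 2) (*-monoʳ-≤ (D ^ (2 * r)) h₃) ⟩
    M ^ 2 * (D ^ (2 * r) * q) ∎
    where
    open ≤-Reasoning
    double : ∀ z → z ^ r * z ^ r ≡ z ^ (2 * r)
    double z = ≡-trans (sym (^-distribˡ-+-* z r r)) (cong (z ^_) (cong (r +_) (sym (+-identityʳ r))))
    lem : ∀ k n a r x → 2 * (k * (n * a) * (r * x) * (k * (n * a) * (r * x) * 1)) ≡ 2 * (k * k * (r * r)) * (n * n) * (x * x) * (a * a)
    lem = solve-∀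
    lem₂ : ∀ c n x d f → c * (n * n) * (x * x) * (n * (d * (f * f))) ≡ c * (n * n * n) * d * (x * f * (x * f))
    lem₂ = solve-∀
    lem₃ : ∀ c n d m y → c * n * d * (m * y * (m * y)) ≡ m * (m * 1) * (d * (c * (y * y) * n))
    lem₃ = solve-∀

  -- The power 2r undoes the rounding in `β`. For m = ra + 1 the difference of `tri m` and `β m` is
  -- about r tri a + a: the extra vertex adds `a` bits to those of `r` independent `a`-sets.
  raise-bound : ∀ W M a m → m ≡ suc (r * a) → 2 * W ^ 2 ≤ M ^ 2 * 2 ^ (2 * r * tri a + 2 * a) → W * 2 ^ β m ≤ M * 2 ^ tri m
  raise-bound W M a m m≡ h₁ = pow-cancel-≤ (2 * r) (s≤s z≤n) (*-cancelʳ-≤ _ _ (2 ^ r) {{m^n≢0 2 r}} (begin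
    (W * 2 ^ β m) ^ (2 * r) * 2 ^ r
      ≡⟨ cong (_* 2 ^ r) (≡-trans (^-distribʳ-* (2 * r) W (2 ^ β m)) (cong₂ _*_ (sym (^-*-assoc W 2 r)) (≡-trans (^-*-assoc 2 (β m) (2 * r)) (cong (2 ^_) (*-comm (β m) (2 * r)))))) ⟩
    (W ^ 2) ^ r * 2 ^ (2 * r * β m) * 2 ^ r
      ≤⟨ *-monoˡ-≤ (2 ^ r) (*-monoʳ-≤ ((W ^ 2) ^ r) (^-monoʳ-≤ 2 (2rβ≤ m))) ⟩
    (W ^ 2) ^ r * 2 ^ (r′ * (m * m)) * 2 ^ r
      ≡⟨ ≡-trans (lem ((W ^ 2) ^ r) (2 ^ (r′ * (m * m))) (2 ^ r)) (cong (_* 2 ^ (r′ * (m * m))) (sym (^-distribʳ-* r 2 (W ^ 2)))) ⟩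
    (2 * W ^ 2) ^ r * 2 ^ (r′ * (m * m))
      ≤⟨ *-monoˡ-≤ (2 ^ (r′ * (m * m))) (^-monoˡ-≤ r h₁) ⟩
    (M ^ 2 * 2 ^ e) ^ r * 2 ^ (r′ * (m * m))
      ≡⟨ ≡-trans (cong (_* 2 ^ (r′ * (m * m))) (≡-trans (^-distribʳ-* r (M ^ 2) (2 ^ e)) (cong ((M ^ 2) ^ r *_) (^-*-assoc 2 e r))))
           (≡-trans (*-assoc ((M ^ 2) ^ r) _ _) (cong ((M ^ 2) ^ r *_) (sym (^-distribˡ-+-* 2 (e * r) (r′ * (m * m)))))) ⟩
    (M ^ 2) ^ r * 2 ^ (e * r + r′ * (m * m))
      ≤⟨ *-monoʳ-≤ ((M ^ 2) ^ r) (^-monoʳ-≤ 2 expo) ⟩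
    (M ^ 2) ^ r * 2 ^ (tri m * (2 * r) + r)
      ≡⟨ cong₂ _*_ (^-*-assoc M 2 r) (≡-trans (^-distribˡ-+-* 2 (tri m * (2 * r)) r) (cong (_* 2 ^ r) (sym (^-*-assoc 2 (tri m) (2 * r))))) ⟩
    M ^ (2 * r) * ((2 ^ tri m) ^ (2 * r) * 2 ^ r)
      ≡⟨ ≡-trans (sym (*-assoc (M ^ (2 * r)) _ _)) (cong (_* 2 ^ r) (sym (^-distribʳ-* (2 * r) M (2 ^ tri m)))) ⟩
    (M * 2 ^ tri m) ^ (2 * r) * 2 ^ r ∎))
    where
    open ≤-Reasoning
    e : ℕ
    e = 2 * r * tri a + 2 * a
    lem : ∀ a b c → a * b * c ≡ c * a * b
    lem = solve-∀
    expo : e * r + r′ * (m * m) ≤ tri m * (2 * r) + r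
    expo = +-cancelʳ-≤ (r * m) _ _ (begin
      e * r + r′ * (m * m) + r * m            ≡⟨ cong (λ z → e * r + r′ * (m * m) + r * z) m≡ ⟩
      e * r + r′ * (m * m) + r * suc (r * a)  ≡⟨ lem₁ r (tri a) a (r′ * (m * m)) ⟩
      r * r * (2 * tri a + a) + 2 * (r * a) + r + r′ * (m * m) ≡⟨ cong (λ z → r * r * z + 2 * (r * a) + r + r′ * (m * m)) (2tri a) ⟩
      r * r * (a * a) + 2 * (r * a) + r + r′ * (m * m) ≤⟨ n≤1+n _ ⟩
      suc (r * r * (a * a) + 2 * (r * a) + r + r′ * (m * m)) ≡⟨ lem₂ r a (r′ * (m * m)) ⟩
      suc (r * a) * suc (r * a) + r′ * (m * m) + r ≡⟨ cong (λ z → z * z + r′ * (m * m) + r) (sym m≡) ⟩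
      r * (m * m) + r                         ≡⟨ cong (λ z → r * z + r) (sym (2tri m)) ⟩
      r * (2 * tri m + m) + r                 ≡⟨ lem₃ r (tri m) m ⟩
      tri m * (2 * r) + r + r * m ∎)
      where
      lem₁ : ∀ r t a z → (2 * r * t + 2 * a) * r + z + r * suc (r * a) ≡ r * r * (2 * t + a) + 2 * (r * a) + r + z
      lem₁ = solve-∀
      lem₂ : ∀ r a z → suc (r * r * (a * a) + 2 * (r * a) + r + z) ≡ suc (r * a) * suc (r * a) + z + r
      lem₂ = solve-∀
      lem₃ : ∀ r t m → r * (2 * t + m) + r ≡ t * (2 * r) + r + r * m
      lem₃ = solve-∀

  size : ℕ → ℕ
  size n = suc (r * suc (thr n))

  private
    Y = 2 * (k * k * (r * r))
    c₀ = Y * Y * (r ^ r) ^ 4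
    d₀ = r * 4

  upper : Ev (λ n → h * (bin n (size n) * (C * B (size n))) ≤ 2 ^ tri (size n))
  upper = Ev-map (λ n (W , p₁ , p₂) → build n W (p₁ (suc (thr n)) (Window.top W)) (p₂ (suc (thr n)) (Window.top W))) (Ev-× window (Ev-× (polylog 1 8) (polylog c₀ d₀)))
    where
    open ≤-Reasoning
    build : ∀ n → Window n → 1 * suc (suc (thr n)) ^ 8 ≤ n → c₀ * suc (suc (thr n)) ^ d₀ ≤ n → h * (bin n (size n) * (C * B (size n))) ≤ 2 ^ tri (size n)
    build n W p₁ p₂ = *-cancelʳ-≤ _ _ (m !) {{>-nonZero (!>0 m)}} (begin
      h * (bin n m * (C * (r ^ m * 2 ^ β m))) * m !    ≡⟨ lem h (bin n m) C (r ^ m) (2 ^ β m) (m !) ⟩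
      k * (bin n m * m !) * r ^ m * 2 ^ β m            ≤⟨ *-monoˡ-≤ (2 ^ β m) (*-monoˡ-≤ (r ^ m) (*-monoʳ-≤ k (bin*!≤^ n m))) ⟩
      k * n ^ m * r ^ m * 2 ^ β m                      ≤⟨ raise-bound (k * n ^ m * r ^ m) (m !) a m refl squared ⟩
      m ! * 2 ^ tri m                                  ≡⟨ *-comm (m !) (2 ^ tri m) ⟩
      2 ^ tri m * m ! ∎)
      where
      open Window W
      a m : ℕ
      a = suc t
      m = size n
      lem : ∀ h b c x y f → h * (b * (c * (x * y))) * f ≡ h * c * (b * f) * x * y
      lem = solve-∀
      y : ℕ
      y = (r * a) ^ r
      big : n ^ 7 ≤ 2 ^ (4 * a)
      big = few⇒≥ n t 1≤n (≤-trans (^-monoˡ-≤ 8 (n≤1+n a)) (≤-trans (≤-reflexive (sym (*-identityˡ _))) p₁)) few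
      Y²≤n : Y * (y * y) * (Y * (y * y)) ≤ n
      Y²≤n = begin
        Y * (y * y) * (Y * (y * y))            ≡⟨ lem₄ Y y ⟩
        Y * Y * y ^ 4                          ≡⟨ cong (λ z → Y * Y * z ^ 4) (^-distribʳ-* r r a) ⟩
        Y * Y * (r ^ r * a ^ r) ^ 4            ≡⟨ cong (Y * Y *_) (^-distribʳ-* 4 (r ^ r) (a ^ r)) ⟩
        Y * Y * ((r ^ r) ^ 4 * (a ^ r) ^ 4)    ≡⟨ *-assoc (Y * Y) ((r ^ r) ^ 4) ((a ^ r) ^ 4) ⟨
        c₀ * (a ^ r) ^ 4                       ≡⟨ cong (c₀ *_) (^-*-assoc a r 4) ⟩
        c₀ * a ^ d₀                            ≤⟨ *-monoʳ-≤ c₀ (^-monoˡ-≤ d₀ (n≤1+n a)) ⟩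
        c₀ * suc a ^ d₀                        ≤⟨ p₂ ⟩
        n ∎
        where
        lem₄ : ∀ Y y → Y * (y * y) * (Y * (y * y)) ≡ Y * Y * (y * (y * (y * (y * 1))))
        lem₄ = solve-∀
      -- This is 2^a ≥ n^(3/2) with room for powers of log n. After squaring, `big` leaves one
      -- factor `n` for them.
      h₃ : Y * (y * y) * (n * n * n) ≤ 2 ^ (2 * a)
      h₃ = pow-cancel-≤ 2 (s≤s z≤n) (begin
        (Y * (y * y) * (n * n * n)) ^ 2                   ≡⟨ lem₅ (Y * (y * y)) n ⟩
        Y * (y * y) * (Y * (y * y)) * n ^ 6               ≤⟨ *-monoˡ-≤ (n ^ 6) Y²≤n ⟩
        n * n ^ 6                                         ≤⟨ big ⟩
        2 ^ (4 * a)                                       ≡⟨ cong (2 ^_) (lem₆ a) ⟩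
        2 ^ (2 * a * 2)                                   ≡⟨ ^-*-assoc 2 (2 * a) 2 ⟨
        (2 ^ (2 * a)) ^ 2 ∎)
        where
        lem₅ : ∀ Y n → Y * (n * n * n) * (Y * (n * n * n) * 1) ≡ Y * Y * (n * (n * (n * (n * (n * (n * 1))))))
        lem₅ = solve-∀
        lem₆ : ∀ a → 4 * a ≡ 2 * a * 2
        lem₆ = solve-∀
      h₂ : r ^ (r * a) * (a !) ^ r ≤ m ! * y
      h₂ = ≤-trans (multinomial′ r t) (*-monoˡ-≤ y (m≤n*m ((r * a) !) m))
      squared : 2 * (k * n ^ m * r ^ m) ^ 2 ≤ (m !) ^ 2 * 2 ^ (2 * r * tri a + 2 * a)
      squared = begin
        2 * (k * n ^ m * r ^ m) ^ 2
          ≡⟨ cong (λ z → 2 * (k * (n * z) * (r * r ^ (r * a))) ^ 2) (≡-trans (cong (n ^_) (*-comm r a)) (sym (^-*-assoc n a r))) ⟩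
        2 * (k * (n * (n ^ a) ^ r) * (r * r ^ (r * a))) ^ 2
          ≤⟨ square-bound n (n ^ a) (2 ^ tri a) (a !) (m !) (r ^ (r * a)) y (2 ^ (2 * a)) (<⇒≤ (≰⇒> few)) h₂ h₃ ⟩
        (m !) ^ 2 * ((2 ^ tri a) ^ (2 * r) * 2 ^ (2 * a))
          ≡⟨ cong ((m !) ^ 2 *_) (≡-trans (cong (_* 2 ^ (2 * a)) (≡-trans (^-*-assoc 2 (tri a) (2 * r)) (cong (2 ^_) (*-comm (tri a) (2 * r))))) (sym (^-distribˡ-+-* 2 (2 * r * tri a) (2 * a)))) ⟩
        (m !) ^ 2 * 2 ^ (2 * r * tri a + 2 * a) ∎

-- From settings of bits to graphs and vertex subsets.

tri≡C2 : ∀ n → tri n ≡ n choose 2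
tri≡C2 zero    = refl
tri≡C2 (suc n) = ≡-trans (cong₂ _+_ (sym (nC1≡n n)) (tri≡C2 n)) (nCk+nC[k+1]≡[n+1]C[k+1] n 1)

keep-AllPairs : ∀ {A : Set} {R : A → A → Set} (p : A → Bool) {L} → AllPairs R L → AllPairs R (keep p L)
keep-AllPairs p []              = []
keep-AllPairs p {x ∷ L} (a ∷ h) with p x
... | true  = keep-All p a ∷ keep-AllPairs p h
... | false = keep-AllPairs p h

∑-tabulate-∣∣ : ∀ {A : Set} {m} (S : Subset m) (g : Fin m → A) (p : A → Bool) → (∀ i → p (g i) ≡ lookup S i) → cnt p (Data.List.tabulate g) ≡ ∣ S ∣
∑-tabulate-∣∣ []          g p h = refl
∑-tabulate-∣∣ (true  ∷ S) g p h = cong₂ _+_ (cong 𝟙 (h zero)) (∑-tabulate-∣∣ S (g ∘ suc) p (h ∘ suc))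
∑-tabulate-∣∣ (false ∷ S) g p h = cong₂ _+_ (cong 𝟙 (h zero)) (∑-tabulate-∣∣ S (g ∘ suc) p (h ∘ suc))

maximum : ∀ {P : ℕ → Set} → (∀ s → Dec (P s)) → ∀ s d → P s → (∀ s′ → P s′ → s′ ≤ s + d) → ∃ λ a → P a × (∀ s′ → P s′ → s′ ≤ a)
maximum P? s zero    h bd = s , h , λ s′ h′ → ≤-trans (bd s′ h′) (≤-reflexive (+-identityʳ s))
maximum {P} P? s (suc d) h bd with P? (s + suc d)
... | yes q = s + suc d , q , bd
... | no ¬q = maximum P? s d h λ s′ h′ → s≤s⁻¹ (≤-trans (≤∧≢⇒< (bd s′ h′) λ { refl → ¬q h′ }) (≤-reflexive (+-suc s d)))

module Realise (n : ℕ) {k : ℕ} (F : Graph k) where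

  open Copies n F
  open Independent n using (inS; inS⁺; inS⁻; length-pairs-tri)
  open Rows n using (enum-off)

  graph : Ω → Graph n
  graph ω = record { adj = E ω ; sym = E-sym ω ; irrefl = E-irr ω }

  members : Subset n → List V
  members S = keep (lookup S) (allFin n)

  length-members : ∀ S → length (members S) ≡ ∣ S ∣
  length-members S = ≡-trans (length-keep (lookup S) (allFin n)) (∑-tabulate-∣∣ S id (lookup S) λ _ → refl)

  contains⇒ : ∀ {ω S} → ContainsIn F (graph ω) S → Contains ω (members S)
  contains⇒ {S = S} (φ , inj , mem , edge) = φ , (λ i j → inj) , (λ i → ∈-keep⁺ (lookup S) (∈-allFin (φ i)) ([]=⇒lookup (mem i))) , edge

  contains⇐ : ∀ {ω S} → Contains ω (members S) → ContainsIn F (graph ω) S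
  contains⇐ {S = S} (φ , inj , mem , edge) = φ , (λ {i} {j} → inj i j) , (λ i → lookup⇒[]= (φ i) S (proj₂ (∈-keep⁻ (lookup S) {allFin n} (mem i)))) , edge

  fromList : List V → Subset n
  fromList L = tabulate (inS L)

  ∈-members : ∀ {L x} → x ∈ members (fromList L) → x ∈ L
  ∈-members {L} {x} x∈ = inS⁻ {L} (≡-trans (sym (lookup∘tabulate (inS L) x)) (proj₂ (∈-keep⁻ (lookup (fromList L)) {allFin n} x∈)))

  ∣fromList∣ : ∀ {L} → Unique L → ∣ fromList L ∣ ≡ length L
  ∣fromList∣ {L} u = ≡-trans (sym (length-members (fromList L))) (≤-antisym
    (sub-length {L = L} (keep-unique (lookup (fromList L)) (allFin-unique n)) (∈-members {L}))
    (sub-length u λ {x} x∈ → ∈-keep⁺ (lookup (fromList L)) (∈-allFin x) (≡-trans (lookup∘tabulate (inS L) x) (inS⁺ x∈))))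

  -- Subsets of F-free sets are F-free, so it is enough to exclude the single size `suc N`.
  alpha : ∀ ω s N L → Unique L → length L ≡ s → ¬ Contains ω L → (∀ S → S ∈ combs (suc N) (allFin n) → Contains ω S) →
    ∃ λ a → IsAlphaF F (graph ω) a × s ≤ a × a ≤ N
  alpha ω s N L u refl free full = finish (maximum size? s (N ∸ s) here′ below)
    where
    Size : ℕ → Set
    Size a = Σ (Subset n) λ S → FFree F (graph ω) S × ∣ S ∣ ≡ a
    size? : ∀ a → Dec (Size a)
    size? a = anySubset? λ S → ¬? (map′ contains⇐ contains⇒ (contains? ω (members S))) ×-dec (∣ S ∣ ≟ a)
    here′ : Size s
    here′ = fromList L , (λ c → free (Contains-⊆ (∈-members {L}) (contains⇒ c))) , ∣fromList∣ u
    bounded : ∀ S → FFree F (graph ω) S → ∣ S ∣ ≤ N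
    bounded S fr = ≮⇒≥ λ lt → fr (contains⇐ (Contains-⊆ (∈-take⁻ (suc N))
      (full (take (suc N) (members S)) (take-keep-combs (lookup S) (suc N) (allFin n) (≤-trans lt (≤-reflexive (sym (length-members S))))))))
    atMost : ∀ s′ → Size s′ → s′ ≤ N
    atMost s′ (S , fr , refl) = bounded S fr
    below : ∀ s′ → Size s′ → s′ ≤ s + (N ∸ s)
    below s′ q = ≤-trans (atMost s′ q) (m≤n+m∸n N s)
    finish : (∃ λ a → Size a × (∀ s′ → Size s′ → s′ ≤ a)) → ∃ λ a → IsAlphaF F (graph ω) a × s ≤ a × a ≤ N
    finish (a , q , mx) = a , (q , λ S fr → mx ∣ S ∣ (S , fr , refl)) , mx s here′ , atMost a q

  -- Two settings are separated by the first bit in which the enumeration branched, and that bit is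
  -- an adjacency because `Q` consists of bits of pairs.
  different : ∀ Q → Unique Q → (∀ {e} → e ∈ Q → e ∈ pairs (allFin n)) → ∀ ω → AllPairs (λ ω ω′ → DifferentGraphs (graph ω) (graph ω′)) (enum Q ω)
  different []      u       sub ω = [] ∷ []
  different (e ∷ Q) (a ∷ u) sub ω = AllPairs.++⁺ (different Q u (sub ∘ there) _) (different Q u (sub ∘ there) _)
    (All.tabulate λ ω₁∈ → All.tabulate λ ω₂∈ → apart ω₁∈ ω₂∈)
    where
    apart : ∀ {ω₁ ω₂} → ω₁ ∈ enum Q (ω [ e ]≔ false) → ω₂ ∈ enum Q (ω [ e ]≔ true) → DifferentGraphs (graph ω₁) (graph ω₂)
    apart {ω₁} {ω₂} ω₁∈ ω₂∈ same = clash (∈-pairs (allFin n) (allFin-unique n) (sub (here refl)))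
      where
      val : ∀ b {ω′} → ω′ ∈ enum Q (ω [ e ]≔ b) → lookup ω′ e ≡ b
      val b h = ≡-trans (enum-off Q (ω [ e ]≔ b) (All≢⇒∉ a) h) (lookup∘update e ω b)
      clash : (∃ λ u → ∃ λ v → u ∈ allFin n × v ∈ allFin n × u ≢ v × e ≡ key u v) → ⊥
      clash (u , v , _ , _ , ne , eq) = case ≡-trans (sym (at false ω₁∈)) (≡-trans (same u v) (at true ω₂∈)) of λ ()
        where
        at : ∀ b {ω′} → ω′ ∈ enum Q (ω [ e ]≔ b) → E ω′ u v ≡ b
        at b {ω′} h = ≡-trans (E-≢ ω′ ne) (≡-trans (cong (lookup ω′) (sym eq)) (val b h))

-- Concentration of the F-free number.

module Main {k : ℕ} (F : Graph k) {r′ : ℕ} (crit : Critical (suc r′) F) (0<r′ : 0 < r′) where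

  open Counting F crit 0<r′ using (C; claim)
  open Growth r′ using (B)

  private
    r = suc r′

  open Threshold (2 * r) (*-monoʳ-≤ 2 (s≤s z≤n))

  module At (n : ℕ) where

    open Copies n F
    open Independent n
    open Realise n F
    open Moments (thr n)

    m : ℕ
    m = suc (r * suc (thr n))

    𝓣 : List (List V)
    𝓣 = combs m Vs

    Y : Ω → ℕ
    Y ω = ∑ 𝓣 λ S → ff S ω

    free-prob : ∀ {S} → S ∈ 𝓣 → ∀ ω → 2 ^ tri m * 𝔼 Qs ω (ff S) ≤ N₂ * (C * B m)
    free-prob {S} S∈ ω = go (sub-↭ {L = Qs} {M = pairs S} (unique-pairs u) sub)
      where
      open ≤-Reasoning
      u : Unique S
      u = combs-unique m uV S∈
      len : length S ≡ m
      len = combs-length m Vs S∈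
      sub : ∀ {e} → e ∈ pairs S → e ∈ Qs
      sub e∈ = let u₁ , v , _ , _ , ne , eq = ∈-pairs S u e∈ in subst (_∈ Qs) (sym eq) (pairs-∈ Vs (∈-allFin u₁) (∈-allFin v) ne)
      go : (∃ λ rest → Qs ↭ pairs S ++ rest) → 2 ^ tri m * 𝔼 Qs ω (ff S) ≤ N₂ * (C * B m)
      go (rest , p) = begin
        2 ^ tri m * 𝔼 Qs ω (ff S)                               ≡⟨ cong (2 ^ tri m *_) (≡-trans (𝔼-↭ (↭-trans p (Perm.++-comm (pairs S) rest)) ω (ff S)) (𝔼-++ rest (pairs S) ω (ff S))) ⟩
        2 ^ tri m * 𝔼 rest ω (λ ω → 𝔼 (pairs S) ω (ff S))       ≤⟨ *-monoʳ-≤ (2 ^ tri m) (𝔼-bound rest ω (C * B m) λ ω → claim n m S u len ω) ⟩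
        2 ^ tri m * (2 ^ length rest * (C * B m))               ≡⟨ *-assoc (2 ^ tri m) (2 ^ length rest) (C * B m) ⟨
        2 ^ tri m * 2 ^ length rest * (C * B m)                 ≡⟨ cong (_* (C * B m)) (≡-trans (sym (^-distribˡ-+-* 2 (tri m) (length rest))) (cong (2 ^_) lens)) ⟩
        N₂ * (C * B m) ∎
        where
        lens : tri m + length rest ≡ length Qs
        lens = ≡-trans (cong (_+ length rest) (≡-trans (cong tri (sym len)) (sym (length-pairs-tri S)))) (≡-trans (sym (length-++ (pairs S))) (sym (Perm.↭-length p)))

    few-free : ∀ h → h * (bin n m * (C * B m)) ≤ 2 ^ tri m → ∀ ω → h * 𝔼 Qs ω Y ≤ N₂
    few-free h up ω = *-cancelˡ-≤ (2 ^ tri m) {{m^n≢0 2 (tri m)}} (begin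
      2 ^ tri m * (h * 𝔼 Qs ω Y)                        ≡⟨ lem (2 ^ tri m) h (𝔼 Qs ω Y) ⟩
      h * (2 ^ tri m * 𝔼 Qs ω Y)                        ≡⟨ cong (λ z → h * (2 ^ tri m * z)) (∑-swap (enum Qs ω) 𝓣 (λ ω S → ff S ω)) ⟩
      h * (2 ^ tri m * ∑ 𝓣 (λ S → 𝔼 Qs ω (ff S)))       ≡⟨ cong (h *_) (∑-*ˡ 𝓣 (2 ^ tri m) (λ S → 𝔼 Qs ω (ff S))) ⟨
      h * ∑ 𝓣 (λ S → 2 ^ tri m * 𝔼 Qs ω (ff S))         ≤⟨ *-monoʳ-≤ h (∑-bound 𝓣 (N₂ * (C * B m)) (λ S S∈ → free-prob S∈ ω)) ⟩
      h * (length 𝓣 * (N₂ * (C * B m)))                 ≡⟨ cong (λ z → h * (z * (N₂ * (C * B m)))) (≡-trans (length-combs m Vs) (cong (λ z → bin z m) (length-tabulate {n = n} id))) ⟩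
      h * (bin n m * (N₂ * (C * B m)))                  ≡⟨ lem₂ h (bin n m) N₂ (C * B m) ⟩
      h * (bin n m * (C * B m)) * N₂                    ≤⟨ *-monoˡ-≤ N₂ up ⟩
      2 ^ tri m * N₂ ∎)
      where
      open ≤-Reasoning
      lem : ∀ a b c → a * (b * c) ≡ b * (a * c)
      lem = solve-∀
      lem₂ : ∀ h b n c → h * (b * (n * c)) ≡ h * (b * c) * n
      lem₂ = solve-∀

    bad₁ good : Ω → Bool
    bad₁ ω = X ω * X ω <ᵇ suc (r * r * I ω)
    good ω = not (bad₁ ω) ∧ (Y ω <ᵇ 1)

    few-bad₁ : ∀ h → 0 < h → LowerConditions.Lower h n → ∀ ω → h * 𝔼 Qs ω (𝟙 ∘ bad₁) ≤ 4 * suc (r * r) * N₂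
    few-bad₁ h 0<h L ω = Bounded.few-bad W bound r h 0<M (/*≤ M h) ω
      where
      open LowerConditions.Lower L
      instance
        h≢0 : NonZero h
        h≢0 = >-nonZero 0<h
      W t : ℕ
      W = M / h
      t = thr n
      0<t : 0 < t
      0<t = ≤-trans (s≤s z≤n) 4≤t
      0<M : 0 < M
      0<M = begin
        1                ≤⟨ *-mono-≤ (*-mono-≤ 0<h 0<t) (m^n>0 2 (tri t)) ⟩
        h * t * 2 ^ tri t ≤⟨ c₃ ⟩
        bin n t          ≡⟨ ≡-trans (length-combs t Vs) (cong (λ z → bin z t) (length-tabulate {n = n} id)) ⟨
        M ∎
        where open ≤-Reasoning
      4g≤ : t ≤ 4 * (t / 4) + 3
      4g≤ = s≤s⁻¹ (≤-trans (<suc/ t 4) (≤-reflexive (lem (t / 4))))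
        where
        lem : ∀ g → 4 * suc g ≡ suc (4 * g + 3)
        lem = solve-∀
      g<t : suc (t / 4) ≤ t
      g<t = *-cancelˡ-≤ 4 (begin
        4 * suc (t / 4)       ≡⟨ *-suc 4 (t / 4) ⟩
        4 + 4 * (t / 4)       ≤⟨ +-mono-≤ 4≤t (/*≤ t 4) ⟩
        t + t                 ≤⟨ +-monoʳ-≤ t (m≤m+n t _) ⟩
        4 * t ∎)
        where open ≤-Reasoning
      bound : ∀ S → S ∈ 𝓢 → ∑ 𝓢 (λ S′ → 𝟙 (meet S S′) * 2 ^ tri (shared S S′)) ≤ W
      bound S S∈ = ≤/ (*-cancelˡ-≤ t {{>-nonZero 0<t}} (≤-trans (≤-reflexive (lem t h _))
        (shared-sum (t / 4) (h * t) 0<t (*-mono-≤ 0<h 0<t) 4g≤ g<t c₁ c₂ c₃ S S∈)))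
        where
        lem : ∀ t h s → t * (s * h) ≡ h * t * s
        lem = solve-∀

    union-free : ∀ ω → r * r * I ω < X ω * X ω → ∃ λ L → Unique L × length L ≡ r * thr n × ¬ Contains ω L
    union-free ω h = make (good-family r ω h)
      where
      make : (∃ λ (Ss : Vec (List V) r) → (∀ i → lookup Ss i ∈ 𝓢 × ind ω (lookup Ss i) ≡ true) × (∀ i i′ → i ≢ i′ → ∀ {x} → x ∈ lookup Ss i → x ∈ lookup Ss i′ → ⊥)) →
        ∃ λ L → Unique L × length L ≡ r * thr n × ¬ Contains ω L
      make (Ss , mem , dis) = flat Ss , flat-unique Ss (λ i → uS (proj₁ (mem i))) dis , length-flat (thr n) Ss (λ i → lenS (proj₁ (mem i))) ,
        r-coloured-free crit colour proper
        where
        classOf : ∀ u → Dec (∃ λ i → u ∈ lookup Ss i)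
        classOf u = Fin.any? λ i → u ∈? lookup Ss i
        pickColour : ∀ {u} → Dec (∃ λ i → u ∈ lookup Ss i) → Fin r
        pickColour (yes (i , _)) = i
        pickColour (no _)        = zero
        colour : V → Fin r
        colour u = pickColour (classOf u)
        pick-∈ : ∀ {u} (d : Dec (∃ λ i → u ∈ lookup Ss i)) → u ∈ flat Ss → u ∈ lookup Ss (pickColour d)
        pick-∈ (yes (i , u∈)) _  = u∈
        pick-∈ (no ¬p)        u∈ = contradiction (∈-flat⁻ Ss u∈) ¬p
        proper : ∀ {u v} → u ∈ flat Ss → v ∈ flat Ss → E ω u v ≡ true → colour u ≢ colour v
        proper {u} {v} u∈ v∈ e same = case ≡-trans (sym off) (≡-trans (sym (E-≢ ω ne)) e) of λ ()
          where
          ne : u ≢ v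
          ne = E⇒≢ ω e
          S : List V
          S = lookup Ss (colour v)
          off : lookup ω (key u v) ≡ false
          off = allF-∈ (pairs S) (proj₂ (mem (colour v))) (pairs-∈ S (subst (λ c → u ∈ lookup Ss c) same (pick-∈ (classOf u) u∈)) (pick-∈ (classOf v) v∈) ne)

    good⇒alpha : ∀ ω → good ω ≡ true → ∃ λ a → IsAlphaF F (graph ω) a × r * thr n ≤ a × a ≤ r * suc (thr n)
    good⇒alpha ω g = make (union-free ω (<ᵇ-false⁻ {X ω * X ω} (not-true (proj₁ both))))
      where
      not-true : ∀ {b} → not b ≡ true → b ≡ false
      not-true {false} _ = refl
      both : not (bad₁ ω) ≡ true × (Y ω <ᵇ 1) ≡ true
      both = ∧-true {not (bad₁ ω)} g
      decide : ∀ {S} → S ∈ 𝓣 → Dec (Contains ω S) → Contains ω S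
      decide {S} S∈ (yes c) = c
      decide {S} S∈ (no ¬c) = contradiction (<ᵇ-true⁻ {Y ω} (proj₂ both)) (≤⇒≯ (≤-trans (≤-reflexive (sym (ff-one {S} {ω} ¬c))) (∑-∈ (λ S → ff S ω) S∈)))
      make : (∃ λ L → Unique L × length L ≡ r * thr n × ¬ Contains ω L) → ∃ λ a → IsAlphaF F (graph ω) a × r * thr n ≤ a × a ≤ r * suc (thr n)
      make (L , u , len , free) = alpha ω (r * thr n) (r * suc (thr n)) L u len free λ S S∈ → decide S∈ (contains? ω S)

    -- Fixes the bits that belong to no pair; the enumeration overwrites all others.
    ω₀ : Ω
    ω₀ = Data.Vec.replicate _ false

    graphs : List (Graph n)
    graphs = map graph (keep good (enum Qs ω₀))

    graphs-different : AllPairs DifferentGraphs graphs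
    graphs-different = AllPairs.map⁺ (keep-AllPairs good (different Qs (unique-pairs uV) id _))

    graphs-alpha : All (λ G → ∃ λ a → IsAlphaF F G a × r * thr n ≤ a × a ≤ r * suc (thr n)) graphs
    graphs-alpha = All.map⁺ (All.tabulate λ {ω} ω∈ → good⇒alpha ω (proj₂ (∈-keep⁻ good {enum Qs _} ω∈)))

    -- Each of the two kinds of failure gets half of the permitted proportion 1/(j+1), hence the
    -- factor 2(j+1); the constant 4(r² + 1) compensates the loss in `few-bad`.
    graphs-many : ∀ j → LowerConditions.Lower (4 * suc (r * r) * (2 * suc j)) n → 2 * suc j * (bin n m * (C * B m)) ≤ 2 ^ tri m →
      suc j * (2 ^ (n choose 2) ∸ length graphs) ≤ 2 ^ (n choose 2)
    graphs-many j low up = subst (λ z → suc j * (z ∸ length graphs) ≤ z) N₂≡ (*-cancelˡ-≤ 2 (begin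
      2 * (suc j * (N₂ ∸ length graphs))       ≡⟨ *-assoc 2 (suc j) (N₂ ∸ length graphs) ⟨
      2 * suc j * (N₂ ∸ length graphs)         ≤⟨ *-monoʳ-≤ (2 * suc j) (m≤n+o⇒m∸n≤o N₂ (length graphs) most) ⟩
      2 * suc j * (𝔼 Qs ω₀ (𝟙 ∘ bad₁) + 𝔼 Qs ω₀ Y) ≡⟨ *-distribˡ-+ (2 * suc j) (𝔼 Qs ω₀ (𝟙 ∘ bad₁)) (𝔼 Qs ω₀ Y) ⟩
      2 * suc j * 𝔼 Qs ω₀ (𝟙 ∘ bad₁) + 2 * suc j * 𝔼 Qs ω₀ Y ≤⟨ +-mono-≤ h₁ (few-free (2 * suc j) up ω₀) ⟩
      N₂ + N₂                                  ≡⟨ cong (N₂ +_) (sym (+-identityʳ N₂)) ⟩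
      2 * N₂ ∎))
      where
      open ≤-Reasoning
      c = 4 * suc (r * r)
      h₁ : 2 * suc j * 𝔼 Qs ω₀ (𝟙 ∘ bad₁) ≤ N₂
      h₁ = *-cancelˡ-≤ {2 * suc j * 𝔼 Qs ω₀ (𝟙 ∘ bad₁)} {N₂} c (≤-trans (≤-reflexive (sym (*-assoc c (2 * suc j) (𝔼 Qs ω₀ (𝟙 ∘ bad₁))))) (few-bad₁ (c * (2 * suc j)) (s≤s z≤n) low ω₀))
      N₂≡ : N₂ ≡ 2 ^ (n choose 2)
      N₂≡ = cong (2 ^_) (≡-trans (length-pairs-tri Vs) (≡-trans (cong tri (length-tabulate {n = n} id)) (tri≡C2 n)))
      cover : ∀ b y → 1 ≤ 𝟙 (not b ∧ (y <ᵇ 1)) + (𝟙 b + y)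
      cover true  y       = s≤s z≤n
      cover false zero    = s≤s z≤n
      cover false (suc y) = s≤s z≤n
      most : N₂ ≤ length graphs + (𝔼 Qs ω₀ (𝟙 ∘ bad₁) + 𝔼 Qs ω₀ Y)
      most = begin
        N₂                                                        ≡⟨ ≡-trans (𝔼-const Qs ω₀ 1) (*-identityʳ N₂) ⟨
        𝔼 Qs ω₀ (λ _ → 1)                                         ≤⟨ 𝔼-mono Qs ω₀ (λ ω → cover (bad₁ ω) (Y ω)) ⟩
        𝔼 Qs ω₀ (λ ω → 𝟙 (good ω) + (𝟙 (bad₁ ω) + Y ω))           ≡⟨ ≡-trans (∑-+ (enum Qs ω₀) (𝟙 ∘ good) (λ ω → 𝟙 (bad₁ ω) + Y ω)) (cong (𝔼 Qs ω₀ (𝟙 ∘ good) +_) (∑-+ (enum Qs ω₀) (𝟙 ∘ bad₁) Y)) ⟩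
        𝔼 Qs ω₀ (𝟙 ∘ good) + (𝔼 Qs ω₀ (𝟙 ∘ bad₁) + 𝔼 Qs ω₀ Y)     ≡⟨ cong (_+ (𝔼 Qs ω₀ (𝟙 ∘ bad₁) + 𝔼 Qs ω₀ Y)) (≡-trans (length-map graph (keep good (enum Qs ω₀))) (length-keep good (enum Qs ω₀))) ⟨
        length graphs + (𝔼 Qs ω₀ (𝟙 ∘ bad₁) + 𝔼 Qs ω₀ Y) ∎

  concentrated : WHP (λ n G → Σ ℕ λ a → IsAlphaF F G a × r * suc (thr n) ∸ r ≤ a × a ≤ r * suc (thr n))
  concentrated j = Ev-map build (Ev-× (LowerConditions.lower (4 * suc (r * r) * (2 * suc j))) (UpperConditions.upper r′ (2 * suc j) C))
    where
    build : ∀ n → LowerConditions.Lower (4 * suc (r * r) * (2 * suc j)) n × (2 * suc j * (bin n (At.m n) * (C * B (At.m n))) ≤ 2 ^ tri (At.m n)) →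
      Σ (List (Graph n)) λ gs → AllPairs DifferentGraphs gs × All (λ G → Σ ℕ λ a → IsAlphaF F G a × r * suc (thr n) ∸ r ≤ a × a ≤ r * suc (thr n)) gs ×
        suc j * (2 ^ (n choose 2) ∸ length gs) ≤ 2 ^ (n choose 2)
    build n (low , up) = graphs , graphs-different , All.map (λ {G} → widen {G}) graphs-alpha , graphs-many j low up
      where
      open At n
      widen : ∀ {G} → (∃ λ a → IsAlphaF F G a × r * thr n ≤ a × a ≤ r * suc (thr n)) → Σ ℕ λ a → IsAlphaF F G a × r * suc (thr n) ∸ r ≤ a × a ≤ r * suc (thr n)
      widen (a , is , lo , hi) = a , is , ≤-trans (≤-reflexive (≡-trans (cong (_∸ r) (*-suc r (thr n))) (m+n∸m≡n r (r * thr n)))) lo , hi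

theorem3 : ∀ (r : ℕ) → 2 ≤ r → ∀ (k : ℕ) (F : Graph k) → Critical r F →
  Σ (ℕ → ℕ) λ m → WHP (λ n G → Σ ℕ λ a → IsAlphaF F G a × m n ∸ r ≤ a × a ≤ m n)
theorem3 (suc r′) 2≤r k F crit = _ , Main.concentrated F crit (s≤s⁻¹ 2≤r)
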